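{- There does not exist a polynomial $F \in \mathbb{Q}[x,y]$ of degree $4$ such that $F(\mathbb{Z}^2) = \mathbb{Z}_{\geq 0}$, where $F(\mathbb{Z}^2) = \{F(x,y) : (x,y) \in \mathbb{Z}^2\}$. -}

module Defs where

open import Data.Nat using (ℕ; zero; suc; _≤_; _>_)
import Data.Nat as ℕ
open import Data.Integer using (ℤ; +_)
open import Data.Rational using (ℚ; 0ℚ; 1ℚ; _+_; _*_; _/_)
open import Data.Fin using (Fin; toℕ)
open import Data.List using (List; foldr; map; allFin)
open import Data.Product using (Σ; ∃; _×_; ∃-syntax)
open import Relation.Binary.PropositionalEquality using (_≡_; _≢_)

-- A polynomial F ∈ ℚ[x,y] of total degree ≤ 4 is given by its coefficients
-- coeff i j (the coefficient of x^i y^j), for 0 ≤ i, j ≤ 4, subject to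
-- coeff i j = 0 whenever i + j > 4 (see 'DegreeLE4').
Coeffs : Set
Coeffs = Fin 5 → Fin 5 → ℚ

_^ℚ_ : ℚ → ℕ → ℚ
q ^ℚ zero  = 1ℚ
q ^ℚ suc n = q * (q ^ℚ n)

ℤ→ℚ : ℤ → ℚ
ℤ→ℚ z = z / 1

Σ5 : (Fin 5 → ℚ) → ℚ
Σ5 f = foldr _+_ 0ℚ (map f (allFin 5))

eval : Coeffs → ℚ → ℚ → ℚ
eval c x y = Σ5 (λ i → Σ5 (λ j → c i j * ((x ^ℚ toℕ i) * (y ^ℚ toℕ j))))

DegreeLE4 : Coeffs → Set
DegreeLE4 c = ∀ i j → toℕ i ℕ.+ toℕ j > 4 → c i j ≡ 0ℚ

Degree4 : Coeffs → Set
Degree4 c = DegreeLE4 c × (∃[ i ] ∃[ j ] (toℕ i ℕ.+ toℕ j ≡ 4 × c i j ≢ 0ℚ))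

ImageIsNat : Coeffs → Set
ImageIsNat c =
  (∀ (x y : ℤ) → ∃[ n ] (eval c (ℤ→ℚ x) (ℤ→ℚ y) ≡ ℤ→ℚ (+ n)))
  × (∀ (n : ℕ) → ∃[ x ] ∃[ y ] (eval c (ℤ→ℚ x) (ℤ→ℚ y) ≡ ℤ→ℚ (+ n)))

{-# OPTIONS --safe #-}

-- After clearing denominators let G be an integral quartic that is nonnegative on ℤ² and takes all
-- the values E n, and let f be its leading form, which is then positive semidefinite. Whenever the
-- points with G ≤ E M⁴ yield only O(M³) values, counting gives a contradiction.
--
-- If f is anisotropic over ℚ, complete the fourth power: 256 a³ f = φ(X, y) with φ depressed. Either
-- φ ≥ (X⁴ + y⁴) / K, and there are O(M²) points; or φ and its derivative are simultaneously arbitrarily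
-- small, and the Euclidean algorithm forces φ to be the square of a form that is equivalent to V² - d W²
-- with d not a square. Summing G over the orbit of a point under a Pell unit and its inverse then
-- shows that the cubic part is divisible by V² - d W², and that either G is a polynomial in V² - d W²,
-- or G is at least of order (V² - d W²)² + W²; both leave O(M³) values.
--
-- If f has a rational zero, move it to (0, 1). Then G = A(x) y² + B(x) y + C(x), and each line x = const
-- contributes O(M²) values. Either |x| = O(M); or G is asymptotic to x² z² with z linear, and x or z is
-- O(M); or 4 k G = z² + Δ(x) with k constant, z = 2 k y + B(x) and Δ of degree at most 2. In the last case
-- G has O(M²) values if Δ is constant; otherwise a form X² + m Z² represents an arithmetic progression,
-- so that - m is a square modulo almost all primes, which contradicts Gauss's lemma modulo 4 m K - 1.
module Submission where

open import Defs
open import Algebra.Bundles using (CommutativeRing)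
open import Algebra.Solver.Ring.AlmostCommutativeRing using (AlmostCommutativeRing; fromCommutativeRing; _-Raw-AlmostCommutative⟶_)
open import Algebra.Structures using (IsCommutativeRing)
open import Data.Bool using (Bool; true; false; not; _xor_)
import Data.Bool.Properties as BoolP
open import Data.Empty using (⊥; ⊥-elim)
open import Data.Fin as Fin using (Fin; toℕ; fromℕ<; combine; remQuot)
open import Data.Fin.Permutation using (permutation)
import Data.Fin.Properties as FinP
open import Data.Integer as ℤ using (ℤ; +_; -[1+_]; 0ℤ; 1ℤ; ∣_∣; _≤_; +≤+; -≤+)
import Data.Integer.DivMod as ℤD
import Data.Integer.Properties as ℤP
open import Data.List using (List; []; _∷_; _++_; map; length; upTo; concatMap)
open import Data.List.Membership.Propositional using (_∈_)
import Data.List.Membership.Propositional.Properties as MP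
import Data.List.Properties as LP
open import Data.List.Relation.Unary.All as All using (All; []; _∷_)
open import Data.List.Relation.Unary.Any as Any using (here; there)
open import Data.Maybe using (Maybe; just; nothing)
open import Data.Nat as ℕ using (ℕ; zero; suc; z≤n; s≤s)
import Data.Nat.Coprimality as Cop
import Data.Nat.Divisibility as ℕDiv
open import Data.Nat.GCD using (module Bézout; module GCD)
open import Data.Nat.ListAction using (product)
open import Data.Nat.ListAction.Properties using (∈⇒∣product)
open import Data.Nat.Primality using (Prime; euclidsLemma; prime⇒irreducible; prime⇒nonTrivial)
open import Data.Nat.Primality.Factorisation using (PrimeFactorisation; factorise)
import Data.Nat.Properties as ℕP
open import Data.Nat.Solver using (module +-*-Solver)
open import Data.Product using (Σ; ∃; _×_; _,_; proj₁; proj₂; uncurry)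
open import Data.Rational as ℚ using (ℚ; toℚᵘ; mkℚ)
import Data.Rational.Properties as ℚP
open import Data.Rational.Unnormalised as ℚᵘ using (mkℚᵘ; *≡*)
import Data.Rational.Unnormalised.Properties as ℚᵘP
open import Data.Sum using (_⊎_; inj₁; inj₂; [_,_]′)
open import Function using (id)
open import Level using (0ℓ)
open import Relation.Binary.PropositionalEquality using (_≡_; _≢_; refl; sym; trans; cong; cong₂; subst; subst₂; module ≡-Reasoning)
open import Relation.Nullary using (¬_; Dec; yes; no)
open import Algebra.Properties.CommutativeMonoid.Sum (CommutativeRing.+-commutativeMonoid BoolP.xor-∧-commutativeRing) using (sum; sum-permute; ∑-distrib-+; sum-cong-≗)

-- Counting settles every case but one. When `4 k G = z² + Δ(x)` with `Δ` truly quadratic, the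
-- points with `G ≤ E M⁴` are of the order `M⁴`, just like the values to be hit, so that only
-- arithmetic can refute it. The modulus `4 m K - 1` is composite in general: its prime factors
-- cannot divide `2 m K`, the square roots of `- m` modulo them are lifted and glued, and Gauss's
-- lemma holds for every odd modulus. Neither quadratic reciprocity nor primes in progressions are
-- needed. The arms of the hyperbolas `V² - d W² = c` are the obstacle in the anisotropic case: the
-- leading form stays bounded there although the points run to infinity. Pell units move points
-- along these arms, and nonnegativity at far images constrains the terms of lower degree. There are
-- no real numbers. A surd enters only through its square, and a real double root of `φ` is replaced
-- by a family of rational points at which `φ` is at most `1 / j²`. Since the goal is `⊥`,
-- undecidable alternatives are split under a double negation.

infixl 7 _*_
infixl 6 _+_ _-_
infix 8 -_

-- Sealed copies of the integer operations: conversion checking of large polynomial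
-- expressions would otherwise unfold the sign-magnitude multiplication.
opaque
  _+_ _*_ : ℤ → ℤ → ℤ
  _+_ = ℤ._+_
  _*_ = ℤ._*_
  -_ : ℤ → ℤ
  -_ = ℤ.-_

_-_ : ℤ → ℤ → ℤ
x - y = x + - y

opaque
  unfolding _+_ _*_ -_

  +-≡ : ∀ x y → x + y ≡ x ℤ.+ y
  +-≡ x y = refl
  *-≡ : ∀ x y → x * y ≡ x ℤ.* y
  *-≡ x y = refl
  neg-≡ : ∀ x → - x ≡ ℤ.- x
  neg-≡ x = refl
  isCR : IsCommutativeRing _≡_ _+_ _*_ -_ 0ℤ 1ℤ
  isCR = ℤP.+-*-isCommutativeRing
  ∣+∣ : ∀ x y → ∣ x + y ∣ ℕ.≤ ∣ x ∣ ℕ.+ ∣ y ∣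
  ∣+∣ = ℤP.∣i+j∣≤∣i∣+∣j∣
  ∣*∣ : ∀ x y → ∣ x * y ∣ ≡ ∣ x ∣ ℕ.* ∣ y ∣
  ∣*∣ = ℤP.∣i*j∣≡∣i∣*∣j∣
  ∣neg∣ : ∀ x → ∣ - x ∣ ≡ ∣ x ∣
  ∣neg∣ = ℤP.∣-i∣≡∣i∣
  pos-+ : ∀ m n → + (m ℕ.+ n) ≡ + m + + n
  pos-+ = ℤP.pos-+
  pos-* : ∀ m n → + (m ℕ.* n) ≡ + m * + n
  pos-* = ℤP.pos-*
  ≤⇒0≤ : ∀ {x y} → x ≤ y → 0ℤ ≤ y - x
  ≤⇒0≤ = ℤP.i≤j⇒0≤j-i
  0≤⇒≤ : ∀ {x y} → 0ℤ ≤ y - x → x ≤ y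
  0≤⇒≤ = ℤP.0≤i-j⇒j≤i
  +-nn : ∀ {x y} → 0ℤ ≤ x → 0ℤ ≤ y → 0ℤ ≤ x + y
  +-nn = ℤP.+-mono-≤
  *-nn : ∀ {x y} → 0ℤ ≤ x → 0ℤ ≤ y → 0ℤ ≤ x * y
  *-nn {+ m} {+ n} _ _ = subst (0ℤ ≤_) (ℤP.pos-* m n) (+≤+ z≤n)
  sq-nn : ∀ x → 0ℤ ≤ x * x
  sq-nn (+ n) = *-nn {+ n} {+ n} (+≤+ z≤n) (+≤+ z≤n)
  sq-nn -[1+ n ] = +≤+ z≤n
  *-zero-split : ∀ x y → x * y ≡ 0ℤ → x ≡ 0ℤ ⊎ y ≡ 0ℤ
  *-zero-split x y e = ℤP.i*j≡0⇒i≡0∨j≡0 x e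
  *-cancelˡ-nn : ∀ k {x} → 1ℤ ≤ k → 0ℤ ≤ k * x → 0ℤ ≤ x
  *-cancelˡ-nn (+ suc k) {+ n} _ _ = +≤+ z≤n
  *-cancelˡ-nn (+ suc k) { -[1+ n ]} _ ()
  *-cancelˡ-nn (+ zero) (+≤+ ()) _
  ≰⇒> : ∀ {x y} → ¬ x ≤ y → 1ℤ + y ≤ x
  ≰⇒> p = ℤP.i<j⇒suc[i]≤j (ℤP.≰⇒> p)
  div-mod : ∀ n d → 1 ℕ.≤ d → ∃ λ q → ∃ λ r → n ≡ + r + q * + d × suc r ℕ.≤ d
  div-mod n (suc d) _ = n ℤ./ℕ suc d , n ℤ.%ℕ suc d , ℤD.a≡a%ℕn+[a/ℕn]*n n (suc d) , ℤD.n%ℕd<d n (suc d)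

CR : CommutativeRing 0ℓ 0ℓ
CR = record { isCommutativeRing = isCR }

ACR : AlmostCommutativeRing 0ℓ 0ℓ
ACR = fromCommutativeRing CR

coefficient-hom : ℤ.+-*-rawRing -Raw-AlmostCommutative⟶ ACR
coefficient-hom = record
  { ⟦_⟧ = id ; +-homo = λ x y → sym (+-≡ x y) ; *-homo = λ x y → sym (*-≡ x y)
  ; -‿homo = λ x → sym (neg-≡ x) ; 0-homo = refl ; 1-homo = refl }

coefficient≟ : (x y : ℤ) → Maybe (x ≡ y)
coefficient≟ x y with x ℤ.≟ y
... | yes p = just p
... | no _ = nothing

open import Algebra.Solver.Ring ℤ.+-*-rawRing ACR coefficient-hom coefficient≟ using (solve; _:+_; _:*_; _:-_; :-_; _:^_; _:=_; con; Polynomial)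
open import Algebra.Properties.Semiring.Exp (CommutativeRing.semiring CR) using (_^_)

infix 10 #_
#_ : ∀ {n} → ℕ → Polynomial n
# k = con (+ k)

-- Integer inequalities by polynomial certificates

nn-by : ∀ {x y} → x ≡ y → 0ℤ ≤ y → 0ℤ ≤ x
nn-by e p = subst (0ℤ ≤_) (sym e) p

-- The usual form of an inequality proof below: the ring solver rewrites the difference as a sum of
-- products of quantities that are known to be nonnegative.
≤-by : ∀ {x y z} → y - x ≡ z → 0ℤ ≤ z → x ≤ y
≤-by e p = 0≤⇒≤ (nn-by e p)

pos-nn : ∀ n → 0ℤ ≤ + n
pos-nn n = +≤+ z≤n

≤-total : ∀ x y → x ≤ y ⊎ 1ℤ + y ≤ x
≤-total x y with x ℤ.≤? y
... | yes p = inj₁ p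
... | no p = inj₂ (≰⇒> p)

1≤-split : ∀ x → 1ℤ ≤ x ⊎ x ≤ 0ℤ
1≤-split (+ suc n) = inj₁ (+≤+ (s≤s z≤n))
1≤-split (+ zero) = inj₂ (+≤+ z≤n)
1≤-split -[1+ n ] = inj₂ -≤+

absurd≤ : 1ℤ ≤ 0ℤ → ⊥
absurd≤ (+≤+ ())

-- Refutations have this shape: the negated claim and the other hypotheses are combined into a
-- certificate for `- 1 - x`, where `x` is itself nonnegative.
¬0≤-1 : ∀ {x} → 0ℤ ≤ - 1ℤ - x → 0ℤ ≤ x → ⊥
¬0≤-1 {x} p q = absurd≤ (≤-by {z = (- 1ℤ - x) + x} (solve 1 (λ x → # 0 :- # 1 := (:- # 1 :- x) :+ x) refl x)
  (+-nn p q))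

≤0∧0≤⇒≡0 : ∀ {x} → x ≤ 0ℤ → 0ℤ ≤ x → x ≡ 0ℤ
≤0∧0≤⇒≡0 = ℤP.≤-antisym

neg-nn⇒≤0 : ∀ {x} → 0ℤ ≤ - x → x ≤ 0ℤ
neg-nn⇒≤0 {x} p = ≤-by (solve 1 (λ x → # 0 :- x := :- x) refl x) p

both-nn⇒≡0 : ∀ {x} → 0ℤ ≤ x → 0ℤ ≤ - x → x ≡ 0ℤ
both-nn⇒≡0 p q = ≤0∧0≤⇒≡0 (neg-nn⇒≤0 q) p

1≤⇒0≤ : ∀ {x} → 1ℤ ≤ x → 0ℤ ≤ x
1≤⇒0≤ = ℤP.≤-trans (+≤+ z≤n)

1≤-* : ∀ {x y} → 1ℤ ≤ x → 1ℤ ≤ y → 1ℤ ≤ x * y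
1≤-* {x} {y} p q = ≤-by (solve 2 (λ x y → x :* y :- # 1 := (x :- # 1) :* (y :- # 1) :+ (x :- # 1) :+ (y :- # 1)) refl
  x y)
  (+-nn (+-nn (*-nn (≤⇒0≤ p) (≤⇒0≤ q)) (≤⇒0≤ p)) (≤⇒0≤ q))

sq≢0⇒1≤ : ∀ x → x ≢ 0ℤ → 1ℤ ≤ x * x
sq≢0⇒1≤ x ne with 1≤-split (x * x)
... | inj₁ p = p
... | inj₂ p with *-zero-split x x (≤0∧0≤⇒≡0 p (sq-nn x))
...   | inj₁ e = ⊥-elim (ne e)
...   | inj₂ e = ⊥-elim (ne e)

x≤∣x∣ : ∀ x → x ≤ + ∣ x ∣
x≤∣x∣ (+ n) = ℤP.≤-refl
x≤∣x∣ -[1+ n ] = -≤+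

∣x∣≤⇒ : ∀ {x n} → ∣ x ∣ ℕ.≤ n → x ≤ + n
∣x∣≤⇒ {x} p = ℤP.≤-trans (x≤∣x∣ x) (+≤+ p)

∣x∣≤⇒- : ∀ {x n} → ∣ x ∣ ℕ.≤ n → - x ≤ + n
∣x∣≤⇒- {x} p = ∣x∣≤⇒ (subst (ℕ._≤ _) (sym (∣neg∣ x)) p)

+≤⇒ : ∀ {m n} → + m ≤ + n → m ℕ.≤ n
+≤⇒ = ℤP.drop‿+≤+

⇒∣x∣≤ : ∀ {x n} → x ≤ + n → - x ≤ + n → ∣ x ∣ ℕ.≤ n
⇒∣x∣≤ {+ m} p q = +≤⇒ p
⇒∣x∣≤ { -[1+ m ]} p q = +≤⇒ (subst (_≤ _) (neg-≡ -[1+ m ]) q)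

∣sq∣ : ∀ x → + ∣ x ∣ * + ∣ x ∣ ≡ x * x
∣sq∣ x = trans (sym (pos-* ∣ x ∣ ∣ x ∣)) (trans (cong +_ (sym (∣*∣ x x))) (ℤP.0≤i⇒+∣i∣≡i (sq-nn x)))

sq-cancel-≤ : ∀ {x y} → 0ℤ ≤ y → x * x ≤ y * y → x ≤ y
sq-cancel-≤ {x} {y} 0≤y p with ≤-total x y
... | inj₁ q = q
... | inj₂ q = ⊥-elim (¬0≤-1 {y * y - x * x}
  (nn-by (solve 2 (λ x y → :- # 1 :- (y :* y :- x :* x) := (x :- (# 1 :+ y)) :* (x :- (# 1 :+ y)) :+ (x :- (# 1 :+ y))
    :* (# 2 :* y :+ # 2) :+ # 2 :* y) refl x y)
    (+-nn (+-nn (sq-nn (x - (1ℤ + y))) (*-nn (≤⇒0≤ q) (+-nn (*-nn (pos-nn 2) 0≤y) (pos-nn 2))))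
      (*-nn (pos-nn 2) 0≤y)))
  (≤⇒0≤ p))

opaque
  isqrt : ∀ n → ∃ λ r → r ℕ.* r ℕ.≤ n × suc n ℕ.≤ suc r ℕ.* suc r
  isqrt zero = 0 , z≤n , s≤s z≤n
  isqrt (suc n) with isqrt n
  ... | r , p , q with suc r ℕ.* suc r ℕ.≤? suc n
  ...   | yes h = suc r , h , ℕP.≤-trans (s≤s q) (ℕP.*-mono-< {suc r} {suc (suc r)} {suc r} {suc (suc r)} ℕP.≤-refl
    ℕP.≤-refl)
  ...   | no h = r , ℕP.≤-trans p (ℕP.n≤1+n n) , ℕP.≰⇒> h

-- Allows a case distinction, on the way to `⊥`, on whether the leading form has a nontrivial zero,
-- which is not decided here.
em : ∀ {a} {A : Set a} → ¬ ¬ (A ⊎ ¬ A)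
em k = k (inj₂ (λ a → k (inj₁ a)))

-- Univariate polynomials as coefficient lists

ev : List ℤ → ℤ → ℤ
ev [] t = 0ℤ
ev (c ∷ cs) t = c + t * ev cs t

infixl 6 _+ₗ_
infixl 7 _·ₗ_ _*ₗ_

_+ₗ_ : List ℤ → List ℤ → List ℤ
[] +ₗ q = q
p +ₗ [] = p
(a ∷ p) +ₗ (b ∷ q) = (a + b) ∷ (p +ₗ q)

_·ₗ_ : ℤ → List ℤ → List ℤ
c ·ₗ [] = []
c ·ₗ (a ∷ p) = (c * a) ∷ (c ·ₗ p)

_*ₗ_ : List ℤ → List ℤ → List ℤ
[] *ₗ q = []
(a ∷ p) *ₗ q = (a ·ₗ q) +ₗ (0ℤ ∷ (p *ₗ q))

reflectₗ : List ℤ → List ℤ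
reflectₗ [] = []
reflectₗ (a ∷ p) = a ∷ ((- 1ℤ) ·ₗ reflectₗ p)

ev-+ : ∀ p q t → ev (p +ₗ q) t ≡ ev p t + ev q t
ev-+ [] q t = solve 1 (λ x → x := # 0 :+ x) refl (ev q t)
ev-+ (a ∷ p) [] t = solve 1 (λ x → x := x :+ # 0) refl (ev (a ∷ p) t)
ev-+ (a ∷ p) (b ∷ q) t = trans (cong (λ z → (a + b) + t * z) (ev-+ p q t))
  (solve 5 (λ a b t x y → (a :+ b) :+ t :* (x :+ y) := (a :+ t :* x) :+ (b :+ t :* y)) refl a b t (ev p t) (ev q t))

ev-· : ∀ c p t → ev (c ·ₗ p) t ≡ c * ev p t
ev-· c [] t = solve 1 (λ x → # 0 := x :* # 0) refl c
ev-· c (a ∷ p) t = trans (cong (λ z → c * a + t * z) (ev-· c p t))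
  (solve 4 (λ c a t x → c :* a :+ t :* (c :* x) := c :* (a :+ t :* x)) refl c a t (ev p t))

ev-* : ∀ p q t → ev (p *ₗ q) t ≡ ev p t * ev q t
ev-* [] q t = solve 1 (λ x → # 0 := # 0 :* x) refl (ev q t)
ev-* (a ∷ p) q t = trans (ev-+ (a ·ₗ q) (0ℤ ∷ (p *ₗ q)) t)
  (trans (cong₂ (λ x y → x + (0ℤ + t * y)) (ev-· a q t) (ev-* p q t))
  (solve 4 (λ a t x y → a :* y :+ (# 0 :+ t :* (x :* y)) := (a :+ t :* x) :* y) refl a t (ev p t) (ev q t)))

ev-reflect : ∀ p t → ev (reflectₗ p) t ≡ ev p (- t)
ev-reflect [] t = refl
ev-reflect (a ∷ p) t = trans (cong (λ z → a + t * z) (trans (ev-· (- 1ℤ) (reflectₗ p) t)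
  (cong ((- 1ℤ) *_) (ev-reflect p t))))
  (solve 3 (λ a t x → a :+ t :* ((:- # 1) :* x) := a :+ (:- t) :* x) refl a t (ev p (- t)))

-- The last entry even if it is zero. Lists are never normalised, so this is the coefficient of a
-- prescribed power rather than of the highest power that occurs.
lc : List ℤ → ℤ
lc [] = 0ℤ
lc (c ∷ []) = c
lc (c ∷ d ∷ cs) = lc (d ∷ cs)

-- Once the tail `v` of the Horner scheme is at least 1, the value `c + t v` is at least `c + t`,
-- which is positive for `t` beyond `∣ c ∣`.
eventually-positive : ∀ p → 1ℤ ≤ lc p → ∃ λ t₀ → ∀ t → t₀ ℕ.≤ t → 1ℤ ≤ ev p (+ t)
eventually-positive [] (+≤+ ())
eventually-positive (c ∷ []) h = 0 , λ t _ → subst (1ℤ ≤_) (solve 2 (λ c t → c := c :+ t :* # 0) refl c (+ t)) h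
eventually-positive (c ∷ d ∷ cs) h with eventually-positive (d ∷ cs) h
... | t₀ , ih = suc ∣ c ∣ ℕ.+ t₀ , λ t le →
  let v = ev (d ∷ cs) (+ t)
      1≤v = ih t (ℕP.≤-trans (ℕP.m≤n+m t₀ (suc ∣ c ∣)) le)
      c≤t : + suc ∣ c ∣ ≤ + t
      c≤t = +≤+ (ℕP.≤-trans (ℕP.m≤m+n (suc ∣ c ∣) t₀) le)
      -c≤ : - c ≤ + ∣ c ∣
      -c≤ = ∣x∣≤⇒- {c} ℕP.≤-refl
      e = pos-+ 1 ∣ c ∣
  in ≤-by (solve 4 (λ c t v b → (c :+ t :* v) :- # 1 := (t :- (# 1 :+ b)) :+ (b :- (:- c)) :+ t :* (v :- # 1)) refl c
    (+ t) v (+ ∣ c ∣))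
      (+-nn (+-nn (subst (λ z → 0ℤ ≤ + t - z) e (≤⇒0≤ c≤t)) (≤⇒0≤ -c≤)) (*-nn (pos-nn t) (≤⇒0≤ 1≤v)))

lc-neg : ∀ p → lc ((- 1ℤ) ·ₗ p) ≡ - lc p
lc-neg [] = solve 0 (# 0 := :- # 0) refl
lc-neg (c ∷ []) = solve 1 (λ c → (:- # 1) :* c := :- c) refl c
lc-neg (c ∷ d ∷ cs) = lc-neg (d ∷ cs)

-- The main source of sign information: restricted to a ray, a nonnegative function reveals the sign
-- of its top coefficient. Using opposite rays makes coefficients of odd order vanish.
leading-nonneg : ∀ p t₁ → (∀ t → t₁ ℕ.≤ t → 0ℤ ≤ ev p (+ t)) → 0ℤ ≤ lc p
leading-nonneg p t₁ h with 1≤-split (- lc p)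
... | inj₂ q = nn-by (solve 1 (λ c → c := # 0 :- (:- c)) refl (lc p)) (≤⇒0≤ q)
... | inj₁ q with eventually-positive ((- 1ℤ) ·ₗ p) (subst (1ℤ ≤_) (sym (lc-neg p)) q)
...   | t₀ , r = ⊥-elim (¬0≤-1 {ev p (+ t)}
          (nn-by (trans (solve 1 (λ v → :- # 1 :- v := (:- # 1) :* v :- # 1) refl (ev p (+ t)))
            (cong (_- 1ℤ) (sym (ev-· (- 1ℤ) p (+ t)))))
             (≤⇒0≤ (r t (ℕP.m≤m+n t₀ t₁))))
          (h t (ℕP.m≤n+m t₁ t₀)))
  where t = t₀ ℕ.+ t₁

-- Counting
SparseValues : ℕ → ℤ → Set
SparseValues C E = ∀ M → 1 ℕ.≤ M → ∃ λ L → length L ℕ.≤ C ℕ.* (M ℕ.^ 3) × (∀ n → n ℕ.≤ M ℕ.^ 4 → E * + n ∈ L)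

∈-index-injective : ∀ {x y : ℤ} {L : List ℤ} (p : x ∈ L) (q : y ∈ L) → Any.index p ≡ Any.index q → x ≡ y
∈-index-injective (here e) (here e₁) _ = trans e (sym e₁)
∈-index-injective (there p) (there q) e = ∈-index-injective p q (FinP.suc-injective e)

*-cancelˡ : ∀ E {x y} → 1ℤ ≤ E → E * x ≡ E * y → x ≡ y
*-cancelˡ E {x} {y} h e = ℤP.≤-antisym (f e) (f (sym e))
  where
  f : ∀ {x y} → E * x ≡ E * y → x ≤ y
  f {x} {y} e = 0≤⇒≤ (*-cancelˡ-nn E h (nn-by (trans (solve 3 (λ E x y → E :* (y :- x) := E :* y :- E :* x) refl E x
    y) (cong (λ z → E * y - z) e))
     (nn-by (solve 1 (λ z → z :- z := # 0) refl (E * y)) (pos-nn 0))))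

-- M⁴ + 1 values do not fit into a list of length C M³ once M > C.
¬SparseValues : ∀ C E → 1ℤ ≤ E → ¬ SparseValues C E
¬SparseValues C E hE h with h (suc C) (s≤s z≤n)
... | L , len , mem = ℕP.<-irrefl refl (ℕP.≤-trans (FinP.injective⇒≤ {f = f} inj)
  (ℕP.≤-trans len (ℕP.≤-trans (ℕP.n≤1+n _) lem)))
  where
  M = suc C
  f : Fin (suc (M ℕ.^ 4)) → Fin (length L)
  f i = Any.index (mem (toℕ i) (ℕP.≤-pred (FinP.toℕ<n i)))
  inj : ∀ {i j} → f i ≡ f j → i ≡ j
  inj {i} {j} e = FinP.toℕ-injective (ℤP.+-injective (*-cancelˡ E hE
    (∈-index-injective (mem (toℕ i) _) (mem (toℕ j) _) e)))
  lem : suc (C ℕ.* (M ℕ.^ 3)) ℕ.≤ M ℕ.^ 4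
  lem = ℕP.+-monoˡ-≤ (C ℕ.* (M ℕ.^ 3)) (ℕP.m^n>0 M 3)

range : ℤ → ℕ → List ℤ
range u h = map (λ i → u + + i) (upTo h)

length-range : ∀ u h → length (range u h) ≡ h
length-range u h = trans (LP.length-map _ (upTo h)) (LP.length-upTo h)

∈-range : ∀ {u h t} → u ≤ t → 1ℤ + t ≤ u + + h → t ∈ range u h
∈-range {u} {h} {t} p q = subst (_∈ range u h) e (MP.∈-map⁺ (λ i → u + + i) (MP.∈-upTo⁺ lt))
  where
  n = ∣ t - u ∣
  n≡ : + n ≡ t - u
  n≡ = ℤP.0≤i⇒+∣i∣≡i (≤⇒0≤ p)
  e : u + + n ≡ t
  e = trans (cong (_+_ u) n≡) (solve 2 (λ u t → u :+ (t :- u) := t) refl u t)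
  lt : suc n ℕ.≤ h
  lt = +≤⇒ (≤-by (trans (cong (λ z → + h - z) (trans (pos-+ 1 n) (cong (_+_ 1ℤ) n≡)))
    (solve 3 (λ h t u → h :- (# 1 :+ (t :- u)) := (u :+ h) :- (# 1 :+ t)) refl (+ h) t u)) (≤⇒0≤ q))

symmetric-range : ℕ → List ℤ
symmetric-range n = range (- + n) (suc (n ℕ.+ n))

∈-symmetric-range : ∀ {n t} → ∣ t ∣ ℕ.≤ n → t ∈ symmetric-range n
∈-symmetric-range {n} {t} p = ∈-range
  (≤-by (solve 2 (λ t n → t :- (:- n) := n :- (:- t)) refl t (+ n)) (≤⇒0≤ (∣x∣≤⇒- {t} p)))
  (≤-by (trans (cong (λ z → (- + n + z) - (1ℤ + t)) (trans (pos-+ 1 (n ℕ.+ n)) (cong (_+_ 1ℤ) (pos-+ n n))))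
     (solve 2 (λ t n → (:- n :+ (# 1 :+ (n :+ n))) :- (# 1 :+ t) := n :- t) refl t (+ n))) (≤⇒0≤ (∣x∣≤⇒ {t} p)))

length-concatMap : ∀ {A B : Set} (f : A → List B) k xs → (∀ x → length (f x) ℕ.≤ k)
  → length (concatMap f xs) ℕ.≤ length xs ℕ.* k
length-concatMap f k [] h = z≤n
length-concatMap f k (x ∷ xs) h = ℕP.≤-trans (ℕP.≤-reflexive (LP.length-++ (f x)))
  (ℕP.+-mono-≤ (h x) (length-concatMap f k xs h))

∈-concatMap : ∀ {A B : Set} (f : A → List B) {x xs y} → x ∈ xs → y ∈ f x → y ∈ concatMap f xs
∈-concatMap f p q = MP.∈-concatMap⁺ f (Any.map (λ { refl → q }) p)

^4≡ : ∀ M → M ℕ.^ 4 ≡ (M ℕ.* M) ℕ.* (M ℕ.* M)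
^4≡ = +-*-Solver.solve 1 (λ M → M ^ₛ 4 =ₛ (M *ₛ M) *ₛ (M *ₛ M)) refl
  where open +-*-Solver using () renaming (_:^_ to _^ₛ_; _:*_ to _*ₛ_; _:=_ to _=ₛ_)

^3≡ : ∀ M → M ℕ.^ 3 ≡ M ℕ.* (M ℕ.* M)
^3≡ = +-*-Solver.solve 1 (λ M → M ^ₛ 3 =ₛ M *ₛ (M *ₛ M)) refl
  where open +-*-Solver using () renaming (_:^_ to _^ₛ_; _:*_ to _*ₛ_; _:=_ to _=ₛ_)

≤-* : ∀ {m} n → 1 ℕ.≤ n → m ℕ.≤ m ℕ.* n
≤-* {m} n 1≤n = subst (ℕ._≤ m ℕ.* n) (ℕP.*-identityʳ m) (ℕP.*-monoʳ-≤ m 1≤n)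

1≤-^ : ∀ {M} k → 1 ℕ.≤ M → 1 ℕ.≤ M ℕ.^ k
1≤-^ k 1≤M = ℕP.≤-trans (ℕP.≤-reflexive (sym (ℕP.^-zeroˡ k))) (ℕP.^-monoˡ-≤ k 1≤M)

suc≤2* : ∀ {m} → 1 ℕ.≤ m → suc m ℕ.≤ 2 ℕ.* m
suc≤2* {m} 1≤m = ℕP.≤-trans (ℕP.+-monoˡ-≤ m 1≤m) (ℕP.≤-reflexive (cong (m ℕ.+_) (sym (ℕP.+-identityʳ m))))

length-symmetric-range : ∀ {n} → 1 ℕ.≤ n → length (symmetric-range n) ℕ.≤ 3 ℕ.* n
length-symmetric-range {n} 1≤n = ℕP.≤-trans (ℕP.≤-reflexive (length-range (- + n) (suc (n ℕ.+ n))))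
  (ℕP.≤-trans (ℕP.+-monoˡ-≤ (n ℕ.+ n) 1≤n) (ℕP.≤-reflexive (cong (λ k → n ℕ.+ (n ℕ.+ k)) (sym (ℕP.+-identityʳ n)))))

suc+suc≤4* : ∀ {h} → 1 ℕ.≤ h → suc h ℕ.+ suc h ℕ.≤ 4 ℕ.* h
suc+suc≤4* {h} 1≤h = ℕP.≤-trans (ℕP.+-mono-≤ (suc≤2* 1≤h) (suc≤2* 1≤h))
  (ℕP.≤-reflexive (+-*-Solver.solve 1 (λ h → con₂ 2 *ₛ h +ₛ con₂ 2 *ₛ h =ₛ con₂ 4 *ₛ h) refl h))
  where open +-*-Solver using () renaming (_:+_ to _+ₛ_; _:*_ to _*ₛ_; _:=_ to _=ₛ_; con to con₂)

-- No root of the constant is extracted: `C ≤ C²` is enough.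
∣∣≤-from-sq : ∀ C M x → 1 ℕ.≤ C → x * x ≤ + (C ℕ.* M ℕ.^ 4) → ∣ x ∣ ℕ.≤ C ℕ.* (M ℕ.* M)
∣∣≤-from-sq C M x 1≤C h = +≤⇒ (sq-cancel-≤ (pos-nn (C ℕ.* (M ℕ.* M)))
  (ℤP.≤-trans (ℤP.≤-reflexive (∣sq∣ x)) (ℤP.≤-trans h
  (subst (+ (C ℕ.* M ℕ.^ 4) ≤_) (pos-* (C ℕ.* (M ℕ.* M)) (C ℕ.* (M ℕ.* M)))
    (+≤+ (ℕP.≤-trans (ℕP.≤-reflexive (cong (C ℕ.*_) (^4≡ M)))
    (ℕP.≤-trans (≤-* C 1≤C) (ℕP.≤-reflexive (+-*-Solver.solve 2 (λ C M
      → C *ₛ ((M *ₛ M) *ₛ (M *ₛ M)) *ₛ C =ₛ (C *ₛ (M *ₛ M)) *ₛ (C *ₛ (M *ₛ M))) refl C M)))))))))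
  where open +-*-Solver using () renaming (_:*_ to _*ₛ_; _:=_ to _=ₛ_)

1≤-cancelˡ : ∀ k {x} → 1ℤ ≤ k → 1ℤ ≤ k * x → 1ℤ ≤ x
1≤-cancelˡ k {x} hk h with 1≤-split x
... | inj₁ p = p
... | inj₂ p = ⊥-elim (¬0≤-1 {k * (- x)} (nn-by (solve 2 (λ k x → :- # 1 :- k :* (:- x) := k :* x :- # 1) refl k x)
  (≤⇒0≤ h))
   (*-nn (1≤⇒0≤ hk) (nn-by (solve 1 (λ x → :- x := # 0 :- x) refl x) (≤⇒0≤ p))))

1≤-diff : ∀ {x t} → 1ℤ ≤ x - t → 1ℤ + t ≤ x
1≤-diff {x} {t} p = ≤-by (solve 2 (λ x t → x :- (# 1 :+ t) := (x :- t) :- # 1) refl x t) (≤⇒0≤ p)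

-- The floor of the square root of `d`, or 0 for negative `d`. In that case `r * r ≤ d` fails, so
-- minimality among the `z ≥ 0` with `d ≤ z * z` takes its place.
integer-sqrt : ∀ d → ∃ λ r → 0ℤ ≤ r × (∀ z → 0ℤ ≤ z → d ≤ z * z → r ≤ z) × 1ℤ + d ≤ (1ℤ + r) * (1ℤ + r)
integer-sqrt (+ n) with isqrt n
... | r , p , q = + r , pos-nn r
    , (λ z 0≤z h → sq-cancel-≤ 0≤z (ℤP.≤-trans (subst (_≤ + n) (pos-* r r) (+≤+ p)) h))
    , subst₂ _≤_ (pos-+ 1 n) (trans (pos-* (suc r) (suc r)) (cong₂ _*_ (pos-+ 1 r) (pos-+ 1 r))) (+≤+ q)
integer-sqrt d@(-[1+ n ]) = 0ℤ , pos-nn 0 , (λ z h _ → h)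
    , ≤-by (solve 1 (λ d → (# 1 :+ # 0) :* (# 1 :+ # 0) :- (# 1 :+ d) := # 0 :- d) refl d) (≤⇒0≤ { -[1+ n ]} -≤+)

quadratic : ℤ → ℤ → ℤ → ℤ → ℤ
quadratic A B C t = A * (t * t) + B * t + C

-- On the branch where the derivative is nonnegative, the square z² = (p'(t))² lies in an
-- interval of length 4AN, so z lies in one of length 2Ah and t in one of length h.
quadratic-branch : ∀ A B C N h → 1ℤ ≤ A → N ℕ.≤ h ℕ.* h →
  ∃ λ u → ∀ t → 0ℤ ≤ + 2 * A * t + B → 0ℤ ≤ quadratic A B C t → quadratic A B C t ≤ + N → u ≤ t × 1ℤ + t ≤ u + + suc h
quadratic-branch A@(+ a) B C N h 1≤A N≤ = q , λ t 0≤z 0≤p p≤N →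
    let z = + 2 * A * t + B
        p = quadratic A B C t
        id₁ : z * z ≡ disc + + 4 * A * p
        id₁ = solve 4 (λ A B C t → (# 2 :* A :* t :+ B) :* (# 2 :* A :* t :+ B)
          := (B :* B :- # 4 :* A :* C) :+ # 4 :* A :* (A :* (t :* t) :+ B :* t :+ C)) refl A B C t
        r≤z = lower z 0≤z (≤-by (trans (cong (_- disc) id₁) (solve 2 (λ d x → d :+ x :- d := x) refl disc
          (+ 4 * A * p))) (*-nn (*-nn (pos-nn 4) (pos-nn a)) 0≤p))
        z≤ = z-upper t 0≤z p≤N id₁
    in 0≤⇒≤ (*-cancelˡ-nn (+ 2 * A) (1≤-* 1≤2 1≤A)
          (nn-by (trans (solve 5 (λ A t q r B → # 2 :* A :* (t :- q)
            := (# 2 :* A :* t :+ B :- r) :+ (r :- B :- q :* (# 2 :* A))) refl A t q r B)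
                   (cong (λ w → (z - r) + w) (trans (cong (λ w → w - q * (+ 2 * A)) split)
                     (solve 2 (λ x y → x :+ y :- y := x) refl (+ ρ) (q * (+ 2 * A))))))
             (+-nn (≤⇒0≤ r≤z) (pos-nn ρ))))
     , 1≤-diff (1≤-cancelˡ (+ 2 * A) (1≤-* 1≤2 1≤A)
          (≤-by {z = (r + + 2 * A * + h - z) + (+ 2 * A - (1ℤ + + ρ))}
            (trans (cong (λ w → + 2 * A * (q + w - t) - 1ℤ) (pos-+ 1 h))
            (trans (solve 6 (λ A q h t r B → # 2 :* A :* (q :+ (# 1 :+ h) :- t) :- # 1 :=
                      (r :+ # 2 :* A :* h :- (# 2 :* A :* t :+ B))
                        :+ (# 2 :* A :- (# 1 :+ (r :- B :- q :* (# 2 :* A))))) refl A q (+ h) t r B)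
              (cong (λ w → (r + + 2 * A * + h - z) + (+ 2 * A - (1ℤ + w)))
                (trans (cong (λ w → w - q * (+ 2 * A)) split)
                (solve 2 (λ x y → x :+ y :- y := x) refl (+ ρ) (q * (+ 2 * A)))))))
            (+-nn (≤⇒0≤ z≤) (≤⇒0≤ (subst₂ _≤_ (pos-+ 1 ρ) (pos-* 2 a) (+≤+ ρ<))))))
  where
  disc = B * B - + 4 * A * C
  s = integer-sqrt disc
  r = proj₁ s
  0≤r = proj₁ (proj₂ s)
  lower = proj₁ (proj₂ (proj₂ s))
  upper = proj₂ (proj₂ (proj₂ s))
  1≤2 : 1ℤ ≤ + 2
  1≤2 = +≤+ (s≤s z≤n)
  -- The floor `q` of `(r - B) / 2A` lies below every `t` with `2 A t + B ≥ r`, and `z ≤ r + 2 A h`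
  -- keeps `t` below `q + h + 1`.
  dm = div-mod (r - B) (2 ℕ.* a) (ℕP.≤-trans (+≤⇒ 1≤A) (ℕP.m≤m+n a _))
  q = proj₁ dm
  ρ = proj₁ (proj₂ dm)
  ρ< : suc ρ ℕ.≤ 2 ℕ.* a
  ρ< = proj₂ (proj₂ (proj₂ dm))
  split : r - B ≡ + ρ + q * (+ 2 * A)
  split = trans (proj₁ (proj₂ (proj₂ dm))) (cong (λ w → + ρ + q * w) (pos-* 2 a))
  -- From `z ≥ 1 + r + 2 A h` it would follow that `z²` exceeds `disc + 4 A N`, because
  -- `(1 + r)² > disc` and `A h² ≥ N`.
  z-upper : ∀ t → 0ℤ ≤ + 2 * A * t + B → quadratic A B C t ≤ + N → (+ 2 * A * t + B) * (+ 2 * A * t + B)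
    ≡ disc + + 4 * A * quadratic A B C t
    → + 2 * A * t + B ≤ r + + 2 * A * + h
  z-upper t 0≤z p≤N id₁ with ≤-total (+ 2 * A * t + B) (r + + 2 * A * + h)
  ... | inj₁ ok = ok
  ... | inj₂ big = ⊥-elim (¬0≤-1 {+ 4 * A * (+ N - p)}
        (nn-by (trans (cong (λ w → w) (solve 8 (λ A p N h r d z a → :- # 1 :- # 4 :* A :* (N :- p) :=
               ((z :- (# 1 :+ (r :+ # 2 :* A :* h))) :* (z :+ (# 1 :+ (r :+ # 2 :* A :* h)))
                :+ (# 4 :* A :* (h :* (# 1 :+ r)))
                :+ ((# 1 :+ r) :* (# 1 :+ r) :- (# 1 :+ d))
                :+ # 4 :* A :* (h :* h :- N)
                :+ # 4 :* A :* ((A :- # 1) :* (h :* h)))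
                :+ (d :+ # 4 :* A :* p :- z :* z)) refl A p (+ N) (+ h) r disc z (+ a)))
             (trans (cong (λ w → ((z - (1ℤ + (r + + 2 * A * + h))) * (z + (1ℤ + (r + + 2 * A * + h)))
               + (+ 4 * A * (+ h * (1ℤ + r)))
                + ((1ℤ + r) * (1ℤ + r) - (1ℤ + disc)) + + 4 * A * (+ h * + h - + N) + + 4 * A
                  * ((A - 1ℤ) * (+ h * + h))) + (w - z * z)) (sym id₁))
               (solve 2 (λ x y → x :+ (y :- y) := x) refl _ (z * z))))
        (+-nn (+-nn (+-nn (+-nn
          (*-nn (≤⇒0≤ big) (+-nn 0≤z (+-nn (pos-nn 1) (+-nn 0≤r (*-nn (*-nn (pos-nn 2) (pos-nn a)) (pos-nn h))))))
          (*-nn (*-nn (pos-nn 4) (pos-nn a)) (*-nn (pos-nn h) (+-nn (pos-nn 1) 0≤r))))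
          (≤⇒0≤ upper))
          (*-nn (*-nn (pos-nn 4) (pos-nn a)) (≤⇒0≤ (subst (+ N ≤_) (pos-* h h) (+≤+ N≤)))))
          (*-nn (*-nn (pos-nn 4) (pos-nn a)) (*-nn (≤⇒0≤ 1≤A) (sq-nn (+ h))))))
        (*-nn (*-nn (pos-nn 4) (pos-nn a)) (≤⇒0≤ p≤N)))
    where
    z = + 2 * A * t + B
    p = quadratic A B C t
quadratic-branch -[1+ a ] B C N h () N≤

-- One run of `h + 1` integers on each side of the vertex; `t ↦ - t`, `B ↦ - B` exchanges the sides.
-- The count depends on `h` alone, hence is uniform over a family of quadratics.
quadratic-cover : ∀ A B C N h → 1ℤ ≤ A → N ℕ.≤ h ℕ.* h →
  ∃ λ L → length L ℕ.≤ suc h ℕ.+ suc h × (∀ t → 0ℤ ≤ quadratic A B C t → quadratic A B C t ≤ + N → t ∈ L)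
quadratic-cover A B C N h 1≤A N≤ = range u (suc h) ++ map -_ (range v (suc h)) , len , mem
  where
  b₁ = quadratic-branch A B C N h 1≤A N≤
  b₂ = quadratic-branch A (- B) C N h 1≤A N≤
  u = proj₁ b₁
  v = proj₁ b₂
  len = ℕP.≤-reflexive (trans (LP.length-++ (range u (suc h)))
    (cong₂ ℕ._+_ (length-range u (suc h)) (trans (LP.length-map -_ (range v (suc h))) (length-range v (suc h)))))
  mem : ∀ t → 0ℤ ≤ quadratic A B C t → quadratic A B C t ≤ + N → t ∈ range u (suc h) ++ map -_ (range v (suc h))
  mem t 0≤p p≤N with ≤-total 0ℤ (+ 2 * A * t + B)
  ... | inj₁ nn with proj₂ b₁ t nn 0≤p p≤N
  ...   | x , y = MP.∈-++⁺ˡ (∈-range x y)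
  mem t 0≤p p≤N | inj₂ neg with proj₂ b₂ (- t) (nn-by (solve 3 (λ A B t → # 2 :* A :* (:- t) :+ (:- B)
    := (# 0 :- (# 1 :+ (# 2 :* A :* t :+ B))) :+ # 1) refl A B t) (+-nn (≤⇒0≤ neg) (pos-nn 1)))
                        (subst (0ℤ ≤_) same 0≤p) (subst (_≤ + N) same p≤N)
    where same = solve 4 (λ A B C t → A :* (t :* t) :+ B :* t :+ C := A :* ((:- t) :* (:- t)) :+ (:- B) :* (:- t) :+ C) refl A B C t
  ...   | x , y = MP.∈-++⁺ʳ (range u (suc h)) (subst (_∈ map -_ (range v (suc h)))
    (solve 1 (λ t → :- (:- t) := t) refl t) (MP.∈-map⁺ -_ (∈-range x y)))

-- A quadratic that stays nonnegative along the progression t + sT is either constant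
-- or has positive leading coefficient.
quadratic-values : ∀ A B C s N h → 1ℤ ≤ s → N ℕ.≤ h ℕ.* h →
  ∃ λ L → length L ℕ.≤ suc h ℕ.+ suc h ×
    (∀ t → quadratic A B C t ≤ + N → (∀ T → 0ℤ ≤ quadratic A B C (t + s * T)) → quadratic A B C t ∈ L)
quadratic-values A B C s N h 1≤s N≤ with 1≤-split A
... | inj₁ 1≤A with quadratic-cover A B C N h 1≤A N≤
...   | L , len , mem = map (quadratic A B C) L , subst (ℕ._≤ _) (sym (LP.length-map _ L)) len
      , λ t p≤N nn → MP.∈-map⁺ (quadratic A B C) (mem t (subst (λ w → 0ℤ ≤ quadratic A B C w)
        (solve 2 (λ t s → t :+ s :* # 0 := t) refl t s) (nn 0ℤ)) p≤N)
quadratic-values A B C s N h 1≤s N≤ | inj₂ A≤0 = C ∷ [] , s≤s z≤n , λ t p≤N nn → here (const t nn)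
  where
  const : ∀ t → (∀ T → 0ℤ ≤ quadratic A B C (t + s * T)) → quadratic A B C t ≡ C
  const t nn = trans (cong₂ (λ a b → a * (t * t) + b * t + C) A≡0 B≡0)
    (solve 2 (λ t C → # 0 :* (t :* t) :+ # 0 :* t :+ C := C) refl t C)
    where
    A≡0 : A ≡ 0ℤ
    A≡0 = ≤0∧0≤⇒≡0 A≤0 (*-cancelˡ-nn (s * s) (1≤-* 1≤s 1≤s) (leading-nonneg
      (quadratic A B C t ∷ + 2 * A * t * s + B * s ∷ s * s * A ∷ []) 0
      (λ T _ → subst (0ℤ ≤_) (solve 6 (λ A B C t s T → A :* ((t :+ s :* T) :* (t :+ s :* T)) :+ B :* (t :+ s :* T)
        :+ C :=
         (A :* (t :* t) :+ B :* t :+ C) :+ T :* ((# 2 :* A :* t :* s :+ B :* s) :+ T :* (s :* s :* A :+ T :* # 0)))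
           refl A B C t s (+ T)) (nn (+ T)))))
    lin : ∀ T → quadratic A B C (t + s * T) ≡ quadratic 0ℤ B C (t + s * T)
    lin T = cong (λ a → quadratic a B C (t + s * T)) A≡0
    0≤B : 0ℤ ≤ B
    0≤B = *-cancelˡ-nn s 1≤s (leading-nonneg (B * t + C ∷ s * B ∷ []) 0 (λ T _ → subst (0ℤ ≤_) (trans (lin (+ T))
      (solve 5 (λ B C t s T → # 0 :* ((t :+ s :* T) :* (t :+ s :* T)) :+ B :* (t :+ s :* T) :+ C
        := (B :* t :+ C) :+ T :* (s :* B :+ T :* # 0)) refl B C t s (+ T))) (nn (+ T))))
    0≤-B : 0ℤ ≤ - B
    0≤-B = *-cancelˡ-nn s 1≤s (leading-nonneg (B * t + C ∷ s * (- B) ∷ []) 0 (λ T _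
      → subst (0ℤ ≤_) (trans (lin (- + T))
      (solve 5 (λ B C t s T → # 0 :* ((t :+ s :* (:- T)) :* (t :+ s :* (:- T))) :+ B :* (t :+ s :* (:- T)) :+ C
        := (B :* t :+ C) :+ T :* (s :* (:- B) :+ T :* # 0)) refl B C t s (+ T))) (nn (- + T))))
    B≡0 : B ≡ 0ℤ
    B≡0 = both-nn⇒≡0 0≤B 0≤-B

-- Sums of squares in arithmetic progressions

infix 4 _∣ᶻ_
-- The quotient is explicit data, so that divisibility is verified by the ring solver.
_∣ᶻ_ : ℤ → ℤ → Set
d ∣ᶻ x = ∃ λ q → x ≡ q * d

∣ᶻ-+ : ∀ {d x y} → d ∣ᶻ x → d ∣ᶻ y → d ∣ᶻ x + y
∣ᶻ-+ {d} (q , refl) (r , refl) = q + r , solve 3 (λ q r d → q :* d :+ r :* d := (q :+ r) :* d) refl q r d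

∣ᶻ-*ˡ : ∀ {d x} y → d ∣ᶻ x → d ∣ᶻ y * x
∣ᶻ-*ˡ {d} y (q , refl) = y * q , solve 3 (λ q y d → y :* (q :* d) := (y :* q) :* d) refl q y d

∣ᶻ-neg : ∀ {d x} → d ∣ᶻ x → d ∣ᶻ - x
∣ᶻ-neg {d} (q , refl) = - q , solve 2 (λ q d → :- (q :* d) := (:- q) :* d) refl q d

∣ᶻ-by : ∀ {d x y} → x ≡ y → d ∣ᶻ y → d ∣ᶻ x
∣ᶻ-by e p = subst (_ ∣ᶻ_) (sym e) p

∣ᶻ⇒∣ : ∀ {n x} → + n ∣ᶻ x → n ℕDiv.∣ ∣ x ∣
∣ᶻ⇒∣ {n} (q , refl) = ℕDiv.divides ∣ q ∣ (∣*∣ q (+ n))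

∣⇒∣ᶻ : ∀ {n x} → n ℕDiv.∣ ∣ x ∣ → + n ∣ᶻ x
∣⇒∣ᶻ {n} {+ m} (ℕDiv.divides q e) = + q , trans (cong +_ e) (pos-* q n)
∣⇒∣ᶻ {n} { -[1+ m ]} (ℕDiv.divides q e) = - + q
  , trans (sym (neg-≡ (+ suc m))) (trans (cong -_ (trans (cong +_ e) (pos-* q n)))
    (solve 2 (λ q n → :- (q :* n) := (:- q) :* n) refl (+ q) (+ n)))

coprime⇒inverse : ∀ a n → Cop.Coprime ∣ a ∣ n → ∃ λ b → + n ∣ᶻ a * b - 1ℤ
coprime⇒inverse a n c with sign-of a | Cop.coprime-Bézout c
  where
  sign-of : ∀ a → ∃ λ s → + ∣ a ∣ ≡ s * a
  sign-of (+ m) = 1ℤ , solve 1 (λ a → a := # 1 :* a) refl (+ m)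
  sign-of (-[1+ m ]) = - 1ℤ , trans (solve 1 (λ a → a := (:- # 1) :* (:- a)) refl (+ suc m))
    (cong ((- 1ℤ) *_) (neg-≡ (+ suc m)))
... | s , e | Bézout.+- x y eq = + x * s , + y
    , trans (solve 3 (λ a x s → a :* (x :* s) :- # 1 := x :* (s :* a) :- # 1) refl a (+ x) s)
      (trans (cong (λ w → + x * w - 1ℤ) (sym e)) (trans (cong (_- 1ℤ)
        (trans (sym (pos-* x ∣ a ∣)) (trans (cong +_ (sym eq))
        (trans (pos-+ 1 (y ℕ.* n)) (cong (_+_ 1ℤ) (pos-* y n))))))
       (solve 1 (λ z → # 1 :+ z :- # 1 := z) refl (+ y * + n))))
... | s , e | Bézout.-+ x y eq = - (+ x * s) , - + y
    , trans (solve 3 (λ a x s → a :* (:- (x :* s)) :- # 1 := :- (# 1 :+ x :* (s :* a))) refl a (+ x) s)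
      (trans (cong (λ w → - (1ℤ + + x * w)) (sym e)) (trans (cong -_
        (trans (cong (_+_ 1ℤ) (sym (pos-* x ∣ a ∣))) (trans (sym (pos-+ 1 (x ℕ.* ∣ a ∣)))
        (trans (cong +_ eq) (pos-* y n)))))
       (solve 2 (λ y n → :- (y :* n) := (:- y) :* n) refl (+ y) (+ n))))

module _ {p : ℕ} (pr : Prime p) where

  p∤⇒inverse : ∀ a → ¬ + p ∣ᶻ a → ∃ λ b → + p ∣ᶻ a * b - 1ℤ
  p∤⇒inverse a p∤a = coprime⇒inverse a p cop
    where
    cop : Cop.Coprime ∣ a ∣ p
    cop {d} (d∣a , d∣p) with prime⇒irreducible pr d∣p
    ... | inj₁ e = e
    ... | inj₂ refl = ⊥-elim (p∤a (∣⇒∣ᶻ d∣a))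

  euclid : ∀ x y → + p ∣ᶻ x * y → + p ∣ᶻ x ⊎ + p ∣ᶻ y
  euclid x y h with euclidsLemma ∣ x ∣ ∣ y ∣ pr (subst (p ℕDiv.∣_) (∣*∣ x y) (∣ᶻ⇒∣ h))
  ... | inj₁ d = inj₁ (∣⇒∣ᶻ d)
  ... | inj₂ d = inj₂ (∣⇒∣ᶻ d)

  2≤p : 2 ℕ.≤ p
  2≤p = ℕ.nonTrivial⇒n>1 p {{prime⇒nonTrivial pr}}

  p∤1 : ¬ + p ∣ᶻ 1ℤ
  p∤1 h = ℕP.<⇒≢ 2≤p (sym (ℕDiv.∣1⇒≡1 (∣ᶻ⇒∣ h)))

  1≤p : 1ℤ ≤ + p
  1≤p = +≤+ (ℕP.≤-trans (s≤s z≤n) 2≤p)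

  -- A value congruent to p modulo p² is divisible by p exactly once, so a
  -- representation X² + m Z² of it has Z invertible modulo p.
  progression⇒residue : ∀ (m K k : ℤ) → (∀ n → ∃ λ X → ∃ λ Z → X * X + m * (Z * Z) ≡ K * + n + k) →
    ¬ + p ∣ᶻ K → ∃ λ t → + p ∣ᶻ t * t + m
  progression⇒residue m K k rep p∤K = t , t-good
    where
    inv = p∤⇒inverse K p∤K
    y = proj₁ inv
    c = proj₁ (proj₂ inv)
    Ky≡ : K * y ≡ 1ℤ + c * + p
    Ky≡ = trans (solve 1 (λ x → x := # 1 :+ (x :- # 1)) refl (K * y)) (cong (_+_ 1ℤ) (proj₂ (proj₂ inv)))
    -- A Newton step: if `K y = 1 + c p`, then `y (2 - K y)` inverts `K` modulo `p²`, with error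
    -- `- c² p²`. Hence `K v + k` is congruent to `p` modulo `p²`.
    v = (+ p - k) * y * (+ 2 - K * y)
    -- The representation is available for natural arguments only; a multiple of `p²` makes the
    -- argument nonnegative.
    w = v + + p * + p * + ∣ v ∣
    0≤w : 0ℤ ≤ w
    0≤w = nn-by (solve 3 (λ v p a → v :+ p :* p :* a := (a :- (:- v)) :+ (p :* p :- # 1) :* a) refl v (+ p) (+ ∣ v ∣))
      (+-nn (≤⇒0≤ (∣x∣≤⇒- {v} ℕP.≤-refl)) (*-nn (≤⇒0≤ (1≤-* 1≤p 1≤p)) (pos-nn ∣ v ∣)))
    r = rep ∣ w ∣
    X = proj₁ r
    Z = proj₁ (proj₂ r)
    l = K * + ∣ v ∣ - (+ p - k) * (c * c)
    value : X * X + m * (Z * Z) ≡ + p + + p * + p * l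
    value = trans (proj₂ (proj₂ r)) (trans (cong (λ z → K * z + k) (ℤP.0≤i⇒+∣i∣≡i 0≤w))
      (trans (solve 5 (λ K y k p a → K :* ((p :- k) :* y :* (# 2 :- K :* y) :+ p :* p :* a) :+ k :=
              (p :- k) :* ((K :* y) :* (# 2 :- K :* y)) :+ K :* (p :* p :* a) :+ k) refl K y k (+ p) (+ ∣ v ∣))
      (trans (cong (λ z → (+ p - k) * (z * (+ 2 - z)) + K * (+ p * + p * + ∣ v ∣) + k) Ky≡)
       (solve 5 (λ K c k p a → (p :- k) :* ((# 1 :+ c :* p) :* (# 2 :- (# 1 :+ c :* p))) :+ K :* (p :* p :* a) :+ k :=
              p :+ p :* p :* (K :* a :- (p :- k) :* (c :* c))) refl K c k (+ p) (+ ∣ v ∣)))))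
    p∤Z : ¬ + p ∣ᶻ Z
    p∤Z (z , Z≡) = contradiction-at (reduce (euclid X X (∣ᶻ-by
      (trans (solve 3 (λ X m Z → X :* X := (X :* X :+ m :* (Z :* Z)) :- m :* (Z :* Z)) refl X m Z)
      (cong₂ (λ a b → a - m * (b * b)) value Z≡))
           (1ℤ + + p * l - m * (z * z * + p) , solve 4 (λ p l m z → p :+ p :* p :* l :- m :* ((z :* p) :* (z :* p))
             := (# 1 :+ p :* l :- m :* (z :* z :* p)) :* p) refl (+ p) l m z))))
      where
      reduce : ∀ {A : Set} → A ⊎ A → A
      reduce = [ id , id ]′
      contradiction-at : + p ∣ᶻ X → ⊥
      contradiction-at (x , X≡) = p∤1 (x * x + m * (z * z) - l , *-cancelˡ (+ p) 1≤p
        (trans (trans (solve 2 (λ p l → p :* # 1 := (p :+ p :* p :* l) :- p :* p :* l) refl (+ p) l)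
          (cong (λ a → a - + p * + p * l) (trans (sym value) (cong₂ (λ a b → a * a + m * (b * b)) X≡ Z≡))))
          (solve 5 (λ p l m x z → (x :* p) :* (x :* p) :+ m :* ((z :* p) :* (z :* p)) :- p :* p :* l
            := p :* ((x :* x :+ m :* (z :* z) :- l) :* p)) refl (+ p) l m x z)))
    iZ = p∤⇒inverse Z p∤Z
    b = proj₁ iZ
    t = X * b
    t-good : + p ∣ᶻ t * t + m
    t-good = ∣ᶻ-by (solve 4 (λ X b m Z → (X :* b) :* (X :* b) :+ m
      := (b :* b) :* (X :* X :+ m :* (Z :* Z)) :+ :- ((m :* (Z :* b :+ # 1)) :* (Z :* b :- # 1))) refl X b m Z)
      (∣ᶻ-+ (∣ᶻ-*ˡ (b * b) (1ℤ + + p * l , trans value (solve 2 (λ p l → p :+ p :* p :* l := (# 1 :+ p :* l) :* p)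
        refl (+ p) l)))
            (∣ᶻ-neg (∣ᶻ-*ˡ (m * (Z * b + 1ℤ)) (proj₂ iZ))))

-- As `p` divides neither 2 nor `m`, the roots of `t² + m` modulo `p` are simple, which is the
-- hypothesis of Hensel's lemma.
LiftablePrime : ℤ → ℕ → Set
LiftablePrime m p = Prime p × ¬ + p ∣ᶻ + 2 × ¬ + p ∣ᶻ m × (∃ λ r → + p ∣ᶻ r * r + m)

-- Given t² + m = c n, the number t + n s is a root modulo p n exactly when
-- p divides c + 2 t s + n s².
lift-root : ∀ m p n → LiftablePrime m p → (∃ λ t → n ∣ᶻ t * t + m) → ∃ λ t → + p * n ∣ᶻ t * t + m
lift-root m p n (pr , p∤2 , p∤m , r , r-root) (t , c , t-root) = step (div? n)
  where
  P = + p
  div? : ∀ x → Dec (P ∣ᶻ x)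
  div? x with p ℕDiv.∣? ∣ x ∣
  ... | yes d = yes (∣⇒∣ᶻ d)
  ... | no d = no (λ h → d (∣ᶻ⇒∣ h))
  conclude : ∀ s → P ∣ᶻ c + + 2 * t * s + n * (s * s) → ∃ λ t → P * n ∣ᶻ t * t + m
  conclude s (q , e) = t + n * s , q , (begin
    (t + n * s) * (t + n * s) + m               ≡⟨ solve 4 (λ t n s m → (t :+ n :* s) :* (t :+ n :* s) :+ m
      := (t :* t :+ m) :+ n :* (# 2 :* t :* s :+ n :* (s :* s))) refl t n s m ⟩
    (t * t + m) + n * (+ 2 * t * s + n * (s * s)) ≡⟨ cong (λ z → z + n * (+ 2 * t * s + n * (s * s))) t-root ⟩
    c * n + n * (+ 2 * t * s + n * (s * s))     ≡⟨ solve 4 (λ c n t s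
      → c :* n :+ n :* (# 2 :* t :* s :+ n :* (s :* s)) := (c :+ # 2 :* t :* s :+ n :* (s :* s)) :* n) refl c n t s ⟩
    (c + + 2 * t * s + n * (s * s)) * n         ≡⟨ cong (_* n) e ⟩
    (q * P) * n                                 ≡⟨ solve 3 (λ q p n → (q :* p) :* n := q :* (p :* n)) refl q P n ⟩
    q * (P * n) ∎)
    where open ≡-Reasoning
  step : Dec (P ∣ᶻ n) → ∃ λ t → P * n ∣ᶻ t * t + m
  -- Hensel's lemma: modulo `p` the condition on `s` is linear, and its coefficient `2 t` is
  -- invertible since `p ∣ t` would give `p ∣ m`.
  step (yes p∣n) = conclude (- (c * w)) (∣ᶻ-by (solve 4 (λ c t w n
    → c :+ # 2 :* t :* (:- (c :* w)) :+ n :* ((:- (c :* w)) :* (:- (c :* w)))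
    := :- (c :* (# 2 :* t :* w :- # 1)) :+ (c :* w) :* (c :* w) :* n) refl c t w n)
      (∣ᶻ-+ (∣ᶻ-neg (∣ᶻ-*ˡ c (proj₂ iv))) (∣ᶻ-*ˡ ((c * w) * (c * w)) p∣n)))
    where
    p∤2t : ¬ P ∣ᶻ + 2 * t
    p∤2t h with euclid pr (+ 2) t h
    ... | inj₁ d = p∤2 d
    ... | inj₂ d = p∤m (∣ᶻ-by (trans (solve 2 (λ t m → m := (t :* t :+ m) :+ :- (t :* t)) refl t m)
      (cong (_+ - (t * t)) t-root)) (∣ᶻ-+ (∣ᶻ-*ˡ c p∣n) (∣ᶻ-neg (∣ᶻ-*ˡ t d))))
    iv = p∤⇒inverse pr (+ 2 * t) p∤2t
    w = proj₁ iv
  -- Chinese remainders: `s` is chosen so that `t + n s` is congruent to the known root `r` modulo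
  -- `p`.
  step (no p∤n) = conclude s (pick (euclid pr n (c + + 2 * t * s + n * (s * s)) (∣ᶻ-by
      (begin
        n * (c + + 2 * t * s + n * (s * s))  ≡⟨ solve 4 (λ c n t s → n :* (c :+ # 2 :* t :* s :+ n :* (s :* s))
          := c :* n :+ n :* (# 2 :* t :* s :+ n :* (s :* s))) refl c n t s ⟩
        c * n + n * (+ 2 * t * s + n * (s * s)) ≡⟨ cong (λ z → z + n * (+ 2 * t * s + n * (s * s))) (sym t-root) ⟩
        (t * t + m) + n * (+ 2 * t * s + n * (s * s)) ≡⟨ solve 5 (λ t m n w r
          → (t :* t :+ m) :+ n :* (# 2 :* t :* (w :* (r :- t)) :+ n :* ((w :* (r :- t)) :* (w :* (r :- t)))) :=
             (r :* r :+ m) :+ (r :- t) :* (t :+ n :* (w :* (r :- t)) :+ r) :* (n :* w :- # 1)) refl t m n w r ⟩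
        (r * r + m) + (r - t) * (t + n * s + r) * (n * w - 1ℤ) ∎)
      (∣ᶻ-+ r-root (∣ᶻ-*ˡ ((r - t) * (t + n * s + r)) (proj₂ iv))))))
    where
    open ≡-Reasoning
    iv = p∤⇒inverse pr n p∤n
    w = proj₁ iv
    s = w * (r - t)
    pick : P ∣ᶻ n ⊎ P ∣ᶻ (c + + 2 * t * s + n * (s * s)) → P ∣ᶻ (c + + 2 * t * s + n * (s * s))
    pick (inj₁ d) = ⊥-elim (p∤n d)
    pick (inj₂ d) = d

-- A prime may occur several times in the list, which is why lifting has to treat `p ∣ n` as well.
root-modulo-product : ∀ m ps → All (LiftablePrime m) ps → ∃ λ t → + product ps ∣ᶻ t * t + m
root-modulo-product m [] [] = 0ℤ , 0ℤ * 0ℤ + m , solve 1 (λ x → x := x :* # 1) refl _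
root-modulo-product m (p ∷ ps) (g ∷ gs) with lift-root m p (+ product ps) g (root-modulo-product m ps gs)
... | t , h = t , subst (_∣ᶻ t * t + m) (sym (pos-* p (product ps))) h

-- Gauss's lemma, with signs as Booleans and their product as a parity

parity : (ℕ → Bool) → ℕ → Bool
parity f zero = false
parity f (suc n) = f 0 xor parity (λ j → f (suc j)) n

parity-sum : ∀ (f : ℕ → Bool) n → sum {n} (λ i → f (toℕ i)) ≡ parity f n
parity-sum f zero = refl
parity-sum f (suc n) = cong (f 0 xor_) (parity-sum (λ j → f (suc j)) n)

parity-cong : ∀ {f g : ℕ → Bool} n → (∀ j → suc j ℕ.≤ n → f j ≡ g j) → parity f n ≡ parity g n
parity-cong zero h = refl
parity-cong (suc n) h = cong₂ _xor_ (h 0 (s≤s z≤n)) (parity-cong n (λ j p → h (suc j) (s≤s p)))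

parity-+ : ∀ (f : ℕ → Bool) a b → parity f (a ℕ.+ b) ≡ parity f a xor parity (λ j → f (a ℕ.+ j)) b
parity-+ f zero b = refl
parity-+ f (suc a) b = trans (cong (f 0 xor_) (parity-+ (λ j → f (suc j)) a b)) (sym (BoolP.xor-assoc (f 0) _ _))

parity-constant : ∀ b k → parity (λ _ → b) (k ℕ.+ k) ≡ false
parity-constant b k = trans (parity-+ (λ _ → b) k k) (BoolP.xor-same (parity (λ _ → b) k))

-- Each block has even length and a constant value, so it contributes nothing.
parity-blocks : ∀ (f : ℕ → Bool) (e : ℕ → Bool) k m → (∀ i l → suc i ℕ.≤ m → suc l ℕ.≤ k ℕ.+ k
  → f (i ℕ.* (k ℕ.+ k) ℕ.+ l) ≡ e i) →
  parity f (m ℕ.* (k ℕ.+ k)) ≡ false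
parity-blocks f e k zero h = refl
parity-blocks f e k (suc m) h = trans (parity-+ f (k ℕ.+ k) (m ℕ.* (k ℕ.+ k)))
  (cong₂ _xor_ (trans (parity-cong (k ℕ.+ k) (λ l p → h 0 l (s≤s z≤n) p)) (parity-constant (e 0) k))
    (parity-blocks (λ j → f ((k ℕ.+ k) ℕ.+ j)) (λ i → e (suc i)) k m
      (λ i l p q → trans (cong f (sym (ℕP.+-assoc (k ℕ.+ k) (i ℕ.* (k ℕ.+ k)) l))) (h (suc i) l (s≤s p) q))))

signed : Bool → ℤ → ℤ
signed false x = x
signed true x = - x

signed-xor : ∀ a b x → signed a (signed b x) ≡ signed (a xor b) x
signed-xor false b x = refl
signed-xor true false x = refl
signed-xor true true x = solve 1 (λ x → :- (:- x) := x) refl x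

signed-* : ∀ b x y → x * signed b y ≡ signed b (x * y)
signed-* false x y = refl
signed-* true x y = solve 2 (λ x y → x :* (:- y) := :- (x :* y)) refl x y

small-multiple : ∀ {n x} → + n ∣ᶻ x → suc ∣ x ∣ ℕ.≤ n → x ≡ 0ℤ
small-multiple {n} {x} h lt with ∣ x ∣ in e
... | zero = ℤP.∣i∣≡0⇒i≡0 e
... | suc k = ⊥-elim (ℕP.<-irrefl refl (ℕP.≤-trans lt (ℕDiv.∣⇒≤ (subst (n ℕDiv.∣_) e (∣ᶻ⇒∣ h)))))

-- Gauss's lemma for the odd modulus n = 2H + 1, with 0 adjoined to the half system {1,…,H}.
module HalfSystem (H : ℕ) where

  n : ℕ
  n = suc (H ℕ.+ H)

  infix 4 _≋_
  _≋_ : ℤ → ℤ → Set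
  x ≋ y = + n ∣ᶻ x - y

  ≋-by : ∀ {x y z} → x ≋ y → y ≋ z → x ≋ z
  ≋-by {x} {y} {z} p q = ∣ᶻ-by (solve 3 (λ x y z → x :- z := (x :- y) :+ (y :- z)) refl x y z) (∣ᶻ-+ p q)

  ≋-sym : ∀ {x y} → x ≋ y → y ≋ x
  ≋-sym {x} {y} p = ∣ᶻ-by (solve 2 (λ x y → y :- x := :- (x :- y)) refl x y) (∣ᶻ-neg p)

  ≋-* : ∀ {x y} c → x ≋ y → c * x ≋ c * y
  ≋-* {x} {y} c p = ∣ᶻ-by (solve 3 (λ x y c → c :* x :- c :* y := c :* (x :- y)) refl x y c) (∣ᶻ-*ˡ c p)

  ≋-signed : ∀ {x y} b → x ≋ y → signed b x ≋ signed b y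
  ≋-signed false p = p
  ≋-signed {x} {y} true p = ∣ᶻ-by (solve 2 (λ x y → :- x :- :- y := :- (x :- y)) refl x y) (∣ᶻ-neg p)

  -- The absolutely least residue, split into sign and size. The last clause gives 0 a fixed sign,
  -- without which the reduction would not be unique.
  IsReduction : ℤ → Bool → ℕ → Set
  IsReduction x b j = j ℕ.≤ H × x ≋ signed b (+ j) × (j ≡ 0 → b ≡ false)

  reduction : ∀ x → ∃ λ b → ∃ λ j → IsReduction x b j
  reduction x with div-mod x n (s≤s z≤n)
  ... | q , r , e , r< with r ℕ.≤? H
  ...   | yes p = false , r , p , (q , trans (cong (_- + r) e)
    (solve 3 (λ r q n → r :+ q :* n :- r := q :* n) refl (+ r) q (+ n))) , λ _ → refl
  ...   | no p = true , n ℕ.∸ r , le , (q + 1ℤ , trans (cong₂ (λ a b → a - - b) e (n∸r))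
    (solve 3 (λ r q n → r :+ q :* n :- (:- (n :- r)) := (q :+ # 1) :* n) refl (+ r) q (+ n)))
            , λ h → ⊥-elim (ℕP.<⇒≱ r< (ℕP.m∸n≡0⇒m≤n h))
    where
    n∸r : + (n ℕ.∸ r) ≡ + n - + r
    n∸r = trans (solve 2 (λ a r → a := (a :+ r) :- r) refl (+ (n ℕ.∸ r)) (+ r))
      (cong (_- + r) (trans (sym (pos-+ (n ℕ.∸ r) r)) (cong +_ (ℕP.m∸n+n≡m (ℕP.<⇒≤ r<)))))
    le : n ℕ.∸ r ℕ.≤ H
    le = ℕP.≤-trans (ℕP.∸-monoʳ-≤ n (ℕP.≰⇒> p)) (ℕP.≤-reflexive (ℕP.m+n∸n≡m H H))

  sign : ℤ → Bool
  sign x = proj₁ (reduction x)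

  residue : ℤ → ℕ
  residue x = proj₁ (proj₂ (reduction x))

  is-reduction : ∀ x → IsReduction x (sign x) (residue x)
  is-reduction x = proj₂ (proj₂ (reduction x))

  reduction-unique : ∀ {x b j b′ j′} → IsReduction x b j → IsReduction x b′ j′ → b ≡ b′ × j ≡ j′
  reduction-unique {x} {b} {j} {b′} {j′} (p , c , z) (p′ , c′ , z′) = go b b′ (≋-by (≋-sym c) c′) z z′
    where
    lt : suc (j ℕ.+ j′) ℕ.≤ n
    lt = s≤s (ℕP.+-mono-≤ p p′)
    same : ∀ {b} → + j ≋ + j′ → b ≡ b × j ≡ j′
    same h = refl , ℤP.+-injective (trans (solve 2 (λ x y → x := (x :- y) :+ y) refl (+ j) (+ j′))
      (trans (cong (_+ + j′) (small-multiple h (ℕP.≤-trans (s≤s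
        (ℕP.≤-trans (∣+∣ (+ j) (- + j′)) (ℕP.≤-reflexive (cong (j ℕ.+_) (∣neg∣ (+ j′)))))) lt)))
        (solve 1 (λ y → # 0 :+ y := y) refl (+ j′))))
    opposite : + n ∣ᶻ + j + + j′ → j ≡ 0 × j′ ≡ 0
    opposite h = ℕP.m+n≡0⇒m≡0 j e , ℕP.m+n≡0⇒n≡0 j e
      where
      e : j ℕ.+ j′ ≡ 0
      e = ℤP.+-injective (small-multiple (subst (+ n ∣ᶻ_) (sym (pos-+ j j′)) h) lt)
    go : ∀ b b′ → signed b (+ j) ≋ signed b′ (+ j′) → (j ≡ 0 → b ≡ false) → (j′ ≡ 0 → b′ ≡ false) → b ≡ b′ × j ≡ j′
    go false false h _ _ = same h
    go true true h _ _ = same (∣ᶻ-by (solve 2 (λ x y → x :- y := :- (:- x :- :- y)) refl (+ j) (+ j′)) (∣ᶻ-neg h))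
    go false true h _ z′ with opposite (∣ᶻ-by (solve 2 (λ x y → x :+ y := x :- :- y) refl (+ j) (+ j′)) h)
    ... | _ , e with z′ e
    ...   | ()
    go true false h z _ with opposite (∣ᶻ-by (solve 2 (λ x y → x :+ y := :- (:- x :- y)) refl (+ j) (+ j′))
      (∣ᶻ-neg h))
    ... | e , _ with z e
    ...   | ()

  reduced : ∀ {x b j} → IsReduction x b j → sign x ≡ b × residue x ≡ j
  reduced {x} h = reduction-unique (is-reduction x) h

  sign-cong : ∀ {x y} → x ≋ y → sign x ≡ sign y
  sign-cong {x} {y} h = proj₁ (reduced (proj₁ r , ≋-by h (proj₁ (proj₂ r)) , proj₂ (proj₂ r)))
    where r = is-reduction y

  residue≤ : ∀ x → suc (residue x) ℕ.≤ suc H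
  residue≤ x = s≤s (proj₁ (is-reduction x))

  act : ℤ → Fin (suc H) → Fin (suc H)
  act t i = fromℕ< (residue≤ (t * + toℕ i))

  toℕ-act : ∀ t i → toℕ (act t i) ≡ residue (t * + toℕ i)
  toℕ-act t i = FinP.toℕ-fromℕ< _

  module _ (t t′ : ℤ) (inverse : t′ * t ≋ 1ℤ) where

    undo : ∀ y → t′ * (t * y) ≋ y
    undo y = ∣ᶻ-by (solve 3 (λ t s y → s :* (t :* y) :- y := y :* (s :* t :- # 1)) refl t t′ y) (∣ᶻ-*ˡ y inverse)

    residue-zero : ∀ j → residue (t * + j) ≡ 0 → + j ≋ 0ℤ
    residue-zero j e = ≋-by (≋-sym (undo (+ j))) (≋-by (≋-* t′ z)
      (0ℤ , solve 2 (λ s n → s :* # 0 :- # 0 := # 0 :* n) refl t′ (+ n)))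
      where
      r = is-reduction (t * + j)
      z : t * + j ≋ 0ℤ
      z = subst₂ (λ b k → t * + j ≋ signed b (+ k)) (proj₂ (proj₂ r) e) e (proj₁ (proj₂ r))

    act-inverse : ∀ i → act t′ (act t i) ≡ i
    act-inverse i = FinP.toℕ-injective (trans (toℕ-act t′ (act t i))
      (trans (cong (λ k → residue (t′ * + k)) (toℕ-act t i)) (proj₂ (reduced red))))
      where
      j = toℕ i
      b = sign (t * + j)
      k = residue (t * + j)
      r = is-reduction (t * + j)
      red : IsReduction (t′ * + k) b j
      red = ℕP.≤-pred (FinP.toℕ<n i)
          , subst (_≋ signed b (+ j)) (trans (signed-xor b b (t′ * + k))
            (cong (λ c → signed c (t′ * + k)) (BoolP.xor-same b)))
              (≋-signed b (≋-by (≋-sym (subst (t′ * (t * + j) ≋_) (signed-* b t′ (+ k)) (≋-* t′ (proj₁ (proj₂ r)))))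
                (undo (+ j))))
          , λ j≡0 → trans (sign-cong (subst (λ w → t * + w ≋ 0ℤ) (sym j≡0)
            (0ℤ , solve 2 (λ t n → t :* # 0 :- # 0 := # 0 :* n) refl t (+ n))))
            (proj₁ (reduced (z≤n , (0ℤ , solve 1 (λ n → # 0 :- # 0 := # 0 :* n) refl (+ n)) , λ _ → refl)))

    -- If `t j` reduces to `± k`, then `t (t j)` reduces to the same sign times the reduction of
    -- `t k`. If the latter is 0, so is `k` by invertibility, and both signs are positive by
    -- convention.
    sign-square : ∀ j → sign (t * (t * + j)) ≡ sign (t * + j) xor sign (t * + residue (t * + j))
    sign-square j = proj₁ (reduced {b = b xor b₁} {j = k₁}
        ( proj₁ r₁
        , ≋-by (subst (t * (t * + j) ≋_) (signed-* b t (+ k)) (≋-* t (proj₁ (proj₂ r))))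
               (subst (signed b (t * + k) ≋_) (signed-xor b b₁ (+ k₁)) (≋-signed b (proj₁ (proj₂ r₁))))
        , λ e → cong₂ _xor_ (proj₂ (proj₂ r) (k≡0 e)) (proj₂ (proj₂ r₁) e)))
      where
      b = sign (t * + j)
      k = residue (t * + j)
      r = is-reduction (t * + j)
      b₁ = sign (t * + k)
      k₁ = residue (t * + k)
      r₁ = is-reduction (t * + k)
      k≡0 : k₁ ≡ 0 → k ≡ 0
      k≡0 e = proj₂ (reduction-unique {+ k} {false} {k} {false} {0}
        (proj₁ r , (0ℤ , solve 2 (λ x n → x :- x := # 0 :* n) refl (+ k) (+ n)) , λ _ → refl)
        (z≤n , residue-zero k e , λ _ → refl))

  -- `act t` permutes the half system, so the signs of `t * j` and those of `t * act t j` have the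
  -- same parity and cancel.
  square-signs-even : ∀ t t′ → t′ * t ≋ 1ℤ → parity (λ j → sign (t * (t * + j))) (suc H) ≡ false
  square-signs-even t t′ inv = trans (sym (parity-sum (λ j → sign (t * (t * + j))) (suc H)))
    (trans (sum-cong-≗ (λ i → trans (sign-square t t′ inv (toℕ i))
      (cong (λ k → sign (t * + toℕ i) xor sign (t * + k)) (sym (toℕ-act t i)))))
    (trans (∑-distrib-+ f (λ i → f (act t i)))
    (trans (cong (_xor sum (λ i → f (act t i))) (sum-permute f
      (permutation (act t) (act t′) (act-inverse t′ t inv′) (act-inverse t t′ inv))))
      (BoolP.xor-same (sum (λ i → f (act t i)))))))
    where
    f : Fin (suc H) → Bool
    f i = sign (t * + toℕ i)
    inv′ : t * t′ ≋ 1ℤ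
    inv′ = ∣ᶻ-by (solve 2 (λ t s → t :* s :- # 1 := s :* t :- # 1) refl t t′) inv

even : ℕ → Bool
even zero = true
even (suc i) = not (even i)

even-or-odd : ∀ i → (∃ λ h → i ≡ h ℕ.+ h × even i ≡ true) ⊎ (∃ λ h → i ≡ suc (h ℕ.+ h) × even i ≡ false)
even-or-odd zero = inj₁ (0 , refl , refl)
even-or-odd (suc i) with even-or-odd i
... | inj₁ (h , e , b) = inj₂ (h , cong suc e , cong not b)
... | inj₂ (h , e , b) = inj₁ (suc h , cong suc (trans e (sym (ℕP.+-suc h h))) , cong not b)

-- For n = 2H + 1 = 4mk - 1, the sign of - m j is negative exactly when ⌊ j / 2k ⌋ is even and
-- j ≠ 0, which happens an odd number of times for 0 ≤ j ≤ H.
-m-nonresidue : ∀ m k H → suc H ≡ m ℕ.* (k ℕ.+ k) → ∀ t → ¬ + suc (H ℕ.+ H) ∣ᶻ t * t + + m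
-m-nonresidue m k H size t root = bad (trans (sym odd-count) even-count)
  where
  open HalfSystem H
  bad : true ≡ false → ⊥
  bad ()
  sizeℤ : + m * (+ k + + k) ≡ 1ℤ + + H
  sizeℤ = trans (cong (+ m *_) (sym (pos-+ k k))) (trans (sym (pos-* m (k ℕ.+ k)))
    (trans (cong +_ (sym size)) (pos-+ 1 H)))
  n≡ : + n ≡ 1ℤ + (+ H + + H)
  n≡ = trans (pos-+ 1 (H ℕ.+ H)) (cong (_+_ 1ℤ) (pos-+ H H))
  -- Modulo `n = 4 m k - 1` the product `4 k m` is 1, so `t² = - m` makes `- 4 k t` an inverse of
  -- `t`.
  t′ : ℤ
  t′ = - (+ 4 * + k * t)
  inv : t′ * t ≋ 1ℤ
  inv = ∣ᶻ-by (solve 3 (λ k t m → (:- (# 4 :* k :* t)) :* t :- # 1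
    := (:- (# 4 :* k)) :* (t :* t :+ m) :+ (# 2 :* (m :* (k :+ k)) :- # 1)) refl (+ k) t (+ m))
    (∣ᶻ-+ (∣ᶻ-*ˡ (- (+ 4 * + k)) root)
      (1ℤ , trans (cong (λ z → + 2 * z - 1ℤ) sizeℤ) (trans (solve 1 (λ h → # 2 :* (# 1 :+ h) :- # 1
        := # 1 :* (# 1 :+ (h :+ h))) refl (+ H)) (cong (1ℤ *_) (sym n≡)))))
  f : ℕ → Bool
  f j = sign (t * (t * + j))
  f≡ : ∀ {j b i} → IsReduction (- + m * + j) b i → f j ≡ b
  f≡ {j} h = trans (sign-cong (∣ᶻ-by (solve 3 (λ t m j → t :* (t :* j) :- (:- m) :* j := j :* (t :* t :+ m)) refl t
    (+ m) (+ j)) (∣ᶻ-*ˡ (+ j) root))) (proj₁ (reduced h))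
  even-count : parity f (suc H) ≡ false
  even-count = square-signs-even t t′ inv
  f0 : f 0 ≡ false
  f0 = f≡ {0} (z≤n , (0ℤ , solve 2 (λ m n → (:- m) :* # 0 :- # 0 := # 0 :* n) refl (+ m) (+ n)) , λ _ → refl)
  -- The first block consists of negative signs except at 0, whose sign is positive. Flipping that
  -- one value makes all blocks constant and the parity even, so `f` itself has odd parity.
  g : ℕ → Bool
  g zero = true
  g (suc j) = f (suc j)
  bound : ∀ {i l} h → suc h ℕ.≤ m → suc l ℕ.≤ k ℕ.+ k → h ℕ.+ m ℕ.* l ℕ.≤ H
  bound {i} {l} h p q = ℕP.≤-pred (ℕP.≤-trans (ℕP.+-monoˡ-≤ (m ℕ.* l) p)
    (ℕP.≤-trans (ℕP.≤-reflexive (sym (ℕP.*-suc m l)))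
      (ℕP.≤-trans (ℕP.*-monoʳ-≤ m q) (ℕP.≤-reflexive (sym size)))))
  pos-block : ∀ c l → + (c ℕ.* (k ℕ.+ k) ℕ.+ l) ≡ + c * (+ k + + k) + + l
  pos-block c l = trans (pos-+ (c ℕ.* (k ℕ.+ k)) l) (cong (_+ + l)
    (trans (pos-* c (k ℕ.+ k)) (cong (+ c *_) (pos-+ k k))))
  pos-offset : ∀ h l → + (h ℕ.+ m ℕ.* l) ≡ + h + + m * + l
  pos-offset h l = trans (pos-+ h (m ℕ.* l)) (cong (_+_ (+ h)) (pos-* m l))
  -- From `m (2 k) = H + 1` and `2 (H + 1) = n + 1`, the residue of `- m j` at offset `l` is
  -- `- (h + m l)` in block `2 h` and `H - (h + m l)` in block `2 h + 1`.
  block-value : ∀ i l → suc i ℕ.≤ m → suc l ℕ.≤ k ℕ.+ k → 1 ℕ.≤ i ℕ.* (k ℕ.+ k) ℕ.+ l → f (i ℕ.* (k ℕ.+ k) ℕ.+ l)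
    ≡ even i
  block-value i l p q j>0 with even-or-odd i
  ... | inj₁ (h , refl , e) = trans (f≡ {(h ℕ.+ h) ℕ.* (k ℕ.+ k) ℕ.+ l} {true} {h ℕ.+ m ℕ.* l}
          ( bound {i} h (ℕP.≤-trans (s≤s (ℕP.m≤m+n h h)) p) q
          , (- + h , trans (cong₂ (λ a b → - + m * a - - b) (trans (pos-block (h ℕ.+ h) l)
            (cong (λ c → c * (+ k + + k) + + l) (pos-+ h h))) (pos-offset h l))
               (trans (solve 4 (λ m h k l → (:- m) :* ((h :+ h) :* (k :+ k) :+ l) :- (:- (h :+ m :* l))
                 := h :- # 2 :* h :* (m :* (k :+ k))) refl (+ m) (+ h) (+ k) (+ l))
               (trans (cong (λ z → + h - + 2 * + h * z) sizeℤ)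
                 (trans (solve 2 (λ h H → h :- # 2 :* h :* (# 1 :+ H) := (:- h) :* (# 1 :+ (H :+ H))) refl (+ h)
                 (+ H)) (cong (- + h *_) (sym n≡))))))
          , λ z → ⊥-elim (nonzero h l j>0 z))) (sym e)
    where
    m≥1 : 1 ℕ.≤ m
    m≥1 = ℕP.≤-trans (s≤s z≤n) p
    nonzero : ∀ h l → 1 ℕ.≤ (h ℕ.+ h) ℕ.* (k ℕ.+ k) ℕ.+ l → h ℕ.+ m ℕ.* l ≡ 0 → ⊥
    nonzero zero zero () _
    nonzero zero (suc l) _ z = ℕP.<⇒≢ m≥1 (sym (ℕP.m+n≡0⇒m≡0 m (trans (sym (ℕP.*-suc m l)) z)))
    nonzero (suc h) l _ ()
  ... | inj₂ (h , refl , e) = trans (f≡ {suc (h ℕ.+ h) ℕ.* (k ℕ.+ k) ℕ.+ l} {false} {H ℕ.∸ (h ℕ.+ m ℕ.* l)}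
          ( ℕP.m∸n≤m H (h ℕ.+ m ℕ.* l)
          , (- (+ h + 1ℤ) , trans (cong₂ (λ a b → - + m * a - b)
            (trans (pos-block (suc (h ℕ.+ h)) l) (cong (λ c → c * (+ k + + k) + + l)
            (trans (pos-+ 1 (h ℕ.+ h)) (cong (_+_ 1ℤ) (pos-+ h h))))) diff)
               (trans (solve 5 (λ m h k l H → (:- m) :* ((# 1 :+ (h :+ h)) :* (k :+ k) :+ l) :- (H :- (h :+ m :* l))
                 := h :- H :- (# 1 :+ (h :+ h)) :* (m :* (k :+ k))) refl (+ m) (+ h) (+ k) (+ l) (+ H))
               (trans (cong (λ z → + h - + H - (1ℤ + (+ h + + h)) * z) sizeℤ)
                 (trans (solve 2 (λ h H → h :- H :- (# 1 :+ (h :+ h)) :* (# 1 :+ H)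
                 := (:- (h :+ # 1)) :* (# 1 :+ (H :+ H))) refl (+ h) (+ H)) (cong (- (+ h + 1ℤ) *_) (sym n≡))))))
          , λ _ → refl)) (sym e)
    where
    b : h ℕ.+ m ℕ.* l ℕ.≤ H
    b = bound {i} h (ℕP.≤-trans (s≤s (ℕP.≤-trans (ℕP.m≤m+n h h) (ℕP.n≤1+n _))) p) q
    diff : + (H ℕ.∸ (h ℕ.+ m ℕ.* l)) ≡ + H - (+ h + + m * + l)
    diff = trans (solve 2 (λ a r → a := (a :+ r) :- r) refl (+ (H ℕ.∸ (h ℕ.+ m ℕ.* l))) (+ (h ℕ.+ m ℕ.* l)))
      (cong₂ _-_ (trans (sym (pos-+ (H ℕ.∸ (h ℕ.+ m ℕ.* l)) (h ℕ.+ m ℕ.* l))) (cong +_ (ℕP.m∸n+n≡m b)))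
        (pos-offset h l))
  g-block : ∀ i l → suc i ℕ.≤ m → suc l ℕ.≤ k ℕ.+ k → g (i ℕ.* (k ℕ.+ k) ℕ.+ l) ≡ even i
  g-block i l p q with i ℕ.* (k ℕ.+ k) ℕ.+ l in e
  ... | suc j = trans (cong f (sym e)) (block-value i l p q (subst (1 ℕ.≤_) (sym e) (s≤s z≤n)))
  ... | zero with ℕP.m*n≡0⇒m≡0∨n≡0 i (ℕP.m+n≡0⇒m≡0 (i ℕ.* (k ℕ.+ k)) e)
  ...   | inj₁ refl = refl
  ...   | inj₂ z = ⊥-elim (ℕP.<⇒≱ q (subst (ℕ._≤ l) (sym z) z≤n))
  odd-count : parity f (suc H) ≡ true
  odd-count = trans (cong (_xor parity (λ j → f (suc j)) H) f0)
    (trans (sym (BoolP.not-involutive (parity (λ j → f (suc j)) H)))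
      (cong not (trans (cong (parity g) size) (parity-blocks g even k m g-block))))

-- If every k + K n is represented, then - m is a square modulo every prime not dividing K, hence
-- modulo 4 m K - 1.
¬quadratic-form-covers-progression : ∀ (m K : ℕ) (k : ℤ) → 1 ℕ.≤ m → 1 ℕ.≤ K →
  ¬ (∀ n → ∃ λ X → ∃ λ Z → X * X + + m * (Z * Z) ≡ + K * + n + k)
¬quadratic-form-covers-progression m K k 1≤m 1≤K rep = -m-nonresidue m K H size (proj₁ root)
  (subst (λ w → + w ∣ᶻ proj₁ root * proj₁ root + + m) (sym (PrimeFactorisation.isFactorisation fac)) (proj₂ root))
  where
  H = m ℕ.* (K ℕ.+ K) ℕ.∸ 1
  size : suc H ≡ m ℕ.* (K ℕ.+ K)
  size = ℕP.m+[n∸m]≡n {1} (ℕP.*-mono-≤ 1≤m (ℕP.≤-trans 1≤K (ℕP.m≤m+n K K)))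
  n = suc (H ℕ.+ H)
  fac = factorise n
  n≡ : + 1 ≡ + 4 * (+ m * + K) + - + n
  n≡ = trans (solve 2 (λ h x → # 1 := # 2 :* (# 1 :+ h) :+ (:- (# 1 :+ (h :+ h)))) refl (+ H) (+ n))
     (cong₂ (λ a b → a + - b)
        (trans (cong (+ 2 *_) (trans (sym (pos-+ 1 H)) (trans (cong +_ size)
          (trans (pos-* m (K ℕ.+ K)) (cong (+ m *_) (pos-+ K K))))))
           (solve 2 (λ m k → # 2 :* (m :* (k :+ k)) := # 4 :* (m :* k)) refl (+ m) (+ K)))
        (sym (trans (pos-+ 1 (H ℕ.+ H)) (cong (_+_ 1ℤ) (pos-+ H H)))))
  good : ∀ {p} → p ∈ PrimeFactorisation.factors fac → LiftablePrime (+ m) p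
  good {p} mem = pr , no2 , nom , progression⇒residue pr (+ m) (+ K) k rep noK
    where
    pr : Prime p
    pr = All.lookup (PrimeFactorisation.factorsPrime fac) mem
    p∣n : + p ∣ᶻ + n
    p∣n = ∣⇒∣ᶻ (subst (p ℕDiv.∣_) (sym (PrimeFactorisation.isFactorisation fac)) (∈⇒∣product mem))
    -- Consecutive numbers: `p` divides `n = 4 m K - 1`. All coprimality conditions on `p` follow
    -- from this one.
    p∤4mK : ¬ + p ∣ᶻ + 4 * (+ m * + K)
    p∤4mK h = p∤1 pr (∣ᶻ-by n≡ (∣ᶻ-+ h (∣ᶻ-neg p∣n)))
    no2 : ¬ + p ∣ᶻ + 2
    no2 h = p∤4mK (∣ᶻ-by (solve 2 (λ m k → # 4 :* (m :* k) := # 2 :* (m :* k) :* # 2) refl (+ m) (+ K))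
      (∣ᶻ-*ˡ (+ 2 * (+ m * + K)) h))
    nom : ¬ + p ∣ᶻ + m
    nom h = p∤4mK (∣ᶻ-by (solve 2 (λ m k → # 4 :* (m :* k) := # 4 :* k :* m) refl (+ m) (+ K)) (∣ᶻ-*ˡ (+ 4 * + K) h))
    noK : ¬ + p ∣ᶻ + K
    noK h = p∤4mK (∣ᶻ-by (solve 2 (λ m k → # 4 :* (m :* k) := # 4 :* m :* k) refl (+ m) (+ K)) (∣ᶻ-*ˡ (+ 4 * + m) h))
  root = root-modulo-product (+ m) (PrimeFactorisation.factors fac) (All.tabulate good)

-- Pell's equation

0≤⇒pos : ∀ {x} → 0ℤ ≤ x → ∃ λ n → x ≡ + n
0≤⇒pos (+≤+ {n = n} _) = n , refl

NonSquare : ℤ → Set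
NonSquare D = ∀ p q → p * p ≡ D * (q * q) → q ≡ 0ℤ

-- This adds `u ≤ q √D` and `v ≤ i √D` with the surd squared away; the mixed term needs
-- `u v ≤ D q i`, again compared through squares.
sum-below : ∀ D {u q v i} → 0ℤ ≤ D → 0ℤ ≤ u → 0ℤ ≤ q → 0ℤ ≤ v → 0ℤ ≤ i → u * u ≤ D * (q * q) → v * v ≤ D * (i * i) →
  (u + v) * (u + v) ≤ D * ((q + i) * (q + i))
sum-below D {u} {q} {v} {i} 0≤D 0≤u 0≤q 0≤v 0≤i hu hv = ≤-by
  (solve 5 (λ D u q v i → D :* ((q :+ i) :* (q :+ i)) :- (u :+ v) :* (u :+ v)
    := (D :* (q :* q) :- u :* u) :+ (D :* (i :* i) :- v :* v) :+ # 2 :* (D :* (q :* i) :- u :* v)) refl D u q v i)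
  (+-nn (+-nn (≤⇒0≤ hu) (≤⇒0≤ hv)) (*-nn (pos-nn 2) (≤⇒0≤ (sq-cancel-≤ (*-nn 0≤D (*-nn 0≤q 0≤i)) (≤-by
    (solve 5 (λ D u q v i → D :* (q :* i) :* (D :* (q :* i)) :- u :* v :* (u :* v)
      := (D :* (q :* q) :- u :* u) :* (D :* (i :* i)) :+ (u :* u) :* (D :* (i :* i) :- v :* v)) refl D u q v i)
    (+-nn (*-nn (≤⇒0≤ hu) (*-nn 0≤D (sq-nn i))) (*-nn (sq-nn u) (≤⇒0≤ hv))))))))

sum-above : ∀ D {u q v i} → 0ℤ ≤ D → 0ℤ ≤ u → 0ℤ ≤ q → 0ℤ ≤ v → 0ℤ ≤ i → 1ℤ + D * (q * q) ≤ u * u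
  → 1ℤ + D * (i * i) ≤ v * v →
  1ℤ + D * ((q + i) * (q + i)) ≤ (u + v) * (u + v)
sum-above D {u} {q} {v} {i} 0≤D 0≤u 0≤q 0≤v 0≤i hu hv = ≤-by
  (solve 5 (λ D u q v i → (u :+ v) :* (u :+ v) :- (# 1 :+ D :* ((q :+ i) :* (q :+ i)))
    := (u :* u :- (# 1 :+ D :* (q :* q))) :+ (v :* v :- (# 1 :+ D :* (i :* i)))
    :+ (# 1 :+ # 2 :* (u :* v :- D :* (q :* i)))) refl D u q v i)
  (+-nn (+-nn (≤⇒0≤ hu) (≤⇒0≤ hv)) (+-nn (pos-nn 1) (*-nn (pos-nn 2) (≤⇒0≤ (sq-cancel-≤ (*-nn 0≤u 0≤v) (≤-by
    (solve 5 (λ D u q v i → u :* v :* (u :* v) :- D :* (q :* i) :* (D :* (q :* i))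
      := (u :* u :- (# 1 :+ D :* (q :* q)) :+ # 1) :* (D :* (i :* i)) :+ (u :* u)
      :* ((v :* v :- (# 1 :+ D :* (i :* i))) :+ # 1)) refl D u q v i)
    (+-nn (*-nn (+-nn (≤⇒0≤ hu) (pos-nn 1)) (*-nn 0≤D (sq-nn i))) (*-nn (sq-nn u) (+-nn (≤⇒0≤ hv) (pos-nn 1))))))))))

-- Dirichlet's pigeonhole argument: root N j approximates N j √D from below, and two
-- of the fractional parts of j √D for 0 ≤ j ≤ N fall into the same interval of length 1/N.
module Dirichlet (D : ℕ) (1≤D : 1 ℕ.≤ D) where

  Dℤ : ℤ
  Dℤ = + D

  root : ℕ → ℕ
  root x = proj₁ (isqrt (D ℕ.* (x ℕ.* x)))

  pos-D : ∀ x → + (D ℕ.* (x ℕ.* x)) ≡ Dℤ * (+ x * + x)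
  pos-D x = trans (pos-* D (x ℕ.* x)) (cong (Dℤ *_) (pos-* x x))

  root-lower : ∀ x → + root x * + root x ≤ Dℤ * (+ x * + x)
  root-lower x = subst₂ _≤_ (pos-* (root x) (root x)) (pos-D x) (+≤+ (proj₁ (proj₂ (isqrt (D ℕ.* (x ℕ.* x))))))

  root-upper : ∀ x → 1ℤ + Dℤ * (+ x * + x) ≤ (1ℤ + + root x) * (1ℤ + + root x)
  root-upper x = subst₂ _≤_ (trans (pos-+ 1 (D ℕ.* (x ℕ.* x))) (cong (_+_ 1ℤ) (pos-D x)))
    (trans (pos-* (suc (root x)) (suc (root x))) (cong₂ _*_ (pos-+ 1 (root x)) (pos-+ 1 (root x))))
    (+≤+ (proj₂ (proj₂ (isqrt (D ℕ.* (x ℕ.* x))))))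

  <-sq-cancel : ∀ {x y} → 0ℤ ≤ y → 1ℤ + x * x ≤ y * y → 1ℤ + x ≤ y
  <-sq-cancel {x} {y} 0≤y h with ≤-total y x
  ... | inj₂ p = p
  ... | inj₁ p = ⊥-elim (¬0≤-1 {(x * x - y * y)} (nn-by (solve 2 (λ x y → :- # 1 :- (x :* x :- y :* y)
    := y :* y :- (# 1 :+ x :* x)) refl x y) (≤⇒0≤ h))
      (nn-by (solve 2 (λ x y → x :* x :- y :* y := (x :- y) :* ((x :- y) :+ (y :+ y))) refl x y)
        (*-nn (≤⇒0≤ p) (+-nn (≤⇒0≤ p) (+-nn 0≤y 0≤y)))))

  N·p : ℕ → ℤ → ℤ
  N·p N p = + N * p

  -- P stands for N p, the difference of the roots of N j and N i.
  difference-bounds : ∀ N D′ Ai Aj q i P → 0ℤ ≤ N → 0ℤ ≤ D′ → 0ℤ ≤ Ai → 0ℤ ≤ Aj → 0ℤ ≤ i → 0ℤ ≤ q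
    → 1ℤ ≤ D′ * (q * q) →
    Ai * Ai ≤ D′ * (i * i) → 1ℤ + D′ * (i * i) ≤ (1ℤ + Ai) * (1ℤ + Ai) →
    Aj * Aj ≤ D′ * ((q + i) * (q + i)) → 1ℤ + D′ * ((q + i) * (q + i)) ≤ (1ℤ + Aj) * (1ℤ + Aj) →
    P ≡ Aj - Ai → 1ℤ ≤ P × 1ℤ + D′ * (q * q) ≤ (1ℤ + P) * (1ℤ + P) × (P - 1ℤ) * (P - 1ℤ) ≤ D′ * (q * q)
  difference-bounds N D′ Ai Aj q i P 0≤N 0≤D′ 0≤Ai 0≤Aj 0≤i 0≤q 1≤x lower-i upper-i lower-j upper-j P≡ = 1≤P , P-large
    , P-small
    where
    0≤1+P : 0ℤ ≤ 1ℤ + P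
    0≤1+P = nn-by (trans (cong (_+_ 1ℤ) P≡) (solve 2 (λ A B → # 1 :+ (A :- B) := ((# 1 :+ A) :- (# 1 :+ B)) :+ # 1)
      refl Aj Ai))
      (+-nn (≤⇒0≤ (<-sq-cancel (+-nn (pos-nn 1) 0≤Aj) (≤-by
        (solve 5 (λ A B D′ q i → (# 1 :+ A) :* (# 1 :+ A) :- (# 1 :+ B :* B)
          := ((# 1 :+ A) :* (# 1 :+ A) :- (# 1 :+ D′ :* ((q :+ i) :* (q :+ i)))) :+ (D′ :* (i :* i) :- B :* B) :+ D′
          :* (q :* (q :+ # 2 :* i))) refl Aj Ai D′ q i)
        (+-nn (+-nn (≤⇒0≤ upper-j) (≤⇒0≤ lower-i)) (*-nn 0≤D′ (*-nn 0≤q (+-nn 0≤q (*-nn (pos-nn 2) 0≤i))))))))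
          (pos-nn 1))
    P-large : 1ℤ + D′ * (q * q) ≤ (1ℤ + P) * (1ℤ + P)
    P-large with ≤-total ((1ℤ + P) * (1ℤ + P)) (D′ * (q * q))
    ... | inj₂ ok = ok
    ... | inj₁ bad = ⊥-elim (¬0≤-1 (nn-by (solve 2 (λ x y → :- # 1 :- (x :- y) := y :- (# 1 :+ x)) refl
      (D′ * ((q + i) * (q + i))) ((1ℤ + Aj) * (1ℤ + Aj))) (≤⇒0≤ upper-j))
        (≤⇒0≤ (subst (_≤ D′ * ((q + i) * (q + i))) (cong (λ w → w * w)
          (trans (cong (λ w → 1ℤ + w + Ai) P≡) (solve 2 (λ A B → # 1 :+ (A :- B) :+ B := # 1 :+ A) refl Aj Ai)))
           (sum-below D′ 0≤D′ 0≤1+P 0≤q 0≤Ai 0≤i bad lower-i))))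
    1≤P : 1ℤ ≤ P
    1≤P with 1≤-split P
    ... | inj₁ ok = ok
    ... | inj₂ neg = ⊥-elim (¬0≤-1 {0ℤ} (nn-by (solve 2 (λ P x → :- # 1 :- # 0
      := ((# 1 :+ P) :* (# 1 :+ P) :- (# 1 :+ x)) :+ (x :- # 1) :+ (# 1 :+ P) :* (# 0 :- P) :+ (# 0 :- P)) refl P
      (D′ * (q * q)))
        (+-nn (+-nn (+-nn (≤⇒0≤ P-large) (≤⇒0≤ 1≤x)) (*-nn 0≤1+P (≤⇒0≤ neg))) (≤⇒0≤ neg))) (pos-nn 0))
    P-small : (P - 1ℤ) * (P - 1ℤ) ≤ D′ * (q * q)
    P-small with ≤-total ((P - 1ℤ) * (P - 1ℤ)) (D′ * (q * q))
    ... | inj₁ ok = ok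
    ... | inj₂ bad = ⊥-elim (¬0≤-1 (nn-by (solve 2 (λ x y → :- # 1 :- (x :- y) := y :- (# 1 :+ x)) refl
      (D′ * ((q + i) * (q + i))) (Aj * Aj))
        (≤⇒0≤ (subst (1ℤ + D′ * ((q + i) * (q + i)) ≤_) (cong (λ w → w * w)
          (trans (cong (λ w → w - 1ℤ + (1ℤ + Ai)) P≡) (solve 2 (λ A B → A :- B :- # 1 :+ (# 1 :+ B) := A) refl Aj
          Ai)))
           (sum-above D′ 0≤D′ (≤⇒0≤ 1≤P) 0≤q (+-nn (pos-nn 1) 0≤Ai) 0≤i bad upper-i))))
        (≤⇒0≤ lower-j))

  -- The hypotheses say that `N p` is within 1 of `N q √D`. Multiplied out,
  -- `N² ∣ p² - D q² ∣ ≤ 2 N p`; one factor `N` cancels, and `p ≤ D q` because `2 ≤ N` absorbs the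
  -- rounding.
  norm-bound : ∀ N p q → 2 ℕ.≤ N → 1ℤ ≤ N·p N p → 1ℤ + (Dℤ * (+ N * + N)) * (+ q * + q) ≤ (1ℤ + N·p N p)
    * (1ℤ + N·p N p) →
    (N·p N p - 1ℤ) * (N·p N p - 1ℤ) ≤ (Dℤ * (+ N * + N)) * (+ q * + q)
      → N ℕ.* ∣ p * p - Dℤ * (+ q * + q) ∣ ℕ.≤ 2 ℕ.* (D ℕ.* q)
  norm-bound N p q 2≤N 1≤P large small = subst (ℕ._≤ 2 ℕ.* (D ℕ.* q)) (∣*∣ (+ N) e)
     (⇒∣x∣≤ (ℤP.≤-trans (*-cancel-≤ 1≤N Ne≤) 2p≤) (ℤP.≤-trans (*-cancel-≤ 1≤N -Ne≤) 2p≤))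
    where
    P = N·p N p
    e = p * p - Dℤ * (+ q * + q)
    1≤N : 1ℤ ≤ + N
    1≤N = +≤+ (ℕP.≤-trans (s≤s z≤n) 2≤N)
    *-cancel-≤ : ∀ {k x y} → 1ℤ ≤ k → k * x ≤ k * y → x ≤ y
    *-cancel-≤ {k} {x} {y} hk h = 0≤⇒≤ (*-cancelˡ-nn k hk (nn-by
      (solve 3 (λ k x y → k :* (y :- x) := k :* y :- k :* x) refl k x y) (≤⇒0≤ h)))
    Ne≤ : + N * (+ N * e) ≤ + N * (+ 2 * p)
    Ne≤ = ≤-by (solve 4 (λ N p D q → N :* (# 2 :* p) :- N :* (N :* (p :* p :- D :* (q :* q)))
      := ((D :* (N :* N)) :* (q :* q) :- (N :* p :- # 1) :* (N :* p :- # 1)) :+ # 1) refl (+ N) p Dℤ (+ q))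
        (+-nn (≤⇒0≤ small) (pos-nn 1))
    -Ne≤ : + N * (- (+ N * e)) ≤ + N * (+ 2 * p)
    -Ne≤ = ≤-by (solve 4 (λ N p D q → N :* (# 2 :* p) :- N :* (:- (N :* (p :* p :- D :* (q :* q))))
      := ((# 1 :+ N :* p) :* (# 1 :+ N :* p) :- (# 1 :+ (D :* (N :* N)) :* (q :* q)))) refl (+ N) p Dℤ (+ q))
        (≤⇒0≤ large)
    P-1≤ : P - 1ℤ ≤ Dℤ * (+ N * + q)
    P-1≤ = sq-cancel-≤ (*-nn (pos-nn D) (*-nn (pos-nn N) (pos-nn q))) (≤-by
       (solve 4 (λ P D N q → D :* (N :* q) :* (D :* (N :* q)) :- (P :- # 1) :* (P :- # 1)
         := ((D :* (N :* N)) :* (q :* q) :- (P :- # 1) :* (P :- # 1)) :+ D :* (D :- # 1) :* ((N :* N) :* (q :* q)))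
         refl P Dℤ (+ N) (+ q))
       (+-nn (≤⇒0≤ small) (*-nn (*-nn (pos-nn D) (≤⇒0≤ (+≤+ 1≤D))) (*-nn (sq-nn (+ N)) (sq-nn (+ q))))))
    p≤ : p ≤ Dℤ * + q
    p≤ with ≤-total p (Dℤ * + q)
    ... | inj₁ ok = ok
    ... | inj₂ bad = ⊥-elim (¬0≤-1 {0ℤ} (nn-by (solve 4 (λ N p D q → :- # 1 :- # 0
      := (D :* (N :* q) :- (N :* p :- # 1)) :+ N :* (p :- (# 1 :+ D :* q)) :+ (N :- # 2)) refl (+ N) p Dℤ (+ q))
         (+-nn (+-nn (≤⇒0≤ P-1≤) (*-nn (pos-nn N) (≤⇒0≤ bad))) (≤⇒0≤ (+≤+ 2≤N)))) (pos-nn 0))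
    2p≤ : + 2 * p ≤ + (2 ℕ.* (D ℕ.* q))
    2p≤ = subst (+ 2 * p ≤_) (sym (trans (pos-* 2 (D ℕ.* q)) (cong (+ 2 *_) (pos-* D q))))
       (≤-by (solve 3 (λ p D q → # 2 :* (D :* q) :- # 2 :* p := # 2 :* (D :* q :- p)) refl p Dℤ (+ q))
         (*-nn (pos-nn 2) (≤⇒0≤ p≤)))

  module _ (N : ℕ) (2≤N : 2 ℕ.≤ N) where

    private
      Nℤ = + N
      0≤N : 0ℤ ≤ Nℤ
      0≤N = pos-nn N
      1≤N : 1ℤ ≤ Nℤ
      1≤N = +≤+ (ℕP.≤-trans (s≤s z≤n) 2≤N)
      D′ = Dℤ * (Nℤ * Nℤ)

    scaled-root : ℕ → ℤ
    scaled-root j = + root (N ℕ.* j)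

    scaled : ∀ j → Dℤ * (+ (N ℕ.* j) * + (N ℕ.* j)) ≡ D′ * (+ j * + j)
    scaled j = trans (cong (λ z → Dℤ * (z * z)) (pos-* N j))
      (solve 3 (λ D N j → D :* ((N :* j) :* (N :* j)) := (D :* (N :* N)) :* (j :* j)) refl Dℤ Nℤ (+ j))

    scaled-lower : ∀ j → scaled-root j * scaled-root j ≤ D′ * (+ j * + j)
    scaled-lower j = subst (scaled-root j * scaled-root j ≤_) (scaled j) (root-lower (N ℕ.* j))

    scaled-upper : ∀ j → 1ℤ + D′ * (+ j * + j) ≤ (1ℤ + scaled-root j) * (1ℤ + scaled-root j)
    scaled-upper j = subst (_≤ (1ℤ + scaled-root j) * (1ℤ + scaled-root j)) (cong (_+_ 1ℤ) (scaled j))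
      (root-upper (N ℕ.* j))

    floor-below : ∀ a A j → 0ℤ ≤ A → a * a ≤ Dℤ * (j * j) → 1ℤ + D′ * (j * j) ≤ (1ℤ + A) * (1ℤ + A) → 0ℤ ≤ A - Nℤ * a
    floor-below a A j 0≤A lower upper = nn-by (solve 2 (λ x y → y :- x := (# 1 :+ y) :- (# 1 :+ x)) refl (Nℤ * a) A)
      (≤⇒0≤ (<-sq-cancel (+-nn (pos-nn 1) 0≤A) (≤-by
        (solve 5 (λ a A D N j → (# 1 :+ A) :* (# 1 :+ A) :- (# 1 :+ (N :* a) :* (N :* a))
          := ((# 1 :+ A) :* (# 1 :+ A) :- (# 1 :+ (D :* (N :* N)) :* (j :* j))) :+ N :* N
          :* (D :* (j :* j) :- a :* a)) refl a A Dℤ Nℤ j)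
        (+-nn (≤⇒0≤ upper) (*-nn (*-nn 0≤N 0≤N) (≤⇒0≤ lower))))))

    floor-above : ∀ a A j → 0ℤ ≤ a → A * A ≤ D′ * (j * j) → 1ℤ + Dℤ * (j * j) ≤ (1ℤ + a) * (1ℤ + a)
      → 1ℤ + A ≤ Nℤ * (1ℤ + a)
    floor-above a A j 0≤a lower upper = <-sq-cancel (*-nn 0≤N (+-nn (pos-nn 1) 0≤a)) (≤-by
        (solve 5 (λ a A D N j → (N :* (# 1 :+ a)) :* (N :* (# 1 :+ a)) :- (# 1 :+ A :* A)
          := ((D :* (N :* N)) :* (j :* j) :- A :* A) :+ N :* N :* ((# 1 :+ a) :* (# 1 :+ a) :- (# 1 :+ D :* (j :* j)))
          :+ (N :* N :- # 1)) refl a A Dℤ Nℤ j)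
        (+-nn (+-nn (≤⇒0≤ lower) (*-nn (*-nn 0≤N 0≤N) (≤⇒0≤ upper))) (≤⇒0≤ (1≤-* 1≤N 1≤N))))

    -- The difference is the floor of `N` times the fractional part of `j √D`, and so one of the `N`
    -- numbers below `N`.
    Bucket : ℕ → Set
    Bucket j = ∃ λ b → scaled-root j - Nℤ * + root j ≡ + b × suc b ℕ.≤ N

    bucket-bound : ∀ j → (∃ λ b → scaled-root j - Nℤ * + root j ≡ + b) → Bucket j
    bucket-bound j (b , e) = b , e , +≤⇒ (subst (_≤ Nℤ) (sym (trans (pos-+ 1 b) (cong (_+_ 1ℤ) (sym e))))
       (≤-by (solve 3 (λ N A a → N :- (# 1 :+ (A :- N :* a)) := N :* (# 1 :+ a) :- (# 1 :+ A)) refl Nℤ (scaled-root j)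
         (+ root j))
          (≤⇒0≤ (floor-above (+ root j) (scaled-root j) (+ j) (pos-nn (root j)) (scaled-lower j) (root-upper j)))))

    opaque
      bucket : ∀ j → Bucket j
      bucket j = bucket-bound j (0≤⇒pos (floor-below (+ root j) (scaled-root j) (+ j) (pos-nn (root (N ℕ.* j)))
        (root-lower j) (scaled-upper j)))

    bucket-index : Fin (suc N) → Fin N
    bucket-index i = fromℕ< (proj₂ (proj₂ (bucket (toℕ i))))

    Collision : Set
    Collision = ∃ λ i → ∃ λ j → suc i ℕ.≤ j × j ℕ.≤ N × scaled-root i - Nℤ * + root i ≡ scaled-root j - Nℤ * + root j

    same-bucket⇒Collision : (∃ λ (i : Fin (suc N)) → ∃ λ (j : Fin (suc N)) → i Fin.< j × bucket-index i
      ≡ bucket-index j) → Collision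
    same-bucket⇒Collision (i , j , i<j , e) = toℕ i , toℕ j , i<j , ℕP.≤-pred (FinP.toℕ<n j)
        , trans (proj₁ (proj₂ (bucket (toℕ i)))) (trans (cong +_ same) (sym (proj₁ (proj₂ (bucket (toℕ j))))))
      where
      same : proj₁ (bucket (toℕ i)) ≡ proj₁ (bucket (toℕ j))
      same = trans (sym (FinP.toℕ-fromℕ< (proj₂ (proj₂ (bucket (toℕ i))))))
        (trans (cong toℕ e) (FinP.toℕ-fromℕ< (proj₂ (proj₂ (bucket (toℕ j))))))

    opaque
      collision : Collision
      collision = same-bucket⇒Collision (FinP.pigeonhole ℕP.≤-refl bucket-index)

    Approximation : Set
    Approximation = ∃ λ p → ∃ λ q → 1 ℕ.≤ q × q ℕ.≤ N × N ℕ.* ∣ p * p - Dℤ * (+ q * + q) ∣ ℕ.≤ 2 ℕ.* (D ℕ.* q)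

    Collision⇒Approximation : Collision → Approximation
    Collision⇒Approximation (i , j , i<j , j≤N , same) = p , q , 1≤q , ℕP.≤-trans (ℕP.m∸n≤m j i) j≤N
        , norm-bound N p q 2≤N (proj₁ bounds) (proj₁ (proj₂ bounds)) (proj₂ (proj₂ bounds))
      where
      q = j ℕ.∸ i
      p = + root j - + root i
      1≤q : 1 ℕ.≤ q
      1≤q = ℕP.m<n⇒0<n∸m i<j
      j≡ : + j ≡ + q + + i
      j≡ = trans (cong +_ (sym (ℕP.m∸n+n≡m (ℕP.<⇒≤ i<j)))) (pos-+ q i)
      bounds = difference-bounds Nℤ D′ (scaled-root i) (scaled-root j) (+ q) (+ i) (N·p N p) 0≤N
        (*-nn (pos-nn D) (sq-nn Nℤ)) (pos-nn _) (pos-nn _) (pos-nn i) (pos-nn q)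
        (1≤-* (1≤-* (+≤+ 1≤D) (1≤-* 1≤N 1≤N)) (1≤-* (+≤+ 1≤q) (+≤+ 1≤q)))
        (scaled-lower i) (scaled-upper i)
        (subst (λ w → scaled-root j * scaled-root j ≤ D′ * (w * w)) j≡ (scaled-lower j))
        (subst (λ w → 1ℤ + D′ * (w * w) ≤ (1ℤ + scaled-root j) * (1ℤ + scaled-root j)) j≡ (scaled-upper j))
        (trans (solve 5 (λ N a b A B → N :* (a :- b) := (A :- B) :- ((A :- N :* a) :- (B :- N :* b))) refl Nℤ
          (+ root j) (+ root i) (scaled-root j) (scaled-root i))
          (trans (cong (λ x → scaled-root j - scaled-root i - (scaled-root j - Nℤ * + root j - x)) same)
            (solve 2 (λ x y → x :- (y :- y) := x) refl (scaled-root j - scaled-root i)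
            (scaled-root j - Nℤ * + root j))))

    opaque
      approximation : Approximation
      approximation = Collision⇒Approximation collision

  module _ (nonsquare : NonSquare Dℤ) where

    BoundedNorm : ℤ → ℕ → Set
    BoundedNorm p q = 1 ℕ.≤ ∣ p * p - Dℤ * (+ q * + q) ∣ × ∣ p * p - Dℤ * (+ q * + q) ∣ ℕ.≤ 2 ℕ.* D

    Beyond : ℕ → Set
    Beyond B = ∃ λ p → ∃ λ q → suc B ℕ.≤ q × BoundedNorm p q

    Approximation⇒Beyond : ∀ B → Approximation (2 ℕ.+ 2 ℕ.* (D ℕ.* B)) (s≤s (s≤s z≤n)) → Beyond B
    Approximation⇒Beyond B (p , q , 1≤q , q≤N , bound) = p , q , far , norm≥1 , norm≤
      where
      -- Since the norm is not 0, the approximation gives `N ≤ 2 D q`; this value of `N` then forces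
      -- `q` beyond `B`.
      N = 2 ℕ.+ 2 ℕ.* (D ℕ.* B)
      e = ∣ p * p - Dℤ * (+ q * + q) ∣
      norm≥1 : 1 ℕ.≤ e
      norm≥1 with e in eq
      ... | suc _ = s≤s z≤n
      ... | zero = ⊥-elim (ℕP.<⇒≢ 1≤q (sym (ℤP.+-injective (nonsquare p (+ q)
             (trans (solve 2 (λ x y → x := (x :- y) :+ y) refl (p * p) (Dℤ * (+ q * + q)))
               (trans (cong (_+ Dℤ * (+ q * + q)) (ℤP.∣i∣≡0⇒i≡0 eq))
                 (solve 1 (λ y → # 0 :+ y := y) refl (Dℤ * (+ q * + q)))))))))
      norm≤ : e ℕ.≤ 2 ℕ.* D
      norm≤ = ℕP.*-cancelˡ-≤ N (ℕP.≤-trans bound (ℕP.≤-trans (ℕP.*-monoʳ-≤ 2 (ℕP.*-monoʳ-≤ D q≤N))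
         (ℕP.≤-reflexive (trans (sym (ℕP.*-assoc 2 D N)) (ℕP.*-comm (2 ℕ.* D) N)))))
      far : suc B ℕ.≤ q
      far with suc B ℕ.≤? q
      ... | yes ok = ok
      ... | no near = ⊥-elim (ℕP.<-irrefl refl (ℕP.≤-trans (s≤s (ℕP.n≤1+n (2 ℕ.* (D ℕ.* B))))
             (ℕP.≤-trans (ℕP.≤-trans (ℕP.≤-reflexive (sym (ℕP.*-identityʳ N))) (ℕP.*-monoʳ-≤ N norm≥1))
               (ℕP.≤-trans bound (ℕP.*-monoʳ-≤ 2 (ℕP.*-monoʳ-≤ D (ℕP.≤-pred (ℕP.≰⇒> near))))))))

    opaque
      beyond : ∀ B → Beyond B
      beyond B = Approximation⇒Beyond B (approximation (2 ℕ.+ 2 ℕ.* (D ℕ.* B)) (s≤s (s≤s z≤n)))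

    opaque
      -- Each pair is chosen beyond the denominator of its predecessor, so the denominators increase
      -- strictly while the norms stay in a finite set.
      chain : ℕ → ∃ Beyond
      chain zero = 0 , beyond 0
      chain (suc i) = proj₁ (proj₂ (proj₂ (chain i))) , beyond (proj₁ (proj₂ (proj₂ (chain i))))

    chain-p : ℕ → ℤ
    chain-p i = proj₁ (proj₂ (chain i))
    chain-q : ℕ → ℕ
    chain-q i = proj₁ (proj₂ (proj₂ (chain i)))
    chain-norm : ℕ → ℤ
    chain-norm i = chain-p i * chain-p i - Dℤ * (+ chain-q i * + chain-q i)

    chain-bounded : ∀ i → BoundedNorm (chain-p i) (chain-q i)
    chain-bounded i = proj₂ (proj₂ (proj₂ (proj₂ (chain i))))

    opaque
      unfolding chain

      chain-step : ∀ i → suc (chain-q i) ℕ.≤ chain-q (suc i)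
      chain-step i = proj₁ (proj₂ (proj₂ (proj₂ (chain (suc i)))))

    chain-increasing : ∀ i k → suc (chain-q i) ℕ.≤ chain-q (suc (k ℕ.+ i))
    chain-increasing i zero = chain-step i
    chain-increasing i (suc k) = ℕP.≤-trans (chain-increasing i k)
      (ℕP.≤-trans (ℕP.n≤1+n _) (chain-step (suc (k ℕ.+ i))))

    Remainder : ℤ → ℕ → Set
    Remainder x i = ∃ λ c → ∃ λ r → x ≡ + r + c * + ∣ chain-norm i ∣ × suc r ℕ.≤ ∣ chain-norm i ∣

    opaque
      remainder : ∀ x i → Remainder x i
      remainder x i = div-mod x ∣ chain-norm i ∣ (proj₁ (chain-bounded i))

    remainder-index : ℤ → ℕ → Fin (2 ℕ.* D)
    remainder-index x i = fromℕ< (ℕP.≤-trans (proj₂ (proj₂ (proj₂ (remainder x i)))) (proj₂ (chain-bounded i)))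

    shifted-norm : ∀ i → ∃ λ k → chain-norm i + + (2 ℕ.* D) ≡ + k
    shifted-norm i = 0≤⇒pos (nn-by (solve 2 (λ x y → x :+ y := y :- (:- x)) refl (chain-norm i) (+ (2 ℕ.* D)))
      (≤⇒0≤ (∣x∣≤⇒- {chain-norm i} (proj₂ (chain-bounded i)))))

    shifted-norm< : ∀ i → suc (proj₁ (shifted-norm i)) ℕ.≤ suc (2 ℕ.* D ℕ.+ 2 ℕ.* D)
    shifted-norm< i = s≤s (ℕP.≤-trans (ℕP.≤-reflexive (sym (cong ∣_∣ (proj₂ (shifted-norm i)))))
       (ℕP.≤-trans (∣+∣ (chain-norm i) (+ (2 ℕ.* D))) (ℕP.+-monoˡ-≤ (2 ℕ.* D) (proj₂ (chain-bounded i)))))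

    -- Equal norms and congruence modulo that norm make the quotient of two elements `p + q √D`
    -- integral.
    SameClass : ℕ → ℕ → Set
    SameClass i j = chain-norm i ≡ chain-norm j × (∃ λ a → chain-p j ≡ chain-p i + a * chain-norm i) × (∃ λ b
      → + chain-q j ≡ + chain-q i + b * chain-norm i)

    fromℕ<-inj : ∀ {m n k} (p : suc m ℕ.≤ k) (q : suc n ℕ.≤ k) → fromℕ< p ≡ fromℕ< q → m ≡ n
    fromℕ<-inj p q e = trans (sym (FinP.toℕ-fromℕ< p)) (trans (cong toℕ e) (FinP.toℕ-fromℕ< q))

    class : ℕ → Fin (suc (2 ℕ.* D ℕ.+ 2 ℕ.* D) ℕ.* (2 ℕ.* D ℕ.* (2 ℕ.* D)))
    class i = combine (fromℕ< (shifted-norm< i)) (combine (remainder-index (chain-p i) i)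
      (remainder-index (+ chain-q i) i))

    class⇒SameClass : ∀ i j → class i ≡ class j → SameClass i j
    class⇒SameClass i j e = norm≡ , congruent (chain-p i) (chain-p j) (proj₁ e₂) , congruent (+ chain-q i)
      (+ chain-q j) (proj₂ e₂)
      where
      e₁ = FinP.combine-injective (fromℕ< (shifted-norm< i))
        (combine (remainder-index (chain-p i) i) (remainder-index (+ chain-q i) i))
             (fromℕ< (shifted-norm< j)) (combine (remainder-index (chain-p j) j) (remainder-index (+ chain-q j) j)) e
      e₂ = FinP.combine-injective (remainder-index (chain-p i) i) (remainder-index (+ chain-q i) i)
        (remainder-index (chain-p j) j) (remainder-index (+ chain-q j) j) (proj₂ e₁)
      norm≡ : chain-norm i ≡ chain-norm j
      norm≡ = trans (solve 2 (λ x y → x := (x :+ y) :- y) refl (chain-norm i) (+ (2 ℕ.* D)))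
        (trans (cong (_- + (2 ℕ.* D)) (trans (proj₂ (shifted-norm i))
          (trans (cong +_ (fromℕ<-inj (shifted-norm< i) (shifted-norm< j) (proj₁ e₁)))
          (sym (proj₂ (shifted-norm j))))))
          (solve 2 (λ x y → (x :+ y) :- y := x) refl (chain-norm j) (+ (2 ℕ.* D))))
      abs-multiple : ∀ x → ∃ λ s → + ∣ x ∣ ≡ s * x
      abs-multiple (+ m) = 1ℤ , solve 1 (λ a → a := # 1 :* a) refl (+ m)
      abs-multiple (-[1+ m ]) = - 1ℤ , trans (solve 1 (λ a → a := (:- # 1) :* (:- a)) refl (+ suc m))
        (cong ((- 1ℤ) *_) (neg-≡ (+ suc m)))
      congruent : ∀ x y → remainder-index x i ≡ remainder-index y j → ∃ λ a → y ≡ x + a * chain-norm i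
      congruent x y e = (proj₁ ry - proj₁ rx) * proj₁ s , (begin
          y                                      ≡⟨ proj₁ (proj₂ (proj₂ ry)) ⟩
          + proj₁ (proj₂ ry) + proj₁ ry * + ∣ chain-norm j ∣ ≡⟨ cong₂ (λ r n → + r + proj₁ ry * + ∣ n ∣)
            (sym (fromℕ<-inj (ℕP.≤-trans (proj₂ (proj₂ (proj₂ rx))) (proj₂ (chain-bounded i)))
            (ℕP.≤-trans (proj₂ (proj₂ (proj₂ ry))) (proj₂ (chain-bounded j))) e)) (sym norm≡) ⟩
          + proj₁ (proj₂ rx) + proj₁ ry * + ∣ chain-norm i ∣ ≡⟨ solve 4 (λ r a b n → r :+ a :* n
            := (r :+ b :* n) :+ (a :- b) :* n) refl (+ proj₁ (proj₂ rx)) (proj₁ ry) (proj₁ rx) (+ ∣ chain-norm i ∣) ⟩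
          (+ proj₁ (proj₂ rx) + proj₁ rx * + ∣ chain-norm i ∣) + (proj₁ ry - proj₁ rx) * + ∣ chain-norm i ∣ ≡⟨ cong₂
            (λ u v → u + (proj₁ ry - proj₁ rx) * v) (sym (proj₁ (proj₂ (proj₂ rx)))) (proj₂ s) ⟩
          x + (proj₁ ry - proj₁ rx) * (proj₁ s * chain-norm i) ≡⟨ solve 4 (λ x a s n → x :+ a :* (s :* n)
            := x :+ (a :* s) :* n) refl x (proj₁ ry - proj₁ rx) (proj₁ s) (chain-norm i) ⟩
          x + (proj₁ ry - proj₁ rx) * proj₁ s * chain-norm i ∎)
        where
        open ≡-Reasoning
        rx = remainder x i
        ry = remainder y j
        s = abs-multiple (chain-norm i)

    opaque
      sealed-class : ℕ → Fin (suc (2 ℕ.* D ℕ.+ 2 ℕ.* D) ℕ.* (2 ℕ.* D ℕ.* (2 ℕ.* D)))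
      sealed-class = class

      sealed-class⇒SameClass : ∀ i j → sealed-class i ≡ sealed-class j → SameClass i j
      sealed-class⇒SameClass i j e = class⇒SameClass i j e

    PellSolution : Set
    PellSolution = ∃ λ s → ∃ λ t → s * s ≡ 1ℤ + Dℤ * (t * t) × t ≢ 0ℤ

    -- `s + t √D` is `(p₂ + q₂ √D) / (p₁ + q₁ √D)`: multiplied by `e` it becomes
    -- `(p₂ + q₂ √D) (p₁ - q₁ √D)`. If `t` were 0, then `q₂² = q₁²`.
    quotient-unit : ∀ p₁ q₁ p₂ q₂ e a b → e ≡ p₁ * p₁ - Dℤ * (q₁ * q₁) → e ≡ p₂ * p₂ - Dℤ * (q₂ * q₂) → p₂
      ≡ p₁ + a * e → q₂ ≡ q₁ + b * e →
      e ≢ 0ℤ → q₂ * q₂ ≢ q₁ * q₁ → PellSolution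
    quotient-unit p₁ q₁ p₂ q₂ e a b e₁ e₂ p≡ q≡ e≢0 q≢ = s , t , unit , t≢0
      where
      s = 1ℤ + a * p₁ - Dℤ * (b * q₁)
      t = b * p₁ - a * q₁
      es : e * s ≡ p₁ * p₂ - Dℤ * (q₁ * q₂)
      es = trans (solve 6 (λ e D a b p q → e :* (# 1 :+ a :* p :- D :* (b :* q))
        := e :+ a :* e :* p :- D :* (q :* (b :* e))) refl e Dℤ a b p₁ q₁)
        (trans (cong (λ w → w + a * e * p₁ - Dℤ * (q₁ * (b * e))) e₁)
        (trans (solve 6 (λ e D a b p q → (p :* p :- D :* (q :* q)) :+ a :* e :* p :- D :* (q :* (b :* e))
          := p :* (p :+ a :* e) :- D :* (q :* (q :+ b :* e))) refl e Dℤ a b p₁ q₁)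
          (cong₂ (λ x y → p₁ * x - Dℤ * (q₁ * y)) (sym p≡) (sym q≡))))
      et : e * t ≡ p₁ * q₂ - p₂ * q₁
      et = trans (solve 5 (λ e a b p q → e :* (b :* p :- a :* q) := p :* (q :+ b :* e) :- (p :+ a :* e) :* q) refl e a
        b p₁ q₁)
          (cong₂ (λ x y → p₁ * y - x * q₁) (sym p≡) (sym q≡))
      ee : e * e ≡ (p₁ * p₁ - Dℤ * (q₁ * q₁)) * (p₂ * p₂ - Dℤ * (q₂ * q₂))
      ee = cong₂ _*_ e₁ e₂
      1≤ee : 1ℤ ≤ e * e
      1≤ee = sq≢0⇒1≤ e e≢0
      unit : s * s ≡ 1ℤ + Dℤ * (t * t)
      unit = *-cancelˡ (e * e) 1≤ee (begin
        e * e * (s * s)       ≡⟨ solve 2 (λ e s → e :* e :* (s :* s) := (e :* s) :* (e :* s)) refl e s ⟩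
        (e * s) * (e * s)     ≡⟨ cong (λ w → w * w) es ⟩
        (p₁ * p₂ - Dℤ * (q₁ * q₂)) * (p₁ * p₂ - Dℤ * (q₁ * q₂)) ≡⟨ solve 5 (λ p q r s D
          → (p :* r :- D :* (q :* s)) :* (p :* r :- D :* (q :* s))
          := (p :* p :- D :* (q :* q)) :* (r :* r :- D :* (s :* s)) :+ D
          :* ((p :* s :- r :* q) :* (p :* s :- r :* q))) refl p₁ q₁ p₂ q₂ Dℤ ⟩
        (p₁ * p₁ - Dℤ * (q₁ * q₁)) * (p₂ * p₂ - Dℤ * (q₂ * q₂)) + Dℤ * ((p₁ * q₂ - p₂ * q₁) * (p₁ * q₂ - p₂ * q₁)) ≡⟨
          cong₂ (λ u v → u + Dℤ * (v * v)) (sym ee) (sym et) ⟩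
        e * e + Dℤ * ((e * t) * (e * t)) ≡⟨ solve 3 (λ e t D → e :* e :+ D :* ((e :* t) :* (e :* t))
          := e :* e :* (# 1 :+ D :* (t :* t))) refl e t Dℤ ⟩
        e * e * (1ℤ + Dℤ * (t * t)) ∎)
        where open ≡-Reasoning
      t≢0 : t ≢ 0ℤ
      t≢0 t≡0 = q≢ (cancel (begin
        e * (q₂ * q₂)  ≡⟨ cong (_* (q₂ * q₂)) e₁ ⟩
        (p₁ * p₁ - Dℤ * (q₁ * q₁)) * (q₂ * q₂) ≡⟨ solve 5 (λ p q r s D → (p :* p :- D :* (q :* q)) :* (s :* s)
          := (r :* r :- D :* (s :* s)) :* (q :* q) :+ (p :* s :- r :* q) :* (p :* s :+ r :* q)) refl p₁ q₁ p₂ q₂ Dℤ ⟩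
        (p₂ * p₂ - Dℤ * (q₂ * q₂)) * (q₁ * q₁) + (p₁ * q₂ - p₂ * q₁) * (p₁ * q₂ + p₂ * q₁) ≡⟨ cong₂ (λ u v
          → u * (q₁ * q₁) + v * (p₁ * q₂ + p₂ * q₁)) (sym e₂) (trans (sym et) (cong (e *_) t≡0)) ⟩
        e * (q₁ * q₁) + e * 0ℤ * (p₁ * q₂ + p₂ * q₁) ≡⟨ solve 3 (λ e x y → e :* x :+ e :* # 0 :* y := e :* x) refl e
          (q₁ * q₁) (p₁ * q₂ + p₂ * q₁) ⟩
        e * (q₁ * q₁) ∎))
        where
        open ≡-Reasoning
        cancel : e * (q₂ * q₂) ≡ e * (q₁ * q₁) → q₂ * q₂ ≡ q₁ * q₁
        cancel h = *-cancelˡ (e * e) 1≤ee (trans (solve 2 (λ e x → e :* e :* x := e :* (e :* x)) refl e (q₂ * q₂))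
          (trans (cong (e *_) h) (solve 2 (λ e x → e :* (e :* x) := e :* e :* x) refl e (q₁ * q₁))))

    Repetition : Set
    Repetition = ∃ λ i → ∃ λ k → SameClass i (suc (k ℕ.+ i))

    Repetition⇒PellSolution : Repetition → PellSolution
    Repetition⇒PellSolution (i , k , norm≡ , (a , p≡) , (b , q≡)) =
      quotient-unit (chain-p i) (+ chain-q i) (chain-p j) (+ chain-q j) (chain-norm i) a b refl norm≡ p≡ q≡
        (λ z → ℕP.<⇒≢ (proj₁ (chain-bounded i)) (sym (cong ∣_∣ z)))
        (λ e → ℕP.<⇒≢ (ℕP.*-mono-< (chain-increasing i k) (chain-increasing i k))
          (sym (ℤP.+-injective (trans (pos-* (chain-q j) (chain-q j))
          (trans e (sym (pos-* (chain-q i) (chain-q i))))))))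
      where j = suc (k ℕ.+ i)

    pigeonhole⇒Repetition : ∀ {n} → (∃ λ (i : Fin n) → ∃ λ (j : Fin n) → i Fin.< j × sealed-class (toℕ i)
      ≡ sealed-class (toℕ j)) → Repetition
    pigeonhole⇒Repetition (i , j , i<j , e) = toℕ i , toℕ j ℕ.∸ suc (toℕ i)
      , subst (SameClass (toℕ i)) {toℕ j} {suc (toℕ j ℕ.∸ suc (toℕ i) ℕ.+ toℕ i)}
          (trans (sym (ℕP.m∸n+n≡m i<j)) (ℕP.+-suc (toℕ j ℕ.∸ suc (toℕ i)) (toℕ i)))
            (sealed-class⇒SameClass (toℕ i) (toℕ j) e)

    opaque
      pell : PellSolution
      pell = Repetition⇒PellSolution (pigeonhole⇒Repetition (FinP.pigeonhole
        (ℕP.n<1+n (suc (2 ℕ.* D ℕ.+ 2 ℕ.* D) ℕ.* (2 ℕ.* D ℕ.* (2 ℕ.* D)))) (λ i → sealed-class (toℕ i))))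

-- A unit `s + t √d` congruent to 1 modulo `Q` preserves the cosets of a lattice whose determinant
-- is `Q`; letting `B` grow gives images of a point arbitrarily far out.
record LargeUnit (d Q B : ℕ) : Set where
  field
    s t u v : ℤ
    unit : s * s ≡ 1ℤ + + d * (t * t)
    s≡1 : s ≡ 1ℤ + u * + Q
    t≡0 : t ≡ v * + Q
    B≤t : + B ≤ t
    t≤s : t ≤ s

-- Squaring a solution of the Pell equation for d (Q B)² makes s congruent to 1 modulo Q.
solution⇒LargeUnit : ∀ d Q B D s₁ t₁ → 1 ℕ.≤ d → 1 ℕ.≤ Q → 1 ℕ.≤ B → + D ≡ + d * ((+ Q * + B) * (+ Q * + B)) →
  s₁ * s₁ ≡ 1ℤ + + D * (t₁ * t₁) → t₁ ≢ 0ℤ → LargeUnit d Q B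
solution⇒LargeUnit d Q B D s₁ t₁ 1≤d 1≤Q 1≤B D≡ eq t₁≢0 = record
  { s = s ; t = t ; u = + 2 * (+ d * (k * + B) * (t₁ * t₁)) ; v = + B * + ∣ τ ∣
  ; unit = unit
  ; s≡1 = cong (_+_ 1ℤ) (trans (cong (λ z → + 2 * (z * (t₁ * t₁))) D≡)
    (solve 4 (λ d Q B x → # 2 :* (d :* ((Q :* B) :* (Q :* B)) :* x) := (# 2 :* (d :* ((Q :* B) :* B) :* x)) :* Q) refl
    (+ d) (+ Q) (+ B) (t₁ * t₁)))
  ; t≡0 = solve 3 (λ Q B x → Q :* B :* x := (B :* x) :* Q) refl (+ Q) (+ B) (+ ∣ τ ∣)
  ; B≤t = ≤-by (solve 3 (λ Q B x → Q :* B :* x :- B := (Q :- # 1) :* (B :* x) :+ B :* (x :- # 1)) refl (+ Q) (+ B)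
    (+ ∣ τ ∣))
      (+-nn (*-nn (≤⇒0≤ (+≤+ 1≤Q)) (*-nn (pos-nn B) (pos-nn ∣ τ ∣))) (*-nn (pos-nn B) (≤⇒0≤ 1≤∣τ∣)))
  ; t≤s = sq-cancel-≤ 0≤s (≤-by (trans (cong (_- t * t) unit)
    (solve 2 (λ d x → # 1 :+ d :* x :- x := # 1 :+ (d :- # 1) :* x) refl (+ d) (t * t)))
      (+-nn (pos-nn 1) (*-nn (≤⇒0≤ (+≤+ 1≤d)) (sq-nn t))))
  }
  where
  k = + Q * + B
  τ = + 2 * (s₁ * t₁)
  s = 1ℤ + + 2 * (+ D * (t₁ * t₁))
  -- As `√D = Q B √d`, the square of the given solution has `√d`-coefficient `Q B τ`. The absolute
  -- value passes to the inverse unit if `τ` is negative.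
  t = + Q * + B * + ∣ τ ∣
  0≤s : 0ℤ ≤ s
  0≤s = +-nn (pos-nn 1) (*-nn (pos-nn 2) (*-nn (pos-nn D) (sq-nn t₁)))
  1≤τ² : 1ℤ ≤ τ * τ
  1≤τ² = ≤-by (trans (solve 2 (λ x y → (# 2 :* (x :* y)) :* (# 2 :* (x :* y)) :- # 1
    := # 4 :* (x :* x) :* (y :* y) :- # 1) refl s₁ t₁)
           (trans (cong (λ w → + 4 * w * (t₁ * t₁) - 1ℤ) eq)
             (solve 2 (λ D y → # 4 :* (# 1 :+ D :* y) :* y :- # 1 := # 4 :* (D :* (y :* y)) :+ # 3 :* y :+ (y :- # 1))
             refl (+ D) (t₁ * t₁))))
         (+-nn (+-nn (*-nn (pos-nn 4) (*-nn (pos-nn D) (sq-nn (t₁ * t₁)))) (*-nn (pos-nn 3) (sq-nn t₁)))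
           (≤⇒0≤ (sq≢0⇒1≤ t₁ t₁≢0)))
  1≤∣τ∣ : 1ℤ ≤ + ∣ τ ∣
  1≤∣τ∣ with 1≤-split (+ ∣ τ ∣)
  ... | inj₁ ok = ok
  ... | inj₂ z = ⊥-elim (absurd≤ (subst (1ℤ ≤_) (trans (sym (∣sq∣ τ))
    (trans (cong (λ w → w * w) (≤0∧0≤⇒≡0 z (pos-nn ∣ τ ∣))) (solve 0 (# 0 :* # 0 := # 0) refl))) 1≤τ²))
  unit : s * s ≡ 1ℤ + + d * (t * t)
  unit = begin
    s * s ≡⟨ solve 1 (λ x → (# 1 :+ # 2 :* x) :* (# 1 :+ # 2 :* x) := # 1 :+ # 4 :* ((# 1 :+ x) :* x)) refl
      (+ D * (t₁ * t₁)) ⟩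
    1ℤ + + 4 * ((1ℤ + + D * (t₁ * t₁)) * (+ D * (t₁ * t₁))) ≡⟨ cong (λ w → 1ℤ + + 4 * (w * (+ D * (t₁ * t₁))))
      (sym eq) ⟩
    1ℤ + + 4 * (s₁ * s₁ * (+ D * (t₁ * t₁))) ≡⟨ cong (λ w → 1ℤ + + 4 * (s₁ * s₁ * (w * (t₁ * t₁)))) D≡ ⟩
    1ℤ + + 4 * (s₁ * s₁ * (+ d * (k * k) * (t₁ * t₁))) ≡⟨ solve 4 (λ s d k t
      → # 1 :+ # 4 :* (s :* s :* (d :* (k :* k) :* (t :* t)))
      := # 1 :+ d :* ((k :* k) :* ((# 2 :* (s :* t)) :* (# 2 :* (s :* t))))) refl s₁ (+ d) k t₁ ⟩
    1ℤ + + d * ((k * k) * (τ * τ)) ≡⟨ cong (λ w → 1ℤ + + d * ((k * k) * w)) (sym (∣sq∣ τ)) ⟩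
    1ℤ + + d * ((k * k) * (+ ∣ τ ∣ * + ∣ τ ∣)) ≡⟨ solve 3 (λ d k x → # 1 :+ d :* ((k :* k) :* (x :* x))
      := # 1 :+ d :* ((k :* x) :* (k :* x))) refl (+ d) k (+ ∣ τ ∣) ⟩
    1ℤ + + d * (t * t) ∎
    where open ≡-Reasoning

large-unit : ∀ d Q B → 1 ℕ.≤ d → 1 ℕ.≤ Q → 1 ℕ.≤ B → NonSquare (+ d) → LargeUnit d Q B
large-unit d Q B 1≤d 1≤Q 1≤B nonsquare = from (Dirichlet.pell D 1≤D nonsquare-D)
  where
  k = + Q * + B
  D = d ℕ.* ((Q ℕ.* B) ℕ.* (Q ℕ.* B))
  D≡ : + D ≡ + d * (k * k)
  D≡ = trans (pos-* d ((Q ℕ.* B) ℕ.* (Q ℕ.* B))) (cong (+ d *_)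
    (trans (pos-* (Q ℕ.* B) (Q ℕ.* B)) (cong (λ z → z * z) (pos-* Q B))))
  1≤k : 1ℤ ≤ k
  1≤k = 1≤-* (+≤+ 1≤Q) (+≤+ 1≤B)
  1≤D : 1 ℕ.≤ D
  1≤D = +≤⇒ (subst (1ℤ ≤_) (sym D≡) (1≤-* (+≤+ 1≤d) (1≤-* 1≤k 1≤k)))
  nonsquare-D : NonSquare (+ D)
  nonsquare-D p q e with *-zero-split k q (nonsquare p (k * q)
    (trans e (trans (cong (_* (q * q)) D≡) (solve 3 (λ d k q → d :* (k :* k) :* (q :* q)
    := d :* ((k :* q) :* (k :* q))) refl (+ d) k q))))
  ... | inj₁ k≡0 = ⊥-elim (absurd≤ (subst (1ℤ ≤_) k≡0 1≤k))
  ... | inj₂ q≡0 = q≡0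
  from : Dirichlet.PellSolution D 1≤D nonsquare-D → LargeUnit d Q B
  from (s₁ , t₁ , eq , t₁≢0) = solution⇒LargeUnit d Q B D s₁ t₁ 1≤d 1≤Q 1≤B D≡ eq t₁≢0

-- Inequalities along units of unbounded size determine signs in decreasing order of growth s t², t², s.
module Growth (d : ℕ) (a c X Y : ℤ)
  (h : ∀ B → 1 ℕ.≤ B → ∃ λ s → ∃ λ t → + B ≤ t × t ≤ s × s * s ≡ 1ℤ + + d * (t * t) × 0ℤ ≤ a + s * (t * t) * X + s * c + t * t * Y) where

  cubic-nonneg : 0ℤ ≤ X
  cubic-nonneg with 1≤-split (- X)
  ... | inj₂ p = nn-by (solve 1 (λ X → X := # 0 :- (:- X)) refl X) (≤⇒0≤ p)
  ... | inj₁ p with h B (s≤s z≤n)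
    where B = suc (∣ a ∣ ℕ.+ ∣ c ∣ ℕ.+ ∣ Y ∣)
  ...   | s , t , B≤t , t≤s , _ , nn = ⊥-elim (¬0≤-1 {a + s * (t * t) * X + s * c + t * t * Y}
            (nn-by (solve 9 (λ a c X Y s t A C Z → :- # 1 :- (a :+ s :* (t :* t) :* X :+ s :* c :+ t :* t :* Y) :=
                s :* (t :* t) :* (:- X :- # 1) :+ s :* t :* (t :- (# 1 :+ (A :+ C :+ Z))) :+ (s :* t :- # 1) :+ A
                  :* (s :* t :- # 1) :+ (A :- a) :+ s :* (t :- # 1) :* C :+ s :* (C :- c) :+ t :* (s :- t) :* Z :+ t
                  :* t :* (Z :- Y))
                refl a c X Y s t (+ ∣ a ∣) (+ ∣ c ∣) (+ ∣ Y ∣))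
              (+-nn (+-nn (+-nn (+-nn (+-nn (+-nn (+-nn (+-nn
                (*-nn (*-nn 0≤s (sq-nn t)) (≤⇒0≤ p))
                (*-nn (*-nn 0≤s 0≤t) (≤⇒0≤ B≤t′)))
                (≤⇒0≤ (1≤-* 1≤s 1≤t)))
                (*-nn (pos-nn ∣ a ∣) (≤⇒0≤ (1≤-* 1≤s 1≤t))))
                (≤⇒0≤ (x≤∣x∣ a)))
                (*-nn (*-nn 0≤s (≤⇒0≤ 1≤t)) (pos-nn ∣ c ∣)))
                (*-nn 0≤s (≤⇒0≤ (x≤∣x∣ c))))
                (*-nn (*-nn 0≤t (≤⇒0≤ t≤s)) (pos-nn ∣ Y ∣)))
                (*-nn (sq-nn t) (≤⇒0≤ (x≤∣x∣ Y))))) nn)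
    where
    B≤t′ : 1ℤ + (+ ∣ a ∣ + + ∣ c ∣ + + ∣ Y ∣) ≤ t
    B≤t′ = subst (_≤ t) (trans (pos-+ 1 (∣ a ∣ ℕ.+ ∣ c ∣ ℕ.+ ∣ Y ∣))
      (cong (_+_ 1ℤ) (trans (pos-+ (∣ a ∣ ℕ.+ ∣ c ∣) ∣ Y ∣) (cong (_+ + ∣ Y ∣) (pos-+ ∣ a ∣ ∣ c ∣))))) B≤t
    1≤t : 1ℤ ≤ t
    1≤t = ℤP.≤-trans (+≤+ (s≤s z≤n)) B≤t
    1≤s : 1ℤ ≤ s
    1≤s = ℤP.≤-trans 1≤t t≤s
    0≤t : 0ℤ ≤ t
    0≤t = 1≤⇒0≤ 1≤t
    0≤s : 0ℤ ≤ s
    0≤s = 1≤⇒0≤ 1≤s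

  quadratic-nonneg : X ≡ 0ℤ → 0ℤ ≤ Y
  quadratic-nonneg refl with 1≤-split (- Y)
  ... | inj₂ p = nn-by (solve 1 (λ X → X := # 0 :- (:- X)) refl Y) (≤⇒0≤ p)
  ... | inj₁ p with h B (s≤s z≤n)
    where B = suc (∣ a ∣ ℕ.+ suc d ℕ.* ∣ c ∣)
  ...   | s , t , B≤t , t≤s , unit , nn = ⊥-elim (¬0≤-1 {a + s * (t * t) * 0ℤ + s * c + t * t * Y}
            (nn-by (solve 8 (λ a c Y s t A C d → :- # 1 :- (a :+ s :* (t :* t) :* # 0 :+ s :* c :+ t :* t :* Y) :=
                 t :* t :* (:- Y :- # 1) :+ t :* (t :- (# 1 :+ (A :+ (# 1 :+ d) :* C))) :+ (t :- # 1) :+ A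
                   :* (t :- # 1) :+ (A :- a) :+ ((# 1 :+ d) :* t :- s) :* C :+ s :* (C :- c))
                 refl a c Y s t (+ ∣ a ∣) (+ ∣ c ∣) (+ d))
              (+-nn (+-nn (+-nn (+-nn (+-nn (+-nn
                (*-nn (sq-nn t) (≤⇒0≤ p))
                (*-nn 0≤t (≤⇒0≤ B≤t′)))
                (≤⇒0≤ 1≤t))
                (*-nn (pos-nn ∣ a ∣) (≤⇒0≤ 1≤t)))
                (≤⇒0≤ (x≤∣x∣ a)))
                (*-nn (≤⇒0≤ s≤) (pos-nn ∣ c ∣)))
                (*-nn 0≤s (≤⇒0≤ (x≤∣x∣ c))))) nn)
    where
    B≤t′ : 1ℤ + (+ ∣ a ∣ + (1ℤ + + d) * + ∣ c ∣) ≤ t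
    B≤t′ = subst (_≤ t) (trans (pos-+ 1 (∣ a ∣ ℕ.+ suc d ℕ.* ∣ c ∣))
      (cong (_+_ 1ℤ) (trans (pos-+ ∣ a ∣ (suc d ℕ.* ∣ c ∣)) (cong (_+_ (+ ∣ a ∣))
      (trans (pos-* (suc d) ∣ c ∣) (cong (_* + ∣ c ∣) (pos-+ 1 d))))))) B≤t
    1≤t : 1ℤ ≤ t
    1≤t = ℤP.≤-trans (+≤+ (s≤s z≤n)) B≤t
    0≤t : 0ℤ ≤ t
    0≤t = 1≤⇒0≤ 1≤t
    0≤s : 0ℤ ≤ s
    0≤s = 1≤⇒0≤ (ℤP.≤-trans 1≤t t≤s)
    s≤ : s ≤ (1ℤ + + d) * t
    s≤ = sq-cancel-≤ (*-nn (+-nn (pos-nn 1) (pos-nn d)) 0≤t)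
      (≤-by (trans (cong (λ w → (1ℤ + + d) * t * ((1ℤ + + d) * t) - w) unit)
        (solve 2 (λ d t → (# 1 :+ d) :* t :* ((# 1 :+ d) :* t) :- (# 1 :+ d :* (t :* t))
          := (d :* d :+ d) :* (t :* t) :+ (t :- # 1) :* (t :- # 1) :+ # 2 :* (t :- # 1)) refl (+ d) t))
        (+-nn (+-nn (*-nn (+-nn (sq-nn (+ d)) (pos-nn d)) (sq-nn t)) (sq-nn (t - 1ℤ))) (*-nn (pos-nn 2) (≤⇒0≤ 1≤t))))

  linear-nonneg : X ≡ 0ℤ → Y ≡ 0ℤ → 0ℤ ≤ c
  linear-nonneg refl refl with 1≤-split (- c)
  ... | inj₂ p = nn-by (solve 1 (λ X → X := # 0 :- (:- X)) refl c) (≤⇒0≤ p)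
  ... | inj₁ p with h (suc ∣ a ∣) (s≤s z≤n)
  ...   | s , t , B≤t , t≤s , unit , nn = ⊥-elim (¬0≤-1 {a + s * (t * t) * 0ℤ + s * c + t * t * 0ℤ}
            (nn-by (solve 5 (λ a c s t A → :- # 1 :- (a :+ s :* (t :* t) :* # 0 :+ s :* c :+ t :* t :* # 0) :=
                  s :* (:- c :- # 1) :+ (s :- (# 1 :+ A)) :+ (A :- a)) refl a c s t (+ ∣ a ∣))
              (+-nn (+-nn (*-nn 0≤s (≤⇒0≤ p)) (≤⇒0≤ B≤s)) (≤⇒0≤ (x≤∣x∣ a)))) nn)
    where
    B≤s : 1ℤ + + ∣ a ∣ ≤ s
    B≤s = ℤP.≤-trans (subst (_≤ t) (pos-+ 1 ∣ a ∣) B≤t) t≤s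
    0≤s : 0ℤ ≤ s
    0≤s = ℤP.≤-trans (+-nn (pos-nn 1) (pos-nn ∣ a ∣)) B≤s

-- Quartics that are asymptotic to the square of an irreducible indefinite form

-- The pairs `(V, W)` run over a coset of a lattice with triangular basis and determinant `a₁ b₂`. A
-- translation has removed `v³` and `v² w` from the cubic part, which makes it a multiple of `w²`;
-- the aim is to show that it vanishes.
record HyperbolicForm : Set where
  field
    d a₁ b₂ : ℕ
    1≤d : 1 ℕ.≤ d
    1≤a₁ : 1 ℕ.≤ a₁
    1≤b₂ : 1 ℕ.≤ b₂
    nonsquare : NonSquare (+ d)
    v₂ v₀ w₀ μ ν α β γ ρ σ τ : ℤ

  v₁ w₂ D : ℤ
  v₁ = + a₁
  w₂ = + b₂
  D = + d

  V : ℤ → ℤ → ℤ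
  V x y = v₁ * x + v₂ * y + v₀

  W : ℤ → ℤ
  W y = w₂ * y + w₀

  norm cubic quadratic-part linear-part : ℤ → ℤ → ℤ
  norm v w = v * v - D * (w * w)
  cubic v w = w * w * (μ * v + ν * w)
  quadratic-part v w = α * (v * v) + β * (v * w) + γ * (w * w)
  linear-part v w = ρ * v + σ * w

  Φ : ℤ → ℤ → ℤ
  Φ v w = norm v w * norm v w + cubic v w + quadratic-part v w + linear-part v w + τ

  -- The quadratic part equals `α * norm v w + β * (v * w) + κ * (w * w)`, so `κ` and `β` measure
  -- its distance from a multiple of the norm.
  κ : ℤ
  κ = α * D + γ

  -- Up to the factor 2, the coefficients of `s t²` and `t²` when `Φ` is summed over the images of
  -- `(v, w)` under a unit `s + t √D` and its inverse.
  Ξ S : ℤ → ℤ → ℤ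
  Ξ v w = μ * (v * v * v) + + 3 * (ν * (v * v * w)) + + 3 * D * (μ * (v * (w * w))) + D * (ν * (w * w * w))
  S v w = κ * (v * v + D * (w * w)) + + 2 * D * (β * (v * w))

module _ (F : HyperbolicForm) where
  open HyperbolicForm F

  unit-relation : ∀ {s t} x → s * s ≡ 1ℤ + D * (t * t) → (s * s - 1ℤ - D * (t * t)) * x ≡ 0ℤ
  unit-relation {s} {t} x e = trans (cong (λ w → (w - 1ℤ - D * (t * t)) * x) e)
    (solve 2 (λ y x → (# 1 :+ y :- # 1 :- y) :* x := # 0) refl (D * (t * t)) x)

  -- An identity that holds only modulo `s² = 1 + D t²`: the multiple of this relation by which the
  -- two sides differ is supplied as `x`, and the rest is left to the ring solver.
  modulo-unit : ∀ {s t a b} x → s * s ≡ 1ℤ + D * (t * t) → a ≡ b + (s * s - 1ℤ - D * (t * t)) * x → a ≡ b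
  modulo-unit {s} {t} {a} {b} x e h = trans h (trans (cong (_+_ b) (unit-relation {s} {t} x e))
    (solve 1 (λ b → b :+ # 0 := b) refl b))

  norm-invariant : ∀ s t v w → s * s ≡ 1ℤ + D * (t * t) → norm (s * v + D * (t * w)) (t * v + s * w) ≡ norm v w
  norm-invariant s t v w e = modulo-unit {s} {t} (v * v - D * (w * w)) e
    (solve 5 (λ s t v w D → (s :* v :+ D :* (t :* w)) :* (s :* v :+ D :* (t :* w)) :- D
      :* ((t :* v :+ s :* w) :* (t :* v :+ s :* w)) :=
       (v :* v :- D :* (w :* w)) :+ (s :* s :- # 1 :- D :* (t :* t)) :* (v :* v :- D :* (w :* w))) refl s t v w D)

  cubic-orbit : ∀ s t v w → s * s ≡ 1ℤ + D * (t * t) →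
    cubic (s * v + D * (t * w)) (t * v + s * w) + cubic (s * v + D * ((- t) * w)) ((- t) * v + s * w)
      ≡ + 2 * (s * (t * t) * Ξ v w + s * cubic v w)
  cubic-orbit s t v w e = modulo-unit {s} {t} (+ 2 * (s * cubic v w)) e
    (solve 7 (λ s t v w D μ ν →
       (t :* v :+ s :* w) :* (t :* v :+ s :* w) :* (μ :* (s :* v :+ D :* (t :* w)) :+ ν :* (t :* v :+ s :* w))
       :+ ((:- t) :* v :+ s :* w) :* ((:- t) :* v :+ s :* w)
         :* (μ :* (s :* v :+ D :* ((:- t) :* w)) :+ ν :* ((:- t) :* v :+ s :* w)) :=
       # 2 :* (s :* (t :* t) :* (μ :* (v :* v :* v) :+ # 3 :* (ν :* (v :* v :* w)) :+ # 3 :* D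
         :* (μ :* (v :* (w :* w))) :+ D :* (ν :* (w :* w :* w))) :+ s :* (w :* w :* (μ :* v :+ ν :* w)))
       :+ (s :* s :- # 1 :- D :* (t :* t)) :* (# 2 :* (s :* (w :* w :* (μ :* v :+ ν :* w))))) refl s t v w D μ ν)

  quadratic-orbit : ∀ s t v w → s * s ≡ 1ℤ + D * (t * t) →
    quadratic-part (s * v + D * (t * w)) (t * v + s * w) + quadratic-part (s * v + D * ((- t) * w))
      ((- t) * v + s * w) ≡ + 2 * (quadratic-part v w + t * t * S v w)
  quadratic-orbit s t v w e = modulo-unit {s} {t} (+ 2 * quadratic-part v w) e
    (solve 8 (λ s t v w D α β γ →
       (α :* ((s :* v :+ D :* (t :* w)) :* (s :* v :+ D :* (t :* w))) :+ β
         :* ((s :* v :+ D :* (t :* w)) :* (t :* v :+ s :* w)) :+ γ :* ((t :* v :+ s :* w) :* (t :* v :+ s :* w)))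
       :+ (α :* ((s :* v :+ D :* ((:- t) :* w)) :* (s :* v :+ D :* ((:- t) :* w))) :+ β
         :* ((s :* v :+ D :* ((:- t) :* w)) :* ((:- t) :* v :+ s :* w)) :+ γ
         :* (((:- t) :* v :+ s :* w) :* ((:- t) :* v :+ s :* w))) :=
       # 2 :* ((α :* (v :* v) :+ β :* (v :* w) :+ γ :* (w :* w)) :+ t :* t
         :* ((α :* D :+ γ) :* (v :* v :+ D :* (w :* w)) :+ # 2 :* D :* (β :* (v :* w))))
       :+ (s :* s :- # 1 :- D :* (t :* t)) :* (# 2 :* (α :* (v :* v) :+ β :* (v :* w) :+ γ :* (w :* w)))) refl s t v w
         D α β γ)

  -- The sum over a unit and its inverse is even in t, which leaves only the terms below.
  Φ-orbit : ∀ s t v w → s * s ≡ 1ℤ + D * (t * t) →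
    Φ (s * v + D * (t * w)) (t * v + s * w) + Φ (s * v + D * ((- t) * w)) ((- t) * v + s * w) ≡
    + 2 * ((norm v w * norm v w + quadratic-part v w + τ) + s * (t * t) * Ξ v w + s * (cubic v w + linear-part v w)
      + t * t * S v w)
  Φ-orbit s t v w e = begin
    (n₁ * n₁ + c₁ + q₁ + l₁ + τ) + (n₂ * n₂ + c₂ + q₂ + l₂ + τ)
      ≡⟨ cong₂ (λ a b → (a * a + c₁ + q₁ + l₁ + τ) + (b * b + c₂ + q₂ + l₂ + τ)) (norm-invariant s t v w e)
        (norm-invariant s (- t) v w (trans e (solve 2 (λ D t → # 1 :+ D :* (t :* t) := # 1 :+ D :* ((:- t) :* (:- t)))
        refl D t))) ⟩
    (n * n + c₁ + q₁ + l₁ + τ) + (n * n + c₂ + q₂ + l₂ + τ)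
      ≡⟨ solve 8 (λ n c₁ q₁ l₁ c₂ q₂ l₂ τ → (n :* n :+ c₁ :+ q₁ :+ l₁ :+ τ) :+ (n :* n :+ c₂ :+ q₂ :+ l₂ :+ τ)
        := # 2 :* (n :* n :+ τ) :+ (c₁ :+ c₂) :+ (q₁ :+ q₂) :+ (l₁ :+ l₂)) refl n c₁ q₁ l₁ c₂ q₂ l₂ τ ⟩
    + 2 * (n * n + τ) + (c₁ + c₂) + (q₁ + q₂) + (l₁ + l₂)
      ≡⟨ cong₂ (λ a b → + 2 * (n * n + τ) + a + b + (l₁ + l₂)) (cubic-orbit s t v w e) (quadratic-orbit s t v w e) ⟩
    + 2 * (n * n + τ) + + 2 * (s * (t * t) * Ξ v w + s * cubic v w) + + 2 * (quadratic-part v w + t * t * S v w)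
      + (l₁ + l₂)
      ≡⟨ cong (_+_ (+ 2 * (n * n + τ) + + 2 * (s * (t * t) * Ξ v w + s * cubic v w) + + 2
        * (quadratic-part v w + t * t * S v w)))
          (solve 7 (λ s t v w D ρ σ → (ρ :* (s :* v :+ D :* (t :* w)) :+ σ :* (t :* v :+ s :* w))
            :+ (ρ :* (s :* v :+ D :* ((:- t) :* w)) :+ σ :* ((:- t) :* v :+ s :* w))
            := # 2 :* (s :* (ρ :* v :+ σ :* w))) refl s t v w D ρ σ) ⟩
    + 2 * (n * n + τ) + + 2 * (s * (t * t) * Ξ v w + s * cubic v w) + + 2 * (quadratic-part v w + t * t * S v w) + + 2
      * (s * linear-part v w)
      ≡⟨ solve 9 (λ n τ s t X c q S l → # 2 :* (n :* n :+ τ) :+ # 2 :* (s :* (t :* t) :* X :+ s :* c) :+ # 2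
        :* (q :+ t :* t :* S) :+ # 2 :* (s :* l) :=
            # 2 :* ((n :* n :+ q :+ τ) :+ s :* (t :* t) :* X :+ s :* (c :+ l) :+ t :* t :* S)) refl n τ s t (Ξ v w)
              (cubic v w) (quadratic-part v w) (S v w) (linear-part v w) ⟩
    + 2 * ((n * n + quadratic-part v w + τ) + s * (t * t) * Ξ v w + s * (cubic v w + linear-part v w) + t * t * S v w)
      ∎
    where
    open ≡-Reasoning
    n = norm v w
    n₁ = norm (s * v + D * (t * w)) (t * v + s * w)
    n₂ = norm (s * v + D * ((- t) * w)) ((- t) * v + s * w)
    c₁ = cubic (s * v + D * (t * w)) (t * v + s * w)
    c₂ = cubic (s * v + D * ((- t) * w)) ((- t) * v + s * w)
    q₁ = quadratic-part (s * v + D * (t * w)) (t * v + s * w)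
    q₂ = quadratic-part (s * v + D * ((- t) * w)) ((- t) * v + s * w)
    l₁ = linear-part (s * v + D * (t * w)) (t * v + s * w)
    l₂ = linear-part (s * v + D * ((- t) * w)) ((- t) * v + s * w)

  -- Multiplication by `s + t √D` moves `(V, W)` by a multiple of the determinant `v₁ w₂`, and such
  -- a shift can be solved for integral `x′`, `y′` in the triangular system.
  coset-invariant : ∀ s t u k x y → s ≡ 1ℤ + u * (v₁ * w₂) → t ≡ k * (v₁ * w₂) →
    ∃ λ x′ → ∃ λ y′ → V x′ y′ ≡ s * V x y + D * (t * W y) × W y′ ≡ t * V x y + s * W y
  coset-invariant s t u k x y s≡ t≡ = x + w₂ * (u * V x y + D * (k * W y)) - v₂ * (k * V x y + u * W y) , y + v₁
    * (k * V x y + u * W y)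
    , trans (solve 11 (λ v₁ v₂ v₀ w₂ x y X Y u k D → v₁ :* (x :+ w₂ :* (u :* X :+ D :* (k :* Y)) :- v₂
      :* (k :* X :+ u :* Y)) :+ v₂ :* (y :+ v₁ :* (k :* X :+ u :* Y)) :+ v₀ :=
           (v₁ :* x :+ v₂ :* y :+ v₀) :+ u :* (v₁ :* w₂) :* X :+ D :* ((k :* (v₁ :* w₂)) :* Y)) refl v₁ v₂ v₀ w₂ x y
             (V x y) (W y) u k D)
        (trans (solve 4 (λ a X b Y → X :+ a :* X :+ b := (# 1 :+ a) :* X :+ b) refl (u * (v₁ * w₂)) (V x y)
          (D * ((k * (v₁ * w₂)) * W y)) 0ℤ)
          (cong₂ (λ a b → a * V x y + D * (b * W y)) (sym s≡) (sym t≡)))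
    , trans (solve 8 (λ v₁ w₂ w₀ y X Y u k → w₂ :* (y :+ v₁ :* (k :* X :+ u :* Y)) :+ w₀
      := k :* (v₁ :* w₂) :* X :+ ((w₂ :* y :+ w₀) :+ u :* (v₁ :* w₂) :* Y)) refl v₁ w₂ w₀ y (V x y) (W y) u k)
        (trans (solve 3 (λ a Y b → b :+ (Y :+ a :* Y) := b :+ (# 1 :+ a) :* Y) refl (u * (v₁ * w₂)) (W y)
          (k * (v₁ * w₂) * V x y))
          (cong₂ (λ a b → b * V x y + a * W y) (sym s≡) (sym t≡)))

  module _ (nonneg : ∀ x y → 0ℤ ≤ Φ (V x y) (W y)) where

    orbit-nonneg : ∀ x y B → 1 ℕ.≤ B → ∃ λ s → ∃ λ t → + B ≤ t × t ≤ s × s * s ≡ 1ℤ + D * (t * t) ×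
      0ℤ ≤ (norm (V x y) (W y) * norm (V x y) (W y) + quadratic-part (V x y) (W y) + τ) + s * (t * t) * Ξ (V x y)
        (W y) + s * (cubic (V x y) (W y) + linear-part (V x y) (W y)) + t * t * S (V x y) (W y)
    orbit-nonneg x y B 1≤B = from (large-unit d (a₁ ℕ.* b₂) B 1≤d (ℕP.*-mono-≤ 1≤a₁ 1≤b₂) 1≤B nonsquare)
      where
      from : LargeUnit d (a₁ ℕ.* b₂) B → _
      from U = s , t , B≤t , t≤s , unit , *-cancelˡ-nn (+ 2) (+≤+ (s≤s z≤n))
        (nn-by (sym (Φ-orbit s t (V x y) (W y) unit)) (+-nn (image (coset-invariant s t u v x y s≡ t≡))
        (image (coset-invariant s (- t) u (- v) x y s≡ -t≡))))
        where
        open LargeUnit U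
        s≡ : s ≡ 1ℤ + u * (v₁ * w₂)
        s≡ = trans s≡1 (cong (λ z → 1ℤ + u * z) (pos-* a₁ b₂))
        t≡ : t ≡ v * (v₁ * w₂)
        t≡ = trans t≡0 (cong (v *_) (pos-* a₁ b₂))
        -t≡ : - t ≡ (- v) * (v₁ * w₂)
        -t≡ = trans (cong -_ t≡) (solve 2 (λ v z → :- (v :* z) := (:- v) :* z) refl v (v₁ * w₂))
        image : ∀ {a b} → (∃ λ x′ → ∃ λ y′ → V x′ y′ ≡ a × W y′ ≡ b) → 0ℤ ≤ Φ a b
        image (x′ , y′ , e₁ , e₂) = subst₂ (λ a b → 0ℤ ≤ Φ a b) e₁ e₂ (nonneg x′ y′)

    Ξ-nonneg : ∀ x y → 0ℤ ≤ Ξ (V x y) (W y)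
    Ξ-nonneg x y = Growth.cubic-nonneg d _ _ _ _ (orbit-nonneg x y)

    cube-cancel : ∀ {p x} → 1ℤ ≤ p → (∀ e → 0ℤ ≤ x * ((p * e) * (p * e) * (p * e))) → x ≡ 0ℤ
    cube-cancel {p} {x} 1≤p h = both-nn⇒≡0
      (*-cancelˡ-nn (p * p * p) 1≤p³ (nn-by (solve 2 (λ p x → p :* p :* p :* x
        := x :* ((p :* # 1) :* (p :* # 1) :* (p :* # 1))) refl p x) (h 1ℤ)))
      (*-cancelˡ-nn (p * p * p) 1≤p³ (nn-by (solve 2 (λ p x → p :* p :* p :* (:- x)
        := x :* ((p :* (:- # 1)) :* (p :* (:- # 1)) :* (p :* (:- # 1)))) refl p x) (h (- 1ℤ))))
      where
      1≤p³ : 1ℤ ≤ p * p * p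
      1≤p³ = 1≤-* (1≤-* 1≤p 1≤p) 1≤p

    1≤v₁ : 1ℤ ≤ v₁
    1≤v₁ = +≤+ 1≤a₁

    1≤w₂ : 1ℤ ≤ w₂
    1≤w₂ = +≤+ 1≤b₂

    1≤D : 1ℤ ≤ D
    1≤D = +≤+ 1≤d

    -- A cubic that is nonnegative on a coset has no room in odd directions. The line `y = 0` fixes
    -- `W` and isolates `μ`; for `ν` below, the direction `(- v₂, v₁)` fixes `V`.
    μ≡0 : μ ≡ 0ℤ
    μ≡0 = cube-cancel 1≤v₁ (λ e → leading-nonneg (Ξ v₀ w₀ ∷ + 3
      * ((v₁ * e) * (μ * (v₀ * v₀) + + 2 * ν * v₀ * w₀ + D * (μ * (w₀ * w₀)))) ∷ + 3
      * ((v₁ * e) * (v₁ * e) * (μ * v₀ + ν * w₀)) ∷ μ * ((v₁ * e) * (v₁ * e) * (v₁ * e)) ∷ []) 0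
      (λ T _ → subst (0ℤ ≤_) (trans (cong₂ Ξ (solve 5 (λ v₁ v₂ v₀ e T → v₁ :* (e :* T) :+ v₂ :* # 0 :+ v₀
        := v₀ :+ (v₁ :* e) :* T) refl v₁ v₂ v₀ e (+ T)) (solve 2 (λ w₂ w₀ → w₂ :* # 0 :+ w₀ := w₀) refl w₂ w₀))
        (solve 7 (λ p v₀ w₀ D μ ν T → μ :* ((v₀ :+ p :* T) :* (v₀ :+ p :* T) :* (v₀ :+ p :* T)) :+ # 3
          :* (ν :* ((v₀ :+ p :* T) :* (v₀ :+ p :* T) :* w₀)) :+ # 3 :* D :* (μ :* ((v₀ :+ p :* T) :* (w₀ :* w₀))) :+ D
          :* (ν :* (w₀ :* w₀ :* w₀)) :=
            (μ :* (v₀ :* v₀ :* v₀) :+ # 3 :* (ν :* (v₀ :* v₀ :* w₀)) :+ # 3 :* D :* (μ :* (v₀ :* (w₀ :* w₀))) :+ D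
              :* (ν :* (w₀ :* w₀ :* w₀)))
            :+ T :* (# 3 :* (p :* (μ :* (v₀ :* v₀) :+ # 2 :* ν :* v₀ :* w₀ :+ D :* (μ :* (w₀ :* w₀)))) :+ T
              :* (# 3 :* (p :* p :* (μ :* v₀ :+ ν :* w₀)) :+ T :* (μ :* (p :* p :* p) :+ T :* # 0)))) refl (v₁ * e) v₀
              w₀ D μ ν (+ T)))
        (Ξ-nonneg (e * + T) 0ℤ)))

    ν≡0 : ν ≡ 0ℤ
    ν≡0 = cube-cancel (1≤-* 1≤w₂ 1≤v₁) (λ e → *-cancelˡ-nn D 1≤D
      (leading-nonneg (Ξ v₀ w₀ ∷ + 3 * ((w₂ * v₁ * e) * (ν * (v₀ * v₀) + + 2 * D * μ * v₀ * w₀ + D * (ν * (w₀ * w₀))))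
      ∷ + 3 * D * ((w₂ * v₁ * e) * (w₂ * v₁ * e) * (μ * v₀ + ν * w₀)) ∷ D
      * (ν * ((w₂ * v₁ * e) * (w₂ * v₁ * e) * (w₂ * v₁ * e))) ∷ []) 0
      (λ T _ → subst (0ℤ ≤_) (trans (cong₂ Ξ (solve 5 (λ v₁ v₂ v₀ e T
        → v₁ :* ((:- v₂) :* (e :* T)) :+ v₂ :* (v₁ :* (e :* T)) :+ v₀ := v₀) refl v₁ v₂ v₀ e (+ T))
        (solve 5 (λ w₂ w₀ v₁ e T → w₂ :* (v₁ :* (e :* T)) :+ w₀ := w₀ :+ (w₂ :* v₁ :* e) :* T) refl w₂ w₀ v₁ e (+ T)))
        (solve 7 (λ p v₀ w₀ D μ ν T → μ :* (v₀ :* v₀ :* v₀) :+ # 3 :* (ν :* (v₀ :* v₀ :* (w₀ :+ p :* T))) :+ # 3 :* D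
          :* (μ :* (v₀ :* ((w₀ :+ p :* T) :* (w₀ :+ p :* T)))) :+ D
          :* (ν :* ((w₀ :+ p :* T) :* (w₀ :+ p :* T) :* (w₀ :+ p :* T))) :=
            (μ :* (v₀ :* v₀ :* v₀) :+ # 3 :* (ν :* (v₀ :* v₀ :* w₀)) :+ # 3 :* D :* (μ :* (v₀ :* (w₀ :* w₀))) :+ D
              :* (ν :* (w₀ :* w₀ :* w₀)))
            :+ T :* (# 3 :* (p :* (ν :* (v₀ :* v₀) :+ # 2 :* D :* μ :* v₀ :* w₀ :+ D :* (ν :* (w₀ :* w₀)))) :+ T
              :* (# 3 :* D :* (p :* p :* (μ :* v₀ :+ ν :* w₀)) :+ T :* (D :* (ν :* (p :* p :* p)) :+ T :* # 0)))) refl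
              (w₂ * v₁ * e) v₀ w₀ D μ ν (+ T)))
        (Ξ-nonneg ((- v₂) * (e * + T)) (v₁ * (e * + T))))))

    Ξ≡0 : ∀ v w → Ξ v w ≡ 0ℤ
    Ξ≡0 v w = trans (cong₂ (λ m n → m * (v * v * v) + + 3 * (n * (v * v * w)) + + 3 * D * (m * (v * (w * w))) + D
      * (n * (w * w * w))) μ≡0 ν≡0)
      (solve 3 (λ v w D → # 0 :* (v :* v :* v) :+ # 3 :* (# 0 :* (v :* v :* w)) :+ # 3 :* D
        :* (# 0 :* (v :* (w :* w))) :+ D :* (# 0 :* (w :* w :* w)) := # 0) refl v w D)

    cubic≡0 : ∀ v w → cubic v w ≡ 0ℤ
    cubic≡0 v w = trans (cong₂ (λ m n → w * w * (m * v + n * w)) μ≡0 ν≡0)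
      (solve 2 (λ v w → w :* w :* (# 0 :* v :+ # 0 :* w) := # 0) refl v w)

    S-coset-nonneg : ∀ x y → 0ℤ ≤ S (V x y) (W y)
    S-coset-nonneg x y = Growth.quadratic-nonneg d _ _ _ _ (orbit-nonneg x y) (Ξ≡0 (V x y) (W y))

    -- The direction `(w₂ c - v₂ b, v₁ b)` moves `(V, W)` along `(c, b)`, and `S c b` appears in the
    -- top coefficient. This passes from the coset to all integral arguments.
    S-nonneg : ∀ c b → 0ℤ ≤ S c b
    S-nonneg c b = *-cancelˡ-nn (p * p) (1≤-* (1≤-* 1≤v₁ 1≤w₂) (1≤-* 1≤v₁ 1≤w₂))
      (leading-nonneg (S v₀ w₀ ∷ + 2 * (p * (κ * (v₀ * c + D * (w₀ * b)) + D * (β * (v₀ * b + w₀ * c)))) ∷ p * p * S c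
        b ∷ []) 0
      (λ T _ → subst (0ℤ ≤_) (trans (cong₂ S (solve 7 (λ v₁ v₂ v₀ w₂ b c T
        → v₁ :* ((w₂ :* c :- v₂ :* b) :* T) :+ v₂ :* (v₁ :* b :* T) :+ v₀ := v₀ :+ v₁ :* w₂ :* c :* T) refl v₁ v₂ v₀
        w₂ b c (+ T)) (solve 5 (λ w₂ w₀ v₁ b T → w₂ :* (v₁ :* b :* T) :+ w₀ := w₀ :+ v₁ :* w₂ :* b :* T) refl w₂ w₀ v₁
        b (+ T)))
        (solve 9 (λ p c b v₀ w₀ D κ β T → κ :* ((v₀ :+ p :* c :* T) :* (v₀ :+ p :* c :* T) :+ D
          :* ((w₀ :+ p :* b :* T) :* (w₀ :+ p :* b :* T))) :+ # 2 :* D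
          :* (β :* ((v₀ :+ p :* c :* T) :* (w₀ :+ p :* b :* T))) :=
           (κ :* (v₀ :* v₀ :+ D :* (w₀ :* w₀)) :+ # 2 :* D :* (β :* (v₀ :* w₀))) :+ T
             :* (# 2 :* (p :* (κ :* (v₀ :* c :+ D :* (w₀ :* b)) :+ D :* (β :* (v₀ :* b :+ w₀ :* c)))) :+ T
             :* (p :* p :* (κ :* (c :* c :+ D :* (b :* b)) :+ # 2 :* D :* (β :* (c :* b))) :+ T :* # 0)))
           refl p c b v₀ w₀ D κ β (+ T)))
        (S-coset-nonneg ((w₂ * c - v₂ * b) * + T) (v₁ * b * + T))))
      where p = v₁ * w₂

    0≤κ : 0ℤ ≤ κ
    0≤κ = nn-by (solve 3 (λ κ D β → κ := κ :* (# 1 :* # 1 :+ D :* (# 0 :* # 0)) :+ # 2 :* D :* (β :* (# 1 :* # 0)))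
      refl κ D β) (S-nonneg 1ℤ 0ℤ)

    β-by-κ : κ ≡ 0ℤ → β ≡ 0ℤ
    β-by-κ κ≡0 = both-nn⇒≡0
       (*-cancelˡ-nn (+ 2 * D) 1≤2D (nn-by (solve 2 (λ D β → # 2 :* D :* β
         := # 0 :* (# 1 :* # 1 :+ D :* (# 1 :* # 1)) :+ # 2 :* D :* (β :* (# 1 :* # 1))) refl D β)
         (subst (λ k → 0ℤ ≤ k * (1ℤ * 1ℤ + D * (1ℤ * 1ℤ)) + + 2 * D * (β * (1ℤ * 1ℤ))) κ≡0 (S-nonneg 1ℤ 1ℤ))))
       (*-cancelˡ-nn (+ 2 * D) 1≤2D (nn-by (solve 2 (λ D β → # 2 :* D :* (:- β)
         := # 0 :* (# 1 :* # 1 :+ D :* ((:- # 1) :* (:- # 1))) :+ # 2 :* D :* (β :* (# 1 :* (:- # 1)))) refl D β)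
         (subst (λ k → 0ℤ ≤ k * (1ℤ * 1ℤ + D * ((- 1ℤ) * (- 1ℤ))) + + 2 * D * (β * (1ℤ * (- 1ℤ)))) κ≡0
         (S-nonneg 1ℤ (- 1ℤ)))))
       where
       1≤2D : 1ℤ ≤ + 2 * D
       1≤2D = 1≤-* (+≤+ (s≤s z≤n)) 1≤D

    -- `S` at `(- D β, κ)` equals `κ D (κ² - D β²)`. If this were 0, then `κ² = D β²` and
    -- `nonsquare` would give `β = κ = 0`.
    β²<κ² : 1ℤ ≤ κ → 1ℤ ≤ κ * κ - D * (β * β)
    β²<κ² 1≤κ with 1≤-split (κ * κ - D * (β * β))
    ... | inj₁ ok = ok
    ... | inj₂ ≤0 = ⊥-elim (absurd≤ (subst (1ℤ ≤_) κ≡0 1≤κ))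
      where
      disc≡0 : κ * κ - D * (β * β) ≡ 0ℤ
      disc≡0 = ≤0∧0≤⇒≡0 ≤0 (*-cancelˡ-nn (κ * D) (1≤-* 1≤κ 1≤D) (nn-by
         (solve 3 (λ κ D β → κ :* D :* (κ :* κ :- D :* (β :* β))
           := κ :* ((:- (D :* β)) :* (:- (D :* β)) :+ D :* (κ :* κ)) :+ # 2 :* D :* (β :* ((:- (D :* β)) :* κ))) refl
           κ D β) (S-nonneg (- (D * β)) κ)))
      β≡0 : β ≡ 0ℤ
      β≡0 = nonsquare κ β (trans (solve 2 (λ x y → x := (x :- y) :+ y) refl (κ * κ) (D * (β * β)))
        (trans (cong (_+ D * (β * β)) disc≡0) (solve 1 (λ y → # 0 :+ y := y) refl (D * (β * β)))))
      κ≡0 : κ ≡ 0ℤ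
      κ≡0 = [ id , id ]′ (*-zero-split κ κ (trans (solve 2 (λ κ D → κ :* κ := κ :* κ :- D :* (# 0 :* # 0)) refl κ D)
        (trans (cong (λ b → κ * κ - D * (b * b)) (sym β≡0)) disc≡0)))

    module _ (E : ℕ) (1≤E : 1 ℕ.≤ E) (covers : ∀ n → ∃ λ x → ∃ λ y → Φ (V x y) (W y) ≡ + E * + n) where

      -- With `κ = β = 0` the growth argument reaches the linear part, whose two coefficients vanish
      -- because both signs occur. Then `Φ` is a monic quadratic in the norm and has `O(M²)` values.
      κ≢0 : κ ≢ 0ℤ
      κ≢0 κ≡0 = ¬SparseValues (4 ℕ.* E) (+ E) (+≤+ 1≤E) sparse
        where
        β≡0 : β ≡ 0ℤ
        β≡0 = β-by-κ κ≡0
        S≡0 : ∀ v w → S v w ≡ 0ℤ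
        S≡0 v w = trans (cong₂ (λ k b → k * (v * v + D * (w * w)) + + 2 * D * (b * (v * w))) κ≡0 β≡0)
          (solve 3 (λ v w D → # 0 :* (v :* v :+ D :* (w :* w)) :+ # 2 :* D :* (# 0 :* (v :* w)) := # 0) refl v w D)
        linear-nonneg : ∀ x y → 0ℤ ≤ linear-part (V x y) (W y)
        linear-nonneg x y = nn-by (trans (solve 1 (λ l → l := # 0 :+ l) refl (linear-part (V x y) (W y)))
          (cong (_+ linear-part (V x y) (W y)) (sym (cubic≡0 (V x y) (W y)))))
          (Growth.linear-nonneg d _ _ _ _ (orbit-nonneg x y) (Ξ≡0 (V x y) (W y)) (S≡0 (V x y) (W y)))
        linear-cancel : ∀ {p x} → 1ℤ ≤ p → (∀ e → 0ℤ ≤ x * (p * e)) → x ≡ 0ℤ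
        linear-cancel {p} {x} 1≤p h = both-nn⇒≡0
          (*-cancelˡ-nn p 1≤p (nn-by (solve 2 (λ p x → p :* x := x :* (p :* # 1)) refl p x) (h 1ℤ)))
          (*-cancelˡ-nn p 1≤p (nn-by (solve 2 (λ p x → p :* (:- x) := x :* (p :* (:- # 1))) refl p x) (h (- 1ℤ))))
        ρ≡0 : ρ ≡ 0ℤ
        ρ≡0 = linear-cancel 1≤v₁ (λ e → leading-nonneg (linear-part v₀ w₀ ∷ ρ * (v₁ * e) ∷ []) 0 (λ T _
          → subst (0ℤ ≤_)
            (solve 9 (λ v₁ v₂ v₀ w₂ w₀ e T ρ σ → ρ :* (v₁ :* (e :* T) :+ v₂ :* # 0 :+ v₀) :+ σ :* (w₂ :* # 0 :+ w₀)
              := (ρ :* v₀ :+ σ :* w₀) :+ T :* (ρ :* (v₁ :* e) :+ T :* # 0)) refl v₁ v₂ v₀ w₂ w₀ e (+ T) ρ σ)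
            (linear-nonneg (e * + T) 0ℤ)))
        σ≡0 : σ ≡ 0ℤ
        σ≡0 = linear-cancel (1≤-* 1≤w₂ 1≤v₁) (λ e → leading-nonneg (linear-part v₀ w₀ ∷ σ * (w₂ * v₁ * e) ∷ []) 0
          (λ T _ → subst (0ℤ ≤_)
            (solve 9 (λ v₁ v₂ v₀ w₂ w₀ e T ρ σ → ρ :* (v₁ :* ((:- v₂) :* (e :* T)) :+ v₂ :* (v₁ :* (e :* T)) :+ v₀)
              :+ σ :* (w₂ :* (v₁ :* (e :* T)) :+ w₀) := (ρ :* v₀ :+ σ :* w₀) :+ T
              :* (σ :* (w₂ :* v₁ :* e) :+ T :* # 0)) refl v₁ v₂ v₀ w₂ w₀ e (+ T) ρ σ)
            (linear-nonneg ((- v₂) * (e * + T)) (v₁ * (e * + T)))))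
        Φ≡ : ∀ v w → Φ v w ≡ quadratic 1ℤ α τ (norm v w)
        Φ≡ v w = begin
          norm v w * norm v w + cubic v w + quadratic-part v w + linear-part v w + τ
            ≡⟨ cong (λ c → norm v w * norm v w + c + quadratic-part v w + linear-part v w + τ) (cubic≡0 v w) ⟩
          norm v w * norm v w + 0ℤ + quadratic-part v w + linear-part v w + τ
            ≡⟨ cong₂ (λ r s → norm v w * norm v w + 0ℤ + quadratic-part v w + (r * v + s * w) + τ) ρ≡0 σ≡0 ⟩
          norm v w * norm v w + 0ℤ + quadratic-part v w + (0ℤ * v + 0ℤ * w) + τ
            ≡⟨ solve 7 (λ v w D α β γ τ → (v :* v :- D :* (w :* w)) :* (v :* v :- D :* (w :* w)) :+ # 0
              :+ (α :* (v :* v) :+ β :* (v :* w) :+ γ :* (w :* w)) :+ (# 0 :* v :+ # 0 :* w) :+ τ :=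
                   (# 1 :* ((v :* v :- D :* (w :* w)) :* (v :* v :- D :* (w :* w))) :+ α :* (v :* v :- D :* (w :* w))
                     :+ τ) :+ (β :* (v :* w) :+ (α :* D :+ γ) :* (w :* w))) refl v w D α β γ τ ⟩
          quadratic 1ℤ α τ (norm v w) + (β * (v * w) + κ * (w * w))
            ≡⟨ cong₂ (λ b k → quadratic 1ℤ α τ (norm v w) + (b * (v * w) + k * (w * w))) β≡0 κ≡0 ⟩
          quadratic 1ℤ α τ (norm v w) + (0ℤ * (v * w) + 0ℤ * (w * w))
            ≡⟨ solve 3 (λ q x y → q :+ (# 0 :* x :+ # 0 :* y) := q) refl (quadratic 1ℤ α τ (norm v w)) (v * w) (w * w)
              ⟩
          quadratic 1ℤ α τ (norm v w) ∎
          where open ≡-Reasoning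
        sparse : SparseValues (4 ℕ.* E) (+ E)
        sparse M 1≤M = map (quadratic 1ℤ α τ) (proj₁ cover) , len , mem
          where
          h = E ℕ.* (M ℕ.* M)
          1≤h : 1 ℕ.≤ h
          1≤h = ℕP.*-mono-≤ 1≤E (ℕP.*-mono-≤ 1≤M 1≤M)
          N≤ : E ℕ.* M ℕ.^ 4 ℕ.≤ h ℕ.* h
          N≤ = ℕP.≤-trans (ℕP.≤-reflexive (cong (E ℕ.*_) (^4≡ M)))
            (ℕP.≤-trans (≤-* E 1≤E) (ℕP.≤-reflexive (+-*-Solver.solve 2 (λ C M
            → C *ₛ ((M *ₛ M) *ₛ (M *ₛ M)) *ₛ C =ₛ (C *ₛ (M *ₛ M)) *ₛ (C *ₛ (M *ₛ M))) refl E M)))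
            where open +-*-Solver using () renaming (_:*_ to _*ₛ_; _:=_ to _=ₛ_)
          cover = quadratic-cover 1ℤ α τ (E ℕ.* M ℕ.^ 4) h ℤP.≤-refl N≤
          len : length (map (quadratic 1ℤ α τ) (proj₁ cover)) ℕ.≤ 4 ℕ.* E ℕ.* M ℕ.^ 3
          len = ℕP.≤-trans (ℕP.≤-reflexive (LP.length-map _ (proj₁ cover)))
            (ℕP.≤-trans (proj₁ (proj₂ cover)) (ℕP.≤-trans (suc+suc≤4* 1≤h)
            (ℕP.≤-trans (ℕP.≤-reflexive (sym (ℕP.*-assoc 4 E (M ℕ.* M))))
              (ℕP.*-monoʳ-≤ (4 ℕ.* E) (ℕP.≤-trans (≤-* M 1≤M)
              (ℕP.≤-reflexive (trans (ℕP.*-comm (M ℕ.* M) M) (sym (^3≡ M)))))))))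
          mem : ∀ n → n ℕ.≤ M ℕ.^ 4 → + E * + n ∈ map (quadratic 1ℤ α τ) (proj₁ cover)
          mem n n≤ = from (covers n)
            where
            from : (∃ λ x → ∃ λ y → Φ (V x y) (W y) ≡ + E * + n) → + E * + n ∈ map (quadratic 1ℤ α τ) (proj₁ cover)
            from (x , y , e) = subst (_∈ map (quadratic 1ℤ α τ) (proj₁ cover)) value
              (MP.∈-map⁺ (quadratic 1ℤ α τ) (proj₂ (proj₂ cover) q
              (subst (0ℤ ≤_) (sym value) (*-nn (pos-nn E) (pos-nn n)))
                (subst (_≤ + (E ℕ.* M ℕ.^ 4)) (trans (pos-* E n) (sym value)) (+≤+ (ℕP.*-monoʳ-≤ E n≤)))))
              where
              q = norm (V x y) (W y)
              value : quadratic 1ℤ α τ q ≡ + E * + n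
              value = trans (sym (Φ≡ (V x y) (W y))) e

      definite-case : ∀ k → κ ≡ + k → 1 ℕ.≤ k → ⊥
      definite-case k κ≡k 1≤k = ¬SparseValues (24 ℕ.* C ℕ.* C) (+ E) (+≤+ 1≤E) sparse
        where
        1≤κ : 1ℤ ≤ κ
        1≤κ = subst (1ℤ ≤_) (sym κ≡k) (+≤+ 1≤k)
        -- For `lower-bound`, the linear terms in the norm, `v` and `w` are absorbed into squares
        -- shifted by `e`, `g`, `h`, and `C₀` is what remains. The `- κ` in `e` comes from
        -- `2 D (β v w + κ w²) = S - κ * norm`.
        e g h c₀ C₀ : ℤ
        e = + 2 * κ * (+ 2 * D * α - κ)
        g = + 4 * D * κ * ρ
        h = + 4 * D * κ * σ
        c₀ = + 4 * D * κ * τ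
        C₀ = e * e + g * g + h * h - + 2 * c₀
        C : ℕ
        C = 8 ℕ.* (d ℕ.* (k ℕ.* E)) ℕ.+ suc ∣ C₀ ∣
        1≤C : 1 ℕ.≤ C
        1≤C = ℕP.≤-trans (s≤s z≤n) (ℕP.m≤n+m (suc ∣ C₀ ∣) (8 ℕ.* (d ℕ.* (k ℕ.* E))))
        S-lower : ∀ v w → v * v + w * w ≤ + 2 * κ * S v w
        S-lower v w = ≤-by (solve 5 (λ κ D β v w → # 2 :* κ :* (κ :* (v :* v :+ D :* (w :* w)) :+ # 2 :* D
          :* (β :* (v :* w))) :- (v :* v :+ w :* w) :=
             ((κ :* v :+ D :* β :* w) :* (κ :* v :+ D :* β :* w) :+ D :* (κ :* κ :- D :* (β :* β) :- # 1) :* (w :* w)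
               :+ (D :- # 1) :* (w :* w))
             :+ (D :* ((κ :* w :+ β :* v) :* (κ :* w :+ β :* v)) :+ (κ :* κ :- D :* (β :* β) :- # 1) :* (v :* v)))
               refl κ D β v w)
          (+-nn (+-nn (+-nn (sq-nn (κ * v + D * β * w)) (*-nn (*-nn (pos-nn d) Δ≥0) (sq-nn w)))
            (*-nn (≤⇒0≤ 1≤D) (sq-nn w)))
                (+-nn (*-nn (pos-nn d) (sq-nn (κ * w + β * v))) (*-nn Δ≥0 (sq-nn v))))
          where Δ≥0 = ≤⇒0≤ (β²<κ² 1≤κ)
        lower-bound : ∀ v w → norm v w * norm v w + w * w ≤ + 8 * D * κ * Φ v w + C₀
        lower-bound v w = ≤-by
          (trans (cong (λ c → + 8 * D * κ * (norm v w * norm v w + c + quadratic-part v w + linear-part v w + τ) + C₀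
            - (norm v w * norm v w + w * w)) (cubic≡0 v w))
            (trans (cong (λ z → + 8 * D * κ * (norm v w * norm v w + 0ℤ + z + linear-part v w + τ) + C₀
              - (norm v w * norm v w + w * w)) (quadratic≡ v w))
            (solve 11 (λ q v w D κ α ρ σ τ r x → # 8 :* D :* κ
              :* (q :* q :+ # 0 :+ (α :* q :+ r) :+ (ρ :* v :+ σ :* w) :+ τ) :+
                ((# 2 :* κ :* (# 2 :* D :* α :- κ)) :* (# 2 :* κ :* (# 2 :* D :* α :- κ)) :+ (# 4 :* D :* κ :* ρ)
                  :* (# 4 :* D :* κ :* ρ) :+ (# 4 :* D :* κ :* σ) :* (# 4 :* D :* κ :* σ) :- # 2
                  :* (# 4 :* D :* κ :* τ)) :- (q :* q :+ w :* w) :=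
                 # 8 :* (D :* κ :- # 1) :* (q :* q) :+ # 6 :* (q :* q) :+ (q :+ # 2 :* κ :* (# 2 :* D :* α :- κ))
                   :* (q :+ # 2 :* κ :* (# 2 :* D :* α :- κ))
                 :+ (v :+ # 4 :* D :* κ :* ρ) :* (v :+ # 4 :* D :* κ :* ρ) :+ v :* v :+ (w :+ # 4 :* D :* κ :* σ)
                   :* (w :+ # 4 :* D :* κ :* σ)
                 :+ # 2 :* ((# 4 :* D :* κ :* r :+ # 2 :* κ :* (κ :* q)) :- (v :* v :+ w :* w))) refl (norm v w) v w D
                   κ α ρ σ τ (rest v w) 0ℤ)))
          (+-nn (+-nn (+-nn (+-nn (+-nn (+-nn
            (*-nn (*-nn (pos-nn 8) (≤⇒0≤ (1≤-* 1≤D 1≤κ))) (sq-nn (norm v w)))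
            (*-nn (pos-nn 6) (sq-nn (norm v w))))
            (sq-nn (norm v w + e)))
            (sq-nn (v + g)))
            (sq-nn v))
            (sq-nn (w + h)))
            (*-nn (pos-nn 2) (nn-by (cong (_- (v * v + w * w))
              (solve 6 (λ κ D β v w x → # 4 :* D :* κ :* (β :* (v :* w) :+ κ :* (w :* w)) :+ # 2 :* κ
              :* (κ :* (v :* v :- D :* (w :* w))) := # 2 :* κ
              :* (κ :* (v :* v :+ D :* (w :* w)) :+ # 2 :* D :* (β :* (v :* w)))) refl κ D β v w 0ℤ))
              (≤⇒0≤ (S-lower v w)))))
          where
          rest : ℤ → ℤ → ℤ
          rest v w = β * (v * w) + κ * (w * w)
          quadratic≡ : ∀ v w → quadratic-part v w ≡ α * norm v w + rest v w
          quadratic≡ v w = solve 6 (λ v w D α β γ → α :* (v :* v) :+ β :* (v :* w) :+ γ :* (w :* w)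
            := α :* (v :* v :- D :* (w :* w)) :+ (β :* (v :* w) :+ (α :* D :+ γ) :* (w :* w))) refl v w D α β γ
        size : ∀ M n v w → 1 ℕ.≤ M → n ℕ.≤ M ℕ.^ 4 → Φ v w ≡ + E * + n
          → norm v w * norm v w + w * w ≤ + (C ℕ.* M ℕ.^ 4)
        size M n v w 1≤M n≤ e = ℤP.≤-trans (lower-bound v w)
          (subst₂ _≤_ refl (sym (trans (pos-* C (M ℕ.^ 4)) (cong (_* + (M ℕ.^ 4)) C≡)))
            (≤-by (trans (cong (λ z → (+ 8 * (D * (κ * + E)) + (1ℤ + + ∣ C₀ ∣)) * + (M ℕ.^ 4)
              - (+ 8 * D * κ * z + C₀)) e)
               (solve 7 (λ D κ E n m a c → (# 8 :* (D :* (κ :* E)) :+ (# 1 :+ a)) :* m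
                 :- (# 8 :* D :* κ :* (E :* n) :+ c) :=
                  # 8 :* (D :* (κ :* E)) :* (m :- n) :+ m :+ a :* (m :- # 1) :+ (a :- c)) refl D κ (+ E) (+ n)
                    (+ (M ℕ.^ 4)) (+ ∣ C₀ ∣) C₀))
              (+-nn (+-nn (+-nn (*-nn (*-nn (pos-nn 8) (*-nn (pos-nn d) (*-nn 0≤κ (pos-nn E)))) (≤⇒0≤ (+≤+ n≤)))
                (pos-nn (M ℕ.^ 4)))
                 (*-nn (pos-nn ∣ C₀ ∣) (≤⇒0≤ (+≤+ (1≤-^ 4 1≤M))))) (≤⇒0≤ (x≤∣x∣ C₀)))))
          where
          C≡ : + C ≡ + 8 * (D * (κ * + E)) + (1ℤ + + ∣ C₀ ∣)
          C≡ = trans (pos-+ (8 ℕ.* (d ℕ.* (k ℕ.* E))) (suc ∣ C₀ ∣))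
            (cong₂ _+_ (trans (pos-* 8 (d ℕ.* (k ℕ.* E))) (cong (+ 8 *_)
            (trans (pos-* d (k ℕ.* E)) (cong (D *_) (trans (pos-* k E) (cong (_* + E) (sym κ≡k)))))))
            (pos-+ 1 ∣ C₀ ∣))
        sparse : SparseValues (24 ℕ.* C ℕ.* C) (+ E)
        sparse M 1≤M = concatMap row (symmetric-range m) , len , mem
          where
          m = C ℕ.* (M ℕ.* M)
          1≤m : 1 ℕ.≤ m
          1≤m = ℕP.*-mono-≤ 1≤C (ℕP.*-mono-≤ 1≤M 1≤M)
          -- There are `O(M²)` choices of `w`. For each, the norm is within `m` of 0, so `v²` lies
          -- in an interval of length `2 m ≤ l²` and `v` has `O(M)` choices.
          l = 2 ℕ.* (C ℕ.* M)
          1≤l : 1 ℕ.≤ l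
          1≤l = ℕP.*-mono-≤ {1} {2} (s≤s z≤n) (ℕP.*-mono-≤ 1≤C 1≤M)
          m+m≤ : m ℕ.+ m ℕ.≤ l ℕ.* l
          m+m≤ = ℕP.≤-trans (≤-* (2 ℕ.* C) (ℕP.*-mono-≤ {1} {2} (s≤s z≤n) 1≤C))
             (ℕP.≤-reflexive (+-*-Solver.solve 2 (λ C M → (C *ₛ (M *ₛ M) +ₛ C *ₛ (M *ₛ M)) *ₛ (con₂ 2 *ₛ C) =ₛ
               (con₂ 2 *ₛ (C *ₛ M)) *ₛ (con₂ 2 *ₛ (C *ₛ M))) refl C M))
            where open +-*-Solver using () renaming (_:*_ to _*ₛ_; _:+_ to _+ₛ_; _:=_ to _=ₛ_; con to con₂)
          cover : ∀ w → _
          cover w = quadratic-cover 1ℤ 0ℤ (+ m - D * (w * w)) (m ℕ.+ m) l ℤP.≤-refl m+m≤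
          row : ℤ → List ℤ
          row w = map (λ v → Φ v w) (proj₁ (cover w))
          len : length (concatMap row (symmetric-range m)) ℕ.≤ 24 ℕ.* C ℕ.* C ℕ.* M ℕ.^ 3
          len = ℕP.≤-trans (length-concatMap row (4 ℕ.* l) (symmetric-range m) (λ w
            → ℕP.≤-trans (ℕP.≤-reflexive (LP.length-map _ (proj₁ (cover w))))
            (ℕP.≤-trans (proj₁ (proj₂ (cover w))) (suc+suc≤4* 1≤l))))
            (ℕP.≤-trans (ℕP.*-monoˡ-≤ (4 ℕ.* l) (length-symmetric-range 1≤m))
            (ℕP.≤-trans (ℕP.≤-reflexive (+-*-Solver.solve 2 (λ C M
              → (con₂ 3 *ₛ (C *ₛ (M *ₛ M))) *ₛ (con₂ 4 *ₛ (con₂ 2 *ₛ (C *ₛ M))) =ₛ con₂ 24 *ₛ C *ₛ C *ₛ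
              (M *ₛ (M *ₛ M))) refl C M))
            (ℕP.≤-reflexive (cong (24 ℕ.* C ℕ.* C ℕ.*_) (sym (^3≡ M))))))
            where open +-*-Solver using () renaming (_:*_ to _*ₛ_; _:=_ to _=ₛ_; con to con₂)
          mem : ∀ n → n ℕ.≤ M ℕ.^ 4 → + E * + n ∈ concatMap row (symmetric-range m)
          mem n n≤ = from (covers n)
            where
            from : (∃ λ x → ∃ λ y → Φ (V x y) (W y) ≡ + E * + n) → + E * + n ∈ concatMap row (symmetric-range m)
            from (x , y , e) = at (V x y) (W y) e
              where
              at : ∀ v w → Φ v w ≡ + E * + n → + E * + n ∈ concatMap row (symmetric-range m)
              at v w e = ∈-concatMap row (∈-symmetric-range w≤)
                (subst (_∈ row w) e (MP.∈-map⁺ (λ v → Φ v w) (proj₂ (proj₂ (cover w)) v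
                  (subst (0ℤ ≤_) q≡ (nn-by (solve 2 (λ q m → q :+ m := m :- (:- q)) refl (norm v w) (+ m))
                    (≤⇒0≤ (∣x∣≤⇒- {norm v w} q≤))))
                  (subst₂ _≤_ q≡ (sym (pos-+ m m)) (≤-by (solve 2 (λ q m → m :+ m :- (q :+ m) := m :- q) refl
                    (norm v w) (+ m)) (≤⇒0≤ (∣x∣≤⇒ {norm v w} q≤)))))))
                where
                bound = size M n v w 1≤M n≤ e
                q≤ : ∣ norm v w ∣ ℕ.≤ m
                q≤ = ∣∣≤-from-sq C M (norm v w) 1≤C (ℤP.≤-trans
                  (≤-by (solve 2 (λ x y → x :+ y :- x := y) refl (norm v w * norm v w) (w * w)) (sq-nn w)) bound)
                w≤ : ∣ w ∣ ℕ.≤ m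
                w≤ = ∣∣≤-from-sq C M w 1≤C (ℤP.≤-trans (≤-by
                  (solve 2 (λ x y → x :+ y :- y := x) refl (norm v w * norm v w) (w * w)) (sq-nn (norm v w))) bound)
                q≡ : norm v w + + m ≡ quadratic 1ℤ 0ℤ (+ m - D * (w * w)) v
                q≡ = solve 4 (λ v w D m → (v :* v :- D :* (w :* w)) :+ m
                  := # 1 :* (v :* v) :+ # 0 :* v :+ (m :- D :* (w :* w))) refl v w D (+ m)

      hyperbolic-impossible : ⊥
      hyperbolic-impossible = from (0≤⇒pos 0≤κ)
        where
        from : (∃ λ k → κ ≡ + k) → ⊥
        from (zero , e) = κ≢0 e
        from (suc k , e) = definite-case (suc k) e (s≤s z≤n)

-- Uniform domination of integer-valued functions by natural weights

O : {I : Set} → (I → ℕ) → (I → ℤ) → Set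
O w g = ∃ λ C → ∀ i → ∣ g i ∣ ℕ.≤ C ℕ.* w i

module _ {I : Set} where

  O-+ : ∀ {w : I → ℕ} {g h : I → ℤ} → O w g → O w h → O w (λ i → g i + h i)
  O-+ {w} {g} {h} (C , p) (C′ , q) = C ℕ.+ C′ , λ i → ℕP.≤-trans (∣+∣ (g i) (h i))
    (ℕP.≤-trans (ℕP.+-mono-≤ (p i) (q i)) (ℕP.≤-reflexive (sym (ℕP.*-distribʳ-+ (w i) C C′))))

  O-* : ∀ {w w′ : I → ℕ} {g h : I → ℤ} → O w g → O w′ h → O (λ i → w i ℕ.* w′ i) (λ i → g i * h i)
  O-* {w} {w′} {g} {h} (C , p) (C′ , q) = C ℕ.* C′ , λ i → subst₂ ℕ._≤_ (sym (∣*∣ (g i) (h i)))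
    (ℕP.[m*n]*[o*p]≡[m*o]*[n*p] C (w i) C′ (w′ i)) (ℕP.*-mono-≤ (p i) (q i))

  O-scale : ∀ {w : I → ℕ} {g : I → ℤ} c → O w g → O w (λ i → c * g i)
  O-scale {w} {g} c (C , p) = ∣ c ∣ ℕ.* C , λ i → subst₂ ℕ._≤_ (sym (∣*∣ c (g i))) (sym (ℕP.*-assoc ∣ c ∣ C (w i)))
    (ℕP.*-monoʳ-≤ ∣ c ∣ (p i))

  O-const : ∀ {w : I → ℕ} c → (∀ i → 1 ℕ.≤ w i) → O w (λ _ → c)
  O-const {w} c h = ∣ c ∣ , λ i → ≤-* (w i) (h i)

  O-weaken : ∀ {w w′ : I → ℕ} {g : I → ℤ} → (∀ i → w i ℕ.≤ w′ i) → O w g → O w′ g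
  O-weaken h (C , p) = C , λ i → ℕP.≤-trans (p i) (ℕP.*-monoʳ-≤ C (h i))

  O-cong : ∀ {w : I → ℕ} {g h : I → ℤ} → (∀ i → g i ≡ h i) → O w g → O w h
  O-cong e (C , p) = C , λ i → subst (λ z → ∣ z ∣ ℕ.≤ _) (e i) (p i)

-- Depressed quartic forms that are nonnegative but not definite

module Depressed (p q r : ℤ) where

  φ φ′ : ℤ → ℤ → ℤ
  φ X y = X * X * X * X + p * (X * X) * (y * y) + q * X * (y * y * y) + r * (y * y * y * y)
  φ′ X y = + 4 * (X * X * X) + + 2 * p * X * (y * y) + q * (y * y * y)

  Definite : Set
  Definite = ∃ λ K → ∀ X y → X * X * X * X + y * y * y * y ≤ + K * φ X y

  module _ (φ-nonneg : ∀ X y → 0ℤ ≤ φ X y) (no-zero : ∀ X y → φ X y ≡ 0ℤ → y ≡ 0ℤ) (indefinite : ¬ Definite) where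

    -- For `∣ X ∣ ≥ B ∣ y ∣` the term `X⁴` dominates `φ`; in the remaining sector `X⁴ + y⁴ ≤ B′ y⁴`.
    A B B′ : ℕ
    A = ∣ p ∣ ℕ.+ ∣ q ∣ ℕ.+ ∣ r ∣
    B = suc (2 ℕ.* A)
    B′ = suc (B ℕ.* B ℕ.* (B ℕ.* B))

    -- `X / y` is a rational number of bounded size at which `φ` is at most `1 / j²`; for large `j`
    -- it stands for a real zero. The square on `j` is what makes the derivative `O(1 / j)` too.
    record NearZero : Set where
      field
        j : ℕ
        X y : ℤ
        1≤j : 1 ℕ.≤ j
        1≤∣y∣ : 1 ℕ.≤ ∣ y ∣
        X≤By : ∣ X ∣ ℕ.≤ B ℕ.* ∣ y ∣
        small : + j * + j * φ X y ≤ y * y * y * y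
    open NearZero

    ∣y∣^ : ℕ → NearZero → ℕ
    ∣y∣^ k i = ∣ y i ∣ ℕ.^ k

    -- Uniform in the near zero: after division by `y^k` the expression is `O(1)`, respectively
    -- `O(1 / j)`. Tiny expressions act as the ideal of forms that vanish at the limit, closed under
    -- sums and under products with bounded ones.
    Bounded Tiny : ℕ → (NearZero → ℤ) → Set
    Bounded k g = O (∣y∣^ k) g
    Tiny k g = O (∣y∣^ k) (λ i → + j i * g i)

    ∣*∣ᶻ : ∀ x y → + ∣ x * y ∣ ≡ + ∣ x ∣ * + ∣ y ∣
    ∣*∣ᶻ x y = trans (cong +_ (∣*∣ x y)) (pos-* ∣ x ∣ ∣ y ∣)

    -x≤∣x∣ : ∀ x → 0ℤ ≤ x + + ∣ x ∣
    -x≤∣x∣ x = nn-by (solve 2 (λ x a → x :+ a := a :- (:- x)) refl x (+ ∣ x ∣)) (≤⇒0≤ (∣x∣≤⇒- {x} ℕP.≤-refl))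

    Bℤ : + B ≡ 1ℤ + + 2 * (+ ∣ p ∣ + + ∣ q ∣ + + ∣ r ∣)
    Bℤ = trans (pos-+ 1 (2 ℕ.* A)) (cong (_+_ 1ℤ) (trans (pos-* 2 A)
      (cong (+ 2 *_) (trans (pos-+ (∣ p ∣ ℕ.+ ∣ q ∣) ∣ r ∣) (cong (_+ + ∣ r ∣) (pos-+ ∣ p ∣ ∣ q ∣))))))

    -- In this sector the lower terms are at most `A ∣ X ∣³ ∣ y ∣`, hence at most half of `X⁴`; so
    -- `4 φ ≥ 2 X⁴ ≥ X⁴ + y⁴`.
    φ-dominates : ∀ X y → + B * + ∣ y ∣ ≤ + ∣ X ∣ → X * X * X * X + y * y * y * y ≤ + 4 * φ X y
    φ-dominates X y h = ≤-by
      (trans (solve 6 (λ p q r X y w → # 4 :* (X :* X :* X :* X :+ p :* (X :* X) :* (y :* y) :+ q :* X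
        :* (y :* y :* y) :+ r :* (y :* y :* y :* y)) :- (X :* X :* X :* X :+ y :* y :* y :* y) :=
                # 3 :* ((X :* X) :* (X :* X)) :+ # 4 :* p :* (X :* X) :* (y :* y) :+ # 4 :* (q :* X :* (y :* y :* y))
                  :+ # 4 :* r :* ((y :* y) :* (y :* y)) :- (y :* y) :* (y :* y)) refl p q r X y 0ℤ)
      (trans (cong₂ (λ a b → + 3 * (a * a) + + 4 * p * a * b + + 4 * (q * X * (y * y * y)) + + 4 * r * (b * b) - b
        * b) (sym (∣sq∣ X)) (sym (∣sq∣ y)))
      (trans (solve 9 (λ p q r P Q R u v x → # 3 :* ((u :* u) :* (u :* u)) :+ # 4 :* p :* (u :* u) :* (v :* v) :+ # 4
        :* x :+ # 4 :* r :* ((v :* v) :* (v :* v)) :- (v :* v) :* (v :* v) :=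
           # 4 :* (u :* u) :* (v :* v) :* (p :+ P) :+ # 4 :* (x :+ Q :* u :* (v :* v :* v)) :+ # 4 :* (v :* v)
             :* (v :* v) :* (r :+ R)
           :+ # 2 :* (u :* u :* u) :* (u :- (# 1 :+ # 2 :* (P :+ Q :+ R)) :* v) :+ # 2 :* (u :* u :* u) :* v
           :+ (u :- v) :* ((u :+ v) :* (u :* u :+ v :* v) :+ # 4 :* P :* (u :* u :* v) :+ # 4 :* Q :* (u :* v)
             :* (u :+ v) :+ # 4 :* R :* v :* (u :* u :+ u :* v :+ v :* v)))
           refl p q r (+ ∣ p ∣) (+ ∣ q ∣) (+ ∣ r ∣) (+ ∣ X ∣) (+ ∣ y ∣) (q * X * (y * y * y))) refl)))
      (+-nn (+-nn (+-nn (+-nn (+-nn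
        (*-nn (*-nn (*-nn (pos-nn 4) (*-nn 0≤u 0≤u)) (*-nn 0≤v 0≤v)) (-x≤∣x∣ p))
        (*-nn (pos-nn 4) (nn-by (cong (_+_ (q * X * (y * y * y))) (sym abs-qXy³)) (-x≤∣x∣ (q * X * (y * y * y))))))
        (*-nn (*-nn (*-nn (pos-nn 4) (*-nn 0≤v 0≤v)) (*-nn 0≤v 0≤v)) (-x≤∣x∣ r)))
        (*-nn (*-nn (pos-nn 2) (*-nn (*-nn 0≤u 0≤u) 0≤u)) (subst (λ b → 0ℤ ≤ + ∣ X ∣ - b * + ∣ y ∣) Bℤ (≤⇒0≤ h))))
        (*-nn (*-nn (pos-nn 2) (*-nn (*-nn 0≤u 0≤u) 0≤u)) 0≤v))
        (*-nn (≤⇒0≤ v≤u) (+-nn (+-nn (+-nn (*-nn (+-nn 0≤u 0≤v) (+-nn (*-nn 0≤u 0≤u) (*-nn 0≤v 0≤v)))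
           (*-nn (*-nn (pos-nn 4) (pos-nn ∣ p ∣)) (*-nn (*-nn 0≤u 0≤u) 0≤v)))
           (*-nn (*-nn (*-nn (pos-nn 4) (pos-nn ∣ q ∣)) (*-nn 0≤u 0≤v)) (+-nn 0≤u 0≤v)))
           (*-nn (*-nn (*-nn (pos-nn 4) (pos-nn ∣ r ∣)) 0≤v)
             (+-nn (+-nn (*-nn 0≤u 0≤u) (*-nn 0≤u 0≤v)) (*-nn 0≤v 0≤v))))))
      where
      0≤u : 0ℤ ≤ + ∣ X ∣
      0≤u = pos-nn ∣ X ∣
      0≤v : 0ℤ ≤ + ∣ y ∣
      0≤v = pos-nn ∣ y ∣
      abs-qXy³ : + ∣ q * X * (y * y * y) ∣ ≡ + ∣ q ∣ * + ∣ X ∣ * (+ ∣ y ∣ * + ∣ y ∣ * + ∣ y ∣)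
      abs-qXy³ = trans (∣*∣ᶻ (q * X) (y * y * y)) (cong₂ _*_ (∣*∣ᶻ q X)
        (trans (∣*∣ᶻ (y * y) y) (cong (_* + ∣ y ∣) (∣*∣ᶻ y y))))
      v≤u : + ∣ y ∣ ≤ + ∣ X ∣
      v≤u = ℤP.≤-trans (≤-by (trans (cong (λ b → b * + ∣ y ∣ - + ∣ y ∣) Bℤ)
        (solve 2 (λ a v → (# 1 :+ # 2 :* a) :* v :- v := # 2 :* a :* v) refl (+ ∣ p ∣ + + ∣ q ∣ + + ∣ r ∣) (+ ∣ y ∣)))
            (*-nn (*-nn (pos-nn 2) (+-nn (+-nn (pos-nn ∣ p ∣) (pos-nn ∣ q ∣)) (pos-nn ∣ r ∣))) 0≤v)) h

    -- Failure of definiteness, at the constant 4 B′ n².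
    near-zero : ∀ j → 1 ℕ.≤ j → ¬ ¬ (∃ λ i → NearZero.j i ≡ j)
    near-zero n 1≤n none = indefinite (K , λ X y → ok X y (≤-total (X * X * X * X + y * y * y * y) (+ K * φ X y)))
      where
      K = 4 ℕ.* (B′ ℕ.* (n ℕ.* n))
      Kℤ : + K ≡ + 4 * (+ B′ * (+ n * + n))
      Kℤ = trans (pos-* 4 (B′ ℕ.* (n ℕ.* n))) (cong (+ 4 *_)
        (trans (pos-* B′ (n ℕ.* n)) (cong (+ B′ *_) (pos-* n n))))
      ok : ∀ X y → _ → X * X * X * X + y * y * y * y ≤ + K * φ X y
      ok X y (inj₁ h) = h
      ok X y (inj₂ bad) = ⊥-elim (compare (≤-total (+ B * + ∣ y ∣) (+ ∣ X ∣)))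
        where
        S = X * X * X * X + y * y * y * y
        compare : _ → ⊥
        compare (inj₁ far) = ¬0≤-1 {S - + K * φ X y - 1ℤ - (S - + K * φ X y - 1ℤ)}
          (nn-by (solve 3 (λ S K f → :- # 1 :- (S :- K :* f :- # 1 :- (S :- K :* f :- # 1))
          := (S :- (# 1 :+ K :* f)) :+ (K :* f :- S)) refl S (+ K) (φ X y))
            (+-nn (≤⇒0≤ bad) (≤⇒0≤ (ℤP.≤-trans (φ-dominates X y far)
              (≤-by (solve 2 (λ K f → K :* f :- # 4 :* f := (K :- # 4) :* f) refl (+ K) (φ X y))
               (*-nn (≤⇒0≤ (+≤+ (ℕP.*-monoʳ-≤ 4 (ℕP.*-mono-≤ {1} {B′} (s≤s z≤n) (ℕP.*-mono-≤ 1≤n 1≤n)))))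
                 (φ-nonneg X y)))))))
            (nn-by (solve 1 (λ x → x :- x := # 0) refl (S - + K * φ X y - 1ℤ)) (pos-nn 0))
        compare (inj₂ near) = none (record { j = n ; X = X ; y = y ; 1≤j = 1≤n ; 1≤∣y∣ = 1≤∣y∣₀ ; X≤By = X≤By₀ ; small
          = small₀ } , refl)
          where
          v = + ∣ y ∣
          u = + ∣ X ∣
          X<By : 1ℤ + u ≤ + B * v
          X<By = near
          X≤By₀ : ∣ X ∣ ℕ.≤ B ℕ.* ∣ y ∣
          X≤By₀ = +≤⇒ (subst (u ≤_) (sym (pos-* B ∣ y ∣)) (ℤP.≤-trans
            (≤-by (solve 1 (λ u → (# 1 :+ u) :- u := # 1) refl u) (pos-nn 1)) X<By))
          1≤∣y∣₀ : 1 ℕ.≤ ∣ y ∣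
          1≤∣y∣₀ = +≤⇒ (1≤-cancelˡ (+ B) (+≤+ (s≤s z≤n)) (ℤP.≤-trans
            (≤-by (solve 1 (λ u → (# 1 :+ u) :- # 1 := u) refl u) (pos-nn ∣ X ∣)) X<By))
          small₀ : + n * + n * φ X y ≤ y * y * y * y
          small₀ = 0≤⇒≤ (*-cancelˡ-nn (+ 4 * + B′) (1≤-* (+≤+ (s≤s z≤n)) (+≤+ (s≤s z≤n)))
            (nn-by (trans (solve 6 (λ B′ n f x y b → # 4 :* B′ :* (y :* y :* y :* y :- n :* n :* f)
              := (x :* x :* x :* x :+ y :* y :* y :* y :- (# 1 :+ # 4 :* (B′ :* (n :* n)) :* f)) :+ # 1 :+ # 3 :* B′
              :* ((y :* y) :* (y :* y))
                     :+ ((B′ :- (# 1 :+ b :* b :* (b :* b))) :* ((y :* y) :* (y :* y))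
                       :+ (b :* b :* (b :* b) :* ((y :* y) :* (y :* y)) :- (x :* x) :* (x :* x)))) refl (+ B′) (+ n)
                       (φ X y) X y (+ B)) refl)
              (+-nn (+-nn (+-nn (subst (λ k → 0ℤ ≤ S - (1ℤ + k * φ X y)) Kℤ (≤⇒0≤ bad)) (pos-nn 1))
                (*-nn (*-nn (pos-nn 3) (pos-nn B′)) (sq-nn (y * y))))
                (+-nn (*-nn (nn-by (trans (cong (_- (1ℤ + + B * + B * (+ B * + B))) B′ℤ)
                  (solve 1 (λ b → b :- b := # 0) refl (1ℤ + + B * + B * (+ B * + B)))) (pos-nn 0)) (sq-nn (y * y)))
                  X⁴≤))))
            where
            B′ℤ : + B′ ≡ 1ℤ + + B * + B * (+ B * + B)
            B′ℤ = trans (pos-+ 1 (B ℕ.* B ℕ.* (B ℕ.* B))) (cong (_+_ 1ℤ)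
              (trans (pos-* (B ℕ.* B) (B ℕ.* B)) (cong (λ z → z * z) (pos-* B B))))
            X²≤ : 0ℤ ≤ + B * + B * (y * y) - X * X
            X²≤ = nn-by (trans (cong₂ (λ a b → + B * + B * a - b) (sym (∣sq∣ y)) (sym (∣sq∣ X)))
              (solve 3 (λ b v u → b :* b :* (v :* v) :- u :* u := (b :* v :- (# 1 :+ u) :+ # 1) :* (b :* v :+ u)) refl
              (+ B) v u))
                (*-nn (+-nn (≤⇒0≤ X<By) (pos-nn 1)) (+-nn (*-nn (pos-nn B) (pos-nn ∣ y ∣)) (pos-nn ∣ X ∣)))
            X⁴≤ : 0ℤ ≤ + B * + B * (+ B * + B) * ((y * y) * (y * y)) - (X * X) * (X * X)
            X⁴≤ = nn-by (solve 3 (λ b y x → b :* b :* (b :* b) :* (y :* y) :- x :* x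
              := (b :* b :* y :- x) :* (b :* b :* y :+ x)) refl (+ B) (y * y) (X * X))
                (*-nn X²≤ (+-nn (*-nn (sq-nn (+ B)) (sq-nn y)) (sq-nn X)))

    b-const : ∀ c → Bounded 0 (λ _ → c)
    b-const c = O-const {w = ∣y∣^ 0} c (λ _ → s≤s z≤n)

    b-X : Bounded 1 X
    b-X = B , λ i → subst (λ k → ∣ X i ∣ ℕ.≤ B ℕ.* k) (sym (ℕP.*-identityʳ ∣ y i ∣)) (X≤By i)

    b-y : Bounded 1 y
    b-y = 1 , λ i → ℕP.≤-reflexive (sym (trans (ℕP.+-identityʳ _) (ℕP.*-identityʳ ∣ y i ∣)))

    b-* : ∀ {k l g h} → Bounded k g → Bounded l h → Bounded (k ℕ.+ l) (λ i → g i * h i)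
    b-* {k} {l} {g} {h} p q = O-weaken {g = λ i → g i * h i} (λ i
      → ℕP.≤-reflexive (sym (ℕP.^-distribˡ-+-* ∣ y i ∣ k l))) (O-* {g = g} {h = h} p q)

    b-+ : ∀ {k g h} → Bounded k g → Bounded k h → Bounded k (λ i → g i + h i)
    b-+ {k} {g} {h} = O-+ {w = ∣y∣^ k} {g} {h}

    t-* : ∀ {k l g h} → Tiny k g → Bounded l h → Tiny (k ℕ.+ l) (λ i → g i * h i)
    t-* {k} {l} {g} {h} p q = O-cong (λ i → solve 3 (λ j g h → j :* g :* h := j :* (g :* h)) refl (+ j i) (g i) (h i))
      (b-* {k} {l} {λ i → + j i * g i} {h} p q)

    t-+ : ∀ {k g h} → Tiny k g → Tiny k h → Tiny k (λ i → g i + h i)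
    t-+ {k} {g} {h} p q = O-cong (λ i → solve 3 (λ j g h → j :* g :+ j :* h := j :* (g :+ h)) refl (+ j i) (g i)
      (h i)) (b-+ {k} {λ i → + j i * g i} {λ i → + j i * h i} p q)

    t-cong : ∀ {k g h} → (∀ i → g i ≡ h i) → Tiny k g → Tiny k h
    t-cong e = O-cong (λ i → cong (+ j i *_) (e i))

    t-cancel : ∀ {k g} → Tiny (suc k) (λ i → y i * g i) → Tiny k g
    t-cancel {k} {g} (C , h) = C , λ i → ℕP.*-cancelˡ-≤ ∣ y i ∣ {{ℕ.>-nonZero (1≤∣y∣ i)}} (subst₂ ℕ._≤_
      (trans (cong ∣_∣ (solve 3 (λ j y g → j :* (y :* g) := y :* (j :* g)) refl (+ j i) (y i) (g i)))
        (∣*∣ (y i) (+ j i * g i)))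
      (trans (sym (ℕP.*-assoc C ∣ y i ∣ (∣ y i ∣ ℕ.^ k))) (trans (cong (ℕ._* (∣ y i ∣ ℕ.^ k)) (ℕP.*-comm C ∣ y i ∣))
        (ℕP.*-assoc ∣ y i ∣ C (∣ y i ∣ ℕ.^ k)))) (h i))

    -- Taking `j` beyond the implied constant leaves only 0. Decidability of equality with 0
    -- discharges the double negation in `near-zero`.
    t-zero : ∀ {c} → Tiny 0 (λ _ → c) → c ≡ 0ℤ
    t-zero {c} (C , h) = from (c ℤ.≟ 0ℤ)
      where
      from : Dec (c ≡ 0ℤ) → c ≡ 0ℤ
      from (yes e) = e
      from (no c≢0) = ⊥-elim (near-zero (suc C) (s≤s z≤n) (λ w
        → ℕP.<-irrefl refl (ℕP.≤-trans (ℕP.≤-trans (≤-* ∣ c ∣ (ℕP.n≢0⇒n>0 (λ z → c≢0 (ℤP.∣i∣≡0⇒i≡0 z))))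
          (ℕP.≤-reflexive (trans (sym (∣*∣ (+ suc C) c)) (cong (λ n → ∣ + n * c ∣) (sym (proj₂ w))))))
            (ℕP.≤-trans (h (proj₁ w)) (ℕP.≤-reflexive (ℕP.*-identityʳ C))))))

    φᵢ φ′ᵢ : NearZero → ℤ
    φᵢ i = φ (X i) (y i)
    φ′ᵢ i = φ′ (X i) (y i)

    y⁴≡ : ∀ i → y i * y i * y i * y i ≡ + (∣ y i ∣ ℕ.^ 4)
    y⁴≡ i = trans (solve 1 (λ y → y :* y :* y :* y := (y :* y) :* (y :* y)) refl (y i))
      (trans (cong (λ z → z * z) (sym (∣sq∣ (y i))))
       (trans (sym (trans (pos-* (∣ y i ∣ ℕ.* ∣ y i ∣) (∣ y i ∣ ℕ.* ∣ y i ∣))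
         (cong (λ z → z * z) (pos-* ∣ y i ∣ ∣ y i ∣)))) (cong +_ (sym (^4≡ ∣ y i ∣)))))

    φ-tiny : Tiny 4 φᵢ
    φ-tiny = 1 , λ i → +≤⇒ (ℤP.≤-trans (ℤP.≤-reflexive (ℤP.0≤i⇒+∣i∣≡i (*-nn (pos-nn (j i)) (φ-nonneg (X i) (y i)))))
       (ℤP.≤-trans (≤-by (solve 2 (λ j f → j :* j :* f :- j :* f := (j :- # 1) :* (j :* f)) refl (+ j i) (φᵢ i))
         (*-nn (≤⇒0≤ (+≤+ (1≤j i))) (*-nn (pos-nn (j i)) (φ-nonneg (X i) (y i)))))
         (ℤP.≤-trans (small i) (ℤP.≤-reflexive (trans (y⁴≡ i) (cong +_ (sym (ℕP.+-identityʳ _))))))))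

    -- Nonnegativity of φ at X / y ± 1 / j bounds its derivative where φ is small.
    φ′-tiny′ : Tiny 4 (λ i → y i * φ′ᵢ i)
    φ′-tiny′ = suc C , λ i → ⇒∣x∣≤ (bound i 1ℤ (- 1ℤ) (solve 0 ((:- # 1) :* (:- # 1) := # 1) refl)
      (solve 1 (λ z → z := (# 1) :* z) refl _) (solve 1 (λ z → (:- # 1) :* z := :- (# 1 :* z)) refl _))
                                    (bound i (- 1ℤ) 1ℤ (solve 0 (# 1 :* # 1 := # 1) refl)
                                      (solve 1 (λ z → :- z := (:- # 1) :* z) refl _)
                                      (solve 1 (λ z → # 1 :* z := :- ((:- # 1) :* z)) refl _))
      where
      second : NearZero → ℤ
      second i = (+ 6 * (X i * X i) + p * (y i * y i)) * (y i * y i)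
      third : NearZero → ℤ
      third i = X i * (y i * (y i * y i))
      b-second : Bounded 4 second
      b-second = b-* {2} {2} (b-+ {2} (b-* {0} {2} (b-const (+ 6)) (b-* {1} {1} b-X b-X))
        (b-* {0} {2} (b-const p) (b-* {1} {1} b-y b-y))) (b-* {1} {1} b-y b-y)
      b-third : Bounded 4 third
      b-third = b-* {1} {3} b-X (b-* {1} {2} b-y (b-* {1} {1} b-y b-y))
      -- The three summands bound the Taylor terms of orders two, three and four of `φ` at `X / y`
      -- for the step `1 / j`.
      C = proj₁ b-second ℕ.+ 4 ℕ.* proj₁ b-third ℕ.+ 1
      w : NearZero → ℤ
      w i = + (∣ y i ∣ ℕ.^ 4)
      bound : ∀ i e e′ → e′ * e′ ≡ 1ℤ → ∀ {z} → z ≡ e * (+ j i * (y i * φ′ᵢ i)) → e′ * (+ j i * (y i * φ′ᵢ i))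
        ≡ - (e * (+ j i * (y i * φ′ᵢ i))) → z ≤ + (suc C ℕ.* ∣ y i ∣ ℕ.^ 4)
      bound i e e′ sq refl flip = subst (e * (J * (Y * φ′ᵢ i)) ≤_)
        (sym (trans (pos-* (suc C) (∣ y i ∣ ℕ.^ 4)) (cong (_* w i) C≡)))
          (0≤⇒≤ (*-cancelˡ-nn (J * J) (1≤-* 1≤J 1≤J)
            (nn-by (trans (solve 8 (λ J f z w s t c₂ c₃ → J :* J :* ((# 1 :+ (c₂ :+ # 4 :* c₃ :+ # 1)) :* w :- z) :=
                   (J :* J :* (w :- J :* J :* f)) :+ J :* J :* (c₂ :* w :- s) :+ # 4 :* J :* (c₃ :* w :- t) :+ # 4
                     :* J :* (J :- # 1) :* (c₃ :* w) :+ (J :* J :- # 1) :* w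
                   :+ ((J :* J) :* (J :* J) :* f :+ J :* J :* (:- z) :+ J :* J :* s :+ # 4 :* J :* t :+ w)) refl J
                     (φᵢ i) (e * (J * (Y * φ′ᵢ i))) (w i) (second i) (e′ * third i) c₂ c₃)
                 (cong (_+_ _) (sym expand)))
              (+-nn (+-nn (+-nn (+-nn (+-nn
                (*-nn (sq-nn J) (≤⇒0≤ (ℤP.≤-trans (small i) (ℤP.≤-reflexive (y⁴≡ i)))))
                (*-nn (sq-nn J) (≤⇒0≤ (subst (second i ≤_) (pos-* (proj₁ b-second) _)
                  (∣x∣≤⇒ {second i} (proj₂ b-second i))))))
                (*-nn (*-nn (pos-nn 4) 0≤J) (≤⇒0≤ (subst (e′ * third i ≤_) (pos-* (proj₁ b-third) _)
                  (∣x∣≤⇒ {e′ * third i} (subst (ℕ._≤ _) (sym abs-third) (proj₂ b-third i)))))))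
                (*-nn (*-nn (*-nn (pos-nn 4) 0≤J) (≤⇒0≤ 1≤J)) (*-nn (pos-nn (proj₁ b-third)) 0≤w)))
                (*-nn (≤⇒0≤ (1≤-* 1≤J 1≤J)) 0≤w))
                (φ-nonneg (J * X i + e′ * Y) (J * Y))))))
        where
        J = + j i
        Y = y i
        c₂ = + proj₁ b-second
        c₃ = + proj₁ b-third
        1≤J : 1ℤ ≤ J
        1≤J = +≤+ (1≤j i)
        0≤J : 0ℤ ≤ J
        0≤J = pos-nn (j i)
        0≤w : 0ℤ ≤ w i
        0≤w = pos-nn _
        C≡ : + suc C ≡ 1ℤ + (c₂ + + 4 * c₃ + 1ℤ)
        C≡ = trans (pos-+ 1 C) (cong (_+_ 1ℤ) (trans (pos-+ (proj₁ b-second ℕ.+ 4 ℕ.* proj₁ b-third) 1)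
          (cong (_+ 1ℤ) (trans (pos-+ (proj₁ b-second) (4 ℕ.* proj₁ b-third))
          (cong (_+_ c₂) (pos-* 4 (proj₁ b-third)))))))
        ∣e′∣≡1 : ∣ e′ ∣ ≡ 1
        ∣e′∣≡1 = ℕP.m*n≡1⇒m≡1 ∣ e′ ∣ ∣ e′ ∣ (trans (sym (∣*∣ e′ e′)) (cong ∣_∣ sq))
        abs-third : ∣ e′ * third i ∣ ≡ ∣ third i ∣
        abs-third = trans (∣*∣ e′ (third i)) (trans (cong (ℕ._* ∣ third i ∣) ∣e′∣≡1) (ℕP.+-identityʳ _))
        expand : φ (J * X i + e′ * Y) (J * Y) ≡ (J * J) * (J * J) * φᵢ i + J * J * (- (e * (J * (Y * φ′ᵢ i)))) + J * J
          * second i + + 4 * J * (e′ * third i) + w i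
        expand = begin
          φ (J * X i + e′ * Y) (J * Y)
            ≡⟨ solve 7 (λ J X Y e p q r →
                 let Z = J :* X :+ e :* Y
                     V = J :* Y in
                 Z :* Z :* Z :* Z :+ p :* (Z :* Z) :* (V :* V) :+ q :* Z :* (V :* V :* V) :+ r :* (V :* V :* V :* V)
                   :=
                 (J :* J) :* (J :* J) :* (X :* X :* X :* X :+ p :* (X :* X) :* (Y :* Y) :+ q :* X :* (Y :* Y :* Y)
                   :+ r :* (Y :* Y :* Y :* Y))
                 :+ J :* J :* (e :* (J :* (Y :* (# 4 :* (X :* X :* X) :+ # 2 :* p :* X :* (Y :* Y) :+ q
                   :* (Y :* Y :* Y)))))
                 :+ (e :* e) :* (J :* J :* ((# 6 :* (X :* X) :+ p :* (Y :* Y)) :* (Y :* Y)))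
                 :+ (e :* e) :* (# 4 :* J :* (e :* (X :* (Y :* (Y :* Y)))))
                 :+ (e :* e) :* (e :* e) :* (Y :* Y :* Y :* Y)) refl J (X i) Y e′ p q r ⟩
          (J * J) * (J * J) * φᵢ i + J * J * (e′ * (J * (Y * φ′ᵢ i))) + (e′ * e′) * (J * J * second i) + (e′ * e′)
            * (+ 4 * J * (e′ * third i)) + (e′ * e′) * (e′ * e′) * (Y * Y * Y * Y)
            ≡⟨ cong₂ (λ a b → (J * J) * (J * J) * φᵢ i + J * J * a + b * (J * J * second i) + b
              * (+ 4 * J * (e′ * third i)) + b * b * (Y * Y * Y * Y)) flip sq ⟩
          (J * J) * (J * J) * φᵢ i + J * J * (- (e * (J * (Y * φ′ᵢ i)))) + 1ℤ * (J * J * second i) + 1ℤ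
            * (+ 4 * J * (e′ * third i)) + 1ℤ * 1ℤ * (Y * Y * Y * Y)
            ≡⟨ cong (λ z → (J * J) * (J * J) * φᵢ i + J * J * (- (e * (J * (Y * φ′ᵢ i)))) + 1ℤ * (J * J * second i)
              + 1ℤ * (+ 4 * J * (e′ * third i)) + 1ℤ * 1ℤ * z) (y⁴≡ i) ⟩
          (J * J) * (J * J) * φᵢ i + J * J * (- (e * (J * (Y * φ′ᵢ i)))) + 1ℤ * (J * J * second i) + 1ℤ
            * (+ 4 * J * (e′ * third i)) + 1ℤ * 1ℤ * w i
            ≡⟨ solve 4 (λ a b c w → a :+ # 1 :* b :+ # 1 :* c :+ # 1 :* # 1 :* w := a :+ b :+ c :+ w) refl _ _ _ _ ⟩
          _ ∎
          where open ≡-Reasoning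

    φ′-tiny : Tiny 3 φ′ᵢ
    φ′-tiny = t-cancel {3} φ′-tiny′

    -- Modulo `a X + b y`, the product `a⁴ φ` is `y⁴ φ(- b, a)`. So the constant `φ(- b, a)` is
    -- tiny, hence 0, and a zero of `φ` has second coordinate 0.
    linear-tiny : ∀ a b → Tiny 1 (λ i → a * X i + b * y i) → a ≡ 0ℤ
    linear-tiny a b lin = no-zero (- b) a (t-zero (t-cancel {0} (t-cancel {1} (t-cancel {2} (t-cancel {3} (t-cong {4}
        (λ i → solve 7 (λ p q r a b X y →
            let u = a :* X
                v = (:- b) :* y in
            (X :* X :* X :* X :+ p :* (X :* X) :* (y :* y) :+ q :* X :* (y :* y :* y) :+ r :* (y :* y :* y :* y))
              :* (a :* a :* a :* a)
            :+ (a :* X :+ b :* y) :* ((:- # 1) :* (u :* (u :* u) :+ v :* (u :* u) :+ v :* (u :* v) :+ v :* (v :* v)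
              :+ p :* (a :* a) :* (y :* (y :* (u :+ v))) :+ q :* (a :* a :* a) :* (y :* (y :* y)))) :=
            y :* (y :* (y :* (y :* ((:- b) :* (:- b) :* (:- b) :* (:- b) :+ p :* ((:- b) :* (:- b)) :* (a :* a) :+ q
              :* (:- b) :* (a :* a :* a) :+ r :* (a :* a :* a :* a)))))) refl p q r a b (X i) (y i))
        (t-+ {4} (t-* {4} {0} φ-tiny (b-const (a * a * a * a)))
                 (t-* {1} {3} lin (b-* {0} {3} (b-const (- 1ℤ))
                    (b-+ {3} (b-+ {3} (b-+ {3} (b-+ {3} (b-+ {3} (b-* {1} {2} b-u (b-* {1} {1} b-u b-u))
                      (b-* {1} {2} b-v (b-* {1} {1} b-u b-u))) (b-* {1} {2} b-v (b-* {1} {1} b-u b-v)))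
                      (b-* {1} {2} b-v (b-* {1} {1} b-v b-v)))
                       (b-* {0} {3} (b-const (p * (a * a))) (b-* {1} {2} b-y (b-* {1} {1} b-y (b-+ {1} b-u b-v)))))
                       (b-* {0} {3} (b-const (q * (a * a * a))) (b-* {1} {2} b-y (b-* {1} {1} b-y b-y)))))))))))))
      where
      b-u : Bounded 1 (λ i → a * X i)
      b-u = b-* {0} {1} (b-const a) b-X
      b-v : Bounded 1 (λ i → (- b) * y i)
      b-v = b-* {0} {1} (b-const (- b)) b-y

    constant-tiny : ∀ b → Tiny 1 (λ i → b * y i) → b ≡ 0ℤ
    constant-tiny b h = t-zero (t-cancel {0} (t-cong {1} (λ i → solve 2 (λ b y → b :* y := y :* b) refl b (y i)) h))

    -- The first two remainders of the Euclidean algorithm for φ and φ′.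
    ρ-tiny : Tiny 2 (λ i → + 2 * p * (X i * X i) + + 3 * q * (X i * y i) + + 4 * r * (y i * y i))
    ρ-tiny = t-cancel {2} (t-cancel {3} (t-cong {4} (λ i → solve 5 (λ p q r X y →
          (X :* X :* X :* X :+ p :* (X :* X) :* (y :* y) :+ q :* X :* (y :* y :* y) :+ r :* (y :* y :* y :* y)) :* # 4
          :+ (# 4 :* (X :* X :* X) :+ # 2 :* p :* X :* (y :* y) :+ q :* (y :* y :* y)) :* ((:- # 1) :* X) :=
          y :* (y :* (# 2 :* p :* (X :* X) :+ # 3 :* q :* (X :* y) :+ # 4 :* r :* (y :* y)))) refl p q r (X i) (y i))
        (t-+ {4} (t-* {4} {0} φ-tiny (b-const (+ 4))) (t-* {3} {1} φ′-tiny (b-* {0} {1} (b-const (- 1ℤ)) b-X)))))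

    α β : ℤ
    α = + 2 * (p * p * p) - + 8 * p * r + + 9 * (q * q)
    β = q * (p * p + + 12 * r)

    remainder-tiny : Tiny 1 (λ i → α * X i + β * y i)
    remainder-tiny = t-cancel {1} (t-cancel {2} (t-cong {3} (λ i → solve 5 (λ p q r X y →
          (# 4 :* (X :* X :* X) :+ # 2 :* p :* X :* (y :* y) :+ q :* (y :* y :* y)) :* (p :* p)
          :+ (# 2 :* p :* (X :* X) :+ # 3 :* q :* (X :* y) :+ # 4 :* r :* (y :* y))
            :* ((:- (# 2 :* p)) :* X :+ # 3 :* q :* y) :=
          y :* (y :* ((# 2 :* (p :* p :* p) :- # 8 :* p :* r :+ # 9 :* (q :* q)) :* X :+ (q :* (p :* p :+ # 12 :* r))
            :* y))) refl p q r (X i) (y i))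
        (t-+ {3} (t-* {3} {0} φ′-tiny (b-const (p * p))) (t-* {2} {1} ρ-tiny
          (b-+ {1} (b-* {0} {1} (b-const (- (+ 2 * p))) b-X) (b-* {0} {1} (b-const (+ 3 * q)) b-y))))))

    α≡0 : α ≡ 0ℤ
    α≡0 = linear-tiny α β remainder-tiny

    β≡0 : β ≡ 0ℤ
    β≡0 = constant-tiny β (t-cong {1} (λ i → trans (cong (λ a → a * X i + β * y i) α≡0)
      (solve 2 (λ x z → # 0 :* x :+ z := z) refl (X i) (β * y i))) remainder-tiny)

    k*-zero : ∀ k {x} → k ≢ 0ℤ → k * x ≡ 0ℤ → x ≡ 0ℤ
    k*-zero k {x} k≢0 e = [ (λ z → ⊥-elim (k≢0 z)) , id ]′ (*-zero-split k x e)

    1≢0 : 1ℤ ≢ 0ℤ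
    1≢0 ()

    -- For `p = 0` the first remainder is `y` times a linear form, whose coefficients `3 q` and
    -- `4 r` must vanish. Then `(0, 1)` is a zero of `φ`.
    p≢0 : p ≢ 0ℤ
    p≢0 p≡0 = 1≢0 (no-zero 0ℤ 1ℤ (trans (solve 3 (λ p q r → # 0 :* # 0 :* # 0 :* # 0 :+ p :* (# 0 :* # 0)
      :* (# 1 :* # 1) :+ q :* # 0 :* (# 1 :* # 1 :* # 1) :+ r :* (# 1 :* # 1 :* # 1 :* # 1) := r) refl p q r) r≡0))
      where
      reduced-tiny : Tiny 1 (λ i → + 3 * q * X i + + 4 * r * y i)
      reduced-tiny = t-cancel {1} (t-cong {2} (λ i → trans (cong (λ p
        → + 2 * p * (X i * X i) + + 3 * q * (X i * y i) + + 4 * r * (y i * y i)) p≡0)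
          (solve 4 (λ q r X y → # 2 :* # 0 :* (X :* X) :+ # 3 :* q :* (X :* y) :+ # 4 :* r :* (y :* y)
            := y :* (# 3 :* q :* X :+ # 4 :* r :* y)) refl q r (X i) (y i))) ρ-tiny)
      3q≡0 : + 3 * q ≡ 0ℤ
      3q≡0 = linear-tiny (+ 3 * q) (+ 4 * r) reduced-tiny
      r≡0 : r ≡ 0ℤ
      r≡0 = k*-zero (+ 4) (λ ()) (constant-tiny (+ 4 * r) (t-cong {1} (λ i
        → trans (cong (λ a → a * X i + + 4 * r * y i) 3q≡0) (solve 2 (λ x z → # 0 :* x :+ z := z) refl (X i)
        (+ 4 * r * y i))) reduced-tiny))

    q≡0 : q ≡ 0ℤ
    q≡0 = [ id , (λ e → ⊥-elim (p≢0 (k*-zero (+ 4) (λ ()) (no-zero (- (+ 3 * q)) (+ 4 * p) (triple-root e))))) ]′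
      (*-zero-split q (p * p + + 12 * r) β≡0)
      where
      -- If p² + 12 r = 0 then - 3 q / 4 p is a triple root.
      triple-root : p * p + + 12 * r ≡ 0ℤ → φ (- (+ 3 * q)) (+ 4 * p) ≡ 0ℤ
      triple-root e = k*-zero (+ 3) (λ ()) (trans (solve 3 (λ p q r →
          let x = :- (# 3 :* q)
              y = # 4 :* p in
          # 3 :* (x :* x :* x :* x :+ p :* (x :* x) :* (y :* y) :+ q :* x :* (y :* y :* y) :+ r :* (y :* y :* y :* y))
            :=
          (# 27 :* (q :* q) :- # 24 :* (p :* p :* p)) :* (# 2 :* (p :* p :* p) :- # 8 :* p :* r :+ # 9 :* (q :* q))
            :+ (# 18 :* p :* (q :* q) :+ # 48 :* (p :* p :* p :* p)) :* (p :* p :+ # 12 :* r)) refl p q r)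
          (trans (cong₂ (λ a z → (+ 27 * (q * q) - + 24 * (p * p * p)) * a
            + (+ 18 * p * (q * q) + + 48 * (p * p * p * p)) * z) α≡0 e)
            (solve 2 (λ x y → x :* # 0 :+ y :* # 0 := # 0) refl (+ 27 * (q * q) - + 24 * (p * p * p))
              (+ 18 * p * (q * q) + + 48 * (p * p * p * p)))))

    -- With `q = 0`, the coefficient `α` factors as `2 p (p² - 4 r)`.
    p²≡4r : p * p ≡ + 4 * r
    p²≡4r = trans (solve 2 (λ x y → x := (x :- y) :+ y) refl (p * p) (+ 4 * r))
      (trans (cong (_+ + 4 * r) diff) (solve 1 (λ y → # 0 :+ y := y) refl (+ 4 * r)))
      where
      diff : p * p - + 4 * r ≡ 0ℤ
      diff = k*-zero p p≢0 (k*-zero (+ 2) (λ ()) (trans (solve 2 (λ p r → # 2 :* (p :* (p :* p :- # 4 :* r))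
        := # 2 :* (p :* p :* p) :- # 8 :* p :* r :+ # 9 :* (# 0 :* # 0)) refl p r)
         (trans (cong (λ q → + 2 * (p * p * p) - + 8 * p * r + + 9 * (q * q)) (sym q≡0)) α≡0)))

    4φ≡square : ∀ X y → + 4 * φ X y ≡ (+ 2 * (X * X) + p * (y * y)) * (+ 2 * (X * X) + p * (y * y))
    4φ≡square X y = trans (cong (λ q → + 4 * (X * X * X * X + p * (X * X) * (y * y) + q * X * (y * y * y) + r
      * (y * y * y * y))) q≡0)
      (trans (solve 4 (λ p r X y → # 4 :* (X :* X :* X :* X :+ p :* (X :* X) :* (y :* y) :+ # 0 :* X :* (y :* y :* y)
        :+ r :* (y :* y :* y :* y)) :=
            (# 4 :* (X :* X :* X :* X) :+ # 4 :* p :* (X :* X) :* (y :* y)) :+ (# 4 :* r) :* (y :* y :* y :* y)) refl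
              p r X y)
      (trans (cong (λ z → (+ 4 * (X * X * X * X) + + 4 * p * (X * X) * (y * y)) + z * (y * y * y * y)) (sym p²≡4r))
        (solve 3 (λ p X y → (# 4 :* (X :* X :* X :* X) :+ # 4 :* p :* (X :* X) :* (y :* y)) :+ (p :* p)
          :* (y :* y :* y :* y) := (# 2 :* (X :* X) :+ p :* (y :* y)) :* (# 2 :* (X :* X) :+ p :* (y :* y))) refl p X
          y)))

    -- A positive `p` would make the square `(2 X² + p y²)²` definite.
    p<0 : 1ℤ ≤ - p
    p<0 = [ (λ 1≤p → ⊥-elim (indefinite (4 , definite 1≤p))) , (λ p≤0 → from (1≤-split (- p)) p≤0) ]′ (1≤-split p)
      where
      definite : 1ℤ ≤ p → ∀ X y → X * X * X * X + y * y * y * y ≤ + 4 * φ X y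
      definite 1≤p X y = ≤-by (trans (cong (_- (X * X * X * X + y * y * y * y)) (4φ≡square X y))
         (solve 3 (λ p X y → (# 2 :* (X :* X) :+ p :* (y :* y)) :* (# 2 :* (X :* X) :+ p :* (y :* y))
           :- (X :* X :* X :* X :+ y :* y :* y :* y) :=
            # 3 :* ((X :* X) :* (X :* X)) :+ # 4 :* p :* ((X :* X) :* (y :* y)) :+ (p :- # 1) :* (p :+ # 1)
              :* ((y :* y) :* (y :* y))) refl p X y))
         (+-nn (+-nn (*-nn (pos-nn 3) (sq-nn (X * X))) (*-nn (*-nn (pos-nn 4) (1≤⇒0≤ 1≤p))
           (*-nn (sq-nn X) (sq-nn y)))) (*-nn (*-nn (≤⇒0≤ 1≤p) (+-nn (1≤⇒0≤ 1≤p) (pos-nn 1))) (sq-nn (y * y))))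
      from : 1ℤ ≤ - p ⊎ - p ≤ 0ℤ → p ≤ 0ℤ → 1ℤ ≤ - p
      from (inj₁ ok) _ = ok
      from (inj₂ -p≤0) p≤0 = ⊥-elim (p≢0 (≤0∧0≤⇒≡0 p≤0 (nn-by (solve 1 (λ p → p := # 0 :- (:- p)) refl p)
        (≤⇒0≤ -p≤0))))

-- Integral quartics in two variables

record Quartic : Set where
  field
    c₄₀ c₃₁ c₂₂ c₁₃ c₀₄ c₃₀ c₂₁ c₁₂ c₀₃ c₂₀ c₁₁ c₀₂ c₁₀ c₀₁ c₀₀ : ℤ

  form₄ form₃ form₂ form₁ lower value : ℤ → ℤ → ℤ
  form₄ x y = c₄₀ * (x * x * x * x) + c₃₁ * (x * x * x * y) + c₂₂ * (x * x * (y * y)) + c₁₃ * (x * (y * y * y)) + c₀₄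
    * (y * y * y * y)
  form₃ x y = c₃₀ * (x * x * x) + c₂₁ * (x * x * y) + c₁₂ * (x * (y * y)) + c₀₃ * (y * y * y)
  form₂ x y = c₂₀ * (x * x) + c₁₁ * (x * y) + c₀₂ * (y * y)
  form₁ x y = c₁₀ * x + c₀₁ * y
  lower x y = form₃ x y + form₂ x y + form₁ x y + c₀₀
  value x y = form₄ x y + lower x y

Covers : (ℤ → ℤ → ℤ) → ℕ → Set
Covers G E = ∀ n → ∃ λ x → ∃ λ y → G x y ≡ + E * + n

-- Only O(M²) points have coordinates of size O(M).
box-impossible : ∀ (G : ℤ → ℤ → ℤ) E L → 1 ℕ.≤ E → 1 ℕ.≤ L → Covers G E →
  (∀ M n x y → 1 ℕ.≤ M → n ℕ.≤ M ℕ.^ 4 → G x y ≡ + E * + n → ∣ x ∣ ℕ.≤ L ℕ.* M × ∣ y ∣ ℕ.≤ L ℕ.* M) → ⊥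
box-impossible G E L 1≤E 1≤L covers bound = ¬SparseValues (9 ℕ.* L ℕ.* L) (+ E) (+≤+ 1≤E) sparse
  where
  sparse : SparseValues (9 ℕ.* L ℕ.* L) (+ E)
  sparse M 1≤M = concatMap row (symmetric-range N) , len , λ n n≤ → from n n≤ (covers n)
    where
    N = L ℕ.* M
    1≤N : 1 ℕ.≤ N
    1≤N = ℕP.*-mono-≤ 1≤L 1≤M
    row : ℤ → List ℤ
    row x = map (G x) (symmetric-range N)
    len : length (concatMap row (symmetric-range N)) ℕ.≤ 9 ℕ.* L ℕ.* L ℕ.* M ℕ.^ 3
    len = ℕP.≤-trans (length-concatMap row (3 ℕ.* N) (symmetric-range N) (λ x
      → ℕP.≤-trans (ℕP.≤-reflexive (LP.length-map (G x) (symmetric-range N))) (length-symmetric-range 1≤N)))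
      (ℕP.≤-trans (ℕP.*-monoˡ-≤ (3 ℕ.* N) (length-symmetric-range 1≤N))
      (ℕP.≤-trans (≤-* M 1≤M) (ℕP.≤-reflexive (+-*-Solver.solve 2 (λ L M
        → (con₂ 3 *ₛ (L *ₛ M)) *ₛ (con₂ 3 *ₛ (L *ₛ M)) *ₛ M =ₛ con₂ 9 *ₛ L *ₛ L *ₛ M ^ₛ 3) refl L M))))
      where open +-*-Solver using () renaming (_:*_ to _*ₛ_; _:=_ to _=ₛ_; con to con₂; _:^_ to _^ₛ_)
    from : ∀ n → n ℕ.≤ M ℕ.^ 4 → (∃ λ x → ∃ λ y → G x y ≡ + E * + n) → + E * + n ∈ concatMap row (symmetric-range N)
    from n n≤ (x , y , e) = ∈-concatMap row (∈-symmetric-range (proj₁ b))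
      (subst (_∈ row x) e (MP.∈-map⁺ (G x) (∈-symmetric-range (proj₂ b))))
      where b = bound M n x y 1≤M n≤ e

-- If `m ≥ M`, the right-hand side is at most `(P + R) M m³`. If `m < M`, only `P + R = 0` could
-- violate the claim, and then `m⁴ ≤ 0`.
quartic-growth : ∀ P R m M → 1 ℕ.≤ m → m ℕ.^ 4 ℕ.≤ P ℕ.* M ℕ.^ 4 ℕ.+ R ℕ.* m ℕ.^ 3 → 1 ℕ.≤ M → m ℕ.≤ (P ℕ.+ R) ℕ.* M
quartic-growth P R m M 1≤m h 1≤M = from (m ℕ.≤? (P ℕ.+ R) ℕ.* M)
  where
  from : Dec (m ℕ.≤ (P ℕ.+ R) ℕ.* M) → m ℕ.≤ (P ℕ.+ R) ℕ.* M
  from (yes ok) = ok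
  from (no far) = go (ℕP.≰⇒> far) (M ℕ.≤? m)
    where
    go : suc ((P ℕ.+ R) ℕ.* M) ℕ.≤ m → Dec (M ℕ.≤ m) → _
    go far (yes M≤m) = ⊥-elim (ℕP.<-irrefl refl (ℕP.≤-trans (ℕP.*-monoˡ-< (m ℕ.^ 3) {{ℕ.>-nonZero (1≤-^ 3 1≤m)}} far)
      (ℕP.≤-trans h
       (ℕP.≤-trans (ℕP.+-mono-≤ (ℕP.*-monoʳ-≤ P (ℕP.*-monoʳ-≤ M (ℕP.^-monoˡ-≤ 3 M≤m)))
         (ℕP.*-monoʳ-≤ R (≤-* {m ℕ.^ 3} M 1≤M)))
         (ℕP.≤-reflexive (+-*-Solver.solve 4 (λ P R M c → P *ₛ (M *ₛ c) +ₛ R *ₛ (c *ₛ M) =ₛ (P +ₛ R) *ₛ M *ₛ c) refl P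
           R M (m ℕ.^ 3)))))))
      where open +-*-Solver using () renaming (_:*_ to _*ₛ_; _:+_ to _+ₛ_; _:=_ to _=ₛ_)
    go far (no m<M) = ⊥-elim (absurd (P ℕ.+ R) refl)
      where
      absurd : ∀ s → s ≡ P ℕ.+ R → ⊥
      absurd zero e = ℕP.<⇒≱ (1≤-^ 4 1≤m) (ℕP.≤-trans h (ℕP.≤-reflexive
        (cong₂ (λ a b → a ℕ.* M ℕ.^ 4 ℕ.+ b ℕ.* m ℕ.^ 3) (ℕP.m+n≡0⇒m≡0 P (sym e)) (ℕP.m+n≡0⇒n≡0 P (sym e)))))
      absurd (suc s) e = m<M (ℕP.≤-trans (ℕP.≤-trans (ℕP.m≤m+n M (s ℕ.* M)) (ℕP.≤-reflexive (cong (ℕ._* M) e)))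
        (ℕP.<⇒≤ far))

-- Convexity of the fourth power used twice: `(1 + w)⁴ ≤ 8 (1 + w⁴)` for `w = u + v`, and
-- `w⁴ ≤ 8 (u⁴ + v⁴)`.
sum-⁴-bound : ∀ u v → (1ℤ + u + v) * (1ℤ + u + v) * ((1ℤ + u + v) * (1ℤ + u + v)) ≤ + 64
  * (u * u * (u * u) + v * v * (v * v)) + + 8
sum-⁴-bound u v = ≤-by (solve 2 (λ u v → # 64 :* (u :* u :* (u :* u) :+ v :* v :* (v :* v)) :+ # 8 :- (# 1 :+ u :+ v)
  :* (# 1 :+ u :+ v) :* ((# 1 :+ u :+ v) :* (# 1 :+ u :+ v)) :=
    (# 1 :- (u :+ v)) :* (# 1 :- (u :+ v)) :* (# 2 :+ # 2 :* ((u :+ v) :* (u :+ v)) :+ (# 1 :+ u :+ v)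
      :* (# 1 :+ u :+ v))
    :+ # 4 :* ((# 1 :- (u :+ v) :* (u :+ v)) :* (# 1 :- (u :+ v) :* (u :+ v)))
    :+ # 8 :* (# 4 :* ((u :* u :- v :* v) :* (u :* u :- v :* v)) :+ (u :- v) :* (u :- v)
      :* (# 2 :* (u :* u :+ v :* v) :+ (u :+ v) :* (u :+ v)))) refl u v)
  (+-nn (+-nn (*-nn (sq-nn (1ℤ - (u + v))) (+-nn (+-nn (pos-nn 2) (*-nn (pos-nn 2) (sq-nn (u + v))))
    (sq-nn (1ℤ + u + v))))
     (*-nn (pos-nn 4) (sq-nn (1ℤ - (u + v) * (u + v)))))
     (*-nn (pos-nn 8) (+-nn (*-nn (pos-nn 4) (sq-nn (u * u - v * v)))
       (*-nn (sq-nn (u - v)) (+-nn (*-nn (pos-nn 2) (+-nn (sq-nn u) (sq-nn v))) (sq-nn (u + v)))))))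

module _ (Q : Quartic) where
  open Quartic Q

  -- Along the ray through `(x, y)` the value is a polynomial in the parameter with top coefficient
  -- `form₄ x y`.
  form₄-nonneg : (∀ x y → 0ℤ ≤ value x y) → ∀ x y → 0ℤ ≤ form₄ x y
  form₄-nonneg nonneg x y = leading-nonneg (c₀₀ ∷ form₁ x y ∷ form₂ x y ∷ form₃ x y ∷ form₄ x y ∷ []) 0 (λ T _
    → subst (0ℤ ≤_) (expand (+ T)) (nonneg (x * + T) (y * + T)))
    where
    expand : ∀ T → value (x * T) (y * T) ≡ ev (c₀₀ ∷ form₁ x y ∷ form₂ x y ∷ form₃ x y ∷ form₄ x y ∷ []) T
    expand T = begin
      form₄ (x * T) (y * T) + (form₃ (x * T) (y * T) + form₂ (x * T) (y * T) + form₁ (x * T) (y * T) + c₀₀)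
        ≡⟨ cong₂ (λ a b → a + (b + form₂ (x * T) (y * T) + form₁ (x * T) (y * T) + c₀₀))
             (solve 8 (λ a b c d e x y T → a :* (x :* T :* (x :* T) :* (x :* T) :* (x :* T)) :+ b
               :* (x :* T :* (x :* T) :* (x :* T) :* (y :* T)) :+ c :* (x :* T :* (x :* T) :* (y :* T :* (y :* T)))
               :+ d :* (x :* T :* (y :* T :* (y :* T) :* (y :* T))) :+ e
               :* (y :* T :* (y :* T) :* (y :* T) :* (y :* T)) :=
                (T :* T :* T :* T) :* (a :* (x :* x :* x :* x) :+ b :* (x :* x :* x :* y) :+ c :* (x :* x :* (y :* y))
                  :+ d :* (x :* (y :* y :* y)) :+ e :* (y :* y :* y :* y))) refl c₄₀ c₃₁ c₂₂ c₁₃ c₀₄ x y T)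
             (solve 7 (λ a b c d x y T → a :* (x :* T :* (x :* T) :* (x :* T)) :+ b
               :* (x :* T :* (x :* T) :* (y :* T)) :+ c :* (x :* T :* (y :* T :* (y :* T))) :+ d
               :* (y :* T :* (y :* T) :* (y :* T)) :=
                (T :* T :* T) :* (a :* (x :* x :* x) :+ b :* (x :* x :* y) :+ c :* (x :* (y :* y)) :+ d
                  :* (y :* y :* y))) refl c₃₀ c₂₁ c₁₂ c₀₃ x y T) ⟩
      (T * T * T * T) * form₄ x y + ((T * T * T) * form₃ x y + form₂ (x * T) (y * T) + form₁ (x * T) (y * T) + c₀₀)
        ≡⟨ cong₂ (λ a b → (T * T * T * T) * form₄ x y + ((T * T * T) * form₃ x y + a + b + c₀₀))
             (solve 6 (λ a b c x y T → a :* (x :* T :* (x :* T)) :+ b :* (x :* T :* (y :* T)) :+ c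
               :* (y :* T :* (y :* T)) := (T :* T) :* (a :* (x :* x) :+ b :* (x :* y) :+ c :* (y :* y))) refl c₂₀ c₁₁
               c₀₂ x y T)
             (solve 5 (λ a b x y T → a :* (x :* T) :+ b :* (y :* T) := T :* (a :* x :+ b :* y)) refl c₁₀ c₀₁ x y T) ⟩
      (T * T * T * T) * form₄ x y + ((T * T * T) * form₃ x y + (T * T) * form₂ x y + T * form₁ x y + c₀₀)
        ≡⟨ solve 6 (λ f₄ f₃ f₂ f₁ c T → (T :* T :* T :* T) :* f₄
          :+ ((T :* T :* T) :* f₃ :+ (T :* T) :* f₂ :+ T :* f₁ :+ c)
          := c :+ T :* (f₁ :+ T :* (f₂ :+ T :* (f₃ :+ T :* (f₄ :+ T :* # 0))))) refl (form₄ x y) (form₃ x y)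
          (form₂ x y) (form₁ x y) c₀₀ T ⟩
      c₀₀ + T * (form₁ x y + T * (form₂ x y + T * (form₃ x y + T * (form₄ x y + T * 0ℤ)))) ∎
      where open ≡-Reasoning

  record ScaledPoint (B : ℕ) : Set where
    field
      x y : ℤ
      m : ℕ
      1≤m : 1 ℕ.≤ m
      x≤ : ∣ x ∣ ℕ.≤ B ℕ.* m
      y≤ : ∣ y ∣ ℕ.≤ B ℕ.* m

  lower-bounded : ∀ B → O {ScaledPoint B} (λ i → ScaledPoint.m i ℕ.^ 3) (λ i
    → lower (ScaledPoint.x i) (ScaledPoint.y i))
  lower-bounded B = +ᵇ (+ᵇ (+ᵇ
      (+ᵇ (+ᵇ (+ᵇ (sc c₃₀ (bx *ᵇ bx *ᵇ bx)) (sc c₂₁ (bx *ᵇ bx *ᵇ by)))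
        (sc c₁₂ (O-cong (λ i → solve 2 (λ x y → x :* y :* y := x :* (y :* y)) refl (x i) (y i)) (bx *ᵇ by *ᵇ by))))
        (sc c₀₃ (by *ᵇ by *ᵇ by)))
      (+ᵇ (+ᵇ (sc c₂₀ (w₂ {λ i → x i * x i} (bx · bx))) (sc c₁₁ (w₂ {λ i → x i * y i} (bx · by))))
        (sc c₀₂ (w₂ {λ i → y i * y i} (by · by)))))
      (+ᵇ (sc c₁₀ (w₁ {x} bx)) (sc c₀₁ (w₁ {y} by))))
      (O-const {w = m³} c₀₀ (λ i → 1≤-^ 3 (1≤m i)))
    where
    open ScaledPoint
    I = ScaledPoint B
    m³ : I → ℕ
    m³ i = m i ℕ.^ 3
    bx : O m x
    bx = B , x≤
    by : O m y
    by = B , y≤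
    _·_ : ∀ {g h : I → ℤ} → O m g → O m h → O (λ i → m i ℕ.* m i) (λ i → g i * h i)
    _·_ {g} {h} = O-* {w = m} {m} {g} {h}
    infixl 7 _·_
    w₁ : ∀ {g : I → ℤ} → O m g → O m³ g
    w₁ {g} = O-weaken {g = g} (λ i → ≤-* {m i} (m i ℕ.^ 2) (1≤-^ 2 (1≤m i)))
    w₂ : ∀ {g : I → ℤ} → O (λ i → m i ℕ.* m i) g → O m³ g
    w₂ {g} = O-weaken {g = g} (λ i → ℕP.≤-trans (≤-* {m i ℕ.* m i} (m i) (1≤m i))
      (ℕP.≤-reflexive (trans (ℕP.*-comm (m i ℕ.* m i) (m i)) (sym (^3≡ (m i))))))
    triple : ∀ {g h k : I → ℤ} → O m g → O m h → O m k → O m³ (λ i → g i * h i * k i)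
    triple {g} {h} {k} p q r = O-weaken {g = λ i → g i * h i * k i} (λ i
      → ℕP.≤-reflexive (trans (ℕP.*-comm (m i ℕ.* m i) (m i)) (sym (^3≡ (m i)))))
      (O-* {w = λ i → m i ℕ.* m i} {m} {λ i → g i * h i} {k} (p · q) r)
    _*ᵇ_*ᵇ_ : ∀ {g h k : I → ℤ} → O m g → O m h → O m k → O m³ (λ i → g i * h i * k i)
    _*ᵇ_*ᵇ_ {g} {h} {k} = triple {g} {h} {k}
    sc : ∀ {g : I → ℤ} c → O m³ g → O m³ (λ i → c * g i)
    sc {g} = O-scale {w = m³} {g}
    +ᵇ : ∀ {g h : I → ℤ} → O m³ g → O m³ h → O m³ (λ i → g i + h i)
    +ᵇ {g} {h} = O-+ {w = m³} {g} {h}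

  -- 256 c₄₀³ times the leading form in the variables 4 c₄₀ x + c₃₁ y and y
  dep-p dep-q dep-r : ℤ
  dep-p = + 16 * c₄₀ * c₂₂ - + 6 * c₃₁ * c₃₁
  dep-q = + 8 * c₃₁ * c₃₁ * c₃₁ - + 32 * c₄₀ * c₃₁ * c₂₂ + + 64 * c₄₀ * c₄₀ * c₁₃
  dep-r = + 16 * c₄₀ * c₃₁ * c₃₁ * c₂₂ - + 3 * c₃₁ * c₃₁ * c₃₁ * c₃₁ - + 64 * c₄₀ * c₄₀ * c₃₁ * c₁₃ + + 256 * c₄₀
    * c₄₀ * c₄₀ * c₀₄

  open Depressed dep-p dep-q dep-r using (φ; Definite)

  form₄-depressed : ∀ x y → + 256 * (c₄₀ * c₄₀ * c₄₀) * form₄ x y ≡ φ (+ 4 * c₄₀ * x + c₃₁ * y) y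
  form₄-depressed x y = solve 7 (λ a b c d e x y →
      let X = # 4 :* a :* x :+ b :* y
          p = # 16 :* a :* c :- # 6 :* b :* b
          q = # 8 :* b :* b :* b :- # 32 :* a :* b :* c :+ # 64 :* a :* a :* d
          r = # 16 :* a :* b :* b :* c :- # 3 :* b :* b :* b :* b :- # 64 :* a :* a :* b :* d :+ # 256 :* a :* a :* a
            :* e in
      # 256 :* (a :* a :* a) :* (a :* (x :* x :* x :* x) :+ b :* (x :* x :* x :* y) :+ c :* (x :* x :* (y :* y)) :+ d
        :* (x :* (y :* y :* y)) :+ e :* (y :* y :* y :* y)) :=
      X :* X :* X :* X :+ p :* (X :* X) :* (y :* y) :+ q :* X :* (y :* y :* y) :+ r :* (y :* y :* y :* y)) refl c₄₀
        c₃₁ c₂₂ c₁₃ c₀₄ x y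

  -- The inverse change of variables with its denominator `4 c₄₀` cleared. It carries nonnegativity
  -- and the absence of zeros to `φ` at every integral point, not only at those of the form in
  -- `form₄-depressed`.
  depressed-form₄ : ∀ X y → form₄ (X - c₃₁ * y) (+ 4 * c₄₀ * y) ≡ c₄₀ * φ X y
  depressed-form₄ X y = solve 7 (λ a b c d e X y →
      let x = X :- b :* y
          z = # 4 :* a :* y
          p = # 16 :* a :* c :- # 6 :* b :* b
          q = # 8 :* b :* b :* b :- # 32 :* a :* b :* c :+ # 64 :* a :* a :* d
          r = # 16 :* a :* b :* b :* c :- # 3 :* b :* b :* b :* b :- # 64 :* a :* a :* b :* d :+ # 256 :* a :* a :* a
            :* e in
      a :* (x :* x :* x :* x) :+ b :* (x :* x :* x :* z) :+ c :* (x :* x :* (z :* z)) :+ d :* (x :* (z :* z :* z))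
        :+ e :* (z :* z :* z :* z) :=
      a :* (X :* X :* X :* X :+ p :* (X :* X) :* (y :* y) :+ q :* X :* (y :* y :* y) :+ r :* (y :* y :* y :* y))) refl
        c₄₀ c₃₁ c₂₂ c₁₃ c₀₄ X y

  module _ (a : ℕ) (1≤a : 1 ℕ.≤ a) (c₄₀≡a : c₄₀ ≡ + a) (E : ℕ) (1≤E : 1 ℕ.≤ E) (covers : Covers value E) where

    definite-impossible : ¬ Definite
    definite-impossible (K , definite) = box-impossible value E (B ℕ.* (P ℕ.+ R)) 1≤E
      (ℕP.*-mono-≤ {1} {B} (s≤s z≤n) (ℕP.≤-trans (s≤s z≤n) (ℕP.m≤n⇒m≤n+o R (ℕP.m≤n+m 8 P₀)))) covers
        (λ M n x y 1≤M n≤ e → subst (λ k → ∣ x ∣ ℕ.≤ k) (sym (ℕP.*-assoc B (P ℕ.+ R) M))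
          (ℕP.≤-trans (x-bound x y) (ℕP.*-monoʳ-≤ B (small M n x y 1≤M n≤ e)))
                            , subst (λ k → ∣ y ∣ ℕ.≤ k) (sym (ℕP.*-assoc B (P ℕ.+ R) M))
                              (ℕP.≤-trans (y-bound x y) (ℕP.*-monoʳ-≤ B (small M n x y 1≤M n≤ e))))
      where
      B = suc ∣ c₃₁ ∣
      C = proj₁ (lower-bounded B)
      -- Chosen so that `64 (X⁴ + y⁴) ≤ 64 K φ = k₀ form₄`. With `m = 1 + ∣ X ∣ + ∣ y ∣` this gives
      -- `m⁴ ≤ k₀ (E n - lower) + 8`, from which `P` and `R` are read off.
      k₀ = 64 ℕ.* (K ℕ.* (256 ℕ.* (a ℕ.* a ℕ.* a)))
      P₀ = k₀ ℕ.* E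
      P = P₀ ℕ.+ 8
      R = k₀ ℕ.* C
      X : ℤ → ℤ → ℤ
      X x y = + 4 * c₄₀ * x + c₃₁ * y
      m : ℤ → ℤ → ℕ
      m x y = suc (∣ X x y ∣ ℕ.+ ∣ y ∣)
      y-bound : ∀ x y → ∣ y ∣ ℕ.≤ B ℕ.* m x y
      y-bound x y = ℕP.≤-trans (ℕP.m≤n+m ∣ y ∣ ∣ X x y ∣) (ℕP.≤-trans (ℕP.n≤1+n _)
        (ℕP.m≤m+n (m x y) (∣ c₃₁ ∣ ℕ.* m x y)))
      x-bound : ∀ x y → ∣ x ∣ ℕ.≤ B ℕ.* m x y
      x-bound x y = ℕP.≤-trans ∣x∣≤ (ℕP.≤-trans (ℕP.≤-reflexive
        (cong ∣_∣ (solve 4 (λ a b x y → # 4 :* a :* x := (# 4 :* a :* x :+ b :* y) :+ :- (b :* y)) refl c₄₀ c₃₁ x y)))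
         (ℕP.≤-trans (∣+∣ (X x y) (- (c₃₁ * y))) (ℕP.+-mono-≤ {∣ X x y ∣} {m x y}
           (ℕP.≤-trans (ℕP.m≤m+n ∣ X x y ∣ ∣ y ∣) (ℕP.n≤1+n _))
            (ℕP.≤-trans (ℕP.≤-reflexive (trans (∣neg∣ (c₃₁ * y)) (∣*∣ c₃₁ y)))
              (ℕP.*-monoʳ-≤ ∣ c₃₁ ∣ (ℕP.≤-trans (ℕP.m≤n+m ∣ y ∣ ∣ X x y ∣) (ℕP.n≤1+n _)))))))
        where
        ∣x∣≤ : ∣ x ∣ ℕ.≤ ∣ + 4 * c₄₀ * x ∣
        ∣x∣≤ = ℕP.≤-trans (≤-* {∣ x ∣} (4 ℕ.* a) (ℕP.*-mono-≤ {1} {4} (s≤s z≤n) 1≤a))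
          (ℕP.≤-reflexive (trans (ℕP.*-comm ∣ x ∣ (4 ℕ.* a))
          (trans (cong (λ z → ∣ z ∣ ℕ.* ∣ x ∣) (trans (pos-* 4 a) (cong (+ 4 *_) (sym c₄₀≡a))))
          (sym (∣*∣ (+ 4 * c₄₀) x)))))
      pos-^⁴ : ∀ k → + (k ℕ.^ 4) ≡ + k * + k * (+ k * + k)
      pos-^⁴ k = trans (cong +_ (^4≡ k)) (trans (pos-* (k ℕ.* k) (k ℕ.* k)) (cong (λ z → z * z) (pos-* k k)))
      small : ∀ M n x y → 1 ℕ.≤ M → n ℕ.≤ M ℕ.^ 4 → value x y ≡ + E * + n → m x y ℕ.≤ (P ℕ.+ R) ℕ.* M
      small M n x y 1≤M n≤ e = quartic-growth P R (m x y) M (s≤s z≤n)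
        (+≤⇒ (≤-by {z = (+ 64 * (U * U * (U * U) + W * W * (W * W)) + + 8 - + (m x y ℕ.^ 4))
                + + 64 * (+ K * φ (X x y) y - (X x y * X x y * X x y * X x y + y * y * y * y))
                + + k₀ * (+ C * m³ + lower x y) + + k₀ * + E * (M⁴ - + n) + + 8 * (M⁴ - 1ℤ)} identity
            (+-nn (+-nn (+-nn (+-nn (≤⇒0≤ m⁴≤) (*-nn (pos-nn 64) (≤⇒0≤ (definite (X x y) y))))
              (*-nn (pos-nn k₀) lower≥)) (*-nn (*-nn (pos-nn k₀) (pos-nn E)) (≤⇒0≤ (+≤+ n≤))))
              (*-nn (pos-nn 8) (≤⇒0≤ (+≤+ (1≤-^ 4 1≤M))))))) 1≤M
        where
        U = + ∣ X x y ∣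
        W = + ∣ y ∣
        m³ = + (m x y ℕ.^ 3)
        M⁴ = + (M ℕ.^ 4)
        m⁴≤ : + (m x y ℕ.^ 4) ≤ + 64 * (U * U * (U * U) + W * W * (W * W)) + + 8
        m⁴≤ = subst (_≤ + 64 * (U * U * (U * U) + W * W * (W * W)) + + 8)
          (sym (trans (pos-^⁴ (m x y)) (cong (λ z → z * z * (z * z))
          (trans (pos-+ 1 (∣ X x y ∣ ℕ.+ ∣ y ∣)) (trans (cong (_+_ 1ℤ) (pos-+ ∣ X x y ∣ ∣ y ∣))
          (solve 2 (λ u v → # 1 :+ (u :+ v) := # 1 :+ u :+ v) refl U W)))))) (sum-⁴-bound U W)
        point : ScaledPoint B
        point = record { x = x ; y = y ; m = m x y ; 1≤m = s≤s z≤n ; x≤ = x-bound x y ; y≤ = y-bound x y }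
        lower≥ : 0ℤ ≤ + C * m³ + lower x y
        lower≥ = nn-by (solve 2 (λ c l → c :+ l := c :- (:- l)) refl (+ C * m³) (lower x y))
          (≤⇒0≤ (subst (- lower x y ≤_) (pos-* C (m x y ℕ.^ 3)) (∣x∣≤⇒- {lower x y} (proj₂ (lower-bounded B) point))))
        k₀≡ : + k₀ ≡ + 64 * (+ K * (+ 256 * (c₄₀ * c₄₀ * c₄₀)))
        k₀≡ = trans (pos-* 64 (K ℕ.* (256 ℕ.* (a ℕ.* a ℕ.* a))))
          (cong (+ 64 *_) (trans (pos-* K (256 ℕ.* (a ℕ.* a ℕ.* a)))
          (cong (+ K *_) (trans (pos-* 256 (a ℕ.* a ℕ.* a)) (cong (+ 256 *_)
          (trans (pos-* (a ℕ.* a) a) (trans (cong (_* + a) (pos-* a a)) (cong (λ z → z * z * z) (sym c₄₀≡a)))))))))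
        pos-side : + (P ℕ.* M ℕ.^ 4 ℕ.+ R ℕ.* m x y ℕ.^ 3) ≡ (+ k₀ * + E + + 8) * M⁴ + + k₀ * + C * m³
        pos-side = trans (pos-+ (P ℕ.* M ℕ.^ 4) (R ℕ.* m x y ℕ.^ 3))
          (cong₂ _+_ (trans (pos-* P (M ℕ.^ 4)) (cong (_* M⁴) (trans (pos-+ P₀ 8) (cong (_+ + 8) (pos-* k₀ E)))))
          (trans (pos-* R (m x y ℕ.^ 3)) (cong (_* m³) (pos-* k₀ C))))
        identity : + (P ℕ.* M ℕ.^ 4 ℕ.+ R ℕ.* m x y ℕ.^ 3) - + (m x y ℕ.^ 4)
          ≡ (+ 64 * (U * U * (U * U) + W * W * (W * W)) + + 8 - + (m x y ℕ.^ 4))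
                + + 64 * (+ K * φ (X x y) y - (X x y * X x y * X x y * X x y + y * y * y * y))
                + + k₀ * (+ C * m³ + lower x y) + + k₀ * + E * (M⁴ - + n) + + 8 * (M⁴ - 1ℤ)
        identity = begin
          + (P ℕ.* M ℕ.^ 4 ℕ.+ R ℕ.* m x y ℕ.^ 3) - + (m x y ℕ.^ 4)
            ≡⟨ cong (_- + (m x y ℕ.^ 4)) pos-side ⟩
          (+ k₀ * + E + + 8) * M⁴ + + k₀ * + C * m³ - + (m x y ℕ.^ 4)
            ≡⟨ solve 9 (λ k E M C m³ m⁴ S l n → (k :* E :+ # 8) :* M :+ k :* C :* m³ :- m⁴ :=
                  ((# 64 :* S :+ # 8 :- m⁴) :+ (k :* (E :* n :- l) :- # 64 :* S) :+ k :* (C :* m³ :+ l) :+ k :* E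
                    :* (M :- n) :+ # 8 :* (M :- # 1))) refl (+ k₀) (+ E) M⁴ (+ C) m³ (+ (m x y ℕ.^ 4))
                    (U * U * (U * U) + W * W * (W * W)) (lower x y) (+ n) ⟩
          (+ 64 * (U * U * (U * U) + W * W * (W * W)) + + 8 - + (m x y ℕ.^ 4))
            + (+ k₀ * (+ E * + n - lower x y) - + 64 * (U * U * (U * U) + W * W * (W * W))) + + k₀
            * (+ C * m³ + lower x y) + + k₀ * + E * (M⁴ - + n) + + 8 * (M⁴ - 1ℤ)
            ≡⟨ cong (λ z → (+ 64 * (U * U * (U * U) + W * W * (W * W)) + + 8 - + (m x y ℕ.^ 4)) + z + + k₀
              * (+ C * m³ + lower x y) + + k₀ * + E * (M⁴ - + n) + + 8 * (M⁴ - 1ℤ)) middle ⟩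
          _ ∎
          where
          open ≡-Reasoning
          middle : + k₀ * (+ E * + n - lower x y) - + 64 * (U * U * (U * U) + W * W * (W * W))
            ≡ + 64 * (+ K * φ (X x y) y - (X x y * X x y * X x y * X x y + y * y * y * y))
          middle = begin
            + k₀ * (+ E * + n - lower x y) - + 64 * (U * U * (U * U) + W * W * (W * W))
              ≡⟨ cong₂ (λ v s → + k₀ * (v - lower x y) - + 64 * s) (sym e)
                (cong₂ (λ u w → u * u + w * w) (∣sq∣ (X x y)) (∣sq∣ y)) ⟩
            + k₀ * (form₄ x y + lower x y - lower x y) - + 64
              * ((X x y * X x y) * (X x y * X x y) + (y * y) * (y * y))
              ≡⟨ cong (λ k → k * (form₄ x y + lower x y - lower x y) - + 64
                * ((X x y * X x y) * (X x y * X x y) + (y * y) * (y * y))) k₀≡ ⟩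
            + 64 * (+ K * (+ 256 * (c₄₀ * c₄₀ * c₄₀))) * (form₄ x y + lower x y - lower x y) - + 64
              * ((X x y * X x y) * (X x y * X x y) + (y * y) * (y * y))
              ≡⟨ solve 6 (λ K a f l X y → # 64 :* (K :* a) :* (f :+ l :- l) :- # 64
                :* ((X :* X) :* (X :* X) :+ (y :* y) :* (y :* y))
                := # 64 :* (K :* (a :* f) :- (X :* X :* X :* X :+ y :* y :* y :* y))) refl (+ K)
                (+ 256 * (c₄₀ * c₄₀ * c₄₀)) (form₄ x y) (lower x y) (X x y) y ⟩
            + 64 * (+ K * (+ 256 * (c₄₀ * c₄₀ * c₄₀) * form₄ x y) - (X x y * X x y * X x y * X x y + y * y * y * y))
              ≡⟨ cong (λ z → + 64 * (+ K * z - (X x y * X x y * X x y * X x y + y * y * y * y))) (form₄-depressed x y)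
                ⟩
            + 64 * (+ K * φ (X x y) y - (X x y * X x y * X x y * X x y + y * y * y * y)) ∎

-- A quartic (U² - d y²)² + … is brought to the form without U³ and U² y terms by
-- V = 4 d U + d k₃₀, W = 4 d y - k₂₁.
module CompleteSquare (d k₃₀ k₂₁ k₁₂ k₀₃ k₂₀ k₁₁ k₀₂ k₁₀ k₀₁ k₀₀ : ℤ) where

  e₁ c₀ n μ₀ ν₀ qa qb qc ql qm qn : ℤ
  e₁ = d * k₃₀
  c₀ = e₁ * e₁ - d * (k₂₁ * k₂₁)
  μ₀ = + 4 * d * (k₁₂ + d * k₃₀)
  ν₀ = + 4 * d * (k₀₃ + d * k₂₁)
  n = ν₀ * k₂₁ - μ₀ * e₁
  qa = + 16 * d * d * k₂₀ - + 2 * c₀ - + 4 * e₁ * e₁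
  qb = + 16 * d * d * k₁₁ - + 8 * d * e₁ * k₂₁
  qc = + 16 * d * d * k₀₂ + + 2 * d * c₀ - + 4 * d * d * k₂₁ * k₂₁
  ql = + 64 * d * d * d * k₁₀ - + 4 * e₁ * c₀
  qm = + 64 * d * d * d * k₀₁ - + 4 * d * k₂₁ * c₀
  qn = + 256 * d * d * d * d * k₀₀ - c₀ * c₀

  α β γ ρ σ τ : ℤ
  α = qa
  β = qb + + 2 * k₂₁ * μ₀
  γ = qc + n + + 2 * k₂₁ * ν₀
  ρ = ql - + 2 * qa * e₁ + qb * k₂₁ + k₂₁ * k₂₁ * μ₀
  σ = qm - qb * e₁ + + 2 * qc * k₂₁ + + 2 * k₂₁ * n + k₂₁ * k₂₁ * ν₀
  τ = qa * e₁ * e₁ - qb * e₁ * k₂₁ + qc * k₂₁ * k₂₁ - ql * e₁ + qm * k₂₁ + qn + k₂₁ * k₂₁ * n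

  q² : ℤ → ℤ → ℤ
  q² V W = (V * V - d * (W * W)) * (V * V - d * (W * W))

  Ψ : ℤ → ℤ → ℤ
  Ψ V W = q² V W + W * W * (μ₀ * V + ν₀ * W) + (α * (V * V) + β * (V * W) + γ * (W * W)) + (ρ * V + σ * W) + τ

  unshifted : ℤ → ℤ → ℤ
  unshifted U y = (U * U - d * (y * y)) * (U * U - d * (y * y)) + k₃₀ * (U * U * U) + k₂₁ * (U * U * y) + k₁₂
    * (U * (y * y)) + k₀₃ * (y * y * y)
    + k₂₀ * (U * U) + k₁₁ * (U * y) + k₀₂ * (y * y) + k₁₀ * U + k₀₁ * y + k₀₀

  complete-square : ∀ U y → + 256 * d * d * d * d * unshifted U y ≡ Ψ (+ 4 * d * U + e₁) (+ 4 * d * y - k₂₁)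
  complete-square U y = sym (trans (shift (+ 4 * d * U) (+ 4 * d * y))
    (solve 13 (λ d k30 k21 k12 k03 k20 k11 k02 k10 k01 k00 U y →
     let e₁ = d :* k30
         c₀ = e₁ :* e₁ :- d :* (k21 :* k21)
         A = # 4 :* d :* U
         B = # 4 :* d :* y
         V = A :+ e₁
         W = B :- k21 in
      (V :* V :- d :* (W :* W)) :* (V :* V :- d :* (W :* W))
        :+ (B :* B :* (# 4 :* d :* (k12 :+ d :* k30) :* A :+ # 4 :* d :* (k03 :+ d :* k21) :* B)
      :+ ((# 16 :* d :* d :* k20 :- # 2 :* c₀ :- # 4 :* e₁ :* e₁) :* (A :* A)
        :+ (# 16 :* d :* d :* k11 :- # 8 :* d :* e₁ :* k21) :* (A :* B)
        :+ (# 16 :* d :* d :* k02 :+ # 2 :* d :* c₀ :- # 4 :* d :* d :* k21 :* k21) :* (B :* B))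
      :+ ((# 64 :* d :* d :* d :* k10 :- # 4 :* e₁ :* c₀) :* A
        :+ (# 64 :* d :* d :* d :* k01 :- # 4 :* d :* k21 :* c₀) :* B)
        :+ (# 256 :* d :* d :* d :* d :* k00 :- c₀ :* c₀))
      := # 256 :* d :* d :* d :* d :* ((U :* U :- d :* (y :* y)) :* (U :* U :- d :* (y :* y)) :+ k30 :* (U :* U :* U)
        :+ k21 :* (U :* U :* y) :+ k12 :* (U :* (y :* y)) :+ k03 :* (y :* y :* y) :+ k20 :* (U :* U) :+ k11
        :* (U :* y) :+ k02 :* (y :* y) :+ k10 :* U :+ k01 :* y :+ k00)) refl d k₃₀ k₂₁ k₁₂ k₀₃ k₂₀ k₁₁ k₀₂ k₁₀ k₀₁ k₀₀
        U y))
    where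
    shift : ∀ A B → Ψ (A + e₁) (B - k₂₁) ≡ q² (A + e₁) (B - k₂₁)
      + (B * B * (μ₀ * A + ν₀ * B) + (qa * (A * A) + qb * (A * B) + qc * (B * B)) + (ql * A + qm * B) + qn)
    shift A B = trans (solve 5 (λ q a b c d → q :+ a :+ b :+ c :+ d := q :+ (a :+ b :+ c :+ d)) refl (q² V W)
      (W * W * (μ₀ * V + ν₀ * W)) (α * (V * V) + β * (V * W) + γ * (W * W)) (ρ * V + σ * W) τ)
      (cong (_+_ (q² V W)) (solve 12 (λ A B s e μ ν qa qb qc ql qm qn →
         let V = A :+ e
             W = B :- s
             n = ν :* s :- μ :* e in
         W :* W :* (μ :* V :+ ν :* W) :+ (qa :* (V :* V) :+ (qb :+ # 2 :* s :* μ) :* (V :* W)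
           :+ (qc :+ n :+ # 2 :* s :* ν) :* (W :* W))
         :+ ((ql :- # 2 :* qa :* e :+ qb :* s :+ s :* s :* μ) :* V
           :+ (qm :- qb :* e :+ # 2 :* qc :* s :+ # 2 :* s :* n :+ s :* s :* ν) :* W)
         :+ (qa :* e :* e :- qb :* e :* s :+ qc :* s :* s :- ql :* e :+ qm :* s :+ qn :+ s :* s :* n)
         := B :* B :* (μ :* A :+ ν :* B) :+ (qa :* (A :* A) :+ qb :* (A :* B) :+ qc :* (B :* B))
           :+ (ql :* A :+ qm :* B) :+ qn) refl A B k₂₁ e₁ μ₀ ν₀ qa qb qc ql qm qn))
      where
      V = A + e₁
      W = B - k₂₁

-- Anisotropic leading forms

module _ (Q : Quartic) where
  open Quartic Q
  open Depressed (dep-p Q) (dep-q Q) (dep-r Q) using (φ)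

  module _ (a dn E : ℕ) (1≤a : 1 ℕ.≤ a) (1≤dn : 1 ℕ.≤ dn) (1≤E : 1 ℕ.≤ E) (c₄₀≡a : c₄₀ ≡ + a) (d≡ : + dn
    ≡ - (+ 2 * dep-p Q)) (nonsquare : NonSquare (+ dn))
    (4φ≡square : ∀ X y → + 4 * φ X y ≡ (+ 2 * (X * X) + dep-p Q * (y * y)) * (+ 2 * (X * X) + dep-p Q * (y * y)))
    (nonneg : ∀ x y → 0ℤ ≤ value x y) (covers : Covers value E) where

    private
      d = + dn
      b = c₃₁
      U : ℤ → ℤ → ℤ
      U x y = + 8 * c₄₀ * x + + 2 * b * y

    -- The arguments are the coefficients of `4096 c₄₀³ * lower x y` after the substitution
    -- `x = (U - 2 b y) / (8 c₄₀)`.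
    open CompleteSquare d
      (+ 8 * c₃₀)
      (+ 8 * (+ 8 * c₄₀ * c₂₁ - + 6 * b * c₃₀))
      (+ 8 * (+ 12 * b * b * c₃₀ - + 32 * c₄₀ * b * c₂₁ + + 64 * c₄₀ * c₄₀ * c₁₂))
      (+ 8 * (+ 32 * c₄₀ * b * b * c₂₁ - + 8 * b * b * b * c₃₀ - + 128 * c₄₀ * c₄₀ * b * c₁₂ + + 512 * c₄₀ * c₄₀ * c₄₀
        * c₀₃))
      (+ 64 * c₄₀ * c₂₀)
      (+ 64 * c₄₀ * (+ 8 * c₄₀ * c₁₁ - + 4 * b * c₂₀))
      (+ 64 * c₄₀ * (+ 4 * b * b * c₂₀ - + 16 * c₄₀ * b * c₁₁ + + 64 * c₄₀ * c₄₀ * c₀₂))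
      (+ 512 * c₄₀ * c₄₀ * c₁₀)
      (+ 512 * c₄₀ * c₄₀ * (+ 8 * c₄₀ * c₀₁ - + 2 * b * c₁₀))
      (+ 4096 * c₄₀ * c₄₀ * c₄₀ * c₀₀)

    -- `U` is twice the depressed variable `X`, so `U² - d y² = 2 (2 X² + p y²)` for `d = - 2 p`;
    -- its square is `16 φ`, and `4096 = 16 * 256`.
    leading-square : ∀ x y → + 4096 * (c₄₀ * c₄₀ * c₄₀) * form₄ x y
      ≡ (U x y * U x y - d * (y * y)) * (U x y * U x y - d * (y * y))
    leading-square x y = begin
      + 4096 * (c₄₀ * c₄₀ * c₄₀) * form₄ x y ≡⟨ solve 2 (λ a f → # 4096 :* a :* f
        := # 4 :* (# 4 :* (# 256 :* a :* f))) refl (c₄₀ * c₄₀ * c₄₀) (form₄ x y) ⟩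
      + 4 * (+ 4 * (+ 256 * (c₄₀ * c₄₀ * c₄₀) * form₄ x y)) ≡⟨ cong (λ z → + 4 * (+ 4 * z)) (form₄-depressed Q x y) ⟩
      + 4 * (+ 4 * φ X y) ≡⟨ cong (+ 4 *_) (4φ≡square X y) ⟩
      + 4 * ((+ 2 * (X * X) + dep-p Q * (y * y)) * (+ 2 * (X * X) + dep-p Q * (y * y)))
        ≡⟨ solve 5 (λ a b x y p →
             let X = # 4 :* a :* x :+ b :* y
                 U = # 8 :* a :* x :+ # 2 :* b :* y in
             # 4 :* ((# 2 :* (X :* X) :+ p :* (y :* y)) :* (# 2 :* (X :* X) :+ p :* (y :* y)))
               := (U :* U :- (:- (# 2 :* p)) :* (y :* y)) :* (U :* U :- (:- (# 2 :* p)) :* (y :* y))) refl c₄₀ c₃₁ x y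
               (dep-p Q) ⟩
      (U x y * U x y - (- (+ 2 * dep-p Q)) * (y * y)) * (U x y * U x y - (- (+ 2 * dep-p Q)) * (y * y)) ≡⟨ cong (λ z
        → (U x y * U x y - z * (y * y)) * (U x y * U x y - z * (y * y))) (sym d≡) ⟩
      (U x y * U x y - d * (y * y)) * (U x y * U x y - d * (y * y)) ∎
      where
      open ≡-Reasoning
      X = + 4 * c₄₀ * x + c₃₁ * y

    scaled-value : ∀ x y → + 4096 * (c₄₀ * c₄₀ * c₄₀) * value x y ≡ unshifted (U x y) y
    scaled-value x y = begin
      + 4096 * (c₄₀ * c₄₀ * c₄₀) * (form₄ x y + lower x y)
        ≡⟨ solve 3 (λ a f l → a :* (f :+ l) := a :* f :+ a :* l) refl (+ 4096 * (c₄₀ * c₄₀ * c₄₀)) (form₄ x y)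
          (lower x y) ⟩
      + 4096 * (c₄₀ * c₄₀ * c₄₀) * form₄ x y + + 4096 * (c₄₀ * c₄₀ * c₄₀) * lower x y
        ≡⟨ cong (_+ + 4096 * (c₄₀ * c₄₀ * c₄₀) * lower x y) (leading-square x y) ⟩
      N + + 4096 * (c₄₀ * c₄₀ * c₄₀) * lower x y
        ≡⟨ cong (_+_ N) (solve 14 (λ a b h30 h21 h12 h03 g20 g11 g02 l10 l01 m x y →
             let U = # 8 :* a :* x :+ # 2 :* b :* y in
             # 4096 :* (a :* a :* a) :* (h30 :* (x :* x :* x) :+ h21 :* (x :* x :* y) :+ h12 :* (x :* (y :* y)) :+ h03
               :* (y :* y :* y) :+ (g20 :* (x :* x) :+ g11 :* (x :* y) :+ g02 :* (y :* y)) :+ (l10 :* x :+ l01 :* y)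
               :+ m) :=
             # 8 :* h30 :* (U :* U :* U)
             :+ # 8 :* (# 8 :* a :* h21 :- # 6 :* b :* h30) :* (U :* U :* y)
             :+ # 8 :* (# 12 :* b :* b :* h30 :- # 32 :* a :* b :* h21 :+ # 64 :* a :* a :* h12) :* (U :* (y :* y))
             :+ # 8 :* (# 32 :* a :* b :* b :* h21 :- # 8 :* b :* b :* b :* h30 :- # 128 :* a :* a :* b :* h12 :+ #
               512 :* a :* a :* a :* h03) :* (y :* y :* y)
             :+ # 64 :* a :* g20 :* (U :* U) :+ # 64 :* a :* (# 8 :* a :* g11 :- # 4 :* b :* g20) :* (U :* y)
             :+ # 64 :* a :* (# 4 :* b :* b :* g20 :- # 16 :* a :* b :* g11 :+ # 64 :* a :* a :* g02) :* (y :* y)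
             :+ # 512 :* a :* a :* l10 :* U :+ # 512 :* a :* a :* (# 8 :* a :* l01 :- # 2 :* b :* l10) :* y :+ # 4096
               :* a :* a :* a :* m)
             refl c₄₀ c₃₁ c₃₀ c₂₁ c₁₂ c₀₃ c₂₀ c₁₁ c₀₂ c₁₀ c₀₁ c₀₀ x y) ⟩
      N + (_ + _ + _ + _ + _ + _ + _ + _ + _ + _)
        ≡⟨ solve 11 (λ n a b c d e f g h i j → n :+ (a :+ b :+ c :+ d :+ e :+ f :+ g :+ h :+ i :+ j)
          := n :+ a :+ b :+ c :+ d :+ e :+ f :+ g :+ h :+ i :+ j) refl N _ _ _ _ _ _ _ _ _ _ ⟩
      unshifted (U x y) y ∎
      where
      open ≡-Reasoning
      N = (U x y * U x y - d * (y * y)) * (U x y * U x y - d * (y * y))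

    hyperbolic-form : HyperbolicForm
    hyperbolic-form = record
      { d = dn ; a₁ = 32 ℕ.* a ℕ.* dn ; b₂ = 4 ℕ.* dn ; 1≤d = 1≤dn
      ; 1≤a₁ = ℕP.*-mono-≤ (ℕP.*-mono-≤ {1} {32} (s≤s z≤n) 1≤a) 1≤dn ; 1≤b₂ = ℕP.*-mono-≤ {1} {4} (s≤s z≤n) 1≤dn
      ; nonsquare = nonsquare ; v₂ = + 8 * b * d ; v₀ = e₁ ; w₀ = - (+ 8 * (+ 8 * c₄₀ * c₂₁ - + 6 * b * c₃₀))
      ; μ = μ₀ ; ν = ν₀ ; α = α ; β = β ; γ = γ ; ρ = ρ ; σ = σ ; τ = τ }

    module HF = HyperbolicForm hyperbolic-form

    scale : ℕ
    scale = 256 ℕ.* dn ℕ.* dn ℕ.* dn ℕ.* dn ℕ.* (4096 ℕ.* (a ℕ.* a ℕ.* a))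

    1≤scale : 1 ℕ.≤ scale
    1≤scale = ℕP.*-mono-≤ (ℕP.*-mono-≤ (ℕP.*-mono-≤ (ℕP.*-mono-≤ (ℕP.*-mono-≤ {1} {256} (s≤s z≤n) 1≤dn) 1≤dn) 1≤dn)
      1≤dn) (ℕP.*-mono-≤ {1} {4096} (s≤s z≤n) (ℕP.*-mono-≤ (ℕP.*-mono-≤ 1≤a 1≤a) 1≤a))

    scale≡ : + scale ≡ + 256 * d * d * d * d * (+ 4096 * (c₄₀ * c₄₀ * c₄₀))
    scale≡ = trans (pos-* (256 ℕ.* dn ℕ.* dn ℕ.* dn ℕ.* dn) (4096 ℕ.* (a ℕ.* a ℕ.* a))) (cong₂ _*_
      (trans (pos-* (256 ℕ.* dn ℕ.* dn ℕ.* dn) dn) (cong (_* d)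
        (trans (pos-* (256 ℕ.* dn ℕ.* dn) dn) (cong (_* d) (trans (pos-* (256 ℕ.* dn) dn)
        (cong (_* d) (pos-* 256 dn)))))))
      (trans (pos-* 4096 (a ℕ.* a ℕ.* a)) (cong (+ 4096 *_) (trans (pos-* (a ℕ.* a) a)
        (trans (cong (_* + a) (pos-* a a)) (cong (λ z → z * z * z) (sym c₄₀≡a)))))))

    Φ≡value : ∀ x y → HF.Φ (HF.V x y) (HF.W y) ≡ + scale * value x y
    Φ≡value x y = begin
      HF.Φ (HF.V x y) (HF.W y) ≡⟨ cong₂ HF.Φ V≡ W≡ ⟩
      Ψ (+ 4 * d * U x y + e₁) (+ 4 * d * y - + 8 * (+ 8 * c₄₀ * c₂₁ - + 6 * b * c₃₀)) ≡⟨ sym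
        (complete-square (U x y) y) ⟩
      + 256 * d * d * d * d * unshifted (U x y) y ≡⟨ cong (λ z → + 256 * d * d * d * d * z) (sym (scaled-value x y)) ⟩
      + 256 * d * d * d * d * (+ 4096 * (c₄₀ * c₄₀ * c₄₀) * value x y) ≡⟨ solve 3 (λ a b v → a :* (b :* v)
        := a :* b :* v) refl (+ 256 * d * d * d * d) (+ 4096 * (c₄₀ * c₄₀ * c₄₀)) (value x y) ⟩
      + 256 * d * d * d * d * (+ 4096 * (c₄₀ * c₄₀ * c₄₀)) * value x y ≡⟨ cong (_* value x y) (sym scale≡) ⟩
      + scale * value x y ∎
      where
      open ≡-Reasoning
      V≡ : HF.V x y ≡ + 4 * d * U x y + e₁
      V≡ = trans (cong (λ z → z * x + + 8 * b * d * y + e₁) (trans (pos-* (32 ℕ.* a) dn)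
        (cong (_* d) (trans (pos-* 32 a) (cong (+ 32 *_) (sym c₄₀≡a))))))
        (solve 6 (λ a b d x y e → # 32 :* a :* d :* x :+ # 8 :* b :* d :* y :+ e
          := # 4 :* d :* (# 8 :* a :* x :+ # 2 :* b :* y) :+ e) refl c₄₀ b d x y e₁)
      W≡ : HF.W y ≡ + 4 * d * y - + 8 * (+ 8 * c₄₀ * c₂₁ - + 6 * b * c₃₀)
      W≡ = cong (λ z → z * y + - (+ 8 * (+ 8 * c₄₀ * c₂₁ - + 6 * b * c₃₀))) (pos-* 4 dn)

    square-leading-form-impossible : ⊥
    square-leading-form-impossible = hyperbolic-impossible hyperbolic-form
      (λ x y → nn-by (Φ≡value x y) (*-nn (pos-nn scale) (nonneg x y)))
      (scale ℕ.* E) (ℕP.*-mono-≤ 1≤scale 1≤E)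
      (λ n → from n (covers n))
      where
      from : ∀ n → (∃ λ x → ∃ λ y → value x y ≡ + E * + n) → ∃ λ x → ∃ λ y → HF.Φ (HF.V x y) (HF.W y)
        ≡ + (scale ℕ.* E) * + n
      from n (x , y , e) = x , y , trans (Φ≡value x y) (trans (cong (+ scale *_) e)
        (trans (solve 3 (λ a b c → a :* (b :* c) := a :* b :* c) refl (+ scale) (+ E) (+ n))
        (cong (_* + n) (sym (pos-* scale E)))))

  anisotropic-impossible : ∀ a E → 1 ℕ.≤ a → 1 ℕ.≤ E → c₄₀ ≡ + a → (∀ x y → 0ℤ ≤ value x y) → Covers value E
    → (∀ x y → form₄ x y ≡ 0ℤ → y ≡ 0ℤ) → ⊥
  anisotropic-impossible a E 1≤a 1≤E c₄₀≡a nonneg covers no-zero = from (0≤⇒pos (1≤⇒0≤ 1≤-2p))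
    where
    1≤c₄₀ : 1ℤ ≤ c₄₀
    1≤c₄₀ = subst (1ℤ ≤_) (sym c₄₀≡a) (+≤+ 1≤a)
    φ-nonneg : ∀ X y → 0ℤ ≤ φ X y
    φ-nonneg X y = *-cancelˡ-nn c₄₀ 1≤c₄₀ (nn-by (sym (depressed-form₄ Q X y))
      (form₄-nonneg Q nonneg (X - c₃₁ * y) (+ 4 * c₄₀ * y)))
    1≤4c₄₀ : 1ℤ ≤ + 4 * c₄₀
    1≤4c₄₀ = 1≤-* (+≤+ (s≤s z≤n)) 1≤c₄₀
    φ-no-zero : ∀ X y → φ X y ≡ 0ℤ → y ≡ 0ℤ
    φ-no-zero X y e = [ (λ z → ⊥-elim (absurd≤ (subst (1ℤ ≤_) z 1≤4c₄₀))) , id ]′ (*-zero-split (+ 4 * c₄₀) y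
      (no-zero (X - c₃₁ * y) (+ 4 * c₄₀ * y) (trans (depressed-form₄ Q X y)
        (trans (cong (c₄₀ *_) e) (solve 1 (λ a → a :* # 0 := # 0) refl c₄₀)))))
    module T = Depressed (dep-p Q) (dep-q Q) (dep-r Q)
    indefinite : ¬ T.Definite
    indefinite = definite-impossible Q a 1≤a c₄₀≡a E 1≤E covers
    1≤-2p : 1ℤ ≤ - (+ 2 * dep-p Q)
    1≤-2p = subst (1ℤ ≤_) (solve 1 (λ p → # 2 :* (:- p) := :- (# 2 :* p)) refl (dep-p Q))
      (1≤-* {+ 2} (+≤+ (s≤s z≤n)) (T.p<0 φ-nonneg φ-no-zero indefinite))
    from : (∃ λ dn → - (+ 2 * dep-p Q) ≡ + dn) → ⊥
    from (dn , e) = square-leading-form-impossible a dn E 1≤a (+≤⇒ (subst (1ℤ ≤_) e 1≤-2p)) 1≤E c₄₀≡a (sym e)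
      nonsquare square nonneg covers
      where
      square = T.4φ≡square φ-nonneg φ-no-zero indefinite
      -- From `x² = - 2 p y²` the factor `2 X² + p Y²` would vanish at `(x, 2 y)`, and so would `φ`.
      nonsquare : NonSquare (+ dn)
      nonsquare x y h = [ (λ ()) , id ]′ (*-zero-split (+ 2) y
        (φ-no-zero x (+ 2 * y) ([ (λ ()) , id ]′ (*-zero-split (+ 4) (φ x (+ 2 * y))
        (trans (square x (+ 2 * y)) (trans (cong (λ z → z * z) zero-factor) (solve 0 (# 0 :* # 0 := # 0) refl)))))))
        where
        zero-factor : + 2 * (x * x) + dep-p Q * (+ 2 * y * (+ 2 * y)) ≡ 0ℤ
        zero-factor = trans (cong (λ z → + 2 * z + dep-p Q * (+ 2 * y * (+ 2 * y))) h)
          (trans (cong (λ z → + 2 * (z * (y * y)) + dep-p Q * (+ 2 * y * (+ 2 * y))) (sym e))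
          (solve 2 (λ p y → # 2 :* (:- (# 2 :* p) :* (y :* y)) :+ p :* (# 2 :* y :* (# 2 :* y)) := # 0) refl (dep-p Q)
            y))

⁴-root : ∀ K M u → 1 ℕ.≤ K → u ℕ.^ 4 ℕ.≤ K ℕ.* M ℕ.^ 4 → u ℕ.≤ K ℕ.* M
⁴-root K M u 1≤K h = from (u ℕ.≤? K ℕ.* M)
  where
  from : Dec (u ℕ.≤ K ℕ.* M) → u ℕ.≤ K ℕ.* M
  from (yes ok) = ok
  from (no far) = ⊥-elim (ℕP.<-irrefl refl (ℕP.≤-trans (ℕP.^-monoˡ-< 4 (ℕP.≰⇒> far))
    (ℕP.≤-trans h (ℕP.≤-trans (≤-* {K ℕ.* M ℕ.^ 4} (K ℕ.^ 3) (1≤-^ 3 1≤K))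
     (ℕP.≤-reflexive (+-*-Solver.solve 2 (λ K M → K *ₛ M ^ₛ 4 *ₛ K ^ₛ 3 =ₛ (K *ₛ M) ^ₛ 4) refl K M))))))
    where open +-*-Solver using () renaming (_:*_ to _*ₛ_; _:=_ to _=ₛ_; _:^_ to _^ₛ_)

-- Leading forms with a rational zero

module Lines (A B C : ℤ → ℤ) (E : ℕ) (1≤E : 1 ℕ.≤ E)
  (nonneg : ∀ x y → 0ℤ ≤ quadratic (A x) (B x) (C x) y) where

  G : ℤ → ℤ → ℤ
  G x y = quadratic (A x) (B x) (C x) y

  line-height : ℕ → ℕ
  line-height M = E ℕ.* (M ℕ.* M)

  line-height² : ∀ M → E ℕ.* M ℕ.^ 4 ℕ.≤ line-height M ℕ.* line-height M
  line-height² M = ℕP.≤-trans (ℕP.≤-reflexive (cong (E ℕ.*_) (^4≡ M)))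
    (ℕP.≤-trans (≤-* E 1≤E) (ℕP.≤-reflexive (+-*-Solver.solve 2 (λ C M
    → C *ₛ ((M *ₛ M) *ₛ (M *ₛ M)) *ₛ C =ₛ (C *ₛ (M *ₛ M)) *ₛ (C *ₛ (M *ₛ M))) refl E M)))
    where open +-*-Solver using () renaming (_:*_ to _*ₛ_; _:=_ to _=ₛ_)

  line : ℕ → ℤ → List ℤ
  line M x = proj₁ (quadratic-values (A x) (B x) (C x) 1ℤ (E ℕ.* M ℕ.^ 4) (line-height M) ℤP.≤-refl (line-height² M))

  length-line : ∀ M x → 1 ℕ.≤ M → length (line M x) ℕ.≤ 4 ℕ.* line-height M
  length-line M x 1≤M = ℕP.≤-trans (proj₁ (proj₂ (quadratic-values (A x) (B x) (C x) 1ℤ (E ℕ.* M ℕ.^ 4)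
    (line-height M) ℤP.≤-refl (line-height² M)))) (suc+suc≤4* (ℕP.*-mono-≤ 1≤E (ℕP.*-mono-≤ 1≤M 1≤M)))

  E*n≤ : ∀ {M n} → n ℕ.≤ M ℕ.^ 4 → + E * + n ≤ + (E ℕ.* M ℕ.^ 4)
  E*n≤ {M} {n} n≤ = subst (_≤ + (E ℕ.* M ℕ.^ 4)) (pos-* E n) (+≤+ (ℕP.*-monoʳ-≤ E n≤))

  ∈-line : ∀ M n x y → n ℕ.≤ M ℕ.^ 4 → G x y ≡ + E * + n → + E * + n ∈ line M x
  ∈-line M n x y n≤ e = subst (_∈ line M x) e (proj₂ (proj₂ (quadratic-values (A x) (B x) (C x) 1ℤ (E ℕ.* M ℕ.^ 4)
    (line-height M) ℤP.≤-refl (line-height² M))) y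
    (subst (_≤ + (E ℕ.* M ℕ.^ 4)) (sym e) (E*n≤ {M} n≤)) (λ T → nonneg x (y + 1ℤ * T)))

  lines : ℕ → ℕ → List ℤ
  lines M N = concatMap (line M) (symmetric-range N)

  length-lines : ∀ M L → 1 ℕ.≤ M → 1 ℕ.≤ L → length (lines M (L ℕ.* M)) ℕ.≤ 12 ℕ.* L ℕ.* E ℕ.* M ℕ.^ 3
  length-lines M L 1≤M 1≤L = ℕP.≤-trans (length-concatMap (line M) (4 ℕ.* line-height M) (symmetric-range (L ℕ.* M))
    (λ x → length-line M x 1≤M))
    (ℕP.≤-trans (ℕP.*-monoˡ-≤ (4 ℕ.* line-height M) (length-symmetric-range (ℕP.*-mono-≤ 1≤L 1≤M)))
      (ℕP.≤-reflexive (+-*-Solver.solve 3 (λ L E M → (con₂ 3 *ₛ (L *ₛ M)) *ₛ (con₂ 4 *ₛ (E *ₛ (M *ₛ M))) =ₛ con₂ 12 *ₛ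
        L *ₛ E *ₛ M ^ₛ 3) refl L E M)))
    where open +-*-Solver using () renaming (_:*_ to _*ₛ_; _:=_ to _=ₛ_; _:^_ to _^ₛ_; con to con₂)

  ∈-lines : ∀ M N n x y → n ℕ.≤ M ℕ.^ 4 → G x y ≡ + E * + n → ∣ x ∣ ℕ.≤ N → + E * + n ∈ lines M N
  ∈-lines M N n x y n≤ e x≤ = ∈-concatMap (line M) (∈-symmetric-range x≤) (∈-line M n x y n≤ e)

  growth-impossible : Covers G E → ∀ R F → 1 ℕ.≤ R → (∀ x y → R ℕ.≤ ∣ x ∣ → x * x * (x * x) ≤ + F * G x y) → ⊥
  growth-impossible covers R F 1≤R growth = ¬SparseValues (12 ℕ.* L ℕ.* E) (+ E) (+≤+ 1≤E) (λ M 1≤M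
    → lines M (L ℕ.* M) , length-lines M L 1≤M 1≤L , λ n n≤ → from M n 1≤M n≤ (covers n))
    where
    K = F ℕ.* E ℕ.+ 1
    L = R ℕ.+ K
    1≤L : 1 ℕ.≤ L
    1≤L = ℕP.≤-trans 1≤R (ℕP.m≤m+n R K)
    x-bound : ∀ M n x y → 1 ℕ.≤ M → n ℕ.≤ M ℕ.^ 4 → G x y ≡ + E * + n → Dec (R ℕ.≤ ∣ x ∣) → ∣ x ∣ ℕ.≤ L ℕ.* M
    x-bound M n x y 1≤M n≤ e (no near) = ℕP.≤-trans (ℕP.<⇒≤ (ℕP.≰⇒> near)) (ℕP.≤-trans (ℕP.m≤m+n R K) (≤-* M 1≤M))
    x-bound M n x y 1≤M n≤ e (yes far) = ℕP.≤-trans (⁴-root K M ∣ x ∣ (ℕP.m≤n+m 1 (F ℕ.* E))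
      (+≤⇒ (≤-by {z = (+ F * G x y - x * x * (x * x)) + + F * (+ (E ℕ.* M ℕ.^ 4) - G x y) + + (M ℕ.^ 4)}
        (trans (cong₂ _-_ (trans (pos-* K (M ℕ.^ 4)) (cong (_* + (M ℕ.^ 4))
          (trans (pos-+ (F ℕ.* E) 1) (cong (_+ 1ℤ) (pos-* F E)))))
          (trans (cong +_ (^4≡ ∣ x ∣)) (trans (pos-* (∣ x ∣ ℕ.* ∣ x ∣) (∣ x ∣ ℕ.* ∣ x ∣))
          (cong (λ z → z * z) (trans (pos-* ∣ x ∣ ∣ x ∣) (∣sq∣ x))))))
          (trans (solve 5 (λ F E M g x → (F :* E :+ # 1) :* M :- x := (F :* g :- x) :+ F :* (E :* M :- g) :+ M) refl
            (+ F) (+ E) (+ (M ℕ.^ 4)) (G x y) (x * x * (x * x)))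
            (cong (λ w → (+ F * G x y - x * x * (x * x)) + + F * (w - G x y) + + (M ℕ.^ 4))
              (sym (pos-* E (M ℕ.^ 4))))))
        (+-nn (+-nn (≤⇒0≤ (growth x y far)) (*-nn (pos-nn F)
          (≤⇒0≤ (subst (_≤ + (E ℕ.* M ℕ.^ 4)) (sym e) (E*n≤ {M} n≤))))) (pos-nn (M ℕ.^ 4))))))
          (ℕP.*-monoˡ-≤ M (ℕP.m≤n+m K R))
    from : ∀ M n → 1 ℕ.≤ M → n ℕ.≤ M ℕ.^ 4 → (∃ λ x → ∃ λ y → G x y ≡ + E * + n) → + E * + n ∈ lines M (L ℕ.* M)
    from M n 1≤M n≤ (x , y , e) = ∈-lines M (L ℕ.* M) n x y n≤ e (x-bound M n x y 1≤M n≤ e (R ℕ.≤? ∣ x ∣))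

two-sided-positive : ∀ p → 1ℤ ≤ lc p → 1ℤ ≤ lc (reflectₗ p) → ∃ λ R → 1 ℕ.≤ R × (∀ x → R ℕ.≤ ∣ x ∣ → 1ℤ ≤ ev p x)
two-sided-positive p h h′ = from (eventually-positive p h) (eventually-positive (reflectₗ p) h′)
  where
  from : (∃ λ t₀ → ∀ t → t₀ ℕ.≤ t → 1ℤ ≤ ev p (+ t)) → (∃ λ t₀ → ∀ t → t₀ ℕ.≤ t → 1ℤ ≤ ev (reflectₗ p) (+ t)) → ∃ λ R
    → 1 ℕ.≤ R × (∀ x → R ℕ.≤ ∣ x ∣ → 1ℤ ≤ ev p x)
  from (r , f) (s , g) = suc (r ℕ.+ s) , s≤s z≤n , bound
    where
    bound : ∀ x → suc (r ℕ.+ s) ℕ.≤ ∣ x ∣ → 1ℤ ≤ ev p x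
    bound (+ t) le = f t (ℕP.≤-trans (ℕP.m≤m+n r s) (ℕP.≤-trans (ℕP.n≤1+n _) le))
    bound -[1+ t ] le = subst (1ℤ ≤_) (trans (ev-reflect p (+ suc t)) (cong (ev p) (neg-≡ (+ suc t))))
      (g (suc t) (ℕP.≤-trans (ℕP.m≤n+m s r) (ℕP.≤-trans (ℕP.n≤1+n _) le)))

x⁴ : List ℤ
x⁴ = 0ℤ ∷ 0ℤ ∷ 0ℤ ∷ 0ℤ ∷ 1ℤ ∷ []

ev-x⁴ : ∀ x → ev x⁴ x ≡ x * x * (x * x)
ev-x⁴ x = solve 1 (λ x → # 0 :+ x :* (# 0 :+ x :* (# 0 :+ x :* (# 0 :+ x :* (# 1 :+ x :* # 0))))
  := x :* x :* (x :* x)) refl x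

-- 4 A G = (2 A y + B)² + Δ, so G is at least of order x⁴ as soon as F Δ exceeds 4 A x⁴.
module _ (Aₗ Bₗ Cₗ : List ℤ) where

  -- The usual discriminant with the opposite sign.
  discriminant : List ℤ
  discriminant = (+ 4 ·ₗ (Aₗ *ₗ Cₗ)) +ₗ ((- 1ℤ) ·ₗ (Bₗ *ₗ Bₗ))

  excess : ℤ → List ℤ
  excess F = (F ·ₗ discriminant) +ₗ ((- + 4) ·ₗ (Aₗ *ₗ x⁴))

  ev-excess : ∀ F x → ev (excess F) x ≡ F * (+ 4 * (ev Aₗ x * ev Cₗ x) - ev Bₗ x * ev Bₗ x) - + 4 * ev Aₗ x
    * (x * x * (x * x))
  ev-excess F x = begin
    ev (excess F) x ≡⟨ ev-+ (F ·ₗ discriminant) ((- + 4) ·ₗ (Aₗ *ₗ x⁴)) x ⟩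
    ev (F ·ₗ discriminant) x + ev ((- + 4) ·ₗ (Aₗ *ₗ x⁴)) x ≡⟨ cong₂ _+_
      (trans (ev-· F discriminant x) (cong (F *_) (trans (ev-+ (+ 4 ·ₗ (Aₗ *ₗ Cₗ)) ((- 1ℤ) ·ₗ (Bₗ *ₗ Bₗ)) x)
        (cong₂ _+_ (trans (ev-· (+ 4) (Aₗ *ₗ Cₗ) x) (cong (+ 4 *_) (ev-* Aₗ Cₗ x)))
          (trans (ev-· (- 1ℤ) (Bₗ *ₗ Bₗ) x) (cong ((- 1ℤ) *_) (ev-* Bₗ Bₗ x)))))))
        (trans (ev-· (- + 4) (Aₗ *ₗ x⁴) x) (cong ((- + 4) *_) (trans (ev-* Aₗ x⁴ x) (cong (ev Aₗ x *_) (ev-x⁴ x))))) ⟩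
    F * (+ 4 * (ev Aₗ x * ev Cₗ x) + (- 1ℤ) * (ev Bₗ x * ev Bₗ x)) + (- + 4) * (ev Aₗ x * (x * x * (x * x)))
      ≡⟨ solve 5 (λ F a b c x → F :* (# 4 :* (a :* c) :+ (:- # 1) :* (b :* b)) :+ (:- # 4) :* (a :* x)
        := F :* (# 4 :* (a :* c) :- b :* b) :- # 4 :* a :* x) refl F (ev Aₗ x) (ev Bₗ x) (ev Cₗ x) (x * x * (x * x)) ⟩
    F * (+ 4 * (ev Aₗ x * ev Cₗ x) - ev Bₗ x * ev Bₗ x) - + 4 * ev Aₗ x * (x * x * (x * x)) ∎
    where open ≡-Reasoning

  quartic-growth-of-values : ∀ F → 1ℤ ≤ lc Aₗ → 1ℤ ≤ lc (reflectₗ Aₗ) → 1ℤ ≤ lc (excess (+ F))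
    → 1ℤ ≤ lc (reflectₗ (excess (+ F))) →
    ∃ λ R → 1 ℕ.≤ R × (∀ x y → R ℕ.≤ ∣ x ∣ → x * x * (x * x) ≤ + F * quadratic (ev Aₗ x) (ev Bₗ x) (ev Cₗ x) y)
  quartic-growth-of-values F h₁ h₂ h₃ h₄ = from (two-sided-positive Aₗ h₁ h₂)
    (two-sided-positive (excess (+ F)) h₃ h₄)
    where
    from : (∃ λ R → 1 ℕ.≤ R × (∀ x → R ℕ.≤ ∣ x ∣ → 1ℤ ≤ ev Aₗ x))
      → (∃ λ R → 1 ℕ.≤ R × (∀ x → R ℕ.≤ ∣ x ∣ → 1ℤ ≤ ev (excess (+ F)) x)) → _
    from (R , 1≤R , A≥1) (S , _ , P≥1) = R ℕ.+ S , ℕP.≤-trans 1≤R (ℕP.m≤m+n R S) , bound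
      where
      bound : ∀ x y → R ℕ.+ S ℕ.≤ ∣ x ∣ → x * x * (x * x) ≤ + F * quadratic (ev Aₗ x) (ev Bₗ x) (ev Cₗ x) y
      bound x y far = 0≤⇒≤ (*-cancelˡ-nn (+ 4 * a) (1≤-* (+≤+ (s≤s z≤n)) (A≥1 x (ℕP.≤-trans (ℕP.m≤m+n R S) far)))
         (nn-by (solve 6 (λ F a b c y x → # 4 :* a :* (F :* (a :* (y :* y) :+ b :* y :+ c) :- x)
           := F :* ((# 2 :* a :* y :+ b) :* (# 2 :* a :* y :+ b))
           :+ (F :* (# 4 :* (a :* c) :- b :* b) :- # 4 :* a :* x)) refl (+ F) a b c y (x * x * (x * x)))
           (+-nn (*-nn (pos-nn F) (sq-nn (+ 2 * a * y + b)))
             (nn-by (sym (ev-excess (+ F) x)) (1≤⇒0≤ (P≥1 x (ℕP.≤-trans (ℕP.m≤n+m S R) far)))))))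
        where
        a = ev Aₗ x
        b = ev Bₗ x
        c = ev Cₗ x

-- Constant coefficient of y²: completing the square

module ShearForm (k : ℕ) (1≤k : 1 ℕ.≤ k) (b₀ b₁ b₂ c₀ c₁ c₂ c₃ c₄ : ℤ) (E : ℕ) (1≤E : 1 ℕ.≤ E) where

  κ : ℤ
  κ = + k

  Aₗ Bₗ Cₗ : List ℤ
  Aₗ = κ ∷ []
  Bₗ = b₀ ∷ b₁ ∷ b₂ ∷ []
  Cₗ = c₀ ∷ c₁ ∷ c₂ ∷ c₃ ∷ c₄ ∷ []

  G : ℤ → ℤ → ℤ
  G x y = quadratic (ev Aₗ x) (ev Bₗ x) (ev Cₗ x) y

  δ₀ δ₁ δ₂ δ₃ δ₄ : ℤ
  δ₀ = + 4 * κ * c₀ - b₀ * b₀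
  δ₁ = + 4 * κ * c₁ - + 2 * b₀ * b₁
  δ₂ = + 4 * κ * c₂ - b₁ * b₁ - + 2 * b₀ * b₂
  δ₃ = + 4 * κ * c₃ - + 2 * b₁ * b₂
  δ₄ = + 4 * κ * c₄ - b₂ * b₂

  z : ℤ → ℤ → ℤ
  z x y = + 2 * κ * y + (b₀ + b₁ * x + b₂ * (x * x))

  Δ : ℤ → ℤ
  Δ x = δ₀ + δ₁ * x + δ₂ * (x * x) + δ₃ * (x * x * x) + δ₄ * (x * x * (x * x))

  4κG≡ : ∀ x y → + 4 * κ * G x y ≡ z x y * z x y + Δ x
  4κG≡ x y = solve 11 (λ k b₀ b₁ b₂ c₀ c₁ c₂ c₃ c₄ x y →
     let o = # 0
         z = # 2 :* k :* y :+ (b₀ :+ b₁ :* x :+ b₂ :* (x :* x)) in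
     # 4 :* k :* ((k :+ x :* o) :* (y :* y) :+ (b₀ :+ x :* (b₁ :+ x :* (b₂ :+ x :* o))) :* y
       :+ (c₀ :+ x :* (c₁ :+ x :* (c₂ :+ x :* (c₃ :+ x :* (c₄ :+ x :* o)))))) :=
     z :* z :+ ((# 4 :* k :* c₀ :- b₀ :* b₀) :+ (# 4 :* k :* c₁ :- # 2 :* b₀ :* b₁) :* x
       :+ (# 4 :* k :* c₂ :- b₁ :* b₁ :- # 2 :* b₀ :* b₂) :* (x :* x)
        :+ (# 4 :* k :* c₃ :- # 2 :* b₁ :* b₂) :* (x :* x :* x) :+ (# 4 :* k :* c₄ :- b₂ :* b₂)
          :* (x :* x :* (x :* x)))) refl κ b₀ b₁ b₂ c₀ c₁ c₂ c₃ c₄ x y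

  1≤κ : 1ℤ ≤ κ
  1≤κ = +≤+ 1≤k

  module _ (nonneg : ∀ x y → 0ℤ ≤ G x y) (covers : Covers G E) where

    open Lines (ev Aₗ) (ev Bₗ) (ev Cₗ) E 1≤E nonneg using (growth-impossible; E*n≤)

    -- For x a multiple of 2 k the square can be made as small as b₀².
    Δ-bounded : ∀ e T → 0ℤ ≤ ev ((b₀ * b₀ + δ₀) ∷ δ₁ * (κ * e) ∷ δ₂ * (κ * e * (κ * e)) ∷ δ₃
      * (κ * e * (κ * e) * (κ * e)) ∷ δ₄ * (κ * e * (κ * e) * (κ * e * (κ * e))) ∷ []) (+ 2 * T)
    Δ-bounded e T = nn-by (sym (trans (4κG≡ x y) (trans (cong (λ w → w * w + Δ x) (solve 6 (λ k e T b₀ b₁ b₂ →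
           let x = # 2 :* k :* e :* T in
           # 2 :* k :* (:- (# 2 :* k :* b₂ :* (e :* T) :* (e :* T) :+ b₁ :* (e :* T)))
             :+ (b₀ :+ b₁ :* x :+ b₂ :* (x :* x)) := b₀) refl κ e T b₀ b₁ b₂))
        (solve 9 (λ k e T b₀ d₀ d₁ d₂ d₃ d₄ →
           let x = # 2 :* k :* e :* T
               t = # 2 :* T in
           b₀ :* b₀ :+ (d₀ :+ d₁ :* x :+ d₂ :* (x :* x) :+ d₃ :* (x :* x :* x) :+ d₄ :* (x :* x :* (x :* x))) :=
           (b₀ :* b₀ :+ d₀) :+ t :* (d₁ :* (k :* e) :+ t :* (d₂ :* (k :* e :* (k :* e)) :+ t
             :* (d₃ :* (k :* e :* (k :* e) :* (k :* e)) :+ t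
             :* (d₄ :* (k :* e :* (k :* e) :* (k :* e :* (k :* e))) :+ t :* # 0))))) refl κ e T b₀ δ₀ δ₁ δ₂ δ₃ δ₄))))
      (*-nn (*-nn (pos-nn 4) (pos-nn k)) (nonneg x y))
      where
      x = + 2 * κ * e * T
      y = - (+ 2 * κ * b₂ * (e * T) * (e * T) + b₁ * (e * T))

    0≤δ₄ : 0ℤ ≤ δ₄
    0≤δ₄ = *-cancelˡ-nn (+ 16 * (κ * κ * (κ * κ))) (1≤-* (+≤+ (s≤s z≤n)) (1≤-* (1≤-* 1≤κ 1≤κ) (1≤-* 1≤κ 1≤κ)))
      (leading-nonneg
      ((b₀ * b₀ + δ₀) ∷ + 2 * (δ₁ * κ) ∷ + 4 * (δ₂ * (κ * κ)) ∷ + 8 * (δ₃ * (κ * κ * κ)) ∷ + 16 * (κ * κ * (κ * κ))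
        * δ₄ ∷ []) 0
      (λ T _ → subst (0ℤ ≤_) (solve 8 (λ k n d₁ d₂ d₃ d₄ T o →
           let t = # 2 :* T
               p = k :* # 1 in
           n :+ t :* (d₁ :* p :+ t :* (d₂ :* (p :* p) :+ t :* (d₃ :* (p :* p :* p) :+ t
             :* (d₄ :* (p :* p :* (p :* p)) :+ t :* # 0)))) :=
           n :+ T :* (# 2 :* (d₁ :* k) :+ T :* (# 4 :* (d₂ :* (k :* k)) :+ T
             :* (# 8 :* (d₃ :* (k :* k :* k)) :+ T :* (# 16 :* (k :* k :* (k :* k)) :* d₄ :+ T :* # 0))))) refl κ
             (b₀ * b₀ + δ₀) δ₁ δ₂ δ₃ δ₄ (+ T) 0ℤ) (Δ-bounded 1ℤ (+ T))))

    δ₄≱1 : ¬ 1ℤ ≤ δ₄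
    δ₄≱1 1≤δ₄ = from (quartic-growth-of-values Aₗ Bₗ Cₗ F (≤-1 (solve 1 (λ k → k := k) refl κ) 1≤κ)
      (≤-1 (solve 1 (λ k → k := k) refl κ) 1≤κ) 1≤excess (≤-1
      (solve 1 (λ x → (:- # 1) :* ((:- # 1) :* ((:- # 1) :* ((:- # 1) :* x))) := x) refl _) 1≤excess))
      where
      -- The top coefficient of the excess is `F δ₄ - 4 k`, which is positive for this `F` as soon
      -- as `δ₄` is.
      F = 4 ℕ.* k ℕ.+ 1
      F≡ : + F ≡ + 4 * κ + 1ℤ
      F≡ = trans (pos-+ (4 ℕ.* k) 1) (cong (_+ 1ℤ) (pos-* 4 k))
      ≤-1 : ∀ {x y} → x ≡ y → 1ℤ ≤ y → 1ℤ ≤ x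
      ≤-1 e p = subst (1ℤ ≤_) (sym e) p
      1≤excess : 1ℤ ≤ lc (excess Aₗ Bₗ Cₗ (+ F))
      1≤excess = ≤-by (trans (cong (λ f → f * (+ 4 * (κ * c₄) + (- 1ℤ) * (b₂ * b₂)) + (- + 4) * (κ * 1ℤ) - 1ℤ) F≡)
         (solve 3 (λ k b c → (# 4 :* k :+ # 1) :* (# 4 :* (k :* c) :+ (:- # 1) :* (b :* b)) :+ (:- # 4) :* (k :* # 1)
           :- # 1 := (# 4 :* k :+ # 1) :* (# 4 :* k :* c :- b :* b :- # 1)) refl κ b₂ c₄))
         (*-nn (+-nn (*-nn (pos-nn 4) (pos-nn k)) (pos-nn 1)) (≤⇒0≤ 1≤δ₄))
      from : (∃ λ R → 1 ℕ.≤ R × (∀ x y → R ℕ.≤ ∣ x ∣ → x * x * (x * x) ≤ + F * G x y)) → ⊥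
      from (R , 1≤R , growth) = growth-impossible covers R F 1≤R growth

    δ₄≡0 : δ₄ ≡ 0ℤ
    δ₄≡0 = ≤0∧0≤⇒≡0 ([ (λ p → ⊥-elim (δ₄≱1 p)) , id ]′ (1≤-split δ₄)) 0≤δ₄

    δ₃-sided : ∀ e → 0ℤ ≤ + 8 * (κ * κ * κ) * (δ₃ * (e * e * e))
    δ₃-sided e = leading-nonneg ((b₀ * b₀ + δ₀) ∷ + 2 * (δ₁ * (κ * e)) ∷ + 4 * (δ₂ * (κ * e * (κ * e))) ∷ + 8
      * (κ * κ * κ) * (δ₃ * (e * e * e)) ∷ []) 0
      (λ T _ → subst (0ℤ ≤_) (trans (cong (λ d₄ → ev ((b₀ * b₀ + δ₀) ∷ δ₁ * (κ * e) ∷ δ₂ * (κ * e * (κ * e)) ∷ δ₃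
        * (κ * e * (κ * e) * (κ * e)) ∷ d₄ * (κ * e * (κ * e) * (κ * e * (κ * e))) ∷ []) (+ 2 * + T)) δ₄≡0)
        (solve 7 (λ k e n d₁ d₂ d₃ T →
           let t = # 2 :* T
               p = k :* e in
           n :+ t :* (d₁ :* p :+ t :* (d₂ :* (p :* p) :+ t :* (d₃ :* (p :* p :* p) :+ t
             :* (# 0 :* (p :* p :* (p :* p)) :+ t :* # 0)))) :=
           n :+ T :* (# 2 :* (d₁ :* p) :+ T :* (# 4 :* (d₂ :* (p :* p)) :+ T
             :* (# 8 :* (k :* k :* k) :* (d₃ :* (e :* e :* e)) :+ T :* # 0)))) refl κ e (b₀ * b₀ + δ₀) δ₁ δ₂ δ₃
             (+ T))) (Δ-bounded e (+ T)))

    1≤8κ³ : 1ℤ ≤ + 8 * (κ * κ * κ)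
    1≤8κ³ = 1≤-* (+≤+ (s≤s z≤n)) (1≤-* (1≤-* 1≤κ 1≤κ) 1≤κ)

    δ₃≡0 : δ₃ ≡ 0ℤ
    δ₃≡0 = both-nn⇒≡0
      (nn-by (solve 1 (λ d → d := d :* (# 1 :* # 1 :* # 1)) refl δ₃) (*-cancelˡ-nn _ 1≤8κ³ (δ₃-sided 1ℤ)))
      (nn-by (solve 1 (λ d → :- d := d :* ((:- # 1) :* (:- # 1) :* (:- # 1))) refl δ₃)
        (*-cancelˡ-nn _ 1≤8κ³ (δ₃-sided (- 1ℤ))))

    Δ-quadratic : ∀ e T → 0ℤ ≤ ev ((b₀ * b₀ + δ₀) ∷ + 2 * κ * (δ₁ * e) ∷ + 4 * (κ * κ) * (δ₂ * (e * e)) ∷ []) T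
    Δ-quadratic e T = subst (0ℤ ≤_) (trans (cong₂ (λ d₃ d₄ → ev
      ((b₀ * b₀ + δ₀) ∷ δ₁ * (κ * e) ∷ δ₂ * (κ * e * (κ * e)) ∷ d₃ * (κ * e * (κ * e) * (κ * e)) ∷ d₄
      * (κ * e * (κ * e) * (κ * e * (κ * e))) ∷ []) (+ 2 * T)) δ₃≡0 δ₄≡0)
        (solve 6 (λ k e n d₁ d₂ T →
           let t = # 2 :* T
               p = k :* e in
           n :+ t :* (d₁ :* p :+ t :* (d₂ :* (p :* p) :+ t :* (# 0 :* (p :* p :* p) :+ t
             :* (# 0 :* (p :* p :* (p :* p)) :+ t :* # 0)))) :=
           n :+ T :* (# 2 :* k :* (d₁ :* e) :+ T :* (# 4 :* (k :* k) :* (d₂ :* (e :* e)) :+ T :* # 0))) refl κ e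
             (b₀ * b₀ + δ₀) δ₁ δ₂ T)) (Δ-bounded e T)

    0≤δ₂ : 0ℤ ≤ δ₂
    0≤δ₂ = *-cancelˡ-nn (+ 4 * (κ * κ)) (1≤-* (+≤+ (s≤s z≤n)) (1≤-* 1≤κ 1≤κ))
      (nn-by (solve 2 (λ k d → k :* d := k :* (d :* (# 1 :* # 1))) refl (+ 4 * (κ * κ)) δ₂)
       (leading-nonneg ((b₀ * b₀ + δ₀) ∷ + 2 * κ * (δ₁ * 1ℤ) ∷ + 4 * (κ * κ) * (δ₂ * (1ℤ * 1ℤ)) ∷ []) 0 (λ T _
         → Δ-quadratic 1ℤ (+ T))))

    4κG≡₂ : ∀ x y → + 4 * κ * G x y ≡ z x y * z x y + (δ₀ + δ₁ * x + δ₂ * (x * x))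
    4κG≡₂ x y = trans (4κG≡ x y) (trans (cong₂ (λ d₃ d₄ → z x y * z x y
      + (δ₀ + δ₁ * x + δ₂ * (x * x) + d₃ * (x * x * x) + d₄ * (x * x * (x * x)))) δ₃≡0 δ₄≡0)
      (solve 5 (λ z d₀ d₁ d₂ x → z :* z :+ (d₀ :+ d₁ :* x :+ d₂ :* (x :* x) :+ # 0 :* (x :* x :* x) :+ # 0
        :* (x :* x :* (x :* x))) := z :* z :+ (d₀ :+ d₁ :* x :+ d₂ :* (x :* x))) refl (z x y) δ₀ δ₁ δ₂ x))

    -- Completing the square in `x` too gives `16 k δ₂ G + δ₁² - 4 δ₂ δ₀ = (2 δ₂ x + δ₁)² + 4 δ₂
    -- z²`. Since `G` covers the multiples of `E`, this form would represent a whole arithmetic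
    -- progression.
    δ₂≢positive : ∀ m → δ₂ ≡ + m → 1 ℕ.≤ m → ⊥
    δ₂≢positive m δ₂≡ 1≤m = ¬quadratic-form-covers-progression (4 ℕ.* m) (16 ℕ.* k ℕ.* m ℕ.* E)
      (δ₁ * δ₁ - + 4 * δ₂ * δ₀)
        (ℕP.*-mono-≤ {1} {4} (s≤s z≤n) 1≤m) (ℕP.*-mono-≤ (ℕP.*-mono-≤ (ℕP.*-mono-≤ {1} {16} (s≤s z≤n) 1≤k) 1≤m) 1≤E)
          (λ n → from n (covers n))
      where
      from : ∀ n → (∃ λ x → ∃ λ y → G x y ≡ + E * + n) → ∃ λ X → ∃ λ Z → X * X + + (4 ℕ.* m) * (Z * Z)
        ≡ + (16 ℕ.* k ℕ.* m ℕ.* E) * + n + (δ₁ * δ₁ - + 4 * δ₂ * δ₀)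
      from n (x , y , e) = + 2 * δ₂ * x + δ₁ , z x y , (begin
        (+ 2 * δ₂ * x + δ₁) * (+ 2 * δ₂ * x + δ₁) + + (4 ℕ.* m) * (z x y * z x y)
          ≡⟨ cong (λ w → (+ 2 * δ₂ * x + δ₁) * (+ 2 * δ₂ * x + δ₁) + w * (z x y * z x y))
            (trans (pos-* 4 m) (cong (+ 4 *_) (sym δ₂≡))) ⟩
        (+ 2 * δ₂ * x + δ₁) * (+ 2 * δ₂ * x + δ₁) + + 4 * δ₂ * (z x y * z x y)
          ≡⟨ solve 5 (λ d₀ d₁ d₂ x z → (# 2 :* d₂ :* x :+ d₁) :* (# 2 :* d₂ :* x :+ d₁) :+ # 4 :* d₂ :* (z :* z)
            := # 4 :* d₂ :* (z :* z :+ (d₀ :+ d₁ :* x :+ d₂ :* (x :* x))) :+ (d₁ :* d₁ :- # 4 :* d₂ :* d₀)) refl δ₀ δ₁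
            δ₂ x (z x y) ⟩
        + 4 * δ₂ * (z x y * z x y + (δ₀ + δ₁ * x + δ₂ * (x * x))) + (δ₁ * δ₁ - + 4 * δ₂ * δ₀)
          ≡⟨ cong (λ w → + 4 * δ₂ * w + (δ₁ * δ₁ - + 4 * δ₂ * δ₀)) (trans (sym (4κG≡₂ x y)) (cong (+ 4 * κ *_) e)) ⟩
        + 4 * δ₂ * (+ 4 * κ * (+ E * + n)) + (δ₁ * δ₁ - + 4 * δ₂ * δ₀)
          ≡⟨ cong (_+ (δ₁ * δ₁ - + 4 * δ₂ * δ₀)) (trans (solve 4 (λ d k E n → # 4 :* d :* (# 4 :* k :* (E :* n))
            := # 16 :* k :* d :* E :* n) refl δ₂ κ (+ E) (+ n))
               (cong (_* + n) (trans (cong (λ d → + 16 * κ * d * + E) δ₂≡)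
                 (sym (trans (pos-* (16 ℕ.* k ℕ.* m) E) (cong (_* + E)
                 (trans (pos-* (16 ℕ.* k) m) (cong (_* + m) (pos-* 16 k))))))))) ⟩
        + (16 ℕ.* k ℕ.* m ℕ.* E) * + n + (δ₁ * δ₁ - + 4 * δ₂ * δ₀) ∎)
        where open ≡-Reasoning

    δ₂≢0 : δ₂ ≢ 0ℤ
    δ₂≢0 δ₂≡0 = ¬SparseValues (3 ℕ.* C) (+ (4 ℕ.* k ℕ.* E)) (+≤+
      (ℕP.*-mono-≤ (ℕP.*-mono-≤ {1} {4} (s≤s z≤n) 1≤k) 1≤E)) sparse
      where
      δ₁-sided : ∀ e → 0ℤ ≤ + 2 * κ * (δ₁ * e)
      δ₁-sided e = leading-nonneg ((b₀ * b₀ + δ₀) ∷ + 2 * κ * (δ₁ * e) ∷ []) 0 (λ T _ → subst (0ℤ ≤_)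
         (trans (cong (λ d₂ → ev ((b₀ * b₀ + δ₀) ∷ + 2 * κ * (δ₁ * e) ∷ + 4 * (κ * κ) * (d₂ * (e * e)) ∷ []) (+ T))
           δ₂≡0)
           (solve 5 (λ n l k e T → n :+ T :* (l :+ T :* (# 4 :* (k :* k) :* (# 0 :* (e :* e)) :+ T :* # 0))
             := n :+ T :* (l :+ T :* # 0)) refl (b₀ * b₀ + δ₀) (+ 2 * κ * (δ₁ * e)) κ e (+ T)))
         (Δ-quadratic e (+ T)))
      1≤2κ : 1ℤ ≤ + 2 * κ
      1≤2κ = 1≤-* (+≤+ (s≤s z≤n)) 1≤κ
      δ₁≡0 : δ₁ ≡ 0ℤ
      δ₁≡0 = both-nn⇒≡0
        (nn-by (solve 1 (λ d → d := d :* # 1) refl δ₁) (*-cancelˡ-nn _ 1≤2κ (δ₁-sided 1ℤ)))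
        (nn-by (solve 1 (λ d → :- d := d :* (:- # 1)) refl δ₁) (*-cancelˡ-nn _ 1≤2κ (δ₁-sided (- 1ℤ))))
      4κG≡₀ : ∀ x y → + 4 * κ * G x y ≡ z x y * z x y + δ₀
      4κG≡₀ x y = trans (4κG≡₂ x y) (trans (cong₂ (λ d₁ d₂ → z x y * z x y + (δ₀ + d₁ * x + d₂ * (x * x))) δ₁≡0 δ₂≡0)
        (solve 3 (λ z d₀ x → z :+ (d₀ :+ # 0 :* x :+ # 0 :* (x :* x)) := z :+ d₀) refl (z x y * z x y) δ₀ x))
      C = 4 ℕ.* k ℕ.* E ℕ.+ suc ∣ δ₀ ∣
      1≤C : 1 ℕ.≤ C
      1≤C = ℕP.≤-trans (s≤s z≤n) (ℕP.m≤n+m (suc ∣ δ₀ ∣) (4 ℕ.* k ℕ.* E))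
      4kE≡ : + (4 ℕ.* k ℕ.* E) ≡ + 4 * κ * + E
      4kE≡ = trans (pos-* (4 ℕ.* k) E) (cong (_* + E) (pos-* 4 k))
      sparse : SparseValues (3 ℕ.* C) (+ (4 ℕ.* k ℕ.* E))
      sparse M 1≤M = map (λ w → w * w + δ₀) (symmetric-range (C ℕ.* (M ℕ.* M))) , len , λ n n≤ → from n n≤ (covers n)
        where
        len : length (map (λ w → w * w + δ₀) (symmetric-range (C ℕ.* (M ℕ.* M)))) ℕ.≤ 3 ℕ.* C ℕ.* M ℕ.^ 3
        len = ℕP.≤-trans (ℕP.≤-reflexive (LP.length-map _ (symmetric-range (C ℕ.* (M ℕ.* M)))))
          (ℕP.≤-trans (length-symmetric-range (ℕP.*-mono-≤ 1≤C (ℕP.*-mono-≤ 1≤M 1≤M)))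
          (ℕP.≤-trans (≤-* M 1≤M) (ℕP.≤-reflexive (+-*-Solver.solve 2 (λ C M
            → con₂ 3 *ₛ (C *ₛ (M *ₛ M)) *ₛ M =ₛ con₂ 3 *ₛ C *ₛ M ^ₛ 3) refl C M))))
          where open +-*-Solver using () renaming (_:*_ to _*ₛ_; _:=_ to _=ₛ_; _:^_ to _^ₛ_; con to con₂)
        from : ∀ n → n ℕ.≤ M ℕ.^ 4 → (∃ λ x → ∃ λ y → G x y ≡ + E * + n)
          → + (4 ℕ.* k ℕ.* E) * + n ∈ map (λ w → w * w + δ₀) (symmetric-range (C ℕ.* (M ℕ.* M)))
        from n n≤ (x , y , e) = subst (_∈ map (λ w → w * w + δ₀) (symmetric-range (C ℕ.* (M ℕ.* M)))) value
          (MP.∈-map⁺ (λ w → w * w + δ₀) (∈-symmetric-range (∣∣≤-from-sq C M (z x y) 1≤C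
            (≤-by {z = + (4 ℕ.* k ℕ.* E) * (+ (M ℕ.^ 4) - + n) + + (M ℕ.^ 4) + + ∣ δ₀ ∣ * (+ (M ℕ.^ 4) - 1ℤ)
              + (+ ∣ δ₀ ∣ + δ₀)}
              (trans (cong₂ _-_ (trans (pos-* C (M ℕ.^ 4)) (cong (_* + (M ℕ.^ 4))
                (trans (pos-+ (4 ℕ.* k ℕ.* E) (suc ∣ δ₀ ∣)) (cong (_+_ (+ (4 ℕ.* k ℕ.* E))) (pos-+ 1 ∣ δ₀ ∣)))))
                (trans (solve 2 (λ w d → w := (w :+ d) :- d) refl (z x y * z x y) δ₀) (cong (_- δ₀) value)))
                (solve 5 (λ K a M n d → (K :+ (# 1 :+ a)) :* M :- (K :* n :- d)
                  := K :* (M :- n) :+ M :+ a :* (M :- # 1) :+ (a :+ d)) refl (+ (4 ℕ.* k ℕ.* E)) (+ ∣ δ₀ ∣)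
                  (+ (M ℕ.^ 4)) (+ n) δ₀))
              (+-nn (+-nn (+-nn (*-nn (pos-nn _) (≤⇒0≤ (+≤+ n≤))) (pos-nn _))
                (*-nn (pos-nn _) (≤⇒0≤ (+≤+ (1≤-^ 4 1≤M)))))
                 (nn-by (solve 2 (λ a d → a :+ d := a :- (:- d)) refl (+ ∣ δ₀ ∣) δ₀)
                   (≤⇒0≤ (∣x∣≤⇒- {δ₀} ℕP.≤-refl))))))))
          where
          value : z x y * z x y + δ₀ ≡ + (4 ℕ.* k ℕ.* E) * + n
          value = trans (sym (4κG≡₀ x y)) (trans (cong (+ 4 * κ *_) e)
            (trans (solve 3 (λ a b c → a :* (b :* c) := a :* b :* c) refl (+ 4 * κ) (+ E) (+ n))
            (cong (_* + n) (sym 4kE≡))))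

    shear-impossible : ⊥
    shear-impossible = from (0≤⇒pos 0≤δ₂)
      where
      from : (∃ λ m → δ₂ ≡ + m) → ⊥
      from (zero , e) = δ₂≢0 e
      from (suc m , e) = δ₂≢positive (suc m) e (s≤s z≤n)

-- Quadratic coefficient of y²: forms asymptotic to a multiple of x² z²

module CrossForm (k : ℕ) (1≤k : 1 ℕ.≤ k) (a₀ a₁ b₀ b₁ b₂ b c₀ c₁ c₂ c₃ c₄ : ℤ) (E : ℕ) (1≤E : 1 ℕ.≤ E) where

  κ : ℤ
  κ = + k

  Aₗ Bₗ Cₗ : List ℤ
  Aₗ = a₀ ∷ a₁ ∷ κ ∷ []
  Bₗ = b₀ ∷ b₁ ∷ b₂ ∷ b ∷ []
  Cₗ = c₀ ∷ c₁ ∷ c₂ ∷ c₃ ∷ c₄ ∷ []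

  G : ℤ → ℤ → ℤ
  G x y = quadratic (ev Aₗ x) (ev Bₗ x) (ev Cₗ x) y

  -- Coefficients of `4 κ² G` after `y = (z - b x) / (2 κ)`: `κ δ` belongs to `x⁴`, `θ` to `x³`, and
  -- the others to the terms of `rest`.
  δ θ κ₁ κ₂ κ₃ κ₄ κ₅ κ₆ : ℤ
  δ = + 4 * κ * c₄ - b * b
  θ = a₁ * (b * b) - + 2 * κ * b * b₂ + + 4 * (κ * κ) * c₃
  κ₁ = + 2 * κ * b₂ - + 2 * a₁ * b
  κ₂ = + 2 * κ * b₁ - + 2 * a₀ * b
  κ₃ = + 2 * κ * b₀
  κ₄ = a₀ * (b * b) - + 2 * κ * b * b₁ + + 4 * (κ * κ) * c₂
  κ₅ = + 4 * (κ * κ) * c₁ - + 2 * κ * b * b₀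
  κ₆ = + 4 * (κ * κ) * c₀

  z : ℤ → ℤ → ℤ
  z x y = + 2 * κ * y + b * x

  -- 4 k² G in the variables x and z when the coefficients of x⁴ and x³ vanish
  H rest : ℤ → ℤ → ℤ
  rest x w = a₁ * (x * (w * w)) + κ₁ * (x * x * w) + a₀ * (w * w) + κ₂ * (x * w) + κ₄ * (x * x) + κ₃ * w + κ₅ * x + κ₆
  H x w = κ * (x * x * (w * w)) + rest x w

  4κ²G≡ : ∀ x y → + 4 * (κ * κ) * G x y ≡ H x (z x y) + (κ * δ * (x * x * (x * x)) + θ * (x * x * x))
  4κ²G≡ x y = solve 14 (λ k a₀ a₁ b₀ b₁ b₂ b c₀ c₁ c₂ c₃ c₄ x y →
     let o = # 0
         z = # 2 :* k :* y :+ b :* x in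
     # 4 :* (k :* k) :* ((a₀ :+ x :* (a₁ :+ x :* (k :+ x :* o))) :* (y :* y)
       :+ (b₀ :+ x :* (b₁ :+ x :* (b₂ :+ x :* (b :+ x :* o)))) :* y
       :+ (c₀ :+ x :* (c₁ :+ x :* (c₂ :+ x :* (c₃ :+ x :* (c₄ :+ x :* o)))))) :=
     k :* (x :* x :* (z :* z)) :+ (a₁ :* (x :* (z :* z)) :+ (# 2 :* k :* b₂ :- # 2 :* a₁ :* b) :* (x :* x :* z) :+ a₀
       :* (z :* z)
       :+ (# 2 :* k :* b₁ :- # 2 :* a₀ :* b) :* (x :* z) :+ (a₀ :* (b :* b) :- # 2 :* k :* b :* b₁ :+ # 4 :* (k :* k)
         :* c₂) :* (x :* x)
       :+ # 2 :* k :* b₀ :* z :+ (# 4 :* (k :* k) :* c₁ :- # 2 :* k :* b :* b₀) :* x :+ # 4 :* (k :* k) :* c₀)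
     :+ (k :* (# 4 :* k :* c₄ :- b :* b) :* (x :* x :* (x :* x))
       :+ (a₁ :* (b :* b) :- # 2 :* k :* b :* b₂ :+ # 4 :* (k :* k) :* c₃) :* (x :* x :* x)))
     refl κ a₀ a₁ b₀ b₁ b₂ b c₀ c₁ c₂ c₃ c₄ x y

  1≤κ : 1ℤ ≤ κ
  1≤κ = +≤+ 1≤k

  1≤4κ² : 1ℤ ≤ + 4 * (κ * κ)
  1≤4κ² = 1≤-* (+≤+ (s≤s z≤n)) (1≤-* 1≤κ 1≤κ)

  module _ (nonneg : ∀ x y → 0ℤ ≤ G x y) (covers : Covers G E) where

    open Lines (ev Aₗ) (ev Bₗ) (ev Cₗ) E 1≤E nonneg using (growth-impossible; lines; length-lines; ∈-lines)

    -- restriction to the line z = 0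
    on-axis : ∀ e T → 0ℤ ≤ ev (κ₆ ∷ κ₅ * (+ 2 * κ * e) ∷ κ₄ * (+ 2 * κ * e * (+ 2 * κ * e)) ∷ θ
      * (+ 2 * κ * e * (+ 2 * κ * e) * (+ 2 * κ * e)) ∷ κ * δ
      * (+ 2 * κ * e * (+ 2 * κ * e) * (+ 2 * κ * e * (+ 2 * κ * e))) ∷ []) T
    on-axis e T = nn-by (sym (trans (4κ²G≡ x y) (trans (cong (λ w
      → H x w + (κ * δ * (x * x * (x * x)) + θ * (x * x * x)))
      (solve 4 (λ k b e T → # 2 :* k :* (:- (b :* (e :* T))) :+ b :* (# 2 :* k :* e :* T) := # 0) refl κ b e T))
        (solve 12 (λ k T p a₁ a₀ k₁ k₂ k₃ k₄ k₅ k₆ r →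
           let x = p :* T
               o = # 0 in
           k :* (x :* x :* (o :* o)) :+ (a₁ :* (x :* (o :* o)) :+ k₁ :* (x :* x :* o) :+ a₀ :* (o :* o) :+ k₂
             :* (x :* o) :+ k₄ :* (x :* x) :+ k₃ :* o :+ k₅ :* x :+ k₆) :+ r :=
           k₆ :+ k₅ :* x :+ k₄ :* (x :* x) :+ r) refl κ T (+ 2 * κ * e) a₁ a₀ κ₁ κ₂ κ₃ κ₄ κ₅ κ₆
             (κ * δ * (x * x * (x * x)) + θ * (x * x * x)) ⨾
         solve 7 (λ T p k₄ k₅ k₆ t d →
           let x = p :* T in
           k₆ :+ k₅ :* x :+ k₄ :* (x :* x) :+ (d :* (x :* x :* (x :* x)) :+ t :* (x :* x :* x)) :=
           k₆ :+ T :* (k₅ :* p :+ T :* (k₄ :* (p :* p) :+ T :* (t :* (p :* p :* p) :+ T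
             :* (d :* (p :* p :* (p :* p)) :+ T :* # 0))))) refl T (+ 2 * κ * e) κ₄ κ₅ κ₆ θ (κ * δ)))))
      (*-nn (1≤⇒0≤ 1≤4κ²) (nonneg x y))
      where
      infixr 2 _⨾_
      _⨾_ : ∀ {a b c : ℤ} → a ≡ b → b ≡ c → a ≡ c
      _⨾_ = trans
      x = + 2 * κ * e * T
      y = - (b * (e * T))

    1≤2κ : 1ℤ ≤ + 2 * κ * 1ℤ
    1≤2κ = 1≤-* (1≤-* {+ 2} (+≤+ (s≤s z≤n)) 1≤κ) ℤP.≤-refl

    0≤δ : 0ℤ ≤ δ
    0≤δ = *-cancelˡ-nn κ 1≤κ (*-cancelˡ-nn (p * p * (p * p)) (1≤-* (1≤-* 1≤2κ 1≤2κ) (1≤-* 1≤2κ 1≤2κ))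
      (nn-by (solve 2 (λ p d → p :* d := d :* p) refl (p * p * (p * p)) (κ * δ))
      (leading-nonneg (κ₆ ∷ κ₅ * p ∷ κ₄ * (p * p) ∷ θ * (p * p * p) ∷ κ * δ * (p * p * (p * p)) ∷ []) 0 (λ T _
        → on-axis 1ℤ (+ T)))))
      where p = + 2 * κ * 1ℤ

    δ≱1 : ¬ 1ℤ ≤ δ
    δ≱1 1≤δ = from (quartic-growth-of-values Aₗ Bₗ Cₗ F 1≤κ (≤-1
      (solve 1 (λ x → (:- # 1) :* ((:- # 1) :* x) := x) refl κ) 1≤κ) 1≤excess
        (≤-1 (solve 1 (λ x → (:- # 1) :* ((:- # 1) :* ((:- # 1) :* ((:- # 1) :* ((:- # 1) :* ((:- # 1) :* x))))) := x)
          refl _) 1≤excess))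
      where
      F = 4 ℕ.* k ℕ.+ 1
      F≡ : + F ≡ + 4 * κ + 1ℤ
      F≡ = trans (pos-+ (4 ℕ.* k) 1) (cong (_+ 1ℤ) (pos-* 4 k))
      ≤-1 : ∀ {x y} → x ≡ y → 1ℤ ≤ y → 1ℤ ≤ x
      ≤-1 e p = subst (1ℤ ≤_) (sym e) p
      1≤excess : 1ℤ ≤ lc (excess Aₗ Bₗ Cₗ (+ F))
      1≤excess = ≤-by (trans (cong (λ f → f * (+ 4 * (κ * c₄) + (- 1ℤ) * (b * b)) + (- + 4) * (κ * 1ℤ) - 1ℤ) F≡)
         (solve 3 (λ k b c → (# 4 :* k :+ # 1) :* (# 4 :* (k :* c) :+ (:- # 1) :* (b :* b)) :+ (:- # 4) :* (k :* # 1)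
           :- # 1 := (# 4 :* k :+ # 1) :* (# 4 :* k :* c :- b :* b :- # 1)) refl κ b c₄))
         (*-nn (+-nn (*-nn (pos-nn 4) (pos-nn k)) (pos-nn 1)) (≤⇒0≤ 1≤δ))
      from : (∃ λ R → 1 ℕ.≤ R × (∀ x y → R ℕ.≤ ∣ x ∣ → x * x * (x * x) ≤ + F * G x y)) → ⊥
      from (R , 1≤R , growth) = growth-impossible covers R F 1≤R growth

    δ≡0 : δ ≡ 0ℤ
    δ≡0 = ≤0∧0≤⇒≡0 ([ (λ p → ⊥-elim (δ≱1 p)) , id ]′ (1≤-split δ)) 0≤δ

    θ-sided : ∀ e → 0ℤ ≤ θ * (+ 2 * κ * e * (+ 2 * κ * e) * (+ 2 * κ * e))
    θ-sided e = leading-nonneg (κ₆ ∷ κ₅ * p ∷ κ₄ * (p * p) ∷ θ * (p * p * p) ∷ []) 0 (λ T _ → subst (0ℤ ≤_)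
       (trans (cong (λ d → ev (κ₆ ∷ κ₅ * p ∷ κ₄ * (p * p) ∷ θ * (p * p * p) ∷ κ * d * (p * p * (p * p)) ∷ []) (+ T))
         δ≡0)
         (solve 7 (λ k u v w r k₆ T → k₆ :+ T :* (u :+ T :* (v :+ T :* (w :+ T :* (k :* # 0 :* r :+ T :* # 0))))
           := k₆ :+ T :* (u :+ T :* (v :+ T :* (w :+ T :* # 0)))) refl κ (κ₅ * p) (κ₄ * (p * p)) (θ * (p * p * p))
           (p * p * (p * p)) κ₆ (+ T)))
       (on-axis e (+ T)))
      where p = + 2 * κ * e

    θ≡0 : θ ≡ 0ℤ
    θ≡0 = both-nn⇒≡0
      (*-cancelˡ-nn _ 1≤8κ³ (nn-by (solve 2 (λ t k → # 8 :* (k :* k :* k) :* t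
        := t :* (# 2 :* k :* # 1 :* (# 2 :* k :* # 1) :* (# 2 :* k :* # 1))) refl θ κ) (θ-sided 1ℤ)))
      (*-cancelˡ-nn _ 1≤8κ³ (nn-by (solve 2 (λ t k → # 8 :* (k :* k :* k) :* (:- t)
        := t :* (# 2 :* k :* (:- # 1) :* (# 2 :* k :* (:- # 1)) :* (# 2 :* k :* (:- # 1)))) refl θ κ)
        (θ-sided (- 1ℤ))))
      where
      1≤8κ³ : 1ℤ ≤ + 8 * (κ * κ * κ)
      1≤8κ³ = 1≤-* (+≤+ (s≤s z≤n)) (1≤-* (1≤-* 1≤κ 1≤κ) 1≤κ)

    4κ²G≡H : ∀ x y → + 4 * (κ * κ) * G x y ≡ H x (z x y)
    4κ²G≡H x y = trans (4κ²G≡ x y) (trans (cong₂ (λ d t → H x (z x y) + (κ * d * (x * x * (x * x)) + t * (x * x * x)))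
      δ≡0 θ≡0)
      (solve 4 (λ h k u v → h :+ (k :* # 0 :* u :+ # 0 :* v) := h) refl (H x (z x y)) κ (x * x * (x * x))
        (x * x * x)))

    record OffAxes : Set where
      field
        x w : ℤ
        1≤∣x∣ : 1 ℕ.≤ ∣ x ∣
        1≤∣w∣ : 1 ℕ.≤ ∣ w ∣

    -- When `x` and `w` are nonzero it dominates every monomial of `rest`, and it is smaller than
    -- `x² w²` by a factor of at least half the smaller of `∣ x ∣` and `∣ w ∣`.
    weight : OffAxes → ℕ
    weight i = ∣ OffAxes.x i ∣ ℕ.* ∣ OffAxes.w i ∣ ℕ.* (∣ OffAxes.x i ∣ ℕ.+ ∣ OffAxes.w i ∣)

    rest-bounded : O weight (λ i → rest (OffAxes.x i) (OffAxes.w i))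
    rest-bounded = +ᵇ (+ᵇ (+ᵇ (+ᵇ (+ᵇ (+ᵇ (+ᵇ
        (sc a₁ xww) (sc κ₁ xxw)) (sc a₀ ww)) (sc κ₂ xw)) (sc κ₄ xx)) (sc κ₃ ow)) (sc κ₅ ox))
          (O-const {w = weight} κ₆ (λ i → ℕP.*-mono-≤ (ℕP.*-mono-≤ (1≤∣x∣ i) (1≤∣w∣ i))
          (ℕP.≤-trans (1≤∣x∣ i) (ℕP.m≤m+n _ _))))
      where
      open OffAxes
      u v : OffAxes → ℕ
      u i = ∣ x i ∣
      v i = ∣ w i ∣
      +ᵇ : ∀ {g h : OffAxes → ℤ} → O weight g → O weight h → O weight (λ i → g i + h i)
      +ᵇ {g} {h} = O-+ {w = weight} {g} {h}
      sc : ∀ {g : OffAxes → ℤ} c → O weight g → O weight (λ i → c * g i)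
      sc {g} = O-scale {w = weight} {g}
      from-≤ : ∀ (g : OffAxes → ℤ) → (∀ i → ∣ g i ∣ ℕ.≤ weight i) → O weight g
      from-≤ g h = 1 , λ i → ℕP.≤-trans (h i) (ℕP.≤-reflexive (sym (ℕP.+-identityʳ _)))
      u≤ : ∀ i → u i ℕ.≤ u i ℕ.* v i
      u≤ i = ≤-* (v i) (1≤∣w∣ i)
      v≤ : ∀ i → v i ℕ.≤ u i ℕ.* v i
      v≤ i = ℕP.≤-trans (≤-* (u i) (1≤∣x∣ i)) (ℕP.≤-reflexive (ℕP.*-comm (v i) (u i)))
      ow : O weight w
      ow = from-≤ w (λ i → ℕP.≤-trans (v≤ i) (≤-* (u i ℕ.+ v i) (ℕP.≤-trans (1≤∣x∣ i) (ℕP.m≤m+n _ _))))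
      ox : O weight x
      ox = from-≤ x (λ i → ℕP.≤-trans (u≤ i) (≤-* (u i ℕ.+ v i) (ℕP.≤-trans (1≤∣x∣ i) (ℕP.m≤m+n _ _))))
      xw : O weight (λ i → x i * w i)
      xw = from-≤ (λ i → x i * w i) (λ i → ℕP.≤-trans (ℕP.≤-reflexive (∣*∣ (x i) (w i)))
        (≤-* (u i ℕ.+ v i) (ℕP.≤-trans (1≤∣x∣ i) (ℕP.m≤m+n _ _))))
      xx : O weight (λ i → x i * x i)
      xx = from-≤ (λ i → x i * x i) (λ i → ℕP.≤-trans (ℕP.≤-reflexive (∣*∣ (x i) (x i)))
        (ℕP.*-mono-≤ (u≤ i) (ℕP.m≤m+n (u i) (v i))))
      ww : O weight (λ i → w i * w i)
      ww = from-≤ (λ i → w i * w i) (λ i → ℕP.≤-trans (ℕP.≤-reflexive (∣*∣ (w i) (w i)))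
        (ℕP.*-mono-≤ (v≤ i) (ℕP.m≤n+m (v i) (u i))))
      xxw : O weight (λ i → x i * x i * w i)
      xxw = from-≤ (λ i → x i * x i * w i) (λ i → ℕP.≤-trans
        (ℕP.≤-reflexive (trans (∣*∣ (x i * x i) (w i)) (trans (cong (ℕ._* v i) (∣*∣ (x i) (x i)))
        (trans (ℕP.*-assoc (u i) (u i) (v i)) (ℕP.*-comm (u i) (u i ℕ.* v i))))))
        (ℕP.*-monoʳ-≤ (u i ℕ.* v i) (ℕP.m≤m+n (u i) (v i))))
      xww : O weight (λ i → x i * (w i * w i))
      xww = from-≤ (λ i → x i * (w i * w i)) (λ i → ℕP.≤-trans
        (ℕP.≤-reflexive (trans (∣*∣ (x i) (w i * w i)) (trans (cong (u i ℕ.*_) (∣*∣ (w i) (w i)))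
        (sym (ℕP.*-assoc (u i) (v i) (v i)))))) (ℕP.*-monoʳ-≤ (u i ℕ.* v i) (ℕP.m≤n+m (v i) (u i))))

    D : ℕ
    D = proj₁ rest-bounded

    -- If both coordinates reach `4 D`, then `rest` is at most `D * weight`, hence at most half of
    -- `x² w²`.
    H-lower : ∀ x w → 1 ℕ.≤ ∣ x ∣ → 1 ℕ.≤ ∣ w ∣ → 4 ℕ.* D ℕ.≤ ∣ x ∣ → 4 ℕ.* D ℕ.≤ ∣ w ∣
      → x * x * (w * w) ≤ + 2 * H x w
    H-lower x w 1≤∣x∣ 1≤∣w∣ hx hw = 0≤⇒≤ (*-cancelˡ-nn (+ 2) (+≤+ (s≤s z≤n)) (nn-by
        (trans (solve 4 (λ k x w r → # 2 :* (# 2 :* (k :* (x :* x :* (w :* w)) :+ r) :- x :* x :* (w :* w))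
          := # 4 :* (k :- # 1) :* (x :* x :* (w :* w)) :+ (# 2 :* ((x :* x) :* (w :* w)) :+ # 4 :* r)) refl κ x w
          (rest x w))
        (cong (_+_ (+ 4 * (κ - 1ℤ) * (x * x * (w * w)))) (trans
          (cong₂ (λ a b → + 2 * (a * b) + + 4 * rest x w) (sym (∣sq∣ x)) (sym (∣sq∣ w)))
          (solve 4 (λ u v r d → # 2 :* (u :* u :* (v :* v)) :+ # 4 :* r
            := # 4 :* (d :* (u :* v :* (u :+ v)) :+ r) :+ u :* v :* (u :* (v :- # 4 :* d) :+ v :* (u :- # 4 :* d)))
            refl u v (rest x w) (+ D)))))
        (+-nn (*-nn (*-nn (pos-nn 4) (≤⇒0≤ 1≤κ)) (*-nn (sq-nn x) (sq-nn w)))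
          (+-nn (*-nn (pos-nn 4) (nn-by (solve 2 (λ b r → b :+ r := b :- (:- r)) refl (+ D * (u * v * (u + v)))
            (rest x w)) (≤⇒0≤ (subst (- rest x w ≤_) weight≡ (∣x∣≤⇒- {rest x w} (proj₂ rest-bounded point))))))
            (*-nn (*-nn (pos-nn ∣ x ∣) (pos-nn ∣ w ∣)) (+-nn (*-nn (pos-nn ∣ x ∣) (far hw))
              (*-nn (pos-nn ∣ w ∣) (far hx))))))))
      where
      u = + ∣ x ∣
      v = + ∣ w ∣
      point : OffAxes
      point = record { x = x ; w = w ; 1≤∣x∣ = 1≤∣x∣ ; 1≤∣w∣ = 1≤∣w∣ }
      weight≡ : + (D ℕ.* weight point) ≡ + D * (u * v * (u + v))
      weight≡ = trans (pos-* D (weight point)) (cong (+ D *_)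
        (trans (pos-* (∣ x ∣ ℕ.* ∣ w ∣) (∣ x ∣ ℕ.+ ∣ w ∣)) (cong₂ _*_ (pos-* ∣ x ∣ ∣ w ∣) (pos-+ ∣ x ∣ ∣ w ∣))))
      far : ∀ {n} → 4 ℕ.* D ℕ.≤ n → 0ℤ ≤ + n - + 4 * + D
      far {n} h = subst (λ d → 0ℤ ≤ + n - d) (pos-* 4 D) (≤⇒0≤ (+≤+ h))

    E′ : ℕ
    E′ = 4 ℕ.* (k ℕ.* k) ℕ.* E

    1≤E′ : 1 ℕ.≤ E′
    1≤E′ = ℕP.*-mono-≤ (ℕP.*-mono-≤ {1} {4} (s≤s z≤n) (ℕP.*-mono-≤ 1≤k 1≤k)) 1≤E

    E′≡ : + E′ ≡ + 4 * (κ * κ) * + E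
    E′≡ = trans (pos-* (4 ℕ.* (k ℕ.* k)) E) (cong (_* + E) (trans (pos-* 4 (k ℕ.* k)) (cong (+ 4 *_) (pos-* k k))))

    H-value : ∀ x y n → G x y ≡ + E * + n → H x (z x y) ≡ + E′ * + n
    H-value x y n e = trans (sym (4κ²G≡H x y)) (trans (cong (+ 4 * (κ * κ) *_) e)
      (trans (solve 3 (λ a b c → a :* (b :* c) := a :* b :* c) refl (+ 4 * (κ * κ)) (+ E) (+ n))
      (cong (_* + n) (sym E′≡))))

    -- The summand `4 D` puts points far from both axes within reach of `H-lower`; `2 E′ + 1` makes
    -- `(L M)⁴` exceed the bound `2 E′ M⁴` for `x² w²`.
    L : ℕ
    L = 4 ℕ.* D ℕ.+ (2 ℕ.* E′ ℕ.+ 1)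

    1≤L : 1 ℕ.≤ L
    1≤L = ℕP.≤-trans (ℕP.m≤n+m 1 (2 ℕ.* E′)) (ℕP.m≤n+m _ (4 ℕ.* D))

    near-an-axis : ∀ M n x y → 1 ℕ.≤ M → n ℕ.≤ M ℕ.^ 4 → G x y ≡ + E * + n → ∣ x ∣ ℕ.≤ L ℕ.* M ⊎ ∣ z x y ∣ ℕ.≤ L ℕ.* M
    near-an-axis M n x y 1≤M n≤ e = decide (∣ x ∣ ℕ.≤? L ℕ.* M) (∣ w ∣ ℕ.≤? L ℕ.* M)
      where
      w = z x y
      N = L ℕ.* M
      1≤N : 1 ℕ.≤ N
      1≤N = ℕP.*-mono-≤ 1≤L 1≤M
      4D≤N : 4 ℕ.* D ℕ.≤ N
      4D≤N = ℕP.≤-trans (ℕP.m≤m+n (4 ℕ.* D) _) (≤-* M 1≤M)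
      upper : ∣ x ∣ ℕ.* ∣ x ∣ ℕ.* (∣ w ∣ ℕ.* ∣ w ∣) ℕ.≤ 2 ℕ.* E′ ℕ.* M ℕ.^ 4 → ¬ (N ℕ.≤ ∣ x ∣ × N ℕ.≤ ∣ w ∣)
      upper h (p , q) = ℕP.<-irrefl refl (ℕP.≤-trans (ℕP.≤-trans strict lower-N)
        (ℕP.≤-trans (ℕP.*-mono-≤ (ℕP.*-mono-≤ p p) (ℕP.*-mono-≤ q q)) h))
        where
        strict : suc (2 ℕ.* E′ ℕ.* M ℕ.^ 4) ℕ.≤ L ℕ.* M ℕ.^ 4
        strict = ℕP.≤-trans (ℕP.+-monoˡ-≤ (2 ℕ.* E′ ℕ.* M ℕ.^ 4) (1≤-^ 4 1≤M))
          (ℕP.≤-trans (ℕP.≤-reflexive (+-*-Solver.solve 2 (λ e m → m +ₛ e *ₛ m =ₛ (e +ₛ con₂ 1) *ₛ m) refl (2 ℕ.* E′)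
          (M ℕ.^ 4))) (ℕP.*-monoˡ-≤ (M ℕ.^ 4) (ℕP.m≤n+m (2 ℕ.* E′ ℕ.+ 1) (4 ℕ.* D))))
          where open +-*-Solver using () renaming (_:*_ to _*ₛ_; _:+_ to _+ₛ_; _:=_ to _=ₛ_; con to con₂)
        lower-N : L ℕ.* M ℕ.^ 4 ℕ.≤ N ℕ.* N ℕ.* (N ℕ.* N)
        lower-N = ℕP.≤-trans (≤-* (L ℕ.^ 3) (1≤-^ 3 1≤L)) (ℕP.≤-reflexive
          (+-*-Solver.solve 2 (λ L M → L *ₛ M ^ₛ 4 *ₛ L ^ₛ 3 =ₛ L *ₛ M *ₛ (L *ₛ M) *ₛ (L *ₛ M *ₛ (L *ₛ M))) refl L M))
          where open +-*-Solver using () renaming (_:*_ to _*ₛ_; _:=_ to _=ₛ_; _:^_ to _^ₛ_)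
      decide : Dec (∣ x ∣ ℕ.≤ N) → Dec (∣ w ∣ ℕ.≤ N) → ∣ x ∣ ℕ.≤ N ⊎ ∣ w ∣ ℕ.≤ N
      decide (yes p) _ = inj₁ p
      decide (no _) (yes q) = inj₂ q
      decide (no p) (no q) = ⊥-elim (upper (+≤⇒ (subst₂ _≤_ (sym lhs) (sym rhs)
        (ℤP.≤-trans (H-lower x w (ℕP.≤-trans 1≤N p′) (ℕP.≤-trans 1≤N q′) (ℕP.≤-trans 4D≤N p′) (ℕP.≤-trans 4D≤N q′))
            (≤-by (trans (cong (λ h → + 2 * + E′ * + (M ℕ.^ 4) - + 2 * h) (H-value x y n e))
              (solve 3 (λ E M n → # 2 :* E :* M :- # 2 :* (E :* n) := # 2 :* E :* (M :- n)) refl (+ E′) (+ (M ℕ.^ 4))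
              (+ n))) (*-nn (*-nn (pos-nn 2) (pos-nn E′)) (≤⇒0≤ (+≤+ n≤))))))) (p′ , q′))
        where
        p′ = ℕP.<⇒≤ (ℕP.≰⇒> p)
        q′ = ℕP.<⇒≤ (ℕP.≰⇒> q)
        lhs : + (∣ x ∣ ℕ.* ∣ x ∣ ℕ.* (∣ w ∣ ℕ.* ∣ w ∣)) ≡ x * x * (w * w)
        lhs = trans (pos-* (∣ x ∣ ℕ.* ∣ x ∣) (∣ w ∣ ℕ.* ∣ w ∣))
          (cong₂ _*_ (trans (pos-* ∣ x ∣ ∣ x ∣) (∣sq∣ x)) (trans (pos-* ∣ w ∣ ∣ w ∣) (∣sq∣ w)))
        rhs : + (2 ℕ.* E′ ℕ.* M ℕ.^ 4) ≡ + 2 * + E′ * + (M ℕ.^ 4)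
        rhs = trans (pos-* (2 ℕ.* E′) (M ℕ.^ 4)) (cong (_* + (M ℕ.^ 4)) (pos-* 2 E′))

    Az Bz Cz : ℤ → ℤ
    Az w = κ * (w * w) + κ₁ * w + κ₄
    Bz w = a₁ * (w * w) + κ₂ * w + κ₅
    Cz w = a₀ * (w * w) + κ₃ * w + κ₆

    H≡quadratic : ∀ x w → H x w ≡ quadratic (Az w) (Bz w) (Cz w) x
    H≡quadratic x w = solve 11 (λ k a₁ a₀ k₁ k₂ k₃ k₄ k₅ k₆ x w
      → k :* (x :* x :* (w :* w)) :+ (a₁ :* (x :* (w :* w)) :+ k₁ :* (x :* x :* w) :+ a₀ :* (w :* w) :+ k₂ :* (x :* w)
      :+ k₄ :* (x :* x) :+ k₃ :* w :+ k₅ :* x :+ k₆) :=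
       (k :* (w :* w) :+ k₁ :* w :+ k₄) :* (x :* x) :+ (a₁ :* (w :* w) :+ k₂ :* w :+ k₅) :* x
         :+ (a₀ :* (w :* w) :+ k₃ :* w :+ k₆)) refl κ a₁ a₀ κ₁ κ₂ κ₃ κ₄ κ₅ κ₆ x w

    height : ℕ → ℕ
    height M = E′ ℕ.* (M ℕ.* M)

    height² : ∀ M → E′ ℕ.* M ℕ.^ 4 ℕ.≤ height M ℕ.* height M
    height² M = ℕP.≤-trans (ℕP.≤-reflexive (cong (E′ ℕ.*_) (^4≡ M)))
      (ℕP.≤-trans (≤-* E′ 1≤E′) (ℕP.≤-reflexive (+-*-Solver.solve 2 (λ C M
      → C *ₛ ((M *ₛ M) *ₛ (M *ₛ M)) *ₛ C =ₛ (C *ₛ (M *ₛ M)) *ₛ (C *ₛ (M *ₛ M))) refl E′ M)))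
      where open +-*-Solver using () renaming (_:*_ to _*ₛ_; _:=_ to _=ₛ_)

    -- The shift `(2 κ, - b)` of `(x, y)` preserves `z`. So on the line `z = w` nonnegativity is
    -- known along a progression in `x` of difference `2 κ`, which is the step passed on here.
    z-line-values : ∀ M w → _
    z-line-values M w = quadratic-values (Az w) (Bz w) (Cz w) (+ 2 * κ) (E′ ℕ.* M ℕ.^ 4) (height M)
      (1≤-* (+≤+ (s≤s z≤n)) 1≤κ) (height² M)

    z-line : ℕ → ℤ → List ℤ
    z-line M w = proj₁ (z-line-values M w)

    ∈-z-line : ∀ M n x y → n ℕ.≤ M ℕ.^ 4 → G x y ≡ + E * + n → + E′ * + n ∈ z-line M (z x y)
    ∈-z-line M n x y n≤ e = subst (_∈ z-line M (z x y)) value (proj₂ (proj₂ (z-line-values M (z x y))) x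
        (subst₂ _≤_ (sym value) refl (subst (_≤ + (E′ ℕ.* M ℕ.^ 4)) (pos-* E′ n) (+≤+ (ℕP.*-monoʳ-≤ E′ n≤))))
        (λ T → subst (0ℤ ≤_) (trans (4κ²G≡H (x + + 2 * κ * T) (y - b * T))
          (trans (cong (H (x + + 2 * κ * T)) (solve 5 (λ k b x y T
          → # 2 :* k :* (y :- b :* T) :+ b :* (x :+ # 2 :* k :* T) := # 2 :* k :* y :+ b :* x) refl κ b x y T))
          (H≡quadratic (x + + 2 * κ * T) (z x y))))
           (*-nn (1≤⇒0≤ 1≤4κ²) (nonneg (x + + 2 * κ * T) (y - b * T)))))
      where
      value : quadratic (Az (z x y)) (Bz (z x y)) (Cz (z x y)) x ≡ + E′ * + n
      value = trans (sym (H≡quadratic x (z x y))) (H-value x y n e)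

    cross-impossible : ⊥
    cross-impossible = ¬SparseValues C (+ E′) (+≤+ 1≤E′) sparse
      where
      C = 12 ℕ.* L ℕ.* E ℕ.+ 12 ℕ.* L ℕ.* E′
      sparse : SparseValues C (+ E′)
      sparse M 1≤M = xs ++ zs , len , λ n n≤ → from n n≤ (covers n)
        where
        N = L ℕ.* M
        xs = map (+ 4 * (κ * κ) *_) (lines M N)
        zs = concatMap (z-line M) (symmetric-range N)
        len : length (xs ++ zs) ℕ.≤ C ℕ.* M ℕ.^ 3
        len = ℕP.≤-trans (ℕP.≤-reflexive (trans (LP.length-++ xs)
          (cong (ℕ._+ length zs) (LP.length-map _ (lines M N))))) (ℕP.≤-trans (ℕP.+-mono-≤ (length-lines M L 1≤M 1≤L)
          (ℕP.≤-trans (length-concatMap (z-line M) (4 ℕ.* height M) (symmetric-range N) (λ w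
            → ℕP.≤-trans (proj₁ (proj₂ (z-line-values M w))) (suc+suc≤4* (ℕP.*-mono-≤ 1≤E′ (ℕP.*-mono-≤ 1≤M 1≤M)))))
            (ℕP.≤-trans (ℕP.*-monoˡ-≤ (4 ℕ.* height M) (length-symmetric-range (ℕP.*-mono-≤ 1≤L 1≤M)))
              (ℕP.≤-reflexive (+-*-Solver.solve 3 (λ L E M → (con₂ 3 *ₛ (L *ₛ M)) *ₛ (con₂ 4 *ₛ (E *ₛ (M *ₛ M))) =ₛ
                con₂ 12 *ₛ L *ₛ E *ₛ M ^ₛ 3) refl L E′ M)))))
          (ℕP.≤-reflexive (sym (ℕP.*-distribʳ-+ (M ℕ.^ 3) (12 ℕ.* L ℕ.* E) (12 ℕ.* L ℕ.* E′)))))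
          where open +-*-Solver using () renaming (_:*_ to _*ₛ_; _:=_ to _=ₛ_; _:^_ to _^ₛ_; con to con₂)
        from : ∀ n → n ℕ.≤ M ℕ.^ 4 → (∃ λ x → ∃ λ y → G x y ≡ + E * + n) → + E′ * + n ∈ xs ++ zs
        from n n≤ (x , y , e) = [ (λ x≤ → MP.∈-++⁺ˡ (subst (_∈ xs)
          (trans (solve 3 (λ a b c → a :* (b :* c) := a :* b :* c) refl (+ 4 * (κ * κ)) (+ E) (+ n))
          (cong (_* + n) (sym E′≡))) (MP.∈-map⁺ (+ 4 * (κ * κ) *_) (∈-lines M N n x y n≤ e x≤))))
                                , (λ z≤ → MP.∈-++⁺ʳ xs (∈-concatMap (z-line M) (∈-symmetric-range z≤)
                                  (∈-z-line M n x y n≤ e))) ]′ (near-an-axis M n x y 1≤M n≤ e)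

-- Polynomials in one variable

module Univariate (c₀ c₁ c₂ c₃ c₄ : ℤ) (E : ℕ) (1≤E : 1 ℕ.≤ E) where

  Cₗ : List ℤ
  Cₗ = c₀ ∷ c₁ ∷ c₂ ∷ c₃ ∷ c₄ ∷ []

  module _ (nonneg : ∀ x → 0ℤ ≤ ev Cₗ x) (covers : ∀ n → ∃ λ x → ev Cₗ x ≡ + E * + n) where

    odd-zero : ∀ {c} → (∀ e → e * e ≡ 1ℤ → 0ℤ ≤ c * e) → c ≡ 0ℤ
    odd-zero {c} h = both-nn⇒≡0 (nn-by (solve 1 (λ c → c := c :* # 1) refl c)
      (h 1ℤ (solve 0 (# 1 :* # 1 := # 1) refl)))
      (nn-by (solve 1 (λ c → :- c := c :* (:- # 1)) refl c) (h (- 1ℤ) (solve 0 ((:- # 1) :* (:- # 1) := # 1) refl)))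

    flat : ∀ x y → quadratic (ev [] x) (ev [] x) (ev Cₗ x) y ≡ ev Cₗ x
    flat x y = solve 2 (λ y c → # 0 :* (y :* y) :+ # 0 :* y :+ c := c) refl y (ev Cₗ x)

    open Lines (ev []) (ev []) (ev Cₗ) E 1≤E (λ x y → nn-by (flat x y) (nonneg x)) using (G; growth-impossible)

    covers-G : Covers G E
    covers-G n = from (covers n)
      where
      from : (∃ λ x → ev Cₗ x ≡ + E * + n) → ∃ λ x → ∃ λ y → G x y ≡ + E * + n
      from (x , e) = x , 0ℤ , trans (flat x 0ℤ) e

    c₄≱1 : ¬ 1ℤ ≤ c₄
    c₄≱1 1≤c₄ = from (two-sided-positive P 1≤lc (subst (1ℤ ≤_)
      (solve 1 (λ x → x := (:- # 1) :* ((:- # 1) :* ((:- # 1) :* ((:- # 1) :* x)))) refl (lc P)) 1≤lc))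
      where
      P : List ℤ
      P = (+ 2 ·ₗ Cₗ) +ₗ ((- 1ℤ) ·ₗ x⁴)
      1≤lc : 1ℤ ≤ lc P
      1≤lc = ≤-by (solve 1 (λ c → # 2 :* c :+ (:- # 1) :* # 1 :- # 1 := # 2 :* (c :- # 1)) refl c₄)
        (*-nn (pos-nn 2) (≤⇒0≤ 1≤c₄))
      from : (∃ λ R → 1 ℕ.≤ R × (∀ x → R ℕ.≤ ∣ x ∣ → 1ℤ ≤ ev P x)) → ⊥
      from (R , 1≤R , P≥1) = growth-impossible covers-G R 2 1≤R (λ x y far → ≤-by
        (trans (cong (λ g → + 2 * g - x * x * (x * x)) (flat x y))
          (trans (solve 2 (λ c w → # 2 :* c :- w := # 2 :* c :+ (:- # 1) :* w) refl (ev Cₗ x) (x * x * (x * x)))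
          (trans (cong₂ _+_ (sym (ev-· (+ 2) Cₗ x)) (trans (cong ((- 1ℤ) *_) (sym (ev-x⁴ x)))
            (sym (ev-· (- 1ℤ) x⁴ x)))) (sym (ev-+ (+ 2 ·ₗ Cₗ) ((- 1ℤ) ·ₗ x⁴) x)))))
        (1≤⇒0≤ (P≥1 x far)))

    0≤c₄ : 0ℤ ≤ c₄
    0≤c₄ = leading-nonneg Cₗ 0 (λ T _ → nonneg (+ T))

    c₄≡0 : c₄ ≡ 0ℤ
    c₄≡0 = ≤0∧0≤⇒≡0 ([ (λ p → ⊥-elim (c₄≱1 p)) , id ]′ (1≤-split c₄)) 0≤c₄

    c₃≡0 : c₃ ≡ 0ℤ
    c₃≡0 = odd-zero (λ e ee → leading-nonneg (c₀ ∷ c₁ * e ∷ c₂ * (e * e) ∷ c₃ * e ∷ []) 0 (λ T _ → subst (0ℤ ≤_)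
      (trans (cong (λ c → ev (c₀ ∷ c₁ ∷ c₂ ∷ c₃ ∷ c ∷ []) (e * + T)) c₄≡0) (trans (solve 6 (λ c₀ c₁ c₂ c₃ e T →
          let x = e :* T in
          c₀ :+ x :* (c₁ :+ x :* (c₂ :+ x :* (c₃ :+ x :* (# 0 :+ x :* # 0))))
            := c₀ :+ T :* (c₁ :* e :+ T :* (c₂ :* (e :* e) :+ T :* (c₃ :* ((e :* e) :* e) :+ T :* # 0)))) refl c₀ c₁
            c₂ c₃ e (+ T))
        (cong (λ s → c₀ + + T * (c₁ * e + + T * (c₂ * (e * e) + + T * (c₃ * s + + T * 0ℤ))))
          (trans (cong (_* e) ee) (solve 1 (λ e → # 1 :* e := e) refl e)))))
      (nonneg (e * + T))))

    quadratic≡ : ∀ x → ev Cₗ x ≡ quadratic c₂ c₁ c₀ x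
    quadratic≡ x = trans (cong₂ (λ a b → ev (c₀ ∷ c₁ ∷ c₂ ∷ a ∷ b ∷ []) x) c₃≡0 c₄≡0)
      (solve 4 (λ c₀ c₁ c₂ x → c₀ :+ x :* (c₁ :+ x :* (c₂ :+ x :* (# 0 :+ x :* (# 0 :+ x :* # 0))))
        := c₂ :* (x :* x) :+ c₁ :* x :+ c₀) refl c₀ c₁ c₂ x)

    0≤c₂ : 0ℤ ≤ c₂
    0≤c₂ = leading-nonneg (c₀ ∷ c₁ ∷ c₂ ∷ []) 0 (λ T _ → subst (0ℤ ≤_)
      (trans (quadratic≡ (+ T)) (solve 4 (λ c₀ c₁ c₂ x → c₂ :* (x :* x) :+ c₁ :* x :+ c₀
      := c₀ :+ x :* (c₁ :+ x :* (c₂ :+ x :* # 0))) refl c₀ c₁ c₂ (+ T))) (nonneg (+ T)))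

    -- a quadratic polynomial is a special case of the shear form, with the variables exchanged
    c₂≢positive : ∀ k → c₂ ≡ + k → 1 ℕ.≤ k → ⊥
    c₂≢positive k c₂≡ 1≤k = S.shear-impossible (λ x y → nn-by (S≡ x y) (nonneg y)) (λ n → from n (covers n))
      where
      module S = ShearForm k 1≤k c₁ 0ℤ 0ℤ c₀ 0ℤ 0ℤ 0ℤ 0ℤ E 1≤E
      S≡ : ∀ x y → S.G x y ≡ ev Cₗ y
      S≡ x y = trans (solve 5 (λ k c₁ c₀ x y →
          let o = # 0 in
          (k :+ x :* o) :* (y :* y) :+ (c₁ :+ x :* (o :+ x :* (o :+ x :* o))) :* y
            :+ (c₀ :+ x :* (o :+ x :* (o :+ x :* (o :+ x :* (o :+ x :* o))))) := k :* (y :* y) :+ c₁ :* y :+ c₀) refl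
            (+ k) c₁ c₀ x y)
        (trans (cong (λ c → quadratic c c₁ c₀ y) (sym c₂≡)) (sym (quadratic≡ y)))
      from : ∀ n → (∃ λ x → ev Cₗ x ≡ + E * + n) → ∃ λ x → ∃ λ y → S.G x y ≡ + E * + n
      from n (y , e) = 0ℤ , y , trans (S≡ 0ℤ y) e

    c₂≢0 : c₂ ≢ 0ℤ
    c₂≢0 c₂≡0 = from (covers 0) (covers 1)
      where
      linear≡ : ∀ x → ev Cₗ x ≡ c₁ * x + c₀
      linear≡ x = trans (quadratic≡ x) (trans (cong (λ c → quadratic c c₁ c₀ x) c₂≡0)
        (solve 3 (λ c₀ c₁ x → # 0 :* (x :* x) :+ c₁ :* x :+ c₀ := c₁ :* x :+ c₀) refl c₀ c₁ x))
      c₁≡0 : c₁ ≡ 0ℤ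
      c₁≡0 = odd-zero (λ e ee → leading-nonneg (c₀ ∷ c₁ * e ∷ []) 0 (λ T _
        → subst (0ℤ ≤_) (trans (linear≡ (e * + T)) (solve 4 (λ c₀ c₁ e T → c₁ :* (e :* T) :+ c₀
        := c₀ :+ T :* (c₁ :* e :+ T :* # 0)) refl c₀ c₁ e (+ T))) (nonneg (e * + T))))
      constant≡ : ∀ x → ev Cₗ x ≡ c₀
      constant≡ x = trans (linear≡ x) (trans (cong (λ c → c * x + c₀) c₁≡0)
        (solve 2 (λ c₀ x → # 0 :* x :+ c₀ := c₀) refl c₀ x))
      from : (∃ λ x → ev Cₗ x ≡ + E * + 0) → (∃ λ x → ev Cₗ x ≡ + E * + 1) → ⊥
      from (x , e) (y , f) = 0≢1 (*-cancelˡ (+ E) (+≤+ 1≤E) (trans (sym e)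
        (trans (constant≡ x) (trans (sym (constant≡ y)) f))))
        where
        0≢1 : + 0 ≡ + 1 → ⊥
        0≢1 ()

    univariate-impossible : ⊥
    univariate-impossible = from (0≤⇒pos 0≤c₂)
      where
      from : (∃ λ k → c₂ ≡ + k) → ⊥
      from (zero , e) = c₂≢0 e
      from (suc k , e) = c₂≢positive (suc k) e (s≤s z≤n)

-- Leading forms that vanish at (0, 1)

module AxisZero (Q : Quartic) (E : ℕ) (1≤E : 1 ℕ.≤ E) where
  open Quartic Q

  Aₗ Bₗ Cₗ : List ℤ
  Aₗ = c₀₂ ∷ c₁₂ ∷ c₂₂ ∷ []
  Bₗ = c₀₁ ∷ c₁₁ ∷ c₂₁ ∷ c₃₁ ∷ []
  Cₗ = c₀₀ ∷ c₁₀ ∷ c₂₀ ∷ c₃₀ ∷ c₄₀ ∷ []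

  value-by-y : ∀ x y → value x y ≡ c₀₄ * (y * y * (y * y)) + (c₁₃ * x + c₀₃) * (y * y * y) + quadratic (ev Aₗ x)
    (ev Bₗ x) (ev Cₗ x) y
  value-by-y x y = solve 17 (λ c₄₀ c₃₁ c₂₂ c₁₃ c₀₄ c₃₀ c₂₁ c₁₂ c₀₃ c₂₀ c₁₁ c₀₂ c₁₀ c₀₁ c₀₀ x y →
     let o = # 0 in
     c₄₀ :* (x :* x :* x :* x) :+ c₃₁ :* (x :* x :* x :* y) :+ c₂₂ :* (x :* x :* (y :* y)) :+ c₁₃
       :* (x :* (y :* y :* y)) :+ c₀₄ :* (y :* y :* y :* y)
     :+ ((c₃₀ :* (x :* x :* x) :+ c₂₁ :* (x :* x :* y) :+ c₁₂ :* (x :* (y :* y)) :+ c₀₃ :* (y :* y :* y))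
       :+ (c₂₀ :* (x :* x) :+ c₁₁ :* (x :* y) :+ c₀₂ :* (y :* y)) :+ (c₁₀ :* x :+ c₀₁ :* y) :+ c₀₀)
     := c₀₄ :* (y :* y :* (y :* y)) :+ (c₁₃ :* x :+ c₀₃) :* (y :* y :* y)
       :+ ((c₀₂ :+ x :* (c₁₂ :+ x :* (c₂₂ :+ x :* o))) :* (y :* y)
         :+ (c₀₁ :+ x :* (c₁₁ :+ x :* (c₂₁ :+ x :* (c₃₁ :+ x :* o)))) :* y
         :+ (c₀₀ :+ x :* (c₁₀ :+ x :* (c₂₀ :+ x :* (c₃₀ :+ x :* (c₄₀ :+ x :* o)))))))
     refl c₄₀ c₃₁ c₂₂ c₁₃ c₀₄ c₃₀ c₂₁ c₁₂ c₀₃ c₂₀ c₁₁ c₀₂ c₁₀ c₀₁ c₀₀ x y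

  module _ (c₀₄≡0 : c₀₄ ≡ 0ℤ) (nonneg : ∀ x y → 0ℤ ≤ value x y) (covers : Covers value E) where

    cubic-in-y : ∀ x y → value x y ≡ ev (ev Cₗ x ∷ ev Bₗ x ∷ ev Aₗ x ∷ c₁₃ * x + c₀₃ ∷ []) y
    cubic-in-y x y = trans (value-by-y x y) (trans (cong (λ c
      → c * (y * y * (y * y)) + (c₁₃ * x + c₀₃) * (y * y * y) + quadratic (ev Aₗ x) (ev Bₗ x) (ev Cₗ x) y) c₀₄≡0)
      (solve 5 (λ a b c d y → # 0 :* (y :* y :* (y :* y)) :+ d :* (y :* y :* y) :+ (a :* (y :* y) :+ b :* y :+ c)
        := c :+ y :* (b :+ y :* (a :+ y :* (d :+ y :* # 0)))) refl (ev Aₗ x) (ev Bₗ x) (ev Cₗ x) (c₁₃ * x + c₀₃) y))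

    -- On the line with this `x` the value is a cubic in `y` that is nonnegative in both directions,
    -- so its top coefficient vanishes.
    y³-zero : ∀ x → c₁₃ * x + c₀₃ ≡ 0ℤ
    y³-zero x = both-nn⇒≡0 (leading-nonneg (ev Cₗ x ∷ ev Bₗ x ∷ ev Aₗ x ∷ c₁₃ * x + c₀₃ ∷ []) 0 (λ T _
      → subst (0ℤ ≤_) (cubic-in-y x (+ T)) (nonneg x (+ T))))
      (leading-nonneg (ev Cₗ x ∷ - ev Bₗ x ∷ ev Aₗ x ∷ - (c₁₃ * x + c₀₃) ∷ []) 0 (λ T _
        → subst (0ℤ ≤_) (trans (cubic-in-y x (- + T))
         (solve 5 (λ a b c d T → c :+ (:- T) :* (b :+ (:- T) :* (a :+ (:- T) :* (d :+ (:- T) :* # 0)))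
           := c :+ T :* (:- b :+ T :* (a :+ T :* (:- d :+ T :* # 0)))) refl (ev Aₗ x) (ev Bₗ x) (ev Cₗ x)
           (c₁₃ * x + c₀₃) (+ T))) (nonneg x (- + T))))

    value≡ : ∀ x y → value x y ≡ quadratic (ev Aₗ x) (ev Bₗ x) (ev Cₗ x) y
    value≡ x y = trans (cubic-in-y x y) (trans (cong (λ d → ev (ev Cₗ x ∷ ev Bₗ x ∷ ev Aₗ x ∷ d ∷ []) y) (y³-zero x))
      (solve 4 (λ a b c y → c :+ y :* (b :+ y :* (a :+ y :* (# 0 :+ y :* # 0))) := a :* (y :* y) :+ b :* y :+ c) refl
        (ev Aₗ x) (ev Bₗ x) (ev Cₗ x) y))

    A-nonneg : ∀ x → 0ℤ ≤ ev Aₗ x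
    A-nonneg x = leading-nonneg (ev Cₗ x ∷ ev Bₗ x ∷ ev Aₗ x ∷ []) 0 (λ T _
      → subst (0ℤ ≤_) (trans (value≡ x (+ T)) (solve 4 (λ a b c y → a :* (y :* y) :+ b :* y :+ c
      := c :+ y :* (b :+ y :* (a :+ y :* # 0))) refl (ev Aₗ x) (ev Bₗ x) (ev Cₗ x) (+ T))) (nonneg x (+ T)))

    0≤c₂₂ : 0ℤ ≤ c₂₂
    0≤c₂₂ = leading-nonneg Aₗ 0 (λ T _ → A-nonneg (+ T))

    transfer : ∀ (G : ℤ → ℤ → ℤ) → (∀ x y → G x y ≡ value x y) → Covers G E
    transfer G e n = from (covers n)
      where
      from : (∃ λ x → ∃ λ y → value x y ≡ + E * + n) → ∃ λ x → ∃ λ y → G x y ≡ + E * + n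
      from (x , y , f) = x , y , trans (e x y) f

    c₂₂≢positive : ∀ k → c₂₂ ≡ + k → 1 ℕ.≤ k → ⊥
    c₂₂≢positive k c₂₂≡ 1≤k = C.cross-impossible (λ x y → nn-by (C≡ x y) (nonneg x y)) (transfer C.G C≡)
      where
      module C = CrossForm k 1≤k c₀₂ c₁₂ c₀₁ c₁₁ c₂₁ c₃₁ c₀₀ c₁₀ c₂₀ c₃₀ c₄₀ E 1≤E
      C≡ : ∀ x y → C.G x y ≡ value x y
      C≡ x y = trans (cong (λ c → quadratic (ev (c₀₂ ∷ c₁₂ ∷ c ∷ []) x) (ev Bₗ x) (ev Cₗ x) y) (sym c₂₂≡))
        (sym (value≡ x y))

    module _ (c₂₂≡0 : c₂₂ ≡ 0ℤ) where

      A-linear : ∀ x → ev Aₗ x ≡ c₀₂ + c₁₂ * x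
      A-linear x = trans (cong (λ c → ev (c₀₂ ∷ c₁₂ ∷ c ∷ []) x) c₂₂≡0)
        (solve 3 (λ a b x → a :+ x :* (b :+ x :* (# 0 :+ x :* # 0)) := a :+ b :* x) refl c₀₂ c₁₂ x)

      c₁₂≡0 : c₁₂ ≡ 0ℤ
      c₁₂≡0 = both-nn⇒≡0 (leading-nonneg (c₀₂ ∷ c₁₂ ∷ []) 0 (λ T _
        → subst (0ℤ ≤_) (trans (A-linear (+ T)) (solve 3 (λ a b x → a :+ b :* x := a :+ x :* (b :+ x :* # 0)) refl c₀₂
        c₁₂ (+ T))) (A-nonneg (+ T))))
        (leading-nonneg (c₀₂ ∷ - c₁₂ ∷ []) 0 (λ T _ → subst (0ℤ ≤_)
          (trans (A-linear (- + T)) (solve 3 (λ a b x → a :+ b :* (:- x) := a :+ x :* (:- b :+ x :* # 0)) refl c₀₂ c₁₂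
          (+ T))) (A-nonneg (- + T))))

      A-constant : ∀ x → ev Aₗ x ≡ c₀₂
      A-constant x = trans (A-linear x) (trans (cong (λ c → c₀₂ + c * x) c₁₂≡0)
        (solve 2 (λ a x → a :+ # 0 :* x := a) refl c₀₂ x))

      0≤c₀₂ : 0ℤ ≤ c₀₂
      0≤c₀₂ = subst (0ℤ ≤_) (A-constant 0ℤ) (A-nonneg 0ℤ)

      -- The leading form is now x³ (c₃₁ y + c₄₀ x).
      c₃₁≡0 : c₃₁ ≡ 0ℤ
      c₃₁≡0 = both-nn⇒≡0 (sided 1ℤ ⨾ solve 1 (λ c → c :* # 1 := c) refl c₃₁)
        (sided (- 1ℤ) ⨾ solve 1 (λ c → c :* (:- # 1) := :- c) refl c₃₁)
        where
        _⨾_ : ∀ {x y} → 0ℤ ≤ x → x ≡ y → 0ℤ ≤ y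
        p ⨾ e = subst (0ℤ ≤_) e p
        form : ∀ y → 0ℤ ≤ c₄₀ + c₃₁ * y
        form y = leading-nonneg (c₀₀ ∷ c₁₀ + c₀₁ * y ∷ c₂₀ + c₁₁ * y + c₀₂ * (y * y) ∷ c₃₀ + c₂₁ * y ∷ c₄₀ + c₃₁ * y ∷
          []) 0 (λ T _ → subst (0ℤ ≤_)
          (trans (value≡ (+ T) (y * + T)) (trans (cong (λ a → quadratic a (ev Bₗ (+ T)) (ev Cₗ (+ T)) (y * + T))
            (A-constant (+ T)))
            (solve 12 (λ c₀₂ c₀₁ c₁₁ c₂₁ c₃₁ c₀₀ c₁₀ c₂₀ c₃₀ c₄₀ y T →
              let o = # 0
                  Y = y :* T in
              c₀₂ :* (Y :* Y) :+ (c₀₁ :+ T :* (c₁₁ :+ T :* (c₂₁ :+ T :* (c₃₁ :+ T :* o)))) :* Y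
                :+ (c₀₀ :+ T :* (c₁₀ :+ T :* (c₂₀ :+ T :* (c₃₀ :+ T :* (c₄₀ :+ T :* o))))) :=
              c₀₀ :+ T :* (c₁₀ :+ c₀₁ :* y :+ T :* (c₂₀ :+ c₁₁ :* y :+ c₀₂ :* (y :* y) :+ T
                :* (c₃₀ :+ c₂₁ :* y :+ T :* (c₄₀ :+ c₃₁ :* y :+ T :* o))))) refl c₀₂ c₀₁ c₁₁ c₂₁ c₃₁ c₀₀ c₁₀ c₂₀ c₃₀
                c₄₀ y (+ T))))
          (nonneg (+ T) (y * + T)))
        sided : ∀ e → 0ℤ ≤ c₃₁ * e
        sided e = leading-nonneg (c₄₀ ∷ c₃₁ * e ∷ []) 0 (λ T _
          → subst (0ℤ ≤_) (solve 4 (λ c d e T → c :+ d :* (e :* T) := c :+ T :* (d :* e :+ T :* # 0)) refl c₄₀ c₃₁ e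
          (+ T)) (form (e * + T)))

      c₀₂≢positive : ∀ k → c₀₂ ≡ + k → 1 ℕ.≤ k → ⊥
      c₀₂≢positive k c₀₂≡ 1≤k = S.shear-impossible (λ x y → nn-by (S≡ x y) (nonneg x y)) (transfer S.G S≡)
        where
        module S = ShearForm k 1≤k c₀₁ c₁₁ c₂₁ c₀₀ c₁₀ c₂₀ c₃₀ c₄₀ E 1≤E
        S≡ : ∀ x y → S.G x y ≡ value x y
        S≡ x y = trans (cong₂ (λ a b → quadratic a b (ev Cₗ x) y)
            (trans (solve 2 (λ k x → k :+ x :* # 0 := k) refl (+ k) x) (trans (sym c₀₂≡) (sym (A-constant x))))
            (trans (solve 4 (λ a b c x → a :+ x :* (b :+ x :* (c :+ x :* # 0))
              := a :+ x :* (b :+ x :* (c :+ x :* (# 0 :+ x :* # 0)))) refl c₀₁ c₁₁ c₂₁ x)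
              (cong (λ d → ev (c₀₁ ∷ c₁₁ ∷ c₂₁ ∷ d ∷ []) x) (sym c₃₁≡0))))
          (sym (value≡ x y))

      c₀₂≢0 : c₀₂ ≢ 0ℤ
      c₀₂≢0 c₀₂≡0 = Univariate.univariate-impossible c₀₀ c₁₀ c₂₀ c₃₀ c₄₀ E 1≤E (λ x
        → nn-by (sym (flat x 0ℤ)) (nonneg x 0ℤ)) (λ n → from n (covers n))
        where
        A≡0 : ∀ x → ev Aₗ x ≡ 0ℤ
        A≡0 x = trans (A-constant x) c₀₂≡0
        linear-in-y : ∀ x y → value x y ≡ ev Bₗ x * y + ev Cₗ x
        linear-in-y x y = trans (value≡ x y) (trans (cong (λ a → quadratic a (ev Bₗ x) (ev Cₗ x) y) (A≡0 x))
          (solve 3 (λ b c y → # 0 :* (y :* y) :+ b :* y :+ c := b :* y :+ c) refl (ev Bₗ x) (ev Cₗ x) y))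
        B≡0 : ∀ x → ev Bₗ x ≡ 0ℤ
        B≡0 x = both-nn⇒≡0 (leading-nonneg (ev Cₗ x ∷ ev Bₗ x ∷ []) 0 (λ T _
          → subst (0ℤ ≤_) (trans (linear-in-y x (+ T)) (solve 3 (λ b c y → b :* y :+ c := c :+ y :* (b :+ y :* # 0))
          refl (ev Bₗ x) (ev Cₗ x) (+ T))) (nonneg x (+ T))))
          (leading-nonneg (ev Cₗ x ∷ - ev Bₗ x ∷ []) 0 (λ T _
            → subst (0ℤ ≤_) (trans (linear-in-y x (- + T)) (solve 3 (λ b c y → b :* (:- y) :+ c
            := c :+ y :* (:- b :+ y :* # 0)) refl (ev Bₗ x) (ev Cₗ x) (+ T))) (nonneg x (- + T))))
        flat : ∀ x y → value x y ≡ ev Cₗ x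
        flat x y = trans (linear-in-y x y) (trans (cong (λ b → b * y + ev Cₗ x) (B≡0 x))
          (solve 2 (λ c y → # 0 :* y :+ c := c) refl (ev Cₗ x) y))
        from : ∀ n → (∃ λ x → ∃ λ y → value x y ≡ + E * + n) → ∃ λ x → ev Cₗ x ≡ + E * + n
        from n (x , y , e) = x , trans (sym (flat x y)) e

      degenerate-impossible : ⊥
      degenerate-impossible = from (0≤⇒pos 0≤c₀₂)
        where
        from : (∃ λ k → c₀₂ ≡ + k) → ⊥
        from (zero , e) = c₀₂≢0 e
        from (suc k , e) = c₀₂≢positive (suc k) e (s≤s z≤n)

    axis-zero-impossible : ⊥
    axis-zero-impossible = from (0≤⇒pos 0≤c₂₂)
      where
      from : (∃ λ k → c₂₂ ≡ + k) → ⊥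
      from (zero , e) = degenerate-impossible e
      from (suc k , e) = c₂₂≢positive (suc k) e (s≤s z≤n)

-- Moving a rational zero of the leading form to (0, 1)

substitute : Quartic → ℤ → ℤ → ℤ → ℤ → Quartic
substitute Q α β γ δ = record
  { c₄₀ = form₄ α γ
  ; c₃₁ = + 4 * c₄₀ * α * α * α * β + c₃₁ * (+ 3 * α * α * β * γ + α * α * α * δ) + c₂₂
    * (+ 2 * α * β * γ * γ + + 2 * α * α * γ * δ) + c₁₃ * (β * γ * γ * γ + + 3 * α * γ * γ * δ) + + 4 * c₀₄ * γ * γ
    * γ * δ
  ; c₂₂ = + 6 * c₄₀ * α * α * β * β + c₃₁ * (+ 3 * α * β * β * γ + + 3 * α * α * β * δ) + c₂₂
    * (β * β * γ * γ + + 4 * α * β * γ * δ + α * α * δ * δ) + c₁₃ * (+ 3 * β * γ * γ * δ + + 3 * α * γ * δ * δ) + + 6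
    * c₀₄ * γ * γ * δ * δ
  ; c₁₃ = + 4 * c₄₀ * α * β * β * β + c₃₁ * (β * β * β * γ + + 3 * α * β * β * δ) + c₂₂
    * (+ 2 * β * β * γ * δ + + 2 * α * β * δ * δ) + c₁₃ * (+ 3 * β * γ * δ * δ + α * δ * δ * δ) + + 4 * c₀₄ * γ * δ
    * δ * δ
  ; c₀₄ = form₄ β δ
  ; c₃₀ = form₃ α γ
  ; c₂₁ = + 3 * c₃₀ * α * α * β + c₂₁ * (+ 2 * α * β * γ + α * α * δ) + c₁₂ * (β * γ * γ + + 2 * α * γ * δ) + + 3
    * c₀₃ * γ * γ * δ
  ; c₁₂ = + 3 * c₃₀ * α * β * β + c₂₁ * (β * β * γ + + 2 * α * β * δ) + c₁₂ * (+ 2 * β * γ * δ + α * δ * δ) + + 3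
    * c₀₃ * γ * δ * δ
  ; c₀₃ = form₃ β δ
  ; c₂₀ = form₂ α γ ; c₁₁ = + 2 * c₂₀ * α * β + c₁₁ * (β * γ + α * δ) + + 2 * c₀₂ * γ * δ ; c₀₂ = form₂ β δ
  ; c₁₀ = form₁ α γ ; c₀₁ = form₁ β δ ; c₀₀ = c₀₀ }
  where open Quartic Q

module _ (Q : Quartic) where
  open Quartic Q

  substitute-value : ∀ α β γ δ x y → Quartic.value (substitute Q α β γ δ) x y ≡ value (α * x + β * y) (γ * x + δ * y)
  substitute-value α β γ δ x y = cong₂ _+_ four (cong₂ _+_ (cong₂ _+_ (cong₂ _+_ three two) one) refl)
    where
    module S = Quartic (substitute Q α β γ δ)
    X = α * x + β * y
    Y = γ * x + δ * y
    four : S.form₄ x y ≡ form₄ X Y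
    four = solve 11 (λ a b c d e α β γ δ x y →
      let X = α :* x :+ β :* y
          Y = γ :* x :+ δ :* y
          f = λ u v → a :* (u :* u :* u :* u) :+ b :* (u :* u :* u :* v) :+ c :* (u :* u :* (v :* v)) :+ d
            :* (u :* (v :* v :* v)) :+ e :* (v :* v :* v :* v) in
      f α γ :* (x :* x :* x :* x)
      :+ (# 4 :* a :* α :* α :* α :* β :+ b :* (# 3 :* α :* α :* β :* γ :+ α :* α :* α :* δ) :+ c
        :* (# 2 :* α :* β :* γ :* γ :+ # 2 :* α :* α :* γ :* δ) :+ d :* (β :* γ :* γ :* γ :+ # 3 :* α :* γ :* γ :* δ)
        :+ # 4 :* e :* γ :* γ :* γ :* δ) :* (x :* x :* x :* y)
      :+ (# 6 :* a :* α :* α :* β :* β :+ b :* (# 3 :* α :* β :* β :* γ :+ # 3 :* α :* α :* β :* δ) :+ c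
        :* (β :* β :* γ :* γ :+ # 4 :* α :* β :* γ :* δ :+ α :* α :* δ :* δ) :+ d
        :* (# 3 :* β :* γ :* γ :* δ :+ # 3 :* α :* γ :* δ :* δ) :+ # 6 :* e :* γ :* γ :* δ :* δ)
        :* (x :* x :* (y :* y))
      :+ (# 4 :* a :* α :* β :* β :* β :+ b :* (β :* β :* β :* γ :+ # 3 :* α :* β :* β :* δ) :+ c
        :* (# 2 :* β :* β :* γ :* δ :+ # 2 :* α :* β :* δ :* δ) :+ d :* (# 3 :* β :* γ :* δ :* δ :+ α :* δ :* δ :* δ)
        :+ # 4 :* e :* γ :* δ :* δ :* δ) :* (x :* (y :* y :* y))
      :+ f β δ :* (y :* y :* y :* y) := f X Y) refl c₄₀ c₃₁ c₂₂ c₁₃ c₀₄ α β γ δ x y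
    three : S.form₃ x y ≡ form₃ X Y
    three = solve 10 (λ a b c d α β γ δ x y →
      let X = α :* x :+ β :* y
          Y = γ :* x :+ δ :* y
          f = λ u v → a :* (u :* u :* u) :+ b :* (u :* u :* v) :+ c :* (u :* (v :* v)) :+ d :* (v :* v :* v) in
      f α γ :* (x :* x :* x)
      :+ (# 3 :* a :* α :* α :* β :+ b :* (# 2 :* α :* β :* γ :+ α :* α :* δ) :+ c
        :* (β :* γ :* γ :+ # 2 :* α :* γ :* δ) :+ # 3 :* d :* γ :* γ :* δ) :* (x :* x :* y)
      :+ (# 3 :* a :* α :* β :* β :+ b :* (β :* β :* γ :+ # 2 :* α :* β :* δ) :+ c
        :* (# 2 :* β :* γ :* δ :+ α :* δ :* δ) :+ # 3 :* d :* γ :* δ :* δ) :* (x :* (y :* y))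
      :+ f β δ :* (y :* y :* y) := f X Y) refl c₃₀ c₂₁ c₁₂ c₀₃ α β γ δ x y
    two : S.form₂ x y ≡ form₂ X Y
    two = solve 9 (λ a b c α β γ δ x y →
      let X = α :* x :+ β :* y
          Y = γ :* x :+ δ :* y
          f = λ u v → a :* (u :* u) :+ b :* (u :* v) :+ c :* (v :* v) in
      f α γ :* (x :* x) :+ (# 2 :* a :* α :* β :+ b :* (β :* γ :+ α :* δ) :+ # 2 :* c :* γ :* δ) :* (x :* y) :+ f β δ
        :* (y :* y) := f X Y) refl c₂₀ c₁₁ c₀₂ α β γ δ x y
    one : S.form₁ x y ≡ form₁ X Y
    one = solve 8 (λ a b α β γ δ x y → (a :* α :+ b :* γ) :* x :+ (a :* β :+ b :* δ) :* y
      := a :* (α :* x :+ β :* y) :+ b :* (γ :* x :+ δ :* y)) refl c₁₀ c₀₁ α β γ δ x y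

-- The Bézout coefficients complete the column `(β, δ)` to the matrix with rows `(t, β)` and
-- `(- s, δ)` of determinant 1. The corresponding substitution permutes `ℤ²`, so it preserves
-- nonnegativity and the values taken.
record PrimitiveMultiple (u v : ℤ) : Set where
  field
    g β δ s t : ℤ
    g≢0 : g ≢ 0ℤ
    u≡ : u ≡ β * g
    v≡ : v ≡ δ * g
    unimodular : s * β + t * δ ≡ 1ℤ

sign-split : ∀ u → ∃ λ ε → u ≡ ε * + ∣ u ∣ × ε * ε ≡ 1ℤ
sign-split (+ n) = 1ℤ , solve 1 (λ n → n := # 1 :* n) refl (+ n) , solve 0 (# 1 :* # 1 := # 1) refl
sign-split -[1+ n ] = - 1ℤ , trans (sym (neg-≡ (+ suc n))) (solve 1 (λ n → :- n := (:- # 1) :* n) refl (+ suc n)) ,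
  solve 0 ((:- # 1) :* (:- # 1) := # 1) refl

primitive-multiple : ∀ u v → ¬ (u ≡ 0ℤ × v ≡ 0ℤ) → PrimitiveMultiple u v
primitive-multiple u v nonzero = from (sign-split u) (sign-split v) (Bézout.lemma ∣ u ∣ ∣ v ∣)
  where
  from : (∃ λ ε → u ≡ ε * + ∣ u ∣ × ε * ε ≡ 1ℤ) → (∃ λ η → v ≡ η * + ∣ v ∣ × η * η ≡ 1ℤ) → Bézout.Lemma ∣ u ∣ ∣ v ∣
    → PrimitiveMultiple u v
  from (ε , u≡ , εε) (η , v≡ , ηη) (Bézout.result d is-gcd identity) = with-quotients
    (proj₁ (GCD.commonDivisor is-gcd)) (proj₂ (GCD.commonDivisor is-gcd)) identity
    where
    with-quotients : d ℕDiv.∣ ∣ u ∣ → d ℕDiv.∣ ∣ v ∣ → Bézout.Identity d ∣ u ∣ ∣ v ∣ → PrimitiveMultiple u v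
    with-quotients (ℕDiv.divides a a≡) (ℕDiv.divides b b≡) identity = conclude identity
      where
      u≡′ : u ≡ ε * + a * + d
      u≡′ = trans u≡ (trans (cong (λ n → ε * + n) a≡) (trans (cong (ε *_) (pos-* a d))
        (solve 3 (λ e a d → e :* (a :* d) := e :* a :* d) refl ε (+ a) (+ d))))
      v≡′ : v ≡ η * + b * + d
      v≡′ = trans v≡ (trans (cong (λ n → η * + n) b≡) (trans (cong (η *_) (pos-* b d))
        (solve 3 (λ e a d → e :* (a :* d) := e :* a :* d) refl η (+ b) (+ d))))
      d≢0 : + d ≢ 0ℤ
      d≢0 d≡0 = nonzero (trans u≡′ (trans (cong (ε * + a *_) d≡0) (solve 1 (λ x → x :* # 0 := # 0) refl (ε * + a)))
                       , trans v≡′ (trans (cong (η * + b *_) d≡0) (solve 1 (λ x → x :* # 0 := # 0) refl (η * + b))))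
      1≤d : 1ℤ ≤ + d
      1≤d = +≤+ (ℕP.n≢0⇒n>0 (λ z → d≢0 (cong +_ z)))
      pack : ∀ σ τ → σ * + a + τ * + b ≡ 1ℤ → PrimitiveMultiple u v
      pack σ τ e = record { g = + d ; β = ε * + a ; δ = η * + b ; s = σ * ε ; t = τ * η ; g≢0 = d≢0 ; u≡ = u≡′ ; v≡
        = v≡′
        ; unimodular = trans (solve 6 (λ s e a t n b → s :* e :* (e :* a) :+ t :* n :* (n :* b)
          := s :* a :* (e :* e) :+ t :* b :* (n :* n)) refl σ ε (+ a) τ η (+ b))
            (trans (cong₂ (λ p q → σ * + a * p + τ * + b * q) εε ηη)
              (trans (solve 2 (λ x y → x :* # 1 :+ y :* # 1 := x :+ y) refl (σ * + a) (τ * + b)) e)) }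
      ℤ-identity : ∀ x m y n → d ℕ.+ y ℕ.* (n ℕ.* d) ≡ x ℕ.* (m ℕ.* d) → 1ℤ + + y * + n ≡ + x * + m
      ℤ-identity x m y n e = *-cancelˡ (+ d) 1≤d (trans (solve 3 (λ d y n → d :* (# 1 :+ y :* n)
        := d :+ y :* (n :* d)) refl (+ d) (+ y) (+ n))
        (trans (sym (trans (pos-+ d (y ℕ.* (n ℕ.* d))) (cong (_+_ (+ d))
          (trans (pos-* y (n ℕ.* d)) (cong (+ y *_) (pos-* n d))))))
        (trans (cong +_ e) (trans (trans (pos-* x (m ℕ.* d)) (cong (+ x *_) (pos-* m d)))
          (solve 3 (λ x m d → x :* (m :* d) := d :* (x :* m)) refl (+ x) (+ m) (+ d))))))
      conclude : Bézout.Identity d ∣ u ∣ ∣ v ∣ → PrimitiveMultiple u v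
      conclude (Bézout.+- x y eq) = pack (+ x) (- + y) (trans
        (solve 4 (λ x a y b → x :* a :+ (:- y) :* b := x :* a :- y :* b) refl (+ x) (+ a) (+ y) (+ b))
        (trans (cong (_- + y * + b) (sym (ℤ-identity x a y b (subst₂ (λ m n → d ℕ.+ y ℕ.* n ≡ x ℕ.* m) a≡ b≡ eq))))
          (solve 1 (λ z → # 1 :+ z :- z := # 1) refl (+ y * + b))))
      conclude (Bézout.-+ x y eq) = pack (- + x) (+ y) (trans
        (solve 4 (λ x a y b → (:- x) :* a :+ y :* b := y :* b :- x :* a) refl (+ x) (+ a) (+ y) (+ b))
        (trans (cong (_- + x * + a) (sym (ℤ-identity y b x a (subst₂ (λ m n → d ℕ.+ x ℕ.* m ≡ y ℕ.* n) a≡ b≡ eq))))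
          (solve 1 (λ z → # 1 :+ z :- z := # 1) refl (+ x * + a))))

module _ (Q : Quartic) (E : ℕ) (1≤E : 1 ℕ.≤ E) where
  open Quartic Q

  isotropic-impossible : (∀ x y → 0ℤ ≤ value x y) → Covers value E → ∀ u v → ¬ (u ≡ 0ℤ × v ≡ 0ℤ) → form₄ u v ≡ 0ℤ → ⊥
  isotropic-impossible nonneg covers u v nonzero zero-at = from (primitive-multiple u v nonzero)
    where
    from : PrimitiveMultiple u v → ⊥
    from P = AxisZero.axis-zero-impossible (substitute Q t β (- s) δ) E 1≤E primitive-zero
        (λ x y → nn-by (substitute-value Q t β (- s) δ x y) (nonneg (t * x + β * y) ((- s) * x + δ * y)))
        (λ n → transfer n (covers n))
      where
      open PrimitiveMultiple P
      primitive-zero : form₄ β δ ≡ 0ℤ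
      primitive-zero = cancel (cancel (cancel (cancel (trans (solve 8 (λ a b c d e x y g →
            g :* (g :* (g :* (g :* (a :* (x :* x :* x :* x) :+ b :* (x :* x :* x :* y) :+ c :* (x :* x :* (y :* y))
              :+ d :* (x :* (y :* y :* y)) :+ e :* (y :* y :* y :* y))))) :=
            a :* (x :* g :* (x :* g) :* (x :* g) :* (x :* g)) :+ b :* (x :* g :* (x :* g) :* (x :* g) :* (y :* g))
              :+ c :* (x :* g :* (x :* g) :* (y :* g :* (y :* g))) :+ d
              :* (x :* g :* (y :* g :* (y :* g) :* (y :* g))) :+ e :* (y :* g :* (y :* g) :* (y :* g) :* (y :* g)))
              refl c₄₀ c₃₁ c₂₂ c₁₃ c₀₄ β δ g)
          (trans (cong₂ form₄ (sym u≡) (sym v≡)) zero-at)))))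
        where
        cancel : ∀ {x} → g * x ≡ 0ℤ → x ≡ 0ℤ
        cancel {x} e = [ (λ z → ⊥-elim (g≢0 z)) , id ]′ (*-zero-split g x e)
      transfer : ∀ n → (∃ λ x → ∃ λ y → value x y ≡ + E * + n) → ∃ λ x → ∃ λ y
        → Quartic.value (substitute Q t β (- s) δ) x y ≡ + E * + n
      transfer n (X , Y , e) = δ * X - β * Y , s * X + t * Y , trans
        (substitute-value Q t β (- s) δ (δ * X - β * Y) (s * X + t * Y)) (trans (cong₂ value
          (trans (solve 6 (λ s t β δ X Y → t :* (δ :* X :- β :* Y) :+ β :* (s :* X :+ t :* Y)
            := (s :* β :+ t :* δ) :* X) refl s t β δ X Y) (one-times X))
          (trans (solve 6 (λ s t β δ X Y → (:- s) :* (δ :* X :- β :* Y) :+ δ :* (s :* X :+ t :* Y)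
            := (s :* β :+ t :* δ) :* Y) refl s t β δ X Y) (one-times Y))) e)
        where
        one-times : ∀ x → (s * β + t * δ) * x ≡ x
        one-times x = trans (cong (_* x) unimodular) (solve 1 (λ x → # 1 :* x := x) refl x)

  integral-quartic-impossible : (∀ x y → 0ℤ ≤ value x y) → Covers value E → ⊥
  integral-quartic-impossible nonneg covers = em split
    where
    Isotropic : Set
    Isotropic = ∃ λ u → ∃ λ v → ¬ (u ≡ 0ℤ × v ≡ 0ℤ) × form₄ u v ≡ 0ℤ
    at-axis : form₄ 1ℤ 0ℤ ≡ c₄₀
    at-axis = solve 5 (λ a b c d e → let o = # 0
                                         i = # 1 in a :* (i :* i :* i :* i) :+ b :* (i :* i :* i :* o) :+ c
                                           :* (i :* i :* (o :* o)) :+ d :* (i :* (o :* o :* o)) :+ e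
                                           :* (o :* o :* o :* o) := a) refl c₄₀ c₃₁ c₂₂ c₁₃ c₀₄
    split : Isotropic ⊎ ¬ Isotropic → ⊥
    split (inj₁ (u , v , nonzero , zero-at)) = isotropic-impossible nonneg covers u v nonzero zero-at
    split (inj₂ anisotropic) = from (0≤⇒pos (subst (0ℤ ≤_) at-axis (form₄-nonneg Q nonneg 1ℤ 0ℤ)))
      where
      no-zero : ∀ x y → form₄ x y ≡ 0ℤ → y ≡ 0ℤ
      no-zero x y e = decide (y ℤ.≟ 0ℤ)
        where
        decide : Dec (y ≡ 0ℤ) → y ≡ 0ℤ
        decide (yes p) = p
        decide (no p) = ⊥-elim (anisotropic (x , y , (λ z → p (proj₂ z)) , e))
      from : (∃ λ a → c₄₀ ≡ + a) → ⊥
      from (zero , e) = anisotropic (1ℤ , 0ℤ , (λ { (() , _) }) , trans at-axis e)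
      from (suc a , e) = anisotropic-impossible Q (suc a) E (s≤s z≤n) 1≤E e nonneg covers no-zero

-- Rational coefficients

integral-fraction : ∀ z → toℚᵘ (ℤ→ℚ z) ℚᵘ.≃ mkℚᵘ z 0
integral-fraction z = ℚP.toℚᵘ-fromℚᵘ (mkℚᵘ z 0)

ℤ→ℚ-+ : ∀ x y → ℤ→ℚ (x + y) ≡ ℤ→ℚ x ℚ.+ ℤ→ℚ y
ℤ→ℚ-+ x y = ℚP.toℚᵘ-injective (begin
  toℚᵘ (ℤ→ℚ (x + y))                    ≈⟨ integral-fraction (x + y) ⟩
  mkℚᵘ (x + y) 0                         ≈⟨ *≡* (cong (ℤ._* 1ℤ)
    (trans (+-≡ x y) (cong₂ ℤ._+_ (sym (ℤP.*-identityʳ x)) (sym (ℤP.*-identityʳ y))))) ⟩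
  mkℚᵘ x 0 ℚᵘ.+ mkℚᵘ y 0                 ≈⟨ ℚᵘP.+-cong (integral-fraction x) (integral-fraction y) ⟨
  toℚᵘ (ℤ→ℚ x) ℚᵘ.+ toℚᵘ (ℤ→ℚ y)         ≈⟨ ℚP.toℚᵘ-homo-+ (ℤ→ℚ x) (ℤ→ℚ y) ⟨
  toℚᵘ (ℤ→ℚ x ℚ.+ ℤ→ℚ y)                 ∎)
  where open ℚᵘP.≃-Reasoning

ℤ→ℚ-* : ∀ x y → ℤ→ℚ (x * y) ≡ ℤ→ℚ x ℚ.* ℤ→ℚ y
ℤ→ℚ-* x y = ℚP.toℚᵘ-injective (begin
  toℚᵘ (ℤ→ℚ (x * y))                    ≈⟨ integral-fraction (x * y) ⟩
  mkℚᵘ (x * y) 0                         ≈⟨ *≡* (cong (ℤ._* 1ℤ) (*-≡ x y)) ⟩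
  mkℚᵘ x 0 ℚᵘ.* mkℚᵘ y 0                 ≈⟨ ℚᵘP.*-cong (integral-fraction x) (integral-fraction y) ⟨
  toℚᵘ (ℤ→ℚ x) ℚᵘ.* toℚᵘ (ℤ→ℚ y)         ≈⟨ ℚP.toℚᵘ-homo-* (ℤ→ℚ x) (ℤ→ℚ y) ⟨
  toℚᵘ (ℤ→ℚ x ℚ.* ℤ→ℚ y)                 ∎)
  where open ℚᵘP.≃-Reasoning

ℤ→ℚ-injective : ∀ {x y} → ℤ→ℚ x ≡ ℤ→ℚ y → x ≡ y
ℤ→ℚ-injective {x} {y} e with ℚP.fromℚᵘ-injective {mkℚᵘ x 0} {mkℚᵘ y 0} e
... | *≡* h = trans (sym (ℤP.*-identityʳ x)) (trans h (ℤP.*-identityʳ y))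

ℤ→ℚ-^ : ∀ x k → ℤ→ℚ (x ^ k) ≡ ℤ→ℚ x ^ℚ k
ℤ→ℚ-^ x zero = refl
ℤ→ℚ-^ x (suc k) = trans (ℤ→ℚ-* x (x ^ k)) (cong (ℤ→ℚ x ℚ.*_) (ℤ→ℚ-^ x k))

clear-denominator : ∀ r → ℤ→ℚ (ℚ.↧ r) ℚ.* r ≡ ℤ→ℚ (ℚ.↥ r)
clear-denominator r@(mkℚ n d _) = ℚP.toℚᵘ-injective (begin
  toℚᵘ (ℤ→ℚ (+ suc d) ℚ.* r)             ≈⟨ ℚP.toℚᵘ-homo-* (ℤ→ℚ (+ suc d)) r ⟩
  toℚᵘ (ℤ→ℚ (+ suc d)) ℚᵘ.* mkℚᵘ n d     ≈⟨ ℚᵘP.*-congʳ (integral-fraction (+ suc d)) ⟩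
  mkℚᵘ (+ suc d) 0 ℚᵘ.* mkℚᵘ n d         ≈⟨ *≡* (trans (ℤP.*-identityʳ (+ suc d ℤ.* n))
    (trans (ℤP.*-comm (+ suc d) n) (cong (λ k → n ℤ.* + k) (sym (ℕP.*-identityˡ (suc d)))))) ⟩
  mkℚᵘ n 0                               ≈⟨ integral-fraction n ⟨
  toℚᵘ (ℤ→ℚ n)                           ∎)
  where open ℚᵘP.≃-Reasoning

common-denominator : ∀ {n} (f : Fin n → ℚ) → ∃ λ D → 1 ℕ.≤ D × ∃ λ (g : Fin n → ℤ) → ∀ i → ℤ→ℚ (+ D) ℚ.* f i
  ≡ ℤ→ℚ (g i)
common-denominator {zero} f = 1 , s≤s z≤n , (λ ()) , λ ()
common-denominator {suc n} f = extend (common-denominator (λ i → f (Fin.suc i)))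
  where
  d = ℚ.↧ₙ (f Fin.zero)
  extend : (∃ λ D → 1 ℕ.≤ D × ∃ λ (g : Fin n → ℤ) → ∀ i → ℤ→ℚ (+ D) ℚ.* f (Fin.suc i) ≡ ℤ→ℚ (g i)) → _
  extend (D , 1≤D , g , h) = d ℕ.* D , ℕP.*-mono-≤ {1} {d} (s≤s z≤n) 1≤D , g′ , h′
    where
    g′ : Fin (suc n) → ℤ
    g′ Fin.zero = + D * ℚ.↥ (f Fin.zero)
    g′ (Fin.suc i) = + d * g i
    split : ℤ→ℚ (+ (d ℕ.* D)) ≡ ℤ→ℚ (+ d) ℚ.* ℤ→ℚ (+ D)
    split = trans (cong ℤ→ℚ (pos-* d D)) (ℤ→ℚ-* (+ d) (+ D))
    h′ : ∀ i → ℤ→ℚ (+ (d ℕ.* D)) ℚ.* f i ≡ ℤ→ℚ (g′ i)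
    h′ Fin.zero = begin
      ℤ→ℚ (+ (d ℕ.* D)) ℚ.* f Fin.zero ≡⟨ cong (ℚ._* f Fin.zero) (trans split (ℚP.*-comm (ℤ→ℚ (+ d)) (ℤ→ℚ (+ D)))) ⟩
      ℤ→ℚ (+ D) ℚ.* ℤ→ℚ (+ d) ℚ.* f Fin.zero ≡⟨ ℚP.*-assoc (ℤ→ℚ (+ D)) (ℤ→ℚ (+ d)) (f Fin.zero) ⟩
      ℤ→ℚ (+ D) ℚ.* (ℤ→ℚ (+ d) ℚ.* f Fin.zero) ≡⟨ cong (ℤ→ℚ (+ D) ℚ.*_) (clear-denominator (f Fin.zero)) ⟩
      ℤ→ℚ (+ D) ℚ.* ℤ→ℚ (ℚ.↥ (f Fin.zero)) ≡⟨ sym (ℤ→ℚ-* (+ D) (ℚ.↥ (f Fin.zero))) ⟩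
      ℤ→ℚ (+ D * ℚ.↥ (f Fin.zero)) ∎
      where open ≡-Reasoning
    h′ (Fin.suc i) = begin
      ℤ→ℚ (+ (d ℕ.* D)) ℚ.* f (Fin.suc i) ≡⟨ cong (ℚ._* f (Fin.suc i)) split ⟩
      ℤ→ℚ (+ d) ℚ.* ℤ→ℚ (+ D) ℚ.* f (Fin.suc i) ≡⟨ ℚP.*-assoc (ℤ→ℚ (+ d)) (ℤ→ℚ (+ D)) (f (Fin.suc i)) ⟩
      ℤ→ℚ (+ d) ℚ.* (ℤ→ℚ (+ D) ℚ.* f (Fin.suc i)) ≡⟨ cong (ℤ→ℚ (+ d) ℚ.*_) (h i) ⟩
      ℤ→ℚ (+ d) ℚ.* ℤ→ℚ (g i) ≡⟨ sym (ℤ→ℚ-* (+ d) (g i)) ⟩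
      ℤ→ℚ (+ d * g i) ∎
      where open ≡-Reasoning

-- Written in the shape to which `Σ5` unfolds, final zero included, so that the two sums are
-- compared term by term.
Σ5ℤ : (Fin 5 → ℤ) → ℤ
Σ5ℤ f = f Fin.zero + (f (Fin.suc Fin.zero) + (f (Fin.suc (Fin.suc Fin.zero))
  + (f (Fin.suc (Fin.suc (Fin.suc Fin.zero))) + (f (Fin.suc (Fin.suc (Fin.suc (Fin.suc Fin.zero)))) + 0ℤ))))

Σ5-scale : ∀ D (f : Fin 5 → ℚ) (g : Fin 5 → ℤ) → (∀ i → ℤ→ℚ D ℚ.* f i ≡ ℤ→ℚ (g i)) → ℤ→ℚ D ℚ.* Σ5 f ≡ ℤ→ℚ (Σ5ℤ g)
Σ5-scale D f g h = step (h Fin.zero) (step (h (Fin.suc Fin.zero))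
  (step (h (Fin.suc (Fin.suc Fin.zero))) (step (h (Fin.suc (Fin.suc (Fin.suc Fin.zero))))
  (step (h (Fin.suc (Fin.suc (Fin.suc (Fin.suc Fin.zero))))) (ℚP.*-zeroʳ (ℤ→ℚ D))))))
  where
  step : ∀ {a s x y} → ℤ→ℚ D ℚ.* a ≡ ℤ→ℚ x → ℤ→ℚ D ℚ.* s ≡ ℤ→ℚ y → ℤ→ℚ D ℚ.* (a ℚ.+ s) ≡ ℤ→ℚ (x + y)
  step {a} {s} {x} {y} p q = trans (ℚP.*-distribˡ-+ (ℤ→ℚ D) a s) (trans (cong₂ ℚ._+_ p q) (sym (ℤ→ℚ-+ x y)))

Σ5ℤ-cong : ∀ {f g : Fin 5 → ℤ} → (∀ i → f i ≡ g i) → Σ5ℤ f ≡ Σ5ℤ g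
Σ5ℤ-cong h = cong₂ _+_ (h Fin.zero) (cong₂ _+_ (h (Fin.suc Fin.zero))
  (cong₂ _+_ (h (Fin.suc (Fin.suc Fin.zero))) (cong₂ _+_ (h (Fin.suc (Fin.suc (Fin.suc Fin.zero))))
  (cong₂ _+_ (h (Fin.suc (Fin.suc (Fin.suc (Fin.suc Fin.zero))))) refl))))

integral-eval : (Fin 5 → Fin 5 → ℤ) → ℤ → ℤ → ℤ
integral-eval g x y = Σ5ℤ (λ i → Σ5ℤ (λ j → g i j * (x ^ toℕ i * y ^ toℕ j)))

eval-scale : ∀ D c g → (∀ i j → ℤ→ℚ D ℚ.* c i j ≡ ℤ→ℚ (g i j)) → ∀ x y → ℤ→ℚ D ℚ.* eval c (ℤ→ℚ x) (ℤ→ℚ y)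
  ≡ ℤ→ℚ (integral-eval g x y)
eval-scale D c g h x y = Σ5-scale D (λ i → Σ5 (row i)) (λ i → Σ5ℤ (integral-row i)) (λ i
  → Σ5-scale D (row i) (integral-row i) (λ j → begin
    ℤ→ℚ D ℚ.* (c i j ℚ.* (X ^ℚ toℕ i ℚ.* Y ^ℚ toℕ j)) ≡⟨ sym (ℚP.*-assoc (ℤ→ℚ D) (c i j) (X ^ℚ toℕ i ℚ.* Y ^ℚ toℕ j))
      ⟩
    ℤ→ℚ D ℚ.* c i j ℚ.* (X ^ℚ toℕ i ℚ.* Y ^ℚ toℕ j)   ≡⟨ cong₂ ℚ._*_ (h i j)
      (cong₂ ℚ._*_ (sym (ℤ→ℚ-^ x (toℕ i))) (sym (ℤ→ℚ-^ y (toℕ j)))) ⟩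
    ℤ→ℚ (g i j) ℚ.* (ℤ→ℚ (x ^ toℕ i) ℚ.* ℤ→ℚ (y ^ toℕ j)) ≡⟨ cong (ℤ→ℚ (g i j) ℚ.*_)
      (sym (ℤ→ℚ-* (x ^ toℕ i) (y ^ toℕ j))) ⟩
    ℤ→ℚ (g i j) ℚ.* ℤ→ℚ (x ^ toℕ i * y ^ toℕ j)       ≡⟨ sym (ℤ→ℚ-* (g i j) (x ^ toℕ i * y ^ toℕ j)) ⟩
    ℤ→ℚ (integral-row i j) ∎))
  where
  open ≡-Reasoning
  X = ℤ→ℚ x
  Y = ℤ→ℚ y
  row : Fin 5 → Fin 5 → ℚ
  row i j = c i j ℚ.* (X ^ℚ toℕ i ℚ.* Y ^ℚ toℕ j)
  integral-row : Fin 5 → Fin 5 → ℤ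
  integral-row i j = g i j * (x ^ toℕ i * y ^ toℕ j)

keep : ∀ {A : Set} → Dec A → ℤ → ℤ
keep (yes _) z = z
keep (no _) z = 0ℤ

module _ (g : Fin 5 → Fin 5 → ℤ) where

  -- At closed indices the decision computes, so the coefficients of degree above 4 become literal
  -- zeros and the evaluation unfolds to an expression in 15 coefficients for the ring solver.
  truncated : Fin 5 → Fin 5 → ℤ
  truncated i j = keep (toℕ i ℕ.+ toℕ j ℕ.≤? 4) (g i j)

  private
    i0 i1 i2 i3 i4 : Fin 5
    i0 = Fin.zero
    i1 = Fin.suc Fin.zero
    i2 = Fin.suc (Fin.suc Fin.zero)
    i3 = Fin.suc (Fin.suc (Fin.suc Fin.zero))
    i4 = Fin.suc (Fin.suc (Fin.suc (Fin.suc Fin.zero)))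

  quartic : Quartic
  quartic = record
    { c₄₀ = g i4 i0 ; c₃₁ = g i3 i1 ; c₂₂ = g i2 i2 ; c₁₃ = g i1 i3 ; c₀₄ = g i0 i4
    ; c₃₀ = g i3 i0 ; c₂₁ = g i2 i1 ; c₁₂ = g i1 i2 ; c₀₃ = g i0 i3
    ; c₂₀ = g i2 i0 ; c₁₁ = g i1 i1 ; c₀₂ = g i0 i2 ; c₁₀ = g i1 i0 ; c₀₁ = g i0 i1 ; c₀₀ = g i0 i0 }

  truncated-value : ∀ x y → integral-eval truncated x y ≡ Quartic.value quartic x y
  truncated-value x y = solve 17 (λ c₄₀ c₃₁ c₂₂ c₁₃ c₀₄ c₃₀ c₂₁ c₁₂ c₀₃ c₂₀ c₁₁ c₀₂ c₁₀ c₀₁ c₀₀ x y →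
     let o = # 0
         m = λ c i j → c :* (x :^ i :* y :^ j) in
     (m c₀₀ 0 0 :+ (m c₀₁ 0 1 :+ (m c₀₂ 0 2 :+ (m c₀₃ 0 3 :+ (m c₀₄ 0 4 :+ o)))))
     :+ ((m c₁₀ 1 0 :+ (m c₁₁ 1 1 :+ (m c₁₂ 1 2 :+ (m c₁₃ 1 3 :+ (m o 1 4 :+ o)))))
     :+ ((m c₂₀ 2 0 :+ (m c₂₁ 2 1 :+ (m c₂₂ 2 2 :+ (m o 2 3 :+ (m o 2 4 :+ o)))))
     :+ ((m c₃₀ 3 0 :+ (m c₃₁ 3 1 :+ (m o 3 2 :+ (m o 3 3 :+ (m o 3 4 :+ o)))))
     :+ ((m c₄₀ 4 0 :+ (m o 4 1 :+ (m o 4 2 :+ (m o 4 3 :+ (m o 4 4 :+ o))))) :+ o)))) :=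
     c₄₀ :* (x :* x :* x :* x) :+ c₃₁ :* (x :* x :* x :* y) :+ c₂₂ :* (x :* x :* (y :* y)) :+ c₁₃
       :* (x :* (y :* y :* y)) :+ c₀₄ :* (y :* y :* y :* y)
     :+ ((c₃₀ :* (x :* x :* x) :+ c₂₁ :* (x :* x :* y) :+ c₁₂ :* (x :* (y :* y)) :+ c₀₃ :* (y :* y :* y))
       :+ (c₂₀ :* (x :* x) :+ c₁₁ :* (x :* y) :+ c₀₂ :* (y :* y)) :+ (c₁₀ :* x :+ c₀₁ :* y) :+ c₀₀))
     refl (g i4 i0) (g i3 i1) (g i2 i2) (g i1 i3) (g i0 i4) (g i3 i0) (g i2 i1) (g i1 i2) (g i0 i3) (g i2 i0)
       (g i1 i1) (g i0 i2) (g i1 i0) (g i0 i1) (g i0 i0) x y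

  truncated≡ : (∀ i j → toℕ i ℕ.+ toℕ j ℕ.> 4 → g i j ≡ 0ℤ) → ∀ i j → g i j ≡ truncated i j
  truncated≡ h i j = from (toℕ i ℕ.+ toℕ j ℕ.≤? 4)
    where
    from : (d : Dec (toℕ i ℕ.+ toℕ j ℕ.≤ 4)) → g i j ≡ keep d (g i j)
    from (yes _) = refl
    from (no p) = h i j (ℕP.≰⇒> p)

degree≤4-impossible : ∀ c → DegreeLE4 c → ¬ ImageIsNat c
degree≤4-impossible c degree (image⊆ℕ , ℕ⊆image) = from (common-denominator (λ k → uncurry c (remQuot 5 k)))
  where
  from : (∃ λ D → 1 ℕ.≤ D × ∃ λ (g : Fin 25 → ℤ) → ∀ k → ℤ→ℚ (+ D) ℚ.* uncurry c (remQuot 5 k) ≡ ℤ→ℚ (g k)) → ⊥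
  from (D , 1≤D , g₀ , h₀) = integral-quartic-impossible (quartic g) D 1≤D
      (λ x y → nonneg x y (image⊆ℕ x y)) (λ n → covers n (ℕ⊆image n))
    where
    g : Fin 5 → Fin 5 → ℤ
    g i j = g₀ (combine i j)
    h : ∀ i j → ℤ→ℚ (+ D) ℚ.* c i j ≡ ℤ→ℚ (g i j)
    h i j = trans (cong (λ k → ℤ→ℚ (+ D) ℚ.* uncurry c k) (sym (FinP.remQuot-combine i j))) (h₀ (combine i j))
    high-zero : ∀ i j → toℕ i ℕ.+ toℕ j ℕ.> 4 → g i j ≡ 0ℤ
    high-zero i j p = ℤ→ℚ-injective (trans (sym (h i j)) (trans (cong (ℤ→ℚ (+ D) ℚ.*_) (degree i j p))
      (ℚP.*-zeroʳ (ℤ→ℚ (+ D)))))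
    open Quartic (quartic g) using (value)
    value≡ : ∀ x y n → eval c (ℤ→ℚ x) (ℤ→ℚ y) ≡ ℤ→ℚ (+ n) → value x y ≡ + D * + n
    value≡ x y n e = trans (sym (trans (Σ5ℤ-cong (λ i → Σ5ℤ-cong (λ j
      → cong (_* (x ^ toℕ i * y ^ toℕ j)) (truncated≡ g high-zero i j)))) (truncated-value g x y)))
      (ℤ→ℚ-injective (trans (sym (eval-scale (+ D) c g h x y))
        (trans (cong (ℤ→ℚ (+ D) ℚ.*_) e) (sym (ℤ→ℚ-* (+ D) (+ n))))))
    nonneg : ∀ x y → (∃ λ n → eval c (ℤ→ℚ x) (ℤ→ℚ y) ≡ ℤ→ℚ (+ n)) → 0ℤ ≤ value x y
    nonneg x y (n , e) = nn-by (value≡ x y n e) (*-nn (pos-nn D) (pos-nn n))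
    covers : ∀ n → (∃ λ x → ∃ λ y → eval c (ℤ→ℚ x) (ℤ→ℚ y) ≡ ℤ→ℚ (+ n)) → ∃ λ x → ∃ λ y → value x y ≡ + D * + n
    covers n (x , y , e) = x , y , value≡ x y n e

theorem1p5 : ¬ (Σ Coeffs (λ F → Degree4 F × ImageIsNat F))
theorem1p5 (c , (degree , _) , image) = degree≤4-impossible c degree image
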